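{- Let $A\in\mathbb{F}_2[x]$ be bi-unitary perfect with $\omega(A)=4$. Then $A$ or $\overline{A}$ belongs to $\{C_8,\dots,C_{13},D_1,D_2\}$, where $C_8=x^8(x+1)^8M_4M_5$, $C_9=x^8(x+1)^9M_4M_5^2$, $C_{10}=x^7(x+1)^{10}M_1^2M_5$, $C_{11}=x^7(x+1)^{13}M_2^2M_3^2$, $C_{12}=x^9(x+1)^9M_4^2M_5^2$, $C_{13}=x^{14}(x+1)^{14}M_2^2M_3^2$, $D_1=x^4(x+1)^5M_1^4S_1$, $D_2=x^4(x+1)^5M_1^5S_1^2$.
   Context: All polynomials are in $\mathbb{F}_2[x]$. For nonzero $S$, a divisor $D$ of $S$ is unitary if $\gcd(D,S/D)=1$; $\gcd_u(S,T)$ denotes the greatest common unitary divisor of $S$ and $T$. A divisor $D$ of $S$ is bi-unitary if $\gcd_u(D,S/D)=1$. $\sigma^{**}(S)$ denotes the sum of all bi-unitary divisors of $S$, and $S$ is bi-unitary perfect if $\sigma^{**}(S)=S$. $\omega(S)$ is the number of distinct irreducible factors of $S$. $\overline{S}(x)=S(x+1)$. $M_1=1+x+x^2$, $M_2=1+x+x^3$, $M_3=1+x^2+x^3$, $M_4=1+x+x^2+x^3+x^4$, $M_5=1+x^3+x^4$, $S_1=1+x+x^4$. -}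

module Defs where

open import Data.Bool using (Bool; true; false; not; _xor_; if_then_else_)
open import Data.Nat using (ℕ; zero; suc)
open import Data.List using (List; []; _∷_; foldr; length)
open import Data.List.Membership.Propositional using (_∈_)
open import Data.List.Relation.Unary.Unique.Propositional using (Unique)
open import Data.Product using (Σ; _×_; _,_)
open import Data.Sum using (_⊎_)
open import Relation.Binary.PropositionalEquality using (_≡_; _≢_)
open import Function.Bundles using (_⇔_)

-- Polynomials over F₂ in canonical form (coefficients low degree first,
-- nonzero polynomials have leading coefficient 1), so _≡_ is equality
-- of polynomials.

mutual
  data Poly : Set where
    𝟘  : Poly
    nz : Nz → Poly

  data Nz : Set where
    one  : Nz
    _∷ₙ_ : Bool → Nz → Nz  -- b ∷ₙ p  =  b + x·p

𝟙 : Poly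
𝟙 = nz one

cons : Bool → Poly → Poly
cons false 𝟘      = 𝟘
cons true  𝟘      = 𝟙
cons b     (nz p) = nz (b ∷ₙ p)

const : Bool → Poly
const b = cons b 𝟘

addNz : Nz → Nz → Poly
addNz one      one      = 𝟘
addNz one      (b ∷ₙ q) = nz (not b ∷ₙ q)
addNz (a ∷ₙ p) one      = nz (not a ∷ₙ p)
addNz (a ∷ₙ p) (b ∷ₙ q) = cons (a xor b) (addNz p q)

infixl 6 _+ₚ_
infixl 7 _*ₚ_
infixr 8 _^ₚ_

_+ₚ_ : Poly → Poly → Poly
𝟘    +ₚ q    = q
nz p +ₚ 𝟘    = nz p
nz p +ₚ nz q = addNz p q

mulNz : Nz → Poly → Poly
mulNz one      q = q
mulNz (b ∷ₙ p) q = (if b then q else 𝟘) +ₚ cons false (mulNz p q)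

_*ₚ_ : Poly → Poly → Poly
𝟘    *ₚ q = 𝟘
nz p *ₚ q = mulNz p q

_^ₚ_ : Poly → ℕ → Poly
p ^ₚ zero  = 𝟙
p ^ₚ suc n = p *ₚ (p ^ₚ n)

-- polynomial from its coefficient list (low degree first)
fromBits : List Bool → Poly
fromBits = foldr cons 𝟘

X : Poly
X = fromBits (false ∷ true ∷ [])

X+1 : Poly
X+1 = fromBits (true ∷ true ∷ [])

-- S̄(x) = S(x+1)  (Horner evaluation at x+1)
barNz : Nz → Poly
barNz one      = 𝟙
barNz (b ∷ₙ p) = const b +ₚ X+1 *ₚ barNz p

bar : Poly → Poly
bar 𝟘      = 𝟘
bar (nz p) = barNz p

sumₚ : List Poly → Poly
sumₚ = foldr _+ₚ_ 𝟘

_∣ₚ_ : Poly → Poly → Set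
D ∣ₚ S = Σ Poly (λ Q → D *ₚ Q ≡ S)

IsGcd : Poly → Poly → Poly → Set
IsGcd G S T = G ∣ₚ S × G ∣ₚ T × (∀ E → E ∣ₚ S → E ∣ₚ T → E ∣ₚ G)

UnitaryDiv : Poly → Poly → Set
UnitaryDiv D S = Σ Poly (λ Q → D *ₚ Q ≡ S × IsGcd 𝟙 D Q)

IsGcdᵤ : Poly → Poly → Poly → Set
IsGcdᵤ G S T = UnitaryDiv G S × UnitaryDiv G T
             × (∀ E → UnitaryDiv E S → UnitaryDiv E T → E ∣ₚ G)

BiUnitaryDiv : Poly → Poly → Set
BiUnitaryDiv D S = Σ Poly (λ Q → D *ₚ Q ≡ S × IsGcdᵤ 𝟙 D Q)

IsSigma** : Poly → Poly → Set
IsSigma** S T = Σ (List Poly) (λ L →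
  Unique L × (∀ D → (D ∈ L) ⇔ BiUnitaryDiv D S) × sumₚ L ≡ T)

BiUnitaryPerfect : Poly → Set
BiUnitaryPerfect S = S ≢ 𝟘 × IsSigma** S S

Irreducible : Poly → Set
Irreducible P = P ≢ 𝟘 × P ≢ 𝟙 × (∀ D → D ∣ₚ P → D ≡ 𝟙 ⊎ D ≡ P)

HasOmega : Poly → ℕ → Set
HasOmega S n = Σ (List Poly) (λ L →
  Unique L × (∀ P → (P ∈ L) ⇔ (Irreducible P × P ∣ₚ S)) × length L ≡ n)

M₁ M₂ M₃ M₄ M₅ S₁ : Poly
M₁ = fromBits (true ∷ true ∷ true ∷ [])
M₂ = fromBits (true ∷ true ∷ false ∷ true ∷ [])
M₃ = fromBits (true ∷ false ∷ true ∷ true ∷ [])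
M₄ = fromBits (true ∷ true ∷ true ∷ true ∷ true ∷ [])
M₅ = fromBits (true ∷ false ∷ false ∷ true ∷ true ∷ [])
S₁ = fromBits (true ∷ true ∷ false ∷ false ∷ true ∷ [])

C₈ C₉ C₁₀ C₁₁ C₁₂ C₁₃ D₁ D₂ : Poly
C₈  = X ^ₚ 8 *ₚ X+1 ^ₚ 8 *ₚ M₄ *ₚ M₅
C₉  = X ^ₚ 8 *ₚ X+1 ^ₚ 9 *ₚ M₄ *ₚ M₅ ^ₚ 2
C₁₀ = X ^ₚ 7 *ₚ X+1 ^ₚ 10 *ₚ M₁ ^ₚ 2 *ₚ M₅
C₁₁ = X ^ₚ 7 *ₚ X+1 ^ₚ 13 *ₚ M₂ ^ₚ 2 *ₚ M₃ ^ₚ 2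
C₁₂ = X ^ₚ 9 *ₚ X+1 ^ₚ 9 *ₚ M₄ ^ₚ 2 *ₚ M₅ ^ₚ 2
C₁₃ = X ^ₚ 14 *ₚ X+1 ^ₚ 14 *ₚ M₂ ^ₚ 2 *ₚ M₃ ^ₚ 2
D₁  = X ^ₚ 4 *ₚ X+1 ^ₚ 5 *ₚ M₁ ^ₚ 4 *ₚ S₁
D₂  = X ^ₚ 4 *ₚ X+1 ^ₚ 5 *ₚ M₁ ^ₚ 5 *ₚ S₁ ^ₚ 2

candidates : List Poly
candidates = C₈ ∷ C₉ ∷ C₁₀ ∷ C₁₁ ∷ C₁₂ ∷ C₁₃ ∷ D₁ ∷ D₂ ∷ []

{-# OPTIONS --safe #-}
-- Write y = x + 1 and geo p n = 1 + p + ⋯ + p^(n-1).  For a prime p, σ**(p^a) = (1+p) (geo p s) (geo p t) with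
-- s + t = a + 1 and |s - t| ≤ 1, and geo p (2^r m) = (1+p)^(2^r - 1) (geo p m)^(2^r).  So 1 + p divides σ**(A) = A for
-- every prime p dividing A, and A = x^a y^b P^h Q^k where, if deg P ≤ deg Q, P = 1 + x^i y^j and Q = 1 + x^u y^v P^w.
-- For odd m, geo x m and geo y m are squarefree, hence 1, P, Q or PQ, while geo Q m = 1 and geo P m is 1 or Q.
-- Derivatives determine P, Q and w in each of these cases (together with a trace argument, which shows that
-- 1 + x y^(2^r - 1) is reducible for r > 2).  As the multiplicities of P and Q in σ**(x^a) and σ**(y^b) are zero or
-- powers of two, comparing multiplicities in σ**(A) = A leaves only finitely many exponents.

module Submission where

open import Defs
open import Algebra.Bundles using (RawRing; CommutativeSemiring)
open import Algebra.Solver.Ring.AlmostCommutativeRing using (fromCommutativeSemiring; _-Raw-AlmostCommutative⟶_)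
open import Data.Bool using (Bool; true; false; T; not; _xor_; _∧_; _∨_; if_then_else_)
import Data.Bool.Properties as Bool
open import Data.Empty using (⊥; ⊥-elim)
open import Data.List using (List; []; _∷_; _++_; map; length; cartesianProduct; downFrom)
open import Data.List.Membership.Propositional using (_∈_)
open import Data.List.Membership.Propositional.Properties using (∈-map⁺; ∈-map⁻; ∈-++⁺ˡ; ∈-++⁺ʳ; ∈-++⁻; ∈-∃++; ∈-downFrom⁺; ∈-downFrom⁻; ∈-cartesianProduct⁺; ∈-cartesianProduct⁻)
import Data.List.Membership.DecPropositional as DecMembership
open import Data.List.Properties using (map-++)
open import Data.List.Relation.Binary.Permutation.Propositional using (_↭_; ↭-sym; ↭-trans; ↭-prep; ↭-swap; ↭-refl; ↭⇒↭ₛ)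
open import Data.List.Relation.Binary.Permutation.Propositional.Properties using (∈-resp-↭; shift; ↭-length)
import Data.List.Relation.Binary.Permutation.Setoid.Properties as ↭ₛ
open import Data.List.Relation.Unary.All as All using (All; []; _∷_)
import Data.List.Relation.Unary.All.Properties as All
open import Data.List.Relation.Unary.AllPairs using ([]; _∷_)
open import Data.List.Relation.Unary.Any using (here; there)
open import Data.List.Relation.Unary.Unique.Propositional using (Unique)
import Data.List.Relation.Unary.Unique.Propositional.Properties as Unique
open import Data.Maybe using (Maybe; just; nothing)
open import Data.Nat using (ℕ; zero; suc; pred; _≡ᵇ_; _≤ᵇ_; _+_; _*_; _∸_; _^_; ⌊_/2⌋; ⌈_/2⌉; _≤_; _<_; _<?_; z≤n; s≤s; s≤s⁻¹; s<s⁻¹; >-nonZero)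
open import Data.Nat.Induction using (<-wellFounded)
open import Data.Nat.Logarithm using (⌊log₂_⌋; ⌊log₂[2^n]⌋≡n)
import Data.Nat.Properties as ℕ
open import Data.Nat.Solver using (module +-*-Solver)
open +-*-Solver using () renaming (solve to solveℕ; con to κ; _:+_ to _⊕_; _:*_ to _⊗_; _:=_ to _⊜_)
open import Data.Product using (∃-syntax; _×_; _,_; proj₁; proj₂)
open import Data.Sum using (_⊎_; inj₁; inj₂; [_,_]′)
open import Data.Vec as Vec using (Vec; []; _∷_; zipWith)
open import Data.Vec.Relation.Unary.All as VAll using ([]; _∷_) renaming (All to VAll)
open import Function using (_∘_; id; case_of_)
open import Function.Bundles using (_⇔_; mk⇔; module Equivalence)
open import Induction.WellFounded using (Acc; acc)
open import Relation.Binary.PropositionalEquality using (_≡_; _≢_; refl; sym; trans; cong; cong₂; subst; subst₂; isEquivalence; setoid; module ≡-Reasoning)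
open import Relation.Nullary using (¬_; Dec; yes; no; contradiction)
open import Relation.Nullary.Decidable using (toWitness; _⊎-dec_)

open ≡-Reasoning

-- The exponents n for which `σ** R n` is a power of `1 + R` are 2 and the numbers 2^r - 1; for all
-- others some `geo R m` with odd m > 1 enters. So k is trivial in this sense, and so is h unless
-- `geo P m = Q` contributes. If w = 0 and h is trivial, then h and k are each a sum of two numbers
-- that are zero or powers of two, and such a trivial sum is at most 3. The exponents a and b have
-- no such bound; they follow from the degrees of the geometric sums and the multiplicities of x and
-- y. If w > 0, the summand w k of h obstructs triviality, up to coincidences of size. One of them,
-- w = 2 with deg P = 2, escapes the arithmetic and falls only because `geo x 7` factors. The
-- solutions D₁ and D₂ come from Q = geo P 3. Derivatives are effective because squares are
-- constants in characteristic 2: an odd geometric sum in x is 1 + x y R², and the derivation x y D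
-- fixes x y R² and multiplies every x^a y^b by one of 0, 1, x, y.

-- Ring laws of polynomials over F₂

hd : Poly → Bool
hd 𝟘             = false
hd (nz one)      = true
hd (nz (b ∷ₙ _)) = b

tl : Poly → Poly
tl 𝟘             = 𝟘
tl (nz one)      = 𝟘
tl (nz (_ ∷ₙ p)) = nz p

cons-hd-tl : ∀ p → cons (hd p) (tl p) ≡ p
cons-hd-tl 𝟘                 = refl
cons-hd-tl (nz one)          = refl
cons-hd-tl (nz (false ∷ₙ _)) = refl
cons-hd-tl (nz (true ∷ₙ _))  = refl

-- Induction along `cons` treats 𝟘, 𝟙 and the longer canonical forms alike, so that most ring laws
-- need no case distinction on the constructors of `Nz`.
Poly-ind : (R : Poly → Set) → R 𝟘 → (∀ b p → R p → R (cons b p)) → ∀ p → R p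
Poly-ind R r₀ r₁ 𝟘      = r₀
Poly-ind R r₀ r₁ (nz p) = go p
  where
  go : ∀ p → R (nz p)
  go one          = r₁ true 𝟘 r₀
  go (false ∷ₙ p) = r₁ false (nz p) (go p)
  go (true ∷ₙ p)  = r₁ true (nz p) (go p)

scale : Bool → Poly → Poly
scale b q = if b then q else 𝟘

+ₚ-identityʳ : ∀ p → p +ₚ 𝟘 ≡ p
+ₚ-identityʳ 𝟘      = refl
+ₚ-identityʳ (nz _) = refl

cons-+ₚ : ∀ a p b q → cons a p +ₚ cons b q ≡ cons (a xor b) (p +ₚ q)
cons-+ₚ false 𝟘      false 𝟘      = refl
cons-+ₚ false 𝟘      true  𝟘      = refl
cons-+ₚ true  𝟘      false 𝟘      = refl
cons-+ₚ true  𝟘      true  𝟘      = refl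
cons-+ₚ false 𝟘      false (nz _) = refl
cons-+ₚ false 𝟘      true  (nz _) = refl
cons-+ₚ true  𝟘      false (nz _) = refl
cons-+ₚ true  𝟘      true  (nz _) = refl
cons-+ₚ false (nz _) false 𝟘      = refl
cons-+ₚ false (nz _) true  𝟘      = refl
cons-+ₚ true  (nz _) false 𝟘      = refl
cons-+ₚ true  (nz _) true  𝟘      = refl
cons-+ₚ false (nz _) false (nz _) = refl
cons-+ₚ false (nz _) true  (nz _) = refl
cons-+ₚ true  (nz _) false (nz _) = refl
cons-+ₚ true  (nz _) true  (nz _) = refl

cons-+ₚ-η : ∀ a p q → cons a p +ₚ q ≡ cons (a xor hd q) (p +ₚ tl q)
cons-+ₚ-η a p q = trans (cong (cons a p +ₚ_) (sym (cons-hd-tl q))) (cons-+ₚ a p (hd q) (tl q))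

+ₚ-comm : ∀ p q → p +ₚ q ≡ q +ₚ p
+ₚ-comm = Poly-ind _ (λ q → sym (+ₚ-identityʳ q)) λ a p ih q → begin
  cons a p +ₚ q                    ≡⟨ cons-+ₚ-η a p q ⟩
  cons (a xor hd q) (p +ₚ tl q)    ≡⟨ cong₂ cons (Bool.xor-comm a (hd q)) (ih (tl q)) ⟩
  cons (hd q xor a) (tl q +ₚ p)    ≡⟨ cons-+ₚ (hd q) (tl q) a p ⟨
  cons (hd q) (tl q) +ₚ cons a p   ≡⟨ cong (_+ₚ cons a p) (cons-hd-tl q) ⟩
  q +ₚ cons a p                    ∎

+ₚ-assoc : ∀ p q r → (p +ₚ q) +ₚ r ≡ p +ₚ (q +ₚ r)
+ₚ-assoc = Poly-ind _ (λ q r → refl) λ a p ih q r → begin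
  (cons a p +ₚ q) +ₚ r                                ≡⟨ cong (_+ₚ r) (cons-+ₚ-η a p q) ⟩
  cons (a xor hd q) (p +ₚ tl q) +ₚ r                  ≡⟨ cons-+ₚ-η (a xor hd q) (p +ₚ tl q) r ⟩
  cons ((a xor hd q) xor hd r) ((p +ₚ tl q) +ₚ tl r)  ≡⟨ cong₂ cons (Bool.xor-assoc a (hd q) (hd r)) (ih (tl q) (tl r)) ⟩
  cons (a xor (hd q xor hd r)) (p +ₚ (tl q +ₚ tl r))  ≡⟨ cons-+ₚ a p _ _ ⟨
  cons a p +ₚ cons (hd q xor hd r) (tl q +ₚ tl r)     ≡⟨ cong (cons a p +ₚ_) (cons-+ₚ-η (hd q) (tl q) r) ⟨
  cons a p +ₚ (cons (hd q) (tl q) +ₚ r)               ≡⟨ cong (λ s → cons a p +ₚ (s +ₚ r)) (cons-hd-tl q) ⟩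
  cons a p +ₚ (q +ₚ r)                                ∎

+ₚ-self : ∀ p → p +ₚ p ≡ 𝟘
+ₚ-self = Poly-ind _ refl λ a p ih → trans (cons-+ₚ a p a p) (cong₂ cons (Bool.xor-same a) ih)

+ₚ-medial : ∀ a b c d → (a +ₚ b) +ₚ (c +ₚ d) ≡ (a +ₚ c) +ₚ (b +ₚ d)
+ₚ-medial a b c d = begin
  (a +ₚ b) +ₚ (c +ₚ d)  ≡⟨ +ₚ-assoc a b _ ⟩
  a +ₚ (b +ₚ (c +ₚ d))  ≡⟨ cong (a +ₚ_) (sym (+ₚ-assoc b c d)) ⟩
  a +ₚ ((b +ₚ c) +ₚ d)  ≡⟨ cong (λ s → a +ₚ (s +ₚ d)) (+ₚ-comm b c) ⟩
  a +ₚ ((c +ₚ b) +ₚ d)  ≡⟨ cong (a +ₚ_) (+ₚ-assoc c b d) ⟩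
  a +ₚ (c +ₚ (b +ₚ d))  ≡⟨ sym (+ₚ-assoc a c _) ⟩
  (a +ₚ c) +ₚ (b +ₚ d)  ∎

cons-*ₚ : ∀ b p q → cons b p *ₚ q ≡ scale b q +ₚ cons false (p *ₚ q)
cons-*ₚ false 𝟘      q = refl
cons-*ₚ true  𝟘      q = sym (+ₚ-identityʳ q)
cons-*ₚ false (nz p) q = refl
cons-*ₚ true  (nz p) q = refl

scale-xor : ∀ a b r → scale (a xor b) r ≡ scale a r +ₚ scale b r
scale-xor false b     r = refl
scale-xor true  false r = sym (+ₚ-identityʳ r)
scale-xor true  true  r = sym (+ₚ-self r)

*ₚ-distribʳ : ∀ r p q → (p +ₚ q) *ₚ r ≡ p *ₚ r +ₚ q *ₚ r
*ₚ-distribʳ r = Poly-ind _ (λ q → refl) λ a p ih q → begin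
  (cons a p +ₚ q) *ₚ r                                         ≡⟨ cong (_*ₚ r) (cons-+ₚ-η a p q) ⟩
  cons (a xor hd q) (p +ₚ tl q) *ₚ r                           ≡⟨ cons-*ₚ (a xor hd q) (p +ₚ tl q) r ⟩
  scale (a xor hd q) r +ₚ cons false ((p +ₚ tl q) *ₚ r)        ≡⟨ cong₂ _+ₚ_ (scale-xor a (hd q) r) (cong (cons false) (ih (tl q))) ⟩
  (scale a r +ₚ scale (hd q) r) +ₚ cons false (p *ₚ r +ₚ tl q *ₚ r)
    ≡⟨ cong ((scale a r +ₚ scale (hd q) r) +ₚ_) (sym (cons-+ₚ false (p *ₚ r) false (tl q *ₚ r))) ⟩
  (scale a r +ₚ scale (hd q) r) +ₚ (cons false (p *ₚ r) +ₚ cons false (tl q *ₚ r))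
    ≡⟨ +ₚ-medial (scale a r) _ _ _ ⟩
  (scale a r +ₚ cons false (p *ₚ r)) +ₚ (scale (hd q) r +ₚ cons false (tl q *ₚ r))
    ≡⟨ cong₂ _+ₚ_ (sym (cons-*ₚ a p r)) (sym (cons-*ₚ (hd q) (tl q) r)) ⟩
  cons a p *ₚ r +ₚ cons (hd q) (tl q) *ₚ r                     ≡⟨ cong (λ s → cons a p *ₚ r +ₚ s *ₚ r) (cons-hd-tl q) ⟩
  cons a p *ₚ r +ₚ q *ₚ r                                      ∎

*ₚ-zeroʳ : ∀ p → p *ₚ 𝟘 ≡ 𝟘
*ₚ-zeroʳ = Poly-ind _ refl λ b p ih →
  trans (cons-*ₚ b p 𝟘) (cong₂ (λ s t → s +ₚ cons false t) (scale-zero b) ih)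
  where
  scale-zero : ∀ b → scale b 𝟘 ≡ 𝟘
  scale-zero false = refl
  scale-zero true  = refl

-- Multiplication recurses on its left factor, so commutativity needs this mirror image of
-- `cons-*ₚ`.
*ₚ-cons : ∀ p c q → p *ₚ cons c q ≡ scale c p +ₚ cons false (p *ₚ q)
*ₚ-cons p c q = Poly-ind (λ p → p *ₚ cons c q ≡ scale c p +ₚ cons false (p *ₚ q))
  (base c) step p
  where
  base : ∀ c → 𝟘 ≡ scale c 𝟘 +ₚ 𝟘
  base false = refl
  base true  = refl
  swap : ∀ b c p q r →
         scale b (cons c q) +ₚ cons false (scale c p +ₚ cons false r) ≡
         scale c (cons b p) +ₚ cons false (scale b q +ₚ cons false r)
  swap false false p q r = refl
  swap false true  p q r = sym (cons-+ₚ false p false (cons false r))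
  swap true  false p q r = cons-+ₚ false q false (cons false r)
  swap true  true  p q r = begin
    cons true q +ₚ cons false (p +ₚ cons false r)  ≡⟨ cons-+ₚ true q false _ ⟩
    cons true (q +ₚ (p +ₚ cons false r))           ≡⟨ cong (cons true) (sym (+ₚ-assoc q p _)) ⟩
    cons true ((q +ₚ p) +ₚ cons false r)           ≡⟨ cong (λ s → cons true (s +ₚ cons false r)) (+ₚ-comm q p) ⟩
    cons true ((p +ₚ q) +ₚ cons false r)           ≡⟨ cong (cons true) (+ₚ-assoc p q _) ⟩
    cons true (p +ₚ (q +ₚ cons false r))           ≡⟨ sym (cons-+ₚ true p false _) ⟩
    cons true p +ₚ cons false (q +ₚ cons false r)  ∎
  step : ∀ b p → p *ₚ cons c q ≡ scale c p +ₚ cons false (p *ₚ q) →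
         cons b p *ₚ cons c q ≡ scale c (cons b p) +ₚ cons false (cons b p *ₚ q)
  step b p ih = begin
    cons b p *ₚ cons c q                                              ≡⟨ cons-*ₚ b p _ ⟩
    scale b (cons c q) +ₚ cons false (p *ₚ cons c q)                  ≡⟨ cong (λ s → scale b (cons c q) +ₚ cons false s) ih ⟩
    scale b (cons c q) +ₚ cons false (scale c p +ₚ cons false (p *ₚ q)) ≡⟨ swap b c p q (p *ₚ q) ⟩
    scale c (cons b p) +ₚ cons false (scale b q +ₚ cons false (p *ₚ q)) ≡⟨ cong (λ s → scale c (cons b p) +ₚ cons false s) (sym (cons-*ₚ b p q)) ⟩
    scale c (cons b p) +ₚ cons false (cons b p *ₚ q)                  ∎

*ₚ-comm : ∀ p q → p *ₚ q ≡ q *ₚ p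
*ₚ-comm = Poly-ind _ (λ q → sym (*ₚ-zeroʳ q)) λ b p ih q → begin
  cons b p *ₚ q                       ≡⟨ cons-*ₚ b p q ⟩
  scale b q +ₚ cons false (p *ₚ q)    ≡⟨ cong (λ s → scale b q +ₚ cons false s) (ih q) ⟩
  scale b q +ₚ cons false (q *ₚ p)    ≡⟨ sym (*ₚ-cons q b p) ⟩
  q *ₚ cons b p                       ∎

*ₚ-assoc : ∀ p q r → (p *ₚ q) *ₚ r ≡ p *ₚ (q *ₚ r)
*ₚ-assoc = Poly-ind _ (λ q r → refl) λ b p ih q r → begin
  (cons b p *ₚ q) *ₚ r                              ≡⟨ cong (_*ₚ r) (cons-*ₚ b p q) ⟩
  (scale b q +ₚ cons false (p *ₚ q)) *ₚ r           ≡⟨ *ₚ-distribʳ r (scale b q) _ ⟩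
  scale b q *ₚ r +ₚ cons false (p *ₚ q) *ₚ r        ≡⟨ cong₂ _+ₚ_ (scale-*ₚ b q r) (cons-*ₚ false (p *ₚ q) r) ⟩
  scale b (q *ₚ r) +ₚ cons false ((p *ₚ q) *ₚ r)    ≡⟨ cong (λ s → scale b (q *ₚ r) +ₚ cons false s) (ih q r) ⟩
  scale b (q *ₚ r) +ₚ cons false (p *ₚ (q *ₚ r))    ≡⟨ sym (cons-*ₚ b p (q *ₚ r)) ⟩
  cons b p *ₚ (q *ₚ r)                              ∎
  where
  scale-*ₚ : ∀ b q r → scale b q *ₚ r ≡ scale b (q *ₚ r)
  scale-*ₚ false q r = refl
  scale-*ₚ true  q r = refl

*ₚ-identityʳ : ∀ p → p *ₚ 𝟙 ≡ p
*ₚ-identityʳ p = *ₚ-comm p 𝟙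

*ₚ-distribˡ : ∀ p q r → p *ₚ (q +ₚ r) ≡ p *ₚ q +ₚ p *ₚ r
*ₚ-distribˡ p q r = begin
  p *ₚ (q +ₚ r)     ≡⟨ *ₚ-comm p _ ⟩
  (q +ₚ r) *ₚ p     ≡⟨ *ₚ-distribʳ p q r ⟩
  q *ₚ p +ₚ r *ₚ p  ≡⟨ cong₂ _+ₚ_ (*ₚ-comm q p) (*ₚ-comm r p) ⟩
  p *ₚ q +ₚ p *ₚ r  ∎

Poly-commutativeSemiring : CommutativeSemiring _ _
Poly-commutativeSemiring = record
  { Carrier = Poly ; _≈_ = _≡_ ; _+_ = _+ₚ_ ; _*_ = _*ₚ_ ; 0# = 𝟘 ; 1# = 𝟙
  ; isCommutativeSemiring = record
    { isSemiring = record
      { isSemiringWithoutAnnihilatingZero = record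
        { +-isCommutativeMonoid = record
          { isMonoid = record
            { isSemigroup = record
              { isMagma = record { isEquivalence = isEquivalence ; ∙-cong = cong₂ _+ₚ_ }
              ; assoc = +ₚ-assoc }
            ; identity = (λ _ → refl) , +ₚ-identityʳ }
          ; comm = +ₚ-comm }
        ; *-cong = cong₂ _*ₚ_
        ; *-assoc = *ₚ-assoc
        ; *-identity = (λ _ → refl) , *ₚ-identityʳ
        ; distrib = *ₚ-distribˡ , *ₚ-distribʳ }
      ; zero = (λ _ → refl) , *ₚ-zeroʳ }
    ; *-comm = *ₚ-comm } }

𝔽₂ : RawRing _ _
𝔽₂ = record { Carrier = Bool ; _≈_ = _≡_ ; _+_ = _xor_ ; _*_ = _∧_ ; -_ = id ; 0# = false ; 1# = true }

-- Taking coefficients in 𝔽₂ (with negation the identity) lets the solver use p + p = 0.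
constants : 𝔽₂ -Raw-AlmostCommutative⟶ fromCommutativeSemiring Poly-commutativeSemiring
constants = record
  { ⟦_⟧    = const
  ; +-homo = λ { false false → refl ; false true → refl ; true false → refl ; true true → refl }
  ; *-homo = λ { false false → refl ; false true → refl ; true false → refl ; true true → refl }
  ; -‿homo = λ _ → refl
  ; 0-homo = refl
  ; 1-homo = refl
  }

same-constant : ∀ a b → Maybe (const a ≡ const b)
same-constant false false = just refl
same-constant true  true  = just refl
same-constant _     _     = nothing

import Algebra.Solver.Ring
open Algebra.Solver.Ring 𝔽₂ (fromCommutativeSemiring Poly-commutativeSemiring) constants same-constant
  using (solve; _:=_; _:+_; _:*_; _:^_; con)

-- Degree, division with remainder and Euclid's lemma

degNz : Nz → ℕ
degNz one      = 0
degNz (_ ∷ₙ p) = suc (degNz p)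

deg : Poly → ℕ
deg 𝟘      = 0
deg (nz p) = degNz p

-- Unlike deg, this tells 𝟘 from 𝟙.
size : Poly → ℕ
size 𝟘      = 0
size (nz p) = suc (degNz p)

size≡suc-deg : ∀ {p} → p ≢ 𝟘 → size p ≡ suc (deg p)
size≡suc-deg {𝟘}    p≢𝟘 = contradiction refl p≢𝟘
size≡suc-deg {nz _} _   = refl

_≟ₚ_ : (p q : Poly) → Dec (p ≡ q)
𝟘    ≟ₚ 𝟘    = yes refl
𝟘    ≟ₚ nz _ = no λ ()
nz _ ≟ₚ 𝟘    = no λ ()
nz p ≟ₚ nz q = go p q
  where
  go : (p q : Nz) → Dec (nz p ≡ nz q)
  go one      one      = yes refl
  go one      (_ ∷ₙ _) = no λ ()
  go (_ ∷ₙ _) one      = no λ ()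
  go (a ∷ₙ p) (b ∷ₙ q) with a Bool.≟ b | go p q
  ... | yes refl | yes refl = yes refl
  ... | no a≢b   | _        = no λ { refl → a≢b refl }
  ... | _        | no p≢q   = no λ { refl → p≢q refl }

deg≡0⇒≡𝟙 : ∀ {p} → p ≢ 𝟘 → deg p ≡ 0 → p ≡ 𝟙
deg≡0⇒≡𝟙 {𝟘}      p≢𝟘 _ = contradiction refl p≢𝟘
deg≡0⇒≡𝟙 {nz one} _   _ = refl

size-cons : ∀ b p → size (cons b p) ≤ suc (size p)
size-cons false 𝟘      = z≤n
size-cons true  𝟘      = ℕ.≤-refl
size-cons false (nz p) = ℕ.≤-refl
size-cons true  (nz p) = ℕ.≤-refl

size-tl : ∀ {n} p → size p ≤ suc n → size (tl p) ≤ n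
size-tl 𝟘             _         = z≤n
size-tl (nz one)      _         = z≤n
size-tl (nz (_ ∷ₙ p)) (s≤s le) = le

size-+ₚ : ∀ n p q → size p ≤ n → size q ≤ n → size (p +ₚ q) ≤ n
size-+ₚ zero    𝟘 𝟘 _  _  = z≤n
size-+ₚ (suc n) p q le le′ = subst (λ s → size s ≤ suc n)
  (trans (sym (cons-+ₚ (hd p) (tl p) (hd q) (tl q))) (cong₂ _+ₚ_ (cons-hd-tl p) (cons-hd-tl q)))
  (ℕ.≤-trans (size-cons (hd p xor hd q) _) (s≤s (size-+ₚ n (tl p) (tl q) (size-tl p le) (size-tl q le′))))

-- The leading terms cancel, so the size drops strictly. This completes a step of long division in
-- `divMod`.
addNz-deg≡ : ∀ p q → degNz p ≡ degNz q → size (addNz p q) ≤ degNz q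
addNz-deg≡ one      one      _  = z≤n
addNz-deg≡ (a ∷ₙ p) (b ∷ₙ q) eq =
  ℕ.≤-trans (size-cons (a xor b) (addNz p q)) (s≤s (addNz-deg≡ p q (ℕ.suc-injective eq)))

addNz-deg< : ∀ p q → degNz p < degNz q → ∃[ r ] addNz p q ≡ nz r × degNz r ≡ degNz q
addNz-deg< one      (b ∷ₙ q) _        = not b ∷ₙ q , refl , refl
addNz-deg< (a ∷ₙ p) (b ∷ₙ q) (s≤s lt) with addNz-deg< p q lt
... | r , eq , d rewrite eq = (a xor b) ∷ₙ r , cons-nz (a xor b) r , cong suc d
  where
  cons-nz : ∀ b r → cons b (nz r) ≡ nz (b ∷ₙ r)
  cons-nz false r = refl
  cons-nz true  r = refl

mulNz-deg : ∀ p q → ∃[ r ] mulNz p (nz q) ≡ nz r × degNz r ≡ degNz p + degNz q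
mulNz-deg one      q = q , refl , refl
mulNz-deg (b ∷ₙ p) q with mulNz-deg p q
... | r , eq , d rewrite eq = go b
  where
  go : ∀ b → ∃[ s ] scale b (nz q) +ₚ nz (false ∷ₙ r) ≡ nz s × degNz s ≡ suc (degNz p + degNz q)
  go false = false ∷ₙ r , refl , cong suc d
  go true with addNz-deg< q (false ∷ₙ r) (s≤s (subst (degNz q ≤_) (sym d) (ℕ.m≤n+m (degNz q) (degNz p))))
  ... | s , eq′ , d′ = s , eq′ , trans d′ (cong suc d)

*ₚ-nonzero : ∀ {p q} → p ≢ 𝟘 → q ≢ 𝟘 → p *ₚ q ≢ 𝟘
*ₚ-nonzero {𝟘}    {_}    p≢𝟘 _   _  = p≢𝟘 refl
*ₚ-nonzero {nz _} {𝟘}    _   q≢𝟘 _  = q≢𝟘 refl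
*ₚ-nonzero {nz p} {nz q} _   _   eq with trans (sym (proj₁ (proj₂ (mulNz-deg p q)))) eq
... | ()

deg-*ₚ : ∀ {p q} → p ≢ 𝟘 → q ≢ 𝟘 → deg (p *ₚ q) ≡ deg p + deg q
deg-*ₚ {𝟘}    {_}    p≢𝟘 _   = contradiction refl p≢𝟘
deg-*ₚ {nz _} {𝟘}    _   q≢𝟘 = contradiction refl q≢𝟘
deg-*ₚ {nz p} {nz q} _   _   = let _ , eq , d = mulNz-deg p q in trans (cong deg eq) d

deg-+ₚ-< : ∀ p q → q ≢ 𝟘 → deg p < deg q → deg (p +ₚ q) ≡ deg q × p +ₚ q ≢ 𝟘
deg-+ₚ-< 𝟘      q      q≢𝟘 _  = refl , q≢𝟘
deg-+ₚ-< (nz p) 𝟘      q≢𝟘 _  = contradiction refl q≢𝟘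
deg-+ₚ-< (nz p) (nz q) _   lt with addNz-deg< p q lt
... | r , eq , d rewrite eq = d , λ ()

+ₚ-zero⇒≡ : ∀ p q → p +ₚ q ≡ 𝟘 → p ≡ q
+ₚ-zero⇒≡ p q eq = begin
  p               ≡⟨ solve 2 (λ p q → p := (p :+ q) :+ q) refl p q ⟩
  (p +ₚ q) +ₚ q   ≡⟨ cong (_+ₚ q) eq ⟩
  q               ∎

≡⇒+ₚ-zero : ∀ {p q} → p ≡ q → p +ₚ q ≡ 𝟘
≡⇒+ₚ-zero {p} refl = +ₚ-self p

*ₚ-cancelˡ : ∀ p q r → p ≢ 𝟘 → p *ₚ q ≡ p *ₚ r → q ≡ r
*ₚ-cancelˡ p q r p≢𝟘 eq with (q +ₚ r) ≟ₚ 𝟘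
... | yes z = +ₚ-zero⇒≡ q r z
... | no q+r≢𝟘 = contradiction (trans (*ₚ-distribˡ p q r) (≡⇒+ₚ-zero eq)) (*ₚ-nonzero p≢𝟘 q+r≢𝟘)

-- A record version of _∣ₚ_: from p ∣ₚ q, which unfolds to a Σ-type, Agda cannot infer p.
infix 4 _∣_

record _∣_ (p q : Poly) : Set where
  constructor divides
  field
    quotient : Poly
    equality : p *ₚ quotient ≡ q

to∣ₚ : ∀ {p q} → p ∣ q → p ∣ₚ q
to∣ₚ (divides s eq) = s , eq

from∣ₚ : ∀ {p q} → p ∣ₚ q → p ∣ q
from∣ₚ (s , eq) = divides s eq

∣-refl : ∀ p → p ∣ p
∣-refl p = divides 𝟙 (*ₚ-identityʳ p)

∣-trans : ∀ {p q r} → p ∣ q → q ∣ r → p ∣ r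
∣-trans {p} (divides s refl) (divides t refl) = divides (s *ₚ t) (sym (*ₚ-assoc p s t))

∣-+ₚ : ∀ {p q r} → p ∣ q → p ∣ r → p ∣ q +ₚ r
∣-+ₚ {p} (divides s refl) (divides t refl) = divides (s +ₚ t) (*ₚ-distribˡ p s t)

∣-*ʳ : ∀ {p q} r → p ∣ q → p ∣ q *ₚ r
∣-*ʳ {p} r (divides s refl) = divides (s *ₚ r) (sym (*ₚ-assoc p s r))

∣-*ˡ : ∀ {p q} r → p ∣ q → p ∣ r *ₚ q
∣-*ˡ {p} {q} r p∣q = subst (p ∣_) (*ₚ-comm q r) (∣-*ʳ r p∣q)

p∣p*q : ∀ p q → p ∣ p *ₚ q
p∣p*q p q = divides q refl

𝟙∣ : ∀ p → 𝟙 ∣ p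
𝟙∣ p = divides p refl

∣𝟘 : ∀ p → p ∣ 𝟘
∣𝟘 p = divides 𝟘 (*ₚ-zeroʳ p)

∣-+ₚ-cancel : ∀ {p} q r → p ∣ q +ₚ r → p ∣ q → p ∣ r
∣-+ₚ-cancel {p} q r p∣q+r p∣q =
  subst (p ∣_) (solve 2 (λ q r → (q :+ r) :+ q := r) refl q r) (∣-+ₚ p∣q+r p∣q)

factor-nonzeroˡ : ∀ {p q r} → p *ₚ q ≡ r → r ≢ 𝟘 → p ≢ 𝟘
factor-nonzeroˡ refl r≢𝟘 refl = r≢𝟘 refl

factor-nonzeroʳ : ∀ {p q r} → p *ₚ q ≡ r → r ≢ 𝟘 → q ≢ 𝟘
factor-nonzeroʳ {p} refl r≢𝟘 refl = r≢𝟘 (*ₚ-zeroʳ p)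

deg-∣ : ∀ {p q} → q ≢ 𝟘 → p ∣ q → deg p ≤ deg q
deg-∣ {p} q≢𝟘 (divides s refl) =
  subst (deg p ≤_) (sym (deg-*ₚ (factor-nonzeroˡ {p} refl q≢𝟘) (factor-nonzeroʳ {p} refl q≢𝟘))) (ℕ.m≤m+n _ _)

∣-deg≡⇒≡ : ∀ {p q} → q ≢ 𝟘 → p ∣ q → deg q ≤ deg p → p ≡ q
∣-deg≡⇒≡ {p} q≢𝟘 (divides s refl) le =
  trans (sym (*ₚ-identityʳ p)) (cong (p *ₚ_) (sym (deg≡0⇒≡𝟙 s≢𝟘 (ℕ.n≤0⇒n≡0 (ℕ.+-cancelˡ-≤ (deg p) (deg s) 0
    (subst (deg p + deg s ≤_) (sym (ℕ.+-identityʳ (deg p))) (subst (_≤ deg p) (deg-*ₚ p≢𝟘 s≢𝟘) le)))))))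
  where
  p≢𝟘 = factor-nonzeroˡ {p} refl q≢𝟘
  s≢𝟘 = factor-nonzeroʳ {p} refl q≢𝟘

∣𝟙⇒≡𝟙 : ∀ {p} → p ∣ 𝟙 → p ≡ 𝟙
∣𝟙⇒≡𝟙 p∣𝟙 = ∣-deg≡⇒≡ (λ ()) p∣𝟙 z≤n

-- Horner's scheme on the dividend: if a = b q + r, then `cons c a` has quotient `cons false q` and
-- remainder `cons c r`, and this remainder is too large by at most one degree, which a single
-- subtraction of b repairs.
divMod : ∀ a b → b ≢ 𝟘 → ∃[ q ] ∃[ r ] a ≡ b *ₚ q +ₚ r × size r < size b
divMod a 𝟘        b≢𝟘 = contradiction refl b≢𝟘
divMod a b@(nz b′) b≢𝟘 = Poly-ind (λ a → ∃[ q ] ∃[ r ] a ≡ b *ₚ q +ₚ r × size r < size b)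
  (𝟘 , 𝟘 , sym (trans (+ₚ-identityʳ _) (*ₚ-zeroʳ b)) , s≤s z≤n) step a
  where
  step : ∀ c a → (∃[ q ] ∃[ r ] a ≡ b *ₚ q +ₚ r × size r < size b) →
         ∃[ q ] ∃[ r ] cons c a ≡ b *ₚ q +ₚ r × size r < size b
  step c .(b *ₚ q +ₚ r) (q , r , refl , lt) = finish (cons c r) refl
    where
    r″ = cons c r
    eq : cons c (b *ₚ q +ₚ r) ≡ b *ₚ cons false q +ₚ r″
    eq = begin
      cons c (b *ₚ q +ₚ r)                ≡⟨ cons-+ₚ false (b *ₚ q) c r ⟨
      cons false (b *ₚ q) +ₚ cons c r     ≡⟨ cong (_+ₚ cons c r) (*ₚ-cons b false q) ⟨
      b *ₚ cons false q +ₚ cons c r       ∎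
    le : size r″ ≤ size b
    le = ℕ.≤-trans (size-cons c r) lt
    finish : ∀ s → s ≡ r″ → ∃[ q′ ] ∃[ r′ ] cons c (b *ₚ q +ₚ r) ≡ b *ₚ q′ +ₚ r′ × size r′ < size b
    finish 𝟘 s≡ = cons false q , 𝟘 , trans eq (cong (b *ₚ cons false q +ₚ_) (sym s≡)) , s≤s z≤n
    finish (nz s) s≡ with degNz s <? degNz b′
    ... | yes d<d = cons false q , nz s , trans eq (cong (b *ₚ cons false q +ₚ_) (sym s≡)) , s≤s d<d
    ... | no d≮d = cons false q +ₚ 𝟙 , nz s +ₚ b , trans eq (trans (cong (b *ₚ cons false q +ₚ_) (sym s≡)) eq′)
                 , s≤s (addNz-deg≡ s b′ (ℕ.≤-antisym (s≤s⁻¹ (subst (λ t → size t ≤ size b) (sym s≡) le)) (ℕ.≮⇒≥ d≮d)))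
      where
      eq′ : b *ₚ cons false q +ₚ nz s ≡ b *ₚ (cons false q +ₚ 𝟙) +ₚ (nz s +ₚ b)
      eq′ = solve 3 (λ b q s → b :* q :+ s := b :* (q :+ con true) :+ (s :+ b)) refl b (cons false q) (nz s)

_∣?_ : ∀ p q → Dec (p ∣ q)
𝟘      ∣? 𝟘      = yes (divides 𝟘 refl)
𝟘      ∣? nz _   = no λ { (divides _ ()) }
p@(nz _) ∣? a with divMod a p (λ ())
... | q , 𝟘 , eq , _ = yes (divides q (sym (trans eq (+ₚ-identityʳ _))))
... | q , r@(nz r′) , eq , lt = no λ p∣a → ℕ.<⇒≱ (s<s⁻¹ lt)
  (deg-∣ {p} {r} (λ ()) (∣-+ₚ-cancel (p *ₚ q) r (subst (p ∣_) eq p∣a) (p∣p*q p q)))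

deg≡1⇒irreducible : ∀ {p} → deg p ≡ 1 → Irreducible p
deg≡1⇒irreducible {p} d = p≢𝟘 , (λ { refl → case d of λ () }) , divisors
  where
  p≢𝟘 : p ≢ 𝟘
  p≢𝟘 refl = case d of λ ()
  divisors : ∀ e → e ∣ₚ p → e ≡ 𝟙 ⊎ e ≡ p
  divisors e e∣p with deg e in de
  ... | zero  = inj₁ (deg≡0⇒≡𝟙 (factor-nonzeroˡ (proj₂ e∣p) p≢𝟘) de)
  ... | suc n = inj₂ (∣-deg≡⇒≡ p≢𝟘 (from∣ₚ e∣p) (subst₂ _≤_ (sym d) (sym de) (s≤s z≤n)))

euclid : ∀ {p} a b → Irreducible p → p ∣ a *ₚ b → p ∣ a ⊎ p ∣ b
euclid {p} a b (p≢𝟘 , p≢𝟙 , div) p∣ab with divMod a p p≢𝟘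
... | q , r , eq , lt = reduce r eq lt
  where
  -- The multipliers c with p ∣ c b form an ideal; the Euclidean algorithm on p and c stays in it.
  go : ∀ c → Acc _<_ (size c) → c ≢ 𝟘 → size c < size p → p ∣ c *ₚ b → p ∣ b
  go c (acc rec) c≢𝟘 lt p∣cb with divMod p c c≢𝟘
  ... | q , r , eq , r<c with r ≟ₚ 𝟘
  ... | yes refl with div c (q , sym (trans eq (+ₚ-identityʳ _)))
  ... | inj₁ refl = p∣cb
  ... | inj₂ refl = contradiction lt (ℕ.<-irrefl refl)
  go c (acc rec) c≢𝟘 lt p∣cb | q , r , eq , r<c | no r≢𝟘 =
    go r (rec r<c) r≢𝟘 (ℕ.<-trans r<c lt) (∣-+ₚ-cancel (c *ₚ b *ₚ q) (r *ₚ b) p∣ (∣-*ʳ q p∣cb))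
    where
    p∣ : p ∣ c *ₚ b *ₚ q +ₚ r *ₚ b
    p∣ = divides b (trans (cong (_*ₚ b) eq) (solve 4 (λ b c q r → (c :* q :+ r) :* b := c :* b :* q :+ r :* b) refl b c q r))
  reduce : ∀ r {q} → a ≡ p *ₚ q +ₚ r → size r < size p → p ∣ a ⊎ p ∣ b
  reduce r {q} eq lt with r ≟ₚ 𝟘
  ... | yes refl = inj₁ (divides q (sym (trans eq (+ₚ-identityʳ _))))
  ... | no r≢𝟘   = inj₂ (go r (<-wellFounded _) r≢𝟘 lt (∣-+ₚ-cancel (p *ₚ q *ₚ b) (r *ₚ b)
        (subst (p ∣_) (trans (cong (_*ₚ b) eq) (*ₚ-distribʳ b (p *ₚ q) r)) p∣ab)
        (∣-*ʳ b (p∣p*q p q))))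

-- Powers and multiplicities of irreducible factors

^ₚ-+ : ∀ p m n → p ^ₚ (m + n) ≡ p ^ₚ m *ₚ p ^ₚ n
^ₚ-+ p zero    n = refl
^ₚ-+ p (suc m) n = trans (cong (p *ₚ_) (^ₚ-+ p m n)) (sym (*ₚ-assoc p _ _))

*ₚ-^ₚ : ∀ p q n → (p *ₚ q) ^ₚ n ≡ p ^ₚ n *ₚ q ^ₚ n
*ₚ-^ₚ p q zero    = refl
*ₚ-^ₚ p q (suc n) = trans (cong (p *ₚ q *ₚ_) (*ₚ-^ₚ p q n))
  (solve 4 (λ p q r s → p :* q :* (r :* s) := p :* r :* (q :* s)) refl p q (p ^ₚ n) (q ^ₚ n))

𝟙-^ₚ : ∀ n → 𝟙 ^ₚ n ≡ 𝟙
𝟙-^ₚ zero    = refl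
𝟙-^ₚ (suc n) = 𝟙-^ₚ n

^ₚ-* : ∀ p m n → p ^ₚ (m * n) ≡ (p ^ₚ m) ^ₚ n
^ₚ-* p zero    n = sym (𝟙-^ₚ n)
^ₚ-* p (suc m) n = begin
  p ^ₚ (n + m * n)         ≡⟨ ^ₚ-+ p n (m * n) ⟩
  p ^ₚ n *ₚ p ^ₚ (m * n)   ≡⟨ cong (p ^ₚ n *ₚ_) (^ₚ-* p m n) ⟩
  p ^ₚ n *ₚ (p ^ₚ m) ^ₚ n  ≡⟨ *ₚ-^ₚ p (p ^ₚ m) n ⟨
  (p *ₚ p ^ₚ m) ^ₚ n       ∎

^ₚ-1 : ∀ p → p ^ₚ 1 ≡ p
^ₚ-1 = *ₚ-identityʳ

^ₚ-nonzero : ∀ {p} n → p ≢ 𝟘 → p ^ₚ n ≢ 𝟘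
^ₚ-nonzero zero    _   = λ ()
^ₚ-nonzero (suc n) p≢𝟘 = *ₚ-nonzero p≢𝟘 (^ₚ-nonzero n p≢𝟘)

deg-^ₚ : ∀ {p} n → p ≢ 𝟘 → deg (p ^ₚ n) ≡ n * deg p
deg-^ₚ zero    _   = refl
deg-^ₚ (suc n) p≢𝟘 = trans (deg-*ₚ p≢𝟘 (^ₚ-nonzero n p≢𝟘)) (cong (_ +_) (deg-^ₚ n p≢𝟘))

∣-^ₚ⇒∣ : ∀ {p} q n → Irreducible p → p ∣ q ^ₚ n → p ∣ q
∣-^ₚ⇒∣ q zero    (_ , p≢𝟙 , _) p∣𝟙 = contradiction (∣𝟙⇒≡𝟙 p∣𝟙) p≢𝟙
∣-^ₚ⇒∣ q (suc n) irr p∣ with euclid q (q ^ₚ n) irr p∣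
... | inj₁ p∣q  = p∣q
... | inj₂ p∣qⁿ = ∣-^ₚ⇒∣ q n irr p∣qⁿ

irreducible-∣⇒≡ : ∀ {p q} → Irreducible p → Irreducible q → p ∣ q → p ≡ q
irreducible-∣⇒≡ (_ , p≢𝟙 , _) (_ , _ , div) p∣q with div _ (to∣ₚ p∣q)
... | inj₁ p≡𝟙 = contradiction p≡𝟙 p≢𝟙
... | inj₂ p≡q = p≡q

irreducible⇒deg>0 : ∀ {p} → Irreducible p → 0 < deg p
irreducible⇒deg>0 {p} (p≢𝟘 , p≢𝟙 , _) with deg p in d
... | zero  = contradiction (deg≡0⇒≡𝟙 p≢𝟘 d) p≢𝟙
... | suc _ = s≤s z≤n

valuation : ∀ {p} A → Irreducible p → A ≢ 𝟘 → ∃[ e ] ∃[ B ] A ≡ p ^ₚ e *ₚ B × ¬ p ∣ B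
valuation {p} A irr A≢𝟘 = go A (<-wellFounded _) A≢𝟘
  where
  go : ∀ A → Acc _<_ (deg A) → A ≢ 𝟘 → ∃[ e ] ∃[ B ] A ≡ p ^ₚ e *ₚ B × ¬ p ∣ B
  go A (acc rec) A≢𝟘 with p ∣? A
  ... | no p∤A = 0 , A , refl , p∤A
  ... | yes (divides C refl) with go C (rec C<A) (factor-nonzeroʳ {p} refl A≢𝟘)
    where
    C<A : deg C < deg (p *ₚ C)
    C<A = subst (deg C <_) (sym (deg-*ₚ (proj₁ irr) (factor-nonzeroʳ {p} refl A≢𝟘)))
            (ℕ.+-monoˡ-≤ (deg C) (irreducible⇒deg>0 irr))
  ... | e , B , refl , p∤B = suc e , B , sym (*ₚ-assoc p (p ^ₚ e) B) , p∤B

valuation-unique : ∀ {p} e f {B C} → Irreducible p → ¬ p ∣ B → ¬ p ∣ C →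
                   p ^ₚ e *ₚ B ≡ p ^ₚ f *ₚ C → e ≡ f × B ≡ C
valuation-unique zero    zero    irr p∤B p∤C eq = refl , eq
valuation-unique {p} zero (suc f) {_} {C} irr p∤B p∤C eq =
  contradiction (divides (p ^ₚ f *ₚ C) (trans (sym (*ₚ-assoc p _ C)) (sym eq))) p∤B
valuation-unique {p} (suc e) zero {B} irr p∤B p∤C eq =
  contradiction (divides (p ^ₚ e *ₚ B) (trans (sym (*ₚ-assoc p _ B)) eq)) p∤C
valuation-unique {p} (suc e) (suc f) {B} {C} irr p∤B p∤C eq =
  let e≡f , B≡C = valuation-unique e f irr p∤B p∤C
        (*ₚ-cancelˡ p _ _ (proj₁ irr) (trans (sym (*ₚ-assoc p (p ^ₚ e) B)) (trans eq (*ₚ-assoc p (p ^ₚ f) C))))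
  in cong suc e≡f , B≡C

∤-*ₚ : ∀ {p a b} → Irreducible p → ¬ p ∣ a → ¬ p ∣ b → ¬ p ∣ a *ₚ b
∤-*ₚ {a = a} {b} irr p∤a p∤b p∣ab with euclid a b irr p∣ab
... | inj₁ p∣a = p∤a p∣a
... | inj₂ p∣b = p∤b p∣b

-- Peels one prime off a factorisation. Divisors of monomials and bi-unitary divisors are both
-- handled by this reduction to the cofactor M.
split-prime-power : ∀ {p} e {M} E R → Irreducible p → ¬ p ∣ M → M ≢ 𝟘 → E *ₚ R ≡ p ^ₚ e *ₚ M →
  ∃[ e₁ ] ∃[ e₂ ] ∃[ E′ ] ∃[ R′ ] E ≡ p ^ₚ e₁ *ₚ E′ × R ≡ p ^ₚ e₂ *ₚ R′ × e₁ + e₂ ≡ e × E′ *ₚ R′ ≡ M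
split-prime-power {p} e {M} E R irr p∤M M≢𝟘 eq
  with valuation E irr (factor-nonzeroˡ {E} eq p^eM≢𝟘) | valuation R irr (factor-nonzeroʳ {E} eq p^eM≢𝟘)
  where
  p^eM≢𝟘 : p ^ₚ e *ₚ M ≢ 𝟘
  p^eM≢𝟘 = *ₚ-nonzero (^ₚ-nonzero e (proj₁ irr)) M≢𝟘
... | e₁ , E′ , refl , p∤E′ | e₂ , R′ , refl , p∤R′ =
  e₁ , e₂ , E′ , R′ , refl , refl , valuation-unique (e₁ + e₂) e irr (∤-*ₚ irr p∤E′ p∤R′) p∤M (begin
    p ^ₚ (e₁ + e₂) *ₚ (E′ *ₚ R′)        ≡⟨ cong (_*ₚ (E′ *ₚ R′)) (^ₚ-+ p e₁ e₂) ⟩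
    p ^ₚ e₁ *ₚ p ^ₚ e₂ *ₚ (E′ *ₚ R′)    ≡⟨ solve 4 (λ a b c d → a :* b :* (c :* d) := a :* c :* (b :* d)) refl (p ^ₚ e₁) (p ^ₚ e₂) E′ R′ ⟩
    p ^ₚ e₁ *ₚ E′ *ₚ (p ^ₚ e₂ *ₚ R′)    ≡⟨ eq ⟩
    p ^ₚ e *ₚ M                         ∎)

-- Products of prime powers

mono : ∀ {n} → Vec Poly n → Vec ℕ n → Poly
mono []       []       = 𝟙
mono (p ∷ ps) (e ∷ es) = p ^ₚ e *ₚ mono ps es

data DistinctPrimes : ∀ {n} → Vec Poly n → Set where
  []    : DistinctPrimes []
  prime : ∀ {n} {p} {ps : Vec Poly n} → Irreducible p → VAll (p ≢_) ps → DistinctPrimes ps → DistinctPrimes (p ∷ ps)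

mono-nonzero : ∀ {n} {ps : Vec Poly n} → DistinctPrimes ps → ∀ es → mono ps es ≢ 𝟘
mono-nonzero []               []       = λ ()
mono-nonzero (prime irr _ dist) (e ∷ es) = *ₚ-nonzero (^ₚ-nonzero e (proj₁ irr)) (mono-nonzero dist es)

∤-mono : ∀ {n} {q} {ps : Vec Poly n} → Irreducible q → DistinctPrimes ps → VAll (q ≢_) ps → ∀ es → ¬ q ∣ mono ps es
∤-mono irr []                [] []       q∣𝟙 = proj₁ (proj₂ irr) (∣𝟙⇒≡𝟙 q∣𝟙)
∤-mono irr (prime irr′ _ dist) (q≢p ∷ q≢ps) (e ∷ es) =
  ∤-*ₚ irr (q≢p ∘ irreducible-∣⇒≡ irr irr′ ∘ ∣-^ₚ⇒∣ _ e irr) (∤-mono irr dist q≢ps es)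

mono-injective : ∀ {n} {ps : Vec Poly n} → DistinctPrimes ps → ∀ es fs → mono ps es ≡ mono ps fs → es ≡ fs
mono-injective []                  []       []       _  = refl
mono-injective (prime irr p≢ps dist) (e ∷ es) (f ∷ fs) eq =
  let e≡f , eq′ = valuation-unique e f irr (∤-mono irr dist p≢ps es) (∤-mono irr dist p≢ps fs) eq
  in cong₂ _∷_ e≡f (mono-injective dist es fs eq′)

∣-mono⇒mono : ∀ {n} {ps : Vec Poly n} → DistinctPrimes ps → ∀ es {E} → E ∣ mono ps es → ∃[ fs ] E ≡ mono ps fs
∣-mono⇒mono []                  []       E∣𝟙 = [] , ∣𝟙⇒≡𝟙 E∣𝟙
∣-mono⇒mono {ps = p ∷ ps} (prime irr p≢ps dist) (e ∷ es) {E} (divides R eq)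
  with split-prime-power e E R irr (∤-mono irr dist p≢ps es) (mono-nonzero dist es) eq
... | e₁ , _ , E′ , R′ , refl , _ , _ , eq′ =
  let fs , E′≡ = ∣-mono⇒mono dist es {E′} (divides R′ eq′) in e₁ ∷ fs , cong (p ^ₚ e₁ *ₚ_) E′≡

mono-* : ∀ {n} → (ps : Vec Poly n) → ∀ es fs → mono ps es *ₚ mono ps fs ≡ mono ps (zipWith _+_ es fs)
mono-* []       []       []       = refl
mono-* (p ∷ ps) (e ∷ es) (f ∷ fs) = begin
  p ^ₚ e *ₚ mono ps es *ₚ (p ^ₚ f *ₚ mono ps fs)
    ≡⟨ solve 4 (λ a b c d → a :* b :* (c :* d) := a :* c :* (b :* d)) refl (p ^ₚ e) (mono ps es) (p ^ₚ f) (mono ps fs) ⟩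
  p ^ₚ e *ₚ p ^ₚ f *ₚ (mono ps es *ₚ mono ps fs)
    ≡⟨ cong₂ _*ₚ_ (sym (^ₚ-+ p e f)) (mono-* ps es fs) ⟩
  p ^ₚ (e + f) *ₚ mono ps (zipWith _+_ es fs) ∎

mono-^ : ∀ {n} → (ps : Vec Poly n) → ∀ es m → mono ps es ^ₚ m ≡ mono ps (Vec.map (_* m) es)
mono-^ []       []       m = 𝟙-^ₚ m
mono-^ (p ∷ ps) (e ∷ es) m = trans (*ₚ-^ₚ (p ^ₚ e) (mono ps es) m) (cong₂ _*ₚ_ (sym (^ₚ-* p e m)) (mono-^ ps es m))

totalDeg : ∀ {n} → Vec Poly n → Vec ℕ n → ℕ
totalDeg []       []       = 0
totalDeg (p ∷ ps) (e ∷ es) = e * deg p + totalDeg ps es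

deg-mono : ∀ {n} {ps : Vec Poly n} → DistinctPrimes ps → ∀ es → deg (mono ps es) ≡ totalDeg ps es
deg-mono []               []       = refl
deg-mono (prime irr _ dist) (e ∷ es) =
  trans (deg-*ₚ (^ₚ-nonzero e (proj₁ irr)) (mono-nonzero dist es)) (cong₂ _+_ (deg-^ₚ e (proj₁ irr)) (deg-mono dist es))

factor-out : ∀ {n} {ps : Vec Poly n} → DistinctPrimes ps → ∀ A → A ≢ 𝟘 → ∃[ es ] ∃[ B ] A ≡ mono ps es *ₚ B × VAll (λ p → ¬ p ∣ B) ps
factor-out []               A _   = [] , A , refl , []
factor-out {ps = p ∷ ps} (prime irr _ dist) A A≢𝟘 with valuation A irr A≢𝟘
... | e , C , refl , p∤C with factor-out dist C (factor-nonzeroʳ {p ^ₚ e} refl A≢𝟘)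
... | es , B , refl , ps∤B =
  e ∷ es , B , sym (*ₚ-assoc (p ^ₚ e) (mono ps es) B) , (λ p∣B → p∤C (∣-*ˡ (mono ps es) p∣B)) ∷ ps∤B

-- Every divisor of a polynomial without irreducible divisors again has none,
-- so a minimal counterexample would be irreducible itself.
no-irreducible-divisor⇒𝟙 : ∀ B → B ≢ 𝟘 → (∀ {p} → Irreducible p → ¬ p ∣ B) → B ≡ 𝟙
no-irreducible-divisor⇒𝟙 B B≢𝟘 none with B ≟ₚ 𝟙
... | yes B≡𝟙 = B≡𝟙
... | no B≢𝟙  = ⊥-elim (go B (<-wellFounded _) B≢𝟘 B≢𝟙 none)
  where
  go : ∀ B → Acc _<_ (deg B) → B ≢ 𝟘 → B ≢ 𝟙 → (∀ {p} → Irreducible p → ¬ p ∣ B) → ⊥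
  go B (acc rec) B≢𝟘 B≢𝟙 none = none (B≢𝟘 , B≢𝟙 , divisors) (∣-refl B)
    where
    divisors : ∀ D → D ∣ₚ B → D ≡ 𝟙 ⊎ D ≡ B
    divisors D D∣B with D ≟ₚ 𝟙 | D ≟ₚ B
    ... | yes D≡𝟙 | _       = inj₁ D≡𝟙
    ... | no _    | yes D≡B = inj₂ D≡B
    ... | no D≢𝟙  | no D≢B  = ⊥-elim (go D (rec (ℕ.≰⇒> (D≢B ∘ ∣-deg≡⇒≡ B≢𝟘 (from∣ₚ D∣B))))
      (factor-nonzeroˡ (proj₂ D∣B) B≢𝟘) D≢𝟙 (λ irr p∣D → none irr (∣-trans p∣D (from∣ₚ D∣B))))

prime-∣-mono⇒positive : ∀ {n} {ps : Vec Poly n} → DistinctPrimes ps → ∀ es → VAll (_∣ mono ps es) ps → ∃[ fs ] es ≡ Vec.map suc fs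
prime-∣-mono⇒positive []                  []       []              = [] , refl
prime-∣-mono⇒positive (prime irr p≢ps dist) (zero ∷ es)  (p∣ ∷ _)    = contradiction p∣ (∤-mono irr dist p≢ps es)
prime-∣-mono⇒positive {ps = p ∷ ps} (prime irr p≢ps dist) (suc e ∷ es) (_ ∷ ps∣) =
  let fs , es≡ = prime-∣-mono⇒positive dist es (strip dist p≢ps ps∣) in e ∷ fs , cong (suc e ∷_) es≡
  where
  strip : ∀ {m} {qs : Vec Poly m} {M} → DistinctPrimes qs → VAll (p ≢_) qs →
          VAll (_∣ p ^ₚ suc e *ₚ M) qs → VAll (_∣ M) qs
  strip [] [] [] = []
  strip {M = M} (prime irr′ _ dist) (p≢q ∷ p≢qs) (q∣ ∷ qs∣) with euclid (p ^ₚ suc e) M irr′ q∣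
  ... | inj₁ q∣pᵉ = contradiction (sym (irreducible-∣⇒≡ irr′ irr (∣-^ₚ⇒∣ p (suc e) irr′ q∣pᵉ))) p≢q
  ... | inj₂ q∣M  = q∣M ∷ strip dist p≢qs qs∣

-- The cofactor B left after removing the listed primes has no irreducible divisor: a listed one was
-- removed completely, and an unlisted one would divide A. The exponents are successors because each
-- listed prime divides A.
factorisation : ∀ {n} {ps : Vec Poly n} → DistinctPrimes ps → ∀ A → A ≢ 𝟘 → VAll (_∣ A) ps →
  (∀ {p} → Irreducible p → p ∣ A → ¬ VAll (p ≢_) ps) → ∃[ es ] A ≡ mono ps (Vec.map suc es)
factorisation {ps = ps} dist A A≢𝟘 ps∣A all-in with factor-out dist A A≢𝟘
... | es , B , refl , ps∤B = cont B≡𝟙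
  where
  avoids : ∀ {p m} {qs : Vec Poly m} → p ∣ B → VAll (λ q → ¬ q ∣ B) qs → VAll (p ≢_) qs
  avoids p∣B = VAll.map (λ { q∤B refl → q∤B p∣B })
  B≡𝟙 : B ≡ 𝟙
  B≡𝟙 = no-irreducible-divisor⇒𝟙 B (factor-nonzeroʳ {mono ps es} refl A≢𝟘)
    (λ irr p∣B → all-in irr (∣-*ˡ (mono ps es) p∣B) (avoids p∣B ps∤B))
  cont : B ≡ 𝟙 → ∃[ fs ] mono ps es *ₚ B ≡ mono ps (Vec.map suc fs)
  cont refl =
    let fs , es≡ = prime-∣-mono⇒positive dist es (VAll.map (subst (_ ∣_) (*ₚ-identityʳ _)) ps∣A)
    in fs , trans (*ₚ-identityʳ _) (cong (mono ps) es≡)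

-- Sums of bi-unitary divisors

geo : Poly → ℕ → Poly
geo p zero    = 𝟘
geo p (suc n) = p ^ₚ n +ₚ geo p n

upper lower : ℕ → ℕ
upper a = suc ⌊ a /2⌋
lower a = ⌈ a /2⌉

-- The exponents 0, …, a except a/2.
exponents : ℕ → List ℕ
exponents a = downFrom (lower a) ++ map (upper a +_) (downFrom (lower a))

-- The exponents form two blocks of length `lower a`, starting at 0 and at `upper a`; summing p^e
-- over them gives this product.
σ** : Poly → ℕ → Poly
σ** p a = (𝟙 +ₚ p ^ₚ upper a) *ₚ geo p (lower a)

upper+lower : ∀ a → upper a + lower a ≡ suc a
upper+lower a = cong suc (ℕ.⌊n/2⌋+⌈n/2⌉≡n a)

lower≤upper : ∀ a → lower a ≤ upper a
lower≤upper zero          = z≤n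
lower≤upper (suc zero)    = ℕ.≤-refl
lower≤upper (suc (suc a)) = s≤s (lower≤upper a)

upper≤suc-lower : ∀ a → upper a ≤ suc (lower a)
upper≤suc-lower a = s≤s (ℕ.⌊n/2⌋≤⌈n/2⌉ a)

∈-exponents⁻ : ∀ a e → e ∈ exponents a → ∃[ f ] e + f ≡ a × e ≢ f
∈-exponents⁻ a e e∈ with ∈-++⁻ (downFrom (lower a)) e∈
... | inj₁ e∈ˡ =
  let e<t   = ∈-downFrom⁻ e∈ˡ
      e<s   = ℕ.≤-trans e<t (lower≤upper a)
      2+2e≤ = subst (suc e + suc e ≤_) (upper+lower a) (ℕ.+-mono-≤ e<s e<t)
      f , e+f≡a = ℕ.m≤n⇒∃[o]m+o≡n (ℕ.≤-trans (ℕ.m≤m+n e (suc e)) (s≤s⁻¹ 2+2e≤))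
  in f , e+f≡a , λ e≡f → ℕ.<-irrefl (trans (cong (e +_) e≡f) e+f≡a) (subst (_≤ a) (ℕ.+-suc e e) (s≤s⁻¹ 2+2e≤))
... | inj₂ e∈ʳ with ∈-map⁻ (upper a +_) e∈ʳ
... | e′ , e′∈ , refl =
  let e′<t = ∈-downFrom⁻ e′∈
      f , eq = ℕ.m≤n⇒∃[o]m+o≡n e′<t
  in f , ℕ.suc-injective (trans (cong suc (ℕ.+-assoc (upper a) e′ f))
           (trans (sym (ℕ.+-suc (upper a) (e′ + f))) (trans (cong (upper a +_) eq) (upper+lower a))))
       , λ e≡f → ℕ.<-irrefl (sym e≡f) (ℕ.≤-trans (ℕ.≤-trans (s≤s (ℕ.m≤n+m f e′)) (ℕ.≤-reflexive eq))
           (ℕ.≤-trans (lower≤upper a) (ℕ.m≤m+n _ e′)))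

∈-exponents⁺ : ∀ e f → e ≢ f → e ∈ exponents (e + f)
∈-exponents⁺ e f e≢f = pick (e <? lower a) (e <? upper a)
  where
  a = e + f
  pick : Dec (e < lower a) → Dec (e < upper a) → e ∈ exponents a
  pick (yes e<t) _         = ∈-++⁺ˡ (∈-downFrom⁺ e<t)
  -- The gap between the two blocks has at most one element, namely e = a/2, which would mean e = f.
  pick (no e≮t)  (yes e<s) = contradiction e≡f e≢f
    where
    e≡t : e ≡ lower a
    e≡t = ℕ.≤-antisym (s≤s⁻¹ (ℕ.≤-trans e<s (upper≤suc-lower a))) (ℕ.≮⇒≥ e≮t)
    s≡ : upper a ≡ suc e
    s≡ = ℕ.≤-antisym (ℕ.≤-trans (upper≤suc-lower a) (ℕ.≤-reflexive (cong suc (sym e≡t)))) e<s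
    e≡f : e ≡ f
    e≡f = ℕ.+-cancelˡ-≡ e e f (ℕ.suc-injective (trans (sym (cong₂ _+_ s≡ (sym e≡t))) (upper+lower a)))
  pick (no _) (no e≮s) =
    let e′ , s+e′≡e = ℕ.m≤n⇒∃[o]m+o≡n (ℕ.≮⇒≥ e≮s)
        t≡ : lower a ≡ suc e′ + f
        t≡ = ℕ.+-cancelˡ-≡ (upper a) _ _ (trans (upper+lower a) (trans (cong (λ e → suc (e + f)) (sym s+e′≡e))
               (trans (cong suc (ℕ.+-assoc (upper a) e′ f)) (sym (ℕ.+-suc (upper a) (e′ + f))))))
    in ∈-++⁺ʳ (downFrom (lower a)) (subst (_∈ map (upper a +_) (downFrom (lower a))) s+e′≡e
         (∈-map⁺ (upper a +_) (∈-downFrom⁺ (subst (e′ <_) (sym t≡) (ℕ.m≤m+n (suc e′) f)))))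

exponents-unique : ∀ a → Unique (exponents a)
exponents-unique a = Unique.++⁺ (Unique.downFrom⁺ (lower a))
  (Unique.map⁺ (ℕ.+-cancelˡ-≡ (upper a) _ _) (Unique.downFrom⁺ (lower a)))
  λ { (e∈ˡ , e∈ʳ) → let e′ , _ , e≡ = ∈-map⁻ (upper a +_) e∈ʳ in
      ℕ.<⇒≱ (ℕ.≤-trans (∈-downFrom⁻ e∈ˡ) (lower≤upper a)) (subst (upper a ≤_) (sym e≡) (ℕ.m≤m+n _ e′)) }

sumₚ-++ : ∀ xs ys → sumₚ (xs ++ ys) ≡ sumₚ xs +ₚ sumₚ ys
sumₚ-++ []       ys = refl
sumₚ-++ (x ∷ xs) ys = trans (cong (x +ₚ_) (sumₚ-++ xs ys)) (sym (+ₚ-assoc x _ _))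

sumₚ-exponents : ∀ p a → sumₚ (map (p ^ₚ_) (exponents a)) ≡ σ** p a
sumₚ-exponents p a = trans (cong sumₚ (map-++ (p ^ₚ_) (downFrom t) _)) (trans (sumₚ-++ (map (p ^ₚ_) (downFrom t)) _)
  (trans (cong₂ _+ₚ_ (low t) (high t)) (sym (*ₚ-distribʳ (geo p t) 𝟙 (p ^ₚ s)))))
  where
  s = upper a
  t = lower a
  low : ∀ t → sumₚ (map (p ^ₚ_) (downFrom t)) ≡ geo p t
  low zero    = refl
  low (suc t) = cong (p ^ₚ t +ₚ_) (low t)
  high : ∀ t → sumₚ (map (p ^ₚ_) (map (s +_) (downFrom t))) ≡ p ^ₚ s *ₚ geo p t
  high zero    = sym (*ₚ-zeroʳ (p ^ₚ s))
  high (suc t) = trans (cong₂ _+ₚ_ (^ₚ-+ p s t) (high t)) (sym (*ₚ-distribˡ (p ^ₚ s) (p ^ₚ t) (geo p t)))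

sumₚ-product : ∀ p es L → sumₚ (map (λ (e , D) → p ^ₚ e *ₚ D) (cartesianProduct es L)) ≡
               sumₚ (map (p ^ₚ_) es) *ₚ sumₚ L
sumₚ-product p []       L = refl
sumₚ-product p (e ∷ es) L = begin
  sumₚ (map f (map (e ,_) L ++ cartesianProduct es L))              ≡⟨ cong sumₚ (map-++ f (map (e ,_) L) _) ⟩
  sumₚ (map f (map (e ,_) L) ++ map f (cartesianProduct es L))      ≡⟨ sumₚ-++ (map f (map (e ,_) L)) _ ⟩
  sumₚ (map f (map (e ,_) L)) +ₚ sumₚ (map f (cartesianProduct es L)) ≡⟨ cong₂ _+ₚ_ (row L) (sumₚ-product p es L) ⟩
  p ^ₚ e *ₚ sumₚ L +ₚ sumₚ (map (p ^ₚ_) es) *ₚ sumₚ L                ≡⟨ *ₚ-distribʳ (sumₚ L) (p ^ₚ e) _ ⟨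
  (p ^ₚ e +ₚ sumₚ (map (p ^ₚ_) es)) *ₚ sumₚ L                        ∎
  where
  f : ℕ × Poly → Poly
  f (e , D) = p ^ₚ e *ₚ D
  row : ∀ L → sumₚ (map f (map (e ,_) L)) ≡ p ^ₚ e *ₚ sumₚ L
  row []      = sym (*ₚ-zeroʳ (p ^ₚ e))
  row (D ∷ L) = trans (cong (p ^ₚ e *ₚ D +ₚ_) (row L)) (sym (*ₚ-distribˡ (p ^ₚ e) D (sumₚ L)))

-- Multiplicativity of σ**

unitary-𝟙 : ∀ S → UnitaryDiv 𝟙 S
unitary-𝟙 S = S , refl , to∣ₚ (𝟙∣ 𝟙) , to∣ₚ (𝟙∣ S) , λ _ E∣𝟙 _ → E∣𝟙

∣-p^e*⇒∣ : ∀ {p} {F Q} → Irreducible p → ¬ p ∣ F → ∀ e → F ∣ p ^ₚ e *ₚ Q → F ∣ Q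
∣-p^e*⇒∣ irr p∤F zero    F∣Q = F∣Q
∣-p^e*⇒∣ {p} {F} {Q} irr p∤F (suc e) (divides G eq)
  with euclid F G irr (divides (p ^ₚ e *ₚ Q) (trans (sym (*ₚ-assoc p (p ^ₚ e) Q)) (sym eq)))
... | inj₁ p∣F = contradiction p∣F p∤F
... | inj₂ (divides G′ refl) = ∣-p^e*⇒∣ irr p∤F e (divides G′ (*ₚ-cancelˡ p _ _ (proj₁ irr)
  (trans (solve 3 (λ p f g → p :* (f :* g) := f :* (p :* g)) refl p F G′) (trans eq (*ₚ-assoc p (p ^ₚ e) Q)))))

unitary-p^e* : ∀ {p} {E D} → Irreducible p → ¬ p ∣ D → ∀ e → UnitaryDiv E D → UnitaryDiv E (p ^ₚ e *ₚ D)
unitary-p^e* {p} {E} irr p∤D e (Q , refl , _ , _ , coprime) =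
  p ^ₚ e *ₚ Q , solve 3 (λ e f q → e :* (f :* q) := f :* (e :* q)) refl E (p ^ₚ e) Q
  , to∣ₚ (𝟙∣ _) , to∣ₚ (𝟙∣ _) , λ F F∣E F∣ → coprime F F∣E (to∣ₚ (∣-p^e*⇒∣ irr
      (λ p∣F → p∤D (∣-*ʳ Q (∣-trans p∣F (from∣ₚ {F} F∣E)))) e (from∣ₚ {F} F∣)))

-- If p divided both E and its cofactor, they would not be coprime; so E takes nothing or all of
-- p^e. In the second case `p ∣ E` is recorded separately, because the form `p ^ₚ e *ₚ E′` does not
-- show that e is positive.
unitary-p^e*⁻ : ∀ {p} {E D} → Irreducible p → ¬ p ∣ D → D ≢ 𝟘 → ∀ e → UnitaryDiv E (p ^ₚ e *ₚ D) →
                UnitaryDiv E D ⊎ (∃[ E′ ] E ≡ p ^ₚ e *ₚ E′ × ¬ p ∣ E′ × p ∣ E)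
unitary-p^e*⁻ {p} {E} irr p∤D D≢𝟘 e (R , eq , _ , _ , coprime) with split-prime-power e E R irr p∤D D≢𝟘 eq
... | zero , e₂ , E′ , R′ , refl , refl , _ , eq′ =
  inj₁ (R′ , eq′ , to∣ₚ (𝟙∣ _) , to∣ₚ (𝟙∣ _) , λ F F∣E F∣R′ → coprime F F∣E (to∣ₚ (∣-*ˡ (p ^ₚ e₂) (from∣ₚ {F} F∣R′))))
... | suc e₁ , zero , E′ , R′ , refl , refl , refl , refl rewrite ℕ.+-identityʳ e₁ =
  inj₂ (E′ , refl , (λ p∣E′ → p∤D (∣-*ʳ R′ p∣E′)) , ∣-*ʳ E′ (p∣p*q p (p ^ₚ e₁)))
... | suc e₁ , suc e₂ , E′ , R′ , refl , refl , _ , _ =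
  contradiction (∣𝟙⇒≡𝟙 (from∣ₚ (coprime p (to∣ₚ (∣-*ʳ E′ (p∣p*q p (p ^ₚ e₁)))) (to∣ₚ (∣-*ʳ R′ (p∣p*q p (p ^ₚ e₂)))))))
    (proj₁ (proj₂ irr))

unitary-p^e : ∀ {p} {D} → Irreducible p → ¬ p ∣ D → ∀ e → UnitaryDiv (p ^ₚ e) (p ^ₚ e *ₚ D)
unitary-p^e {p} {D} irr p∤D e = D , refl , to∣ₚ (𝟙∣ _) , to∣ₚ (𝟙∣ _) , λ F F∣pᵉ F∣D →
  to∣ₚ (∣-p^e*⇒∣ {F = F} {Q = 𝟙} irr (λ p∣F → p∤D (∣-trans p∣F (from∣ₚ {F} F∣D))) e
    (subst (F ∣_) (sym (*ₚ-identityʳ _)) (from∣ₚ {F} F∣pᵉ)))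

-- For e = f the power p^e would be a common unitary divisor of D and its cofactor, different from 1
-- because e + e = suc a is positive. Common unitary divisors of the parts prime to p stay common
-- unitary divisors when p^e and p^f are put back.
biunitary-p^e*⁻ : ∀ {p} {a B D} → Irreducible p → ¬ p ∣ B → B ≢ 𝟘 → BiUnitaryDiv D (p ^ₚ suc a *ₚ B) →
  ∃[ e ] ∃[ f ] ∃[ D′ ] D ≡ p ^ₚ e *ₚ D′ × e + f ≡ suc a × e ≢ f × BiUnitaryDiv D′ B
biunitary-p^e*⁻ {p} {a} {D = D} irr p∤B B≢𝟘 (Q , eq , _ , _ , coprime) with split-prime-power (suc a) D Q irr p∤B B≢𝟘 eq
... | e , f , D′ , Q′ , refl , refl , e+f≡ , refl =
  e , f , D′ , refl , e+f≡ , e≢f , Q′ , refl , unitary-𝟙 D′ , unitary-𝟙 Q′ , λ E E∣D′ E∣Q′ →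
    coprime E (unitary-p^e* irr p∤D′ e E∣D′) (unitary-p^e* irr p∤Q′ f E∣Q′)
  where
  p∤D′ : ¬ p ∣ D′
  p∤D′ p∣ = p∤B (∣-*ʳ Q′ p∣)
  p∤Q′ : ¬ p ∣ Q′
  p∤Q′ p∣ = p∤B (∣-*ˡ D′ p∣)
  p^e≢𝟙 : ∀ e → e + e ≡ suc a → p ^ₚ e ≢ 𝟙
  p^e≢𝟙 (suc e) _ pᵉ≡𝟙 = proj₁ (proj₂ irr) (∣𝟙⇒≡𝟙 (divides (p ^ₚ e) pᵉ≡𝟙))
  e≢f : e ≢ f
  e≢f refl = p^e≢𝟙 e e+f≡ (∣𝟙⇒≡𝟙 (from∣ₚ (coprime (p ^ₚ e) (unitary-p^e irr p∤D′ e) (unitary-p^e irr p∤Q′ e))))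

-- A common unitary divisor that contains p would have p-multiplicity e as a divisor of p^e D and f
-- as a divisor of p^f Q. So it is prime to p and already a common unitary divisor of D and Q.
biunitary-p^e*⁺ : ∀ {p} {B D} → Irreducible p → ¬ p ∣ B → B ≢ 𝟘 → ∀ e f → e ≢ f → BiUnitaryDiv D B →
                  BiUnitaryDiv (p ^ₚ e *ₚ D) (p ^ₚ (e + f) *ₚ B)
biunitary-p^e*⁺ {p} {_} {D} irr p∤B B≢𝟘 e f e≢f (Q , refl , _ , _ , coprime) =
  p ^ₚ f *ₚ Q
  , trans (solve 4 (λ a b c d → a :* b :* (c :* d) := a :* c :* (b :* d)) refl (p ^ₚ e) D (p ^ₚ f) Q)
          (cong (_*ₚ (D *ₚ Q)) (sym (^ₚ-+ p e f)))
  , unitary-𝟙 _ , unitary-𝟙 _ , common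
  where
  p∤D : ¬ p ∣ D
  p∤D p∣ = p∤B (∣-*ʳ Q p∣)
  p∤Q : ¬ p ∣ Q
  p∤Q p∣ = p∤B (∣-*ˡ D p∣)
  D≢𝟘 = factor-nonzeroˡ {D} refl B≢𝟘
  Q≢𝟘 = factor-nonzeroʳ {D} refl B≢𝟘
  common : ∀ E → UnitaryDiv E (p ^ₚ e *ₚ D) → UnitaryDiv E (p ^ₚ f *ₚ Q) → E ∣ₚ 𝟙
  common E E∣ E∣′ with unitary-p^e*⁻ irr p∤D D≢𝟘 e E∣ | unitary-p^e*⁻ irr p∤Q Q≢𝟘 f E∣′
  ... | inj₁ E∣D | inj₁ E∣Q = coprime E E∣D E∣Q
  ... | inj₁ (R , ER≡D , _) | inj₂ (_ , _ , _ , p∣E) = contradiction (subst (p ∣_) ER≡D (∣-*ʳ R p∣E)) p∤D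
  ... | inj₂ (_ , _ , _ , p∣E) | inj₁ (R , ER≡Q , _) = contradiction (subst (p ∣_) ER≡Q (∣-*ʳ R p∣E)) p∤Q
  ... | inj₂ (E′ , eq , p∤E′ , _) | inj₂ (E″ , eq′ , p∤E″ , _) =
    contradiction (proj₁ (valuation-unique e f irr p∤E′ p∤E″ (trans (sym eq) eq′))) e≢f

map-unique : ∀ {A B : Set} (f : A → B) (L : List A) → (∀ {x y} → x ∈ L → y ∈ L → f x ≡ f y → x ≡ y) →
             Unique L → Unique (map f L)
map-unique f []      inj []          = []
map-unique f (x ∷ L) inj (x∉L ∷ uniq) =
  All.map⁺ (All.tabulate λ y∈L fx≡fy → All.lookup x∉L y∈L (inj (here refl) (there y∈L) fx≡fy))
  ∷ map-unique f L (λ x∈ y∈ → inj (there x∈) (there y∈)) uniq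

σ**-prime-power-* : ∀ {p} {a B T} → Irreducible p → ¬ p ∣ B → B ≢ 𝟘 → IsSigma** B T →
                    IsSigma** (p ^ₚ suc a *ₚ B) (σ** p (suc a) *ₚ T)
σ**-prime-power-* {p} {a} {B} {T} irr p∤B B≢𝟘 (L , uniq , member , refl) =
  map f pairs
  , map-unique f pairs f-inj (Unique.cartesianProduct⁺ (exponents-unique (suc a)) uniq)
  , (λ D → mk⇔ (to D) (from D))
  , trans (sumₚ-product p (exponents (suc a)) L) (cong (_*ₚ sumₚ L) (sumₚ-exponents p (suc a)))
  where
  pairs = cartesianProduct (exponents (suc a)) L
  f : ℕ × Poly → Poly
  f (e , D) = p ^ₚ e *ₚ D
  p∤ : ∀ {D} → D ∈ L → ¬ p ∣ D
  p∤ D∈ p∣D = let Q , eq , _ = Equivalence.to (member _) D∈ in p∤B (subst (p ∣_) eq (∣-*ʳ Q p∣D))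
  f-inj : ∀ {x y} → x ∈ pairs → y ∈ pairs → f x ≡ f y → x ≡ y
  f-inj {e , D} {e′ , D′} x∈ y∈ eq =
    let e≡ , D≡ = valuation-unique e e′ irr
          (p∤ (proj₂ (∈-cartesianProduct⁻ (exponents (suc a)) L x∈)))
          (p∤ (proj₂ (∈-cartesianProduct⁻ (exponents (suc a)) L y∈))) eq
    in cong₂ _,_ e≡ D≡
  to : ∀ D → D ∈ map f pairs → BiUnitaryDiv D (p ^ₚ suc a *ₚ B)
  to D D∈ with ∈-map⁻ f D∈
  ... | (e , D′) , x∈ , refl with ∈-cartesianProduct⁻ (exponents (suc a)) L x∈
  ... | e∈ , D′∈ with ∈-exponents⁻ (suc a) e e∈
  ... | f′ , e+f≡ , e≢f = subst (λ a → BiUnitaryDiv (p ^ₚ e *ₚ D′) (p ^ₚ a *ₚ B)) e+f≡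
    (biunitary-p^e*⁺ irr p∤B B≢𝟘 e f′ e≢f (Equivalence.to (member D′) D′∈))
  from : ∀ D → BiUnitaryDiv D (p ^ₚ suc a *ₚ B) → D ∈ map f pairs
  from D bud with biunitary-p^e*⁻ irr p∤B B≢𝟘 bud
  ... | e , f′ , D′ , refl , e+f≡ , e≢f , bud′ = ∈-map⁺ f (∈-cartesianProduct⁺
    (subst (λ a → e ∈ exponents a) e+f≡ (∈-exponents⁺ e f′ e≢f)) (Equivalence.from (member D′) bud′))

σ**-𝟙 : IsSigma** 𝟙 𝟙
σ**-𝟙 = 𝟙 ∷ [] , [] ∷ [] , (λ D → mk⇔ to (from D)) , refl
  where
  to : ∀ {D} → D ∈ 𝟙 ∷ [] → BiUnitaryDiv D 𝟙
  to (here refl) = 𝟙 , refl , unitary-𝟙 𝟙 , unitary-𝟙 𝟙 , λ { E (Q , eq , _) _ → Q , eq }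
  from : ∀ D → BiUnitaryDiv D 𝟙 → D ∈ 𝟙 ∷ []
  from D (Q , eq , _) = here (∣𝟙⇒≡𝟙 (divides Q eq))

σ**-product : ∀ {n} → Vec Poly n → Vec ℕ n → Poly
σ**-product []       []       = 𝟙
σ**-product (p ∷ ps) (a ∷ as) = σ** p a *ₚ σ**-product ps as

σ**-mono : ∀ {n} {ps : Vec Poly n} → DistinctPrimes ps → ∀ as → IsSigma** (mono ps (Vec.map suc as)) (σ**-product ps (Vec.map suc as))
σ**-mono []                  []       = σ**-𝟙
σ**-mono (prime irr p≢ps dist) (a ∷ as) =
  σ**-prime-power-* {a = a} irr (∤-mono irr dist p≢ps (Vec.map suc as)) (mono-nonzero dist (Vec.map suc as)) (σ**-mono dist as)

Unique-resp-↭ : ∀ {L L′ : List Poly} → L ↭ L′ → Unique L → Unique L′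
Unique-resp-↭ L↭L′ = ↭ₛ.Unique-resp-↭ (setoid Poly) (↭⇒↭ₛ L↭L′)

-- `IsSigma**` admits every duplicate-free enumeration of the bi-unitary divisors. Independence of
-- the order makes its value unique, so that the product formula can be equated with A itself.
sumₚ-unique : ∀ L L′ → Unique L → Unique L′ → (∀ D → D ∈ L → D ∈ L′) → (∀ D → D ∈ L′ → D ∈ L) → sumₚ L ≡ sumₚ L′
sumₚ-unique []      []       _ _ _ _ = refl
sumₚ-unique []      (D ∷ L′) _ _ _ ⊇ = case ⊇ D (here refl) of λ ()
sumₚ-unique (D ∷ L) L′ (D∉L ∷ uniq) uniq′ ⊆ ⊇ with ∈-∃++ (⊆ D (here refl))
... | ys , zs , refl = begin
  D +ₚ sumₚ L                       ≡⟨ cong (D +ₚ_) (sumₚ-unique L (ys ++ zs) uniq uniq-rest ⊆′ ⊇′) ⟩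
  D +ₚ sumₚ (ys ++ zs)              ≡⟨ cong (D +ₚ_) (sumₚ-++ ys zs) ⟩
  D +ₚ (sumₚ ys +ₚ sumₚ zs)         ≡⟨ solve 3 (λ d y z → d :+ (y :+ z) := y :+ (d :+ z)) refl D (sumₚ ys) (sumₚ zs) ⟩
  sumₚ ys +ₚ (D +ₚ sumₚ zs)         ≡⟨ sumₚ-++ ys (D ∷ zs) ⟨
  sumₚ (ys ++ D ∷ zs)               ∎
  where
  uniq″ : Unique (D ∷ ys ++ zs)
  uniq″ = Unique-resp-↭ (shift D ys zs) uniq′
  uniq-rest : Unique (ys ++ zs)
  uniq-rest = case uniq″ of λ { (_ ∷ u) → u }
  D∉rest : All (D ≢_) (ys ++ zs)
  D∉rest = case uniq″ of λ { (d ∷ _) → d }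
  ⊆′ : ∀ E → E ∈ L → E ∈ ys ++ zs
  ⊆′ E E∈L with ∈-resp-↭ (shift D ys zs) (⊆ E (there E∈L))
  ... | here refl = contradiction refl (All.lookup D∉L E∈L)
  ... | there E∈  = E∈
  ⊇′ : ∀ E → E ∈ ys ++ zs → E ∈ L
  ⊇′ E E∈ with ⊇ E (∈-resp-↭ (↭-sym (shift D ys zs)) (there E∈))
  ... | here refl = contradiction refl (All.lookup D∉rest E∈)
  ... | there E∈L = E∈L

σ**-functional : ∀ {S T T′} → IsSigma** S T → IsSigma** S T′ → T ≡ T′
σ**-functional (L , u , m , refl) (L′ , u′ , m′ , refl) = sumₚ-unique L L′ u u′
  (λ D → Equivalence.from (m′ D) ∘ Equivalence.to (m D)) (λ D → Equivalence.from (m D) ∘ Equivalence.to (m′ D))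

-- The formal derivative

D : Poly → Poly
D 𝟘      = 𝟘
D (nz p) = go p
  where
  go : Nz → Poly
  go one      = 𝟘
  go (_ ∷ₙ p) = nz p +ₚ cons false (go p)

D-cons : ∀ b p → D (cons b p) ≡ p +ₚ cons false (D p)
D-cons false 𝟘      = refl
D-cons true  𝟘      = refl
D-cons false (nz p) = refl
D-cons true  (nz p) = refl

D-+ : ∀ p q → D (p +ₚ q) ≡ D p +ₚ D q
D-+ = Poly-ind _ (λ q → refl) λ b p ih q → begin
  D (cons b p +ₚ q)                                                ≡⟨ cong D (cons-+ₚ-η b p q) ⟩
  D (cons (b xor hd q) (p +ₚ tl q))                                ≡⟨ D-cons (b xor hd q) (p +ₚ tl q) ⟩
  p +ₚ tl q +ₚ cons false (D (p +ₚ tl q))                          ≡⟨ cong (λ s → p +ₚ tl q +ₚ cons false s) (ih (tl q)) ⟩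
  p +ₚ tl q +ₚ cons false (D p +ₚ D (tl q))                        ≡⟨ cong (p +ₚ tl q +ₚ_) (cons-+ₚ false (D p) false (D (tl q))) ⟨
  p +ₚ tl q +ₚ (cons false (D p) +ₚ cons false (D (tl q)))         ≡⟨ +ₚ-medial p (tl q) (cons false (D p)) (cons false (D (tl q))) ⟩
  p +ₚ cons false (D p) +ₚ (tl q +ₚ cons false (D (tl q)))         ≡⟨ cong₂ _+ₚ_ (D-cons b p) (D-cons (hd q) (tl q)) ⟨
  D (cons b p) +ₚ D (cons (hd q) (tl q))                           ≡⟨ cong (λ s → D (cons b p) +ₚ D s) (cons-hd-tl q) ⟩
  D (cons b p) +ₚ D q                                              ∎

D-* : ∀ p q → D (p *ₚ q) ≡ D p *ₚ q +ₚ p *ₚ D q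
D-* p q = Poly-ind (λ p → D (p *ₚ q) ≡ D p *ₚ q +ₚ p *ₚ D q) refl step p
  where
  D-scale : ∀ b → D (scale b q) ≡ scale b (D q)
  D-scale false = refl
  D-scale true  = refl
  step : ∀ b p → D (p *ₚ q) ≡ D p *ₚ q +ₚ p *ₚ D q → D (cons b p *ₚ q) ≡ D (cons b p) *ₚ q +ₚ cons b p *ₚ D q
  step b p ih = begin
    D (cons b p *ₚ q)                                               ≡⟨ cong D (cons-*ₚ b p q) ⟩
    D (scale b q +ₚ cons false (p *ₚ q))                            ≡⟨ D-+ (scale b q) (cons false (p *ₚ q)) ⟩
    D (scale b q) +ₚ D (cons false (p *ₚ q))                        ≡⟨ cong₂ _+ₚ_ (D-scale b) (D-cons false (p *ₚ q)) ⟩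
    scale b (D q) +ₚ (p *ₚ q +ₚ X *ₚ D (p *ₚ q))                    ≡⟨ cong (λ s → scale b (D q) +ₚ (p *ₚ q +ₚ X *ₚ s)) ih ⟩
    scale b (D q) +ₚ (p *ₚ q +ₚ X *ₚ (D p *ₚ q +ₚ p *ₚ D q))
      ≡⟨ solve 6 (λ s x p q p′ q′ → s :+ (p :* q :+ x :* (p′ :* q :+ p :* q′)) := (p :+ x :* p′) :* q :+ (s :+ x :* (p :* q′))) refl
           (scale b (D q)) X p q (D p) (D q) ⟩
    (p +ₚ X *ₚ D p) *ₚ q +ₚ (scale b (D q) +ₚ X *ₚ (p *ₚ D q))      ≡⟨ cong₂ (λ s t → s *ₚ q +ₚ t) (D-cons b p) (cons-*ₚ b p (D q)) ⟨
    D (cons b p) *ₚ q +ₚ cons b p *ₚ D q                            ∎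

-- The two terms of D (p²) coincide and cancel, so squares behave as constants. Most arguments with
-- derivatives below rest on this.
D-square-* : ∀ p q → D (p *ₚ p *ₚ q) ≡ p *ₚ p *ₚ D q
D-square-* p q = begin
  D (p *ₚ p *ₚ q)                                         ≡⟨ D-* (p *ₚ p) q ⟩
  D (p *ₚ p) *ₚ q +ₚ p *ₚ p *ₚ D q                        ≡⟨ cong (λ s → s *ₚ q +ₚ p *ₚ p *ₚ D q) (D-* p p) ⟩
  (D p *ₚ p +ₚ p *ₚ D p) *ₚ q +ₚ p *ₚ p *ₚ D q            ≡⟨ solve 4 (λ p q p′ q′ → (p′ :* p :+ p :* p′) :* q :+ p :* p :* q′ := p :* p :* q′) refl p q (D p) (D q) ⟩
  p *ₚ p *ₚ D q                                           ∎

^ₚ-double : ∀ p n → p ^ₚ (2 * n) ≡ p ^ₚ n *ₚ p ^ₚ n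
^ₚ-double p n = trans (cong (λ m → p ^ₚ (n + m)) (ℕ.+-identityʳ n)) (^ₚ-+ p n n)

D-^-odd : ∀ p n → D (p ^ₚ suc (2 * n)) ≡ p ^ₚ (2 * n) *ₚ D p
D-^-odd p n = begin
  D (p *ₚ p ^ₚ (2 * n))             ≡⟨ cong (λ s → D (p *ₚ s)) (^ₚ-double p n) ⟩
  D (p *ₚ (p ^ₚ n *ₚ p ^ₚ n))       ≡⟨ cong D (*ₚ-comm p _) ⟩
  D (p ^ₚ n *ₚ p ^ₚ n *ₚ p)         ≡⟨ D-square-* (p ^ₚ n) p ⟩
  p ^ₚ n *ₚ p ^ₚ n *ₚ D p           ≡⟨ cong (_*ₚ D p) (^ₚ-double p n) ⟨
  p ^ₚ (2 * n) *ₚ D p               ∎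

D-^-even : ∀ p n → D (p ^ₚ (2 * n)) ≡ 𝟘
D-^-even p n = begin
  D (p ^ₚ (2 * n))              ≡⟨ cong D (trans (^ₚ-double p n) (sym (*ₚ-identityʳ _))) ⟩
  D (p ^ₚ n *ₚ p ^ₚ n *ₚ 𝟙)     ≡⟨ D-square-* (p ^ₚ n) 𝟙 ⟩
  p ^ₚ n *ₚ p ^ₚ n *ₚ 𝟘         ≡⟨ *ₚ-zeroʳ (p ^ₚ n *ₚ p ^ₚ n) ⟩
  𝟘                             ∎

D-^-suc : ∀ p n → ∃[ s ] D (p ^ₚ suc n) ≡ p ^ₚ n *ₚ s
D-^-suc p zero    = D p , cong D (*ₚ-identityʳ p)
D-^-suc p (suc n) = let s , eq = D-^-suc p n in D p +ₚ s , (begin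
  D (p *ₚ p ^ₚ suc n)                                   ≡⟨ D-* p (p ^ₚ suc n) ⟩
  D p *ₚ (p *ₚ p ^ₚ n) +ₚ p *ₚ D (p ^ₚ suc n)           ≡⟨ cong (λ t → D p *ₚ (p *ₚ p ^ₚ n) +ₚ p *ₚ t) eq ⟩
  D p *ₚ (p *ₚ p ^ₚ n) +ₚ p *ₚ (p ^ₚ n *ₚ s)            ≡⟨ solve 4 (λ p p′ pⁿ s → p′ :* (p :* pⁿ) :+ p :* (pⁿ :* s) := p :* pⁿ :* (p′ :+ s)) refl p (D p) (p ^ₚ n) s ⟩
  p *ₚ p ^ₚ n *ₚ (D p +ₚ s)                             ∎)

-- For p = b + X p′ the equation D p = 0 reads p′ = X r with r = D p′. Differentiating this once
-- more gives D r = 0, so r = s² by induction and p = b + X² s² = (b + X s)².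
D≡𝟘⇒square : ∀ p → D p ≡ 𝟘 → ∃[ s ] p ≡ s *ₚ s
D≡𝟘⇒square p = go (size p) p ℕ.≤-refl
  where
  cons-square : ∀ b s → cons b (X *ₚ (s *ₚ s)) ≡ cons b s *ₚ cons b s
  cons-square b s = begin
    cons b (X *ₚ (s *ₚ s))                         ≡⟨ split b (X *ₚ (s *ₚ s)) ⟩
    const b +ₚ X *ₚ (X *ₚ (s *ₚ s))                ≡⟨ cong (_+ₚ X *ₚ (X *ₚ (s *ₚ s))) (idem b) ⟩
    const b *ₚ const b +ₚ X *ₚ (X *ₚ (s *ₚ s))     ≡⟨ solve 3 (λ c x s → c :* c :+ x :* (x :* (s :* s)) := (c :+ x :* s) :* (c :+ x :* s)) refl (const b) X s ⟩
    (const b +ₚ X *ₚ s) *ₚ (const b +ₚ X *ₚ s)     ≡⟨ cong₂ _*ₚ_ (split b s) (split b s) ⟨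
    cons b s *ₚ cons b s                           ∎
    where
    split : ∀ b s → cons b s ≡ const b +ₚ X *ₚ s
    split b s = trans (cong (λ c → cons c s) (sym (Bool.xor-identityʳ b))) (sym (cons-+ₚ b 𝟘 false s))
    idem : ∀ b → const b ≡ const b *ₚ const b
    idem false = refl
    idem true  = refl
  cons-false≡𝟘 : ∀ r → cons false r ≡ 𝟘 → r ≡ 𝟘
  cons-false≡𝟘 𝟘 _ = refl
  go : ∀ n p → size p ≤ n → D p ≡ 𝟘 → ∃[ s ] p ≡ s *ₚ s
  go zero    𝟘 _  _    = 𝟘 , refl
  go (suc n) p le Dp≡𝟘 = let s , r≡ = go n r r-small Dr≡𝟘 in cons b s , (begin
    p                              ≡⟨ cons-hd-tl p ⟨
    cons b p′                      ≡⟨ cong (cons b) p′≡ ⟩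
    cons b (X *ₚ r)                ≡⟨ cong (λ t → cons b (X *ₚ t)) r≡ ⟩
    cons b (X *ₚ (s *ₚ s))         ≡⟨ cons-square b s ⟩
    cons b s *ₚ cons b s           ∎)
    where
    b = hd p
    p′ = tl p
    r = D p′
    p′≡ : p′ ≡ cons false r
    p′≡ = +ₚ-zero⇒≡ p′ (cons false r) (trans (sym (D-cons b p′)) (trans (cong D (cons-hd-tl p)) Dp≡𝟘))
    Dr≡𝟘 : D r ≡ 𝟘
    Dr≡𝟘 = cons-false≡𝟘 (D r) (begin
      cons false (D r)               ≡⟨ solve 2 (λ r s → s := r :+ (r :+ s)) refl r (cons false (D r)) ⟩
      r +ₚ (r +ₚ cons false (D r))   ≡⟨ cong (r +ₚ_) (D-cons false r) ⟨
      r +ₚ D (cons false r)          ≡⟨ cong (λ t → r +ₚ D t) p′≡ ⟨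
      r +ₚ r                         ≡⟨ +ₚ-self r ⟩
      𝟘                              ∎)
    r-small : size r ≤ n
    r-small = ℕ.≤-trans (size-tail r) (subst (λ t → size t ≤ n) p′≡ (size-tl p le))
      where
      size-tail : ∀ r → size r ≤ size (cons false r)
      size-tail 𝟘      = z≤n
      size-tail (nz r) = ℕ.n≤1+n _

size-D : ∀ n p → size p ≤ suc n → size (D p) ≤ n
size-D n p le = subst (λ q → size q ≤ n) (trans (sym (D-cons (hd p) (tl p))) (cong D (cons-hd-tl p)))
  (size-+ₚ n (tl p) (cons false (D (tl p))) tl-small (shifted n tl-small))
  where
  tl-small : size (tl p) ≤ n
  tl-small = size-tl p le
  shifted : ∀ n {q} → size q ≤ n → size (cons false (D q)) ≤ n
  shifted zero    {𝟘} _  = z≤n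
  shifted (suc n) {q} le = ℕ.≤-trans (size-cons false (D q)) (s≤s (size-D n q le))

∣D⇒D≡𝟘 : ∀ {p} {q} → p ≢ 𝟘 → deg p ≤ deg q → q ∣ D p → D p ≡ 𝟘
∣D⇒D≡𝟘 {p} {q} p≢𝟘 p≤q q∣Dp with D p ≟ₚ 𝟘
... | yes Dp≡𝟘 = Dp≡𝟘
... | no Dp≢𝟘  = contradiction (ℕ.≤-trans p≤q (deg-∣ Dp≢𝟘 q∣Dp))
  (ℕ.<⇒≱ (subst (_≤ deg p) (size≡suc-deg Dp≢𝟘) (size-D (deg p) p (ℕ.≤-reflexive (size≡suc-deg p≢𝟘)))))

irreducible⇒D≢𝟘 : ∀ {p} → Irreducible p → D p ≢ 𝟘
irreducible⇒D≢𝟘 {p} (p≢𝟘 , p≢𝟙 , div) Dp≡𝟘 with D≡𝟘⇒square p Dp≡𝟘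
... | s , p≡ss with div s (s , sym p≡ss)
... | inj₁ refl = p≢𝟙 p≡ss
... | inj₂ refl = p≢𝟙 (sym (*ₚ-cancelˡ p 𝟙 p p≢𝟘 (trans (*ₚ-identityʳ p) p≡ss)))

irreducible-∤-D : ∀ {p} {q} → Irreducible p → Irreducible q → deg p ≤ deg q → ¬ q ∣ D p
irreducible-∤-D irr irr′ le q∣ = irreducible⇒D≢𝟘 irr (∣D⇒D≡𝟘 (proj₁ irr) le q∣)

-- Geometric sums

geo-closed : ∀ p n → (𝟙 +ₚ p) *ₚ geo p n ≡ 𝟙 +ₚ p ^ₚ n
geo-closed p zero    = *ₚ-zeroʳ (𝟙 +ₚ p)
geo-closed p (suc n) = begin
  (𝟙 +ₚ p) *ₚ (p ^ₚ n +ₚ geo p n)                    ≡⟨ *ₚ-distribˡ (𝟙 +ₚ p) (p ^ₚ n) (geo p n) ⟩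
  (𝟙 +ₚ p) *ₚ p ^ₚ n +ₚ (𝟙 +ₚ p) *ₚ geo p n          ≡⟨ cong ((𝟙 +ₚ p) *ₚ p ^ₚ n +ₚ_) (geo-closed p n) ⟩
  (𝟙 +ₚ p) *ₚ p ^ₚ n +ₚ (𝟙 +ₚ p ^ₚ n)                ≡⟨ solve 2 (λ p q → (con true :+ p) :* q :+ (con true :+ q) := con true :+ p :* q) refl p (p ^ₚ n) ⟩
  𝟙 +ₚ p *ₚ p ^ₚ n                                   ∎

geo-suc : ∀ p n → geo p (suc n) ≡ 𝟙 +ₚ p *ₚ geo p n
geo-suc p zero    = sym (cong (𝟙 +ₚ_) (*ₚ-zeroʳ p))
geo-suc p (suc n) = begin
  p *ₚ p ^ₚ n +ₚ geo p (suc n)            ≡⟨ cong (p *ₚ p ^ₚ n +ₚ_) (geo-suc p n) ⟩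
  p *ₚ p ^ₚ n +ₚ (𝟙 +ₚ p *ₚ geo p n)      ≡⟨ solve 3 (λ p q g → p :* q :+ (con true :+ p :* g) := con true :+ p :* (q :+ g)) refl p (p ^ₚ n) (geo p n) ⟩
  𝟙 +ₚ p *ₚ (p ^ₚ n +ₚ geo p n)           ∎

frobenius : ∀ p q r → (p +ₚ q) ^ₚ (2 ^ r) ≡ p ^ₚ (2 ^ r) +ₚ q ^ₚ (2 ^ r)
frobenius p q zero    = trans (^ₚ-1 (p +ₚ q)) (sym (cong₂ _+ₚ_ (^ₚ-1 p) (^ₚ-1 q)))
frobenius p q (suc r) = begin
  (p +ₚ q) ^ₚ (2 * m)                                       ≡⟨ ^ₚ-double (p +ₚ q) m ⟩
  (p +ₚ q) ^ₚ m *ₚ (p +ₚ q) ^ₚ m                            ≡⟨ cong₂ _*ₚ_ (frobenius p q r) (frobenius p q r) ⟩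
  (p ^ₚ m +ₚ q ^ₚ m) *ₚ (p ^ₚ m +ₚ q ^ₚ m)                  ≡⟨ solve 2 (λ a b → (a :+ b) :* (a :+ b) := a :* a :+ b :* b) refl (p ^ₚ m) (q ^ₚ m) ⟩
  p ^ₚ m *ₚ p ^ₚ m +ₚ q ^ₚ m *ₚ q ^ₚ m                      ≡⟨ cong₂ _+ₚ_ (^ₚ-double p m) (^ₚ-double q m) ⟨
  p ^ₚ (2 * m) +ₚ q ^ₚ (2 * m)                              ∎
  where m = 2 ^ r

1+-^-2^ : ∀ p r → (𝟙 +ₚ p) ^ₚ (2 ^ r) ≡ 𝟙 +ₚ p ^ₚ (2 ^ r)
1+-^-2^ p r = trans (frobenius 𝟙 p r) (cong (_+ₚ p ^ₚ (2 ^ r)) (𝟙-^ₚ (2 ^ r)))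

-- The factor 1 + p turns the sum into 1 + p^n, to which Frobenius applies; `geo-2^*` cancels it
-- again.
geo-2^ : ∀ p r m → (𝟙 +ₚ p) *ₚ geo p (2 ^ r * m) ≡ ((𝟙 +ₚ p) *ₚ geo p m) ^ₚ (2 ^ r)
geo-2^ p r m = begin
  (𝟙 +ₚ p) *ₚ geo p (2 ^ r * m)          ≡⟨ geo-closed p (2 ^ r * m) ⟩
  𝟙 +ₚ p ^ₚ (2 ^ r * m)                  ≡⟨ cong (λ n → 𝟙 +ₚ p ^ₚ n) (ℕ.*-comm (2 ^ r) m) ⟩
  𝟙 +ₚ p ^ₚ (m * 2 ^ r)                  ≡⟨ cong (𝟙 +ₚ_) (^ₚ-* p m (2 ^ r)) ⟩
  𝟙 +ₚ (p ^ₚ m) ^ₚ (2 ^ r)               ≡⟨ 1+-^-2^ (p ^ₚ m) r ⟨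
  (𝟙 +ₚ p ^ₚ m) ^ₚ (2 ^ r)               ≡⟨ cong (_^ₚ (2 ^ r)) (geo-closed p m) ⟨
  ((𝟙 +ₚ p) *ₚ geo p m) ^ₚ (2 ^ r)       ∎

geo-2^* : ∀ p r m e → 𝟙 +ₚ p ≢ 𝟘 → 2 ^ r ≡ suc e → geo p (2 ^ r * m) ≡ (𝟙 +ₚ p) ^ₚ e *ₚ geo p m ^ₚ (2 ^ r)
geo-2^* p r m e 1+p≢𝟘 eq = *ₚ-cancelˡ (𝟙 +ₚ p) _ _ 1+p≢𝟘 (begin
  (𝟙 +ₚ p) *ₚ geo p (2 ^ r * m)                           ≡⟨ geo-2^ p r m ⟩
  ((𝟙 +ₚ p) *ₚ geo p m) ^ₚ (2 ^ r)                        ≡⟨ *ₚ-^ₚ (𝟙 +ₚ p) (geo p m) (2 ^ r) ⟩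
  (𝟙 +ₚ p) ^ₚ (2 ^ r) *ₚ geo p m ^ₚ (2 ^ r)               ≡⟨ cong (λ n → (𝟙 +ₚ p) ^ₚ n *ₚ geo p m ^ₚ (2 ^ r)) eq ⟩
  (𝟙 +ₚ p) *ₚ (𝟙 +ₚ p) ^ₚ e *ₚ geo p m ^ₚ (2 ^ r)         ≡⟨ *ₚ-assoc (𝟙 +ₚ p) _ _ ⟩
  (𝟙 +ₚ p) *ₚ ((𝟙 +ₚ p) ^ₚ e *ₚ geo p m ^ₚ (2 ^ r))       ∎)

geo-double : ∀ p m → 𝟙 +ₚ p ≢ 𝟘 → geo p (2 * m) ≡ (𝟙 +ₚ p) *ₚ (geo p m *ₚ geo p m)
geo-double p m 1+p≢𝟘 = trans (geo-2^* p 1 m 1 1+p≢𝟘 refl)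
  (cong₂ _*ₚ_ (^ₚ-1 (𝟙 +ₚ p)) (cong (geo p m *ₚ_) (^ₚ-1 (geo p m))))

-- This displays an odd geometric sum as 1 plus p (1 + p) times a square: it is 1 modulo every
-- divisor of 1 + p, and its derivative is that of p (1 + p) up to a square factor.
geo-odd : ∀ p k → 𝟙 +ₚ p ≢ 𝟘 → geo p (suc (2 * k)) ≡ 𝟙 +ₚ p *ₚ ((𝟙 +ₚ p) *ₚ (geo p k *ₚ geo p k))
geo-odd p k 1+p≢𝟘 = trans (geo-suc p (2 * k)) (cong (λ s → 𝟙 +ₚ p *ₚ s) (geo-double p k 1+p≢𝟘))

p∤1+p* : ∀ {p s} → p ≢ 𝟙 → ¬ p ∣ 𝟙 +ₚ p *ₚ s
p∤1+p* {p} {s} p≢𝟙 p∣ = p≢𝟙 (∣𝟙⇒≡𝟙 (∣-+ₚ-cancel (p *ₚ s) 𝟙 (subst (p ∣_) (+ₚ-comm 𝟙 (p *ₚ s)) p∣) (p∣p*q p s)))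

p∤geo : ∀ {p} n → p ≢ 𝟙 → ¬ p ∣ geo p (suc n)
p∤geo {p} n p≢𝟙 = p∤1+p* p≢𝟙 ∘ subst (p ∣_) (geo-suc p n)

geo-nonzero : ∀ {p} n → p ≢ 𝟙 → geo p (suc n) ≢ 𝟘
geo-nonzero {p} n p≢𝟙 eq = p∤geo n p≢𝟙 (subst (p ∣_) (sym eq) (∣𝟘 p))

∣1+p⇒∤geo-odd : ∀ {q p} k → 𝟙 +ₚ p ≢ 𝟘 → Irreducible q → q ∣ 𝟙 +ₚ p → ¬ q ∣ geo p (suc (2 * k))
∣1+p⇒∤geo-odd {q} {p} k 1+p≢𝟘 irr q∣1+p q∣geo = proj₁ (proj₂ irr) (∣𝟙⇒≡𝟙
  (∣-+ₚ-cancel (p *ₚ ((𝟙 +ₚ p) *ₚ (geo p k *ₚ geo p k))) 𝟙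
    (subst (q ∣_) (trans (geo-odd p k 1+p≢𝟘) (+ₚ-comm 𝟙 (p *ₚ ((𝟙 +ₚ p) *ₚ (geo p k *ₚ geo p k))))) q∣geo)
    (∣-*ˡ p (∣-*ʳ (geo p k *ₚ geo p k) q∣1+p))))

deg-1+ : ∀ p → 0 < deg p → deg (𝟙 +ₚ p) ≡ deg p
deg-1+ p lt = proj₁ (deg-+ₚ-< 𝟙 p (λ { refl → case lt of λ () }) lt)

1+-nonzero : ∀ {p} → p ≢ 𝟙 → 𝟙 +ₚ p ≢ 𝟘
1+-nonzero {p} p≢𝟙 eq = p≢𝟙 (sym (+ₚ-zero⇒≡ 𝟙 p eq))

deg-geo : ∀ {p} n → Irreducible p → deg (geo p (suc n)) ≡ n * deg p
deg-geo {p} n irr@(p≢𝟘 , p≢𝟙 , _) = ℕ.+-cancelˡ-≡ (deg p) _ _ (begin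
  deg p + deg (geo p (suc n))            ≡⟨ cong (_+ deg (geo p (suc n))) (deg-1+ p deg>0) ⟨
  deg (𝟙 +ₚ p) + deg (geo p (suc n))     ≡⟨ deg-*ₚ (1+-nonzero p≢𝟙) (geo-nonzero n p≢𝟙) ⟨
  deg ((𝟙 +ₚ p) *ₚ geo p (suc n))        ≡⟨ cong deg (geo-closed p (suc n)) ⟩
  deg (𝟙 +ₚ p ^ₚ suc n)                  ≡⟨ deg-1+ (p ^ₚ suc n) (subst (0 <_) (sym d) (ℕ.≤-trans deg>0 (ℕ.m≤m+n (deg p) _))) ⟩
  deg (p ^ₚ suc n)                       ≡⟨ d ⟩
  deg p + n * deg p                      ∎)
  where
  deg>0 = irreducible⇒deg>0 irr
  d = deg-^ₚ (suc n) p≢𝟘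

-- A double factor q of 1 + x^m divides the derivative x^(m-1), hence also 1. Assuming `D x ≡ 𝟙`
-- instead of x = X makes the result serve x and y = 1 + x alike.
square-∤-geo-odd : ∀ {q x} k → Irreducible q → D x ≡ 𝟙 → ¬ q *ₚ q ∣ geo x (suc (2 * k))
square-∤-geo-odd {q} {x} k irr Dx≡𝟙 (divides s eq) = proj₁ (proj₂ irr) (∣𝟙⇒≡𝟙
  (∣-+ₚ-cancel (x ^ₚ m) 𝟙 (subst (q ∣_) (+ₚ-comm 𝟙 (x ^ₚ m)) q∣1+xᵐ) (∣-*ˡ x q∣x^2k)))
  where
  m = suc (2 * k)
  s′ = s *ₚ (𝟙 +ₚ x)
  qqs : q *ₚ q *ₚ s′ ≡ 𝟙 +ₚ x ^ₚ m
  qqs = trans (sym (*ₚ-assoc (q *ₚ q) s (𝟙 +ₚ x))) (trans (cong (_*ₚ (𝟙 +ₚ x)) eq) (trans (*ₚ-comm _ (𝟙 +ₚ x)) (geo-closed x m)))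
  q∣1+xᵐ : q ∣ 𝟙 +ₚ x ^ₚ m
  q∣1+xᵐ = divides (q *ₚ s′) (trans (sym (*ₚ-assoc q q s′)) qqs)
  q∣x^2k : q ∣ x ^ₚ (2 * k)
  q∣x^2k = divides (q *ₚ D s′) (begin
    q *ₚ (q *ₚ D s′)              ≡⟨ *ₚ-assoc q q (D s′) ⟨
    q *ₚ q *ₚ D s′                ≡⟨ D-square-* q s′ ⟨
    D (q *ₚ q *ₚ s′)              ≡⟨ cong D qqs ⟩
    D (𝟙 +ₚ x ^ₚ m)               ≡⟨ D-+ 𝟙 (x ^ₚ m) ⟩
    D (x ^ₚ m)                    ≡⟨ D-^-odd x k ⟩
    x ^ₚ (2 * k) *ₚ D x           ≡⟨ cong (x ^ₚ (2 * k) *ₚ_) Dx≡𝟙 ⟩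
    x ^ₚ (2 * k) *ₚ 𝟙             ≡⟨ *ₚ-identityʳ _ ⟩
    x ^ₚ (2 * k)                  ∎)

-- Differentiating (1 + p) geo p m = 1 + p^m shows that q^(e-1) divides D p.
geo-odd≡prime-power : ∀ {p q} k e → Irreducible p → Irreducible q → geo p (suc (2 * suc k)) ≡ q ^ₚ e →
                      ∃[ f ] e ≡ suc f × f * deg q < deg p
geo-odd≡prime-power {p} {q} k zero irr _ eq =
  contradiction (trans (sym (deg-geo (2 * suc k) irr)) (cong deg eq)) (ℕ.>⇒≢ (ℕ.*-mono-≤ {1} {2 * suc k} (s≤s z≤n) (irreducible⇒deg>0 irr)))
geo-odd≡prime-power {p} {q} k (suc f) irr irr′ eq = f , refl ,
  subst (_< deg p) (deg-^ₚ f (proj₁ irr′)) (ℕ.≰⇒> (λ le → irreducible⇒D≢𝟘 irr (∣D⇒D≡𝟘 (proj₁ irr) le q^f∣Dp)))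
  where
  m = suc (2 * suc k)
  s = proj₁ (D-^-suc q f)
  identity : p ^ₚ (2 * suc k) *ₚ D p ≡ q ^ₚ f *ₚ (D p *ₚ q +ₚ (𝟙 +ₚ p) *ₚ s)
  identity = begin
    p ^ₚ (2 * suc k) *ₚ D p                                    ≡⟨ D-^-odd p (suc k) ⟨
    D (p ^ₚ m)                                                 ≡⟨ D-+ 𝟙 (p ^ₚ m) ⟨
    D (𝟙 +ₚ p ^ₚ m)                                            ≡⟨ cong D (geo-closed p m) ⟨
    D ((𝟙 +ₚ p) *ₚ geo p m)                                    ≡⟨ cong (λ g → D ((𝟙 +ₚ p) *ₚ g)) eq ⟩
    D ((𝟙 +ₚ p) *ₚ q ^ₚ suc f)                                 ≡⟨ D-* (𝟙 +ₚ p) (q ^ₚ suc f) ⟩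
    D (𝟙 +ₚ p) *ₚ (q *ₚ q ^ₚ f) +ₚ (𝟙 +ₚ p) *ₚ D (q ^ₚ suc f)  ≡⟨ cong₂ (λ a b → a *ₚ (q *ₚ q ^ₚ f) +ₚ (𝟙 +ₚ p) *ₚ b) (D-+ 𝟙 p) (proj₂ (D-^-suc q f)) ⟩
    D p *ₚ (q *ₚ q ^ₚ f) +ₚ (𝟙 +ₚ p) *ₚ (q ^ₚ f *ₚ s)          ≡⟨ solve 5 (λ a q u p s → a :* (q :* u) :+ (con true :+ p) :* (u :* s) := u :* (a :* q :+ (con true :+ p) :* s)) refl (D p) q (q ^ₚ f) p s ⟩
    q ^ₚ f *ₚ (D p *ₚ q +ₚ (𝟙 +ₚ p) *ₚ s)                      ∎
  p∤q^f : ¬ p ∣ q ^ₚ f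
  p∤q^f p∣ = p∤geo (2 * suc k) (proj₁ (proj₂ irr)) (subst (p ∣_) (sym eq) (∣-*ˡ q p∣))
  q^f∣Dp : q ^ₚ f ∣ D p
  q^f∣Dp = ∣-p^e*⇒∣ irr p∤q^f (2 * suc k) (divides _ (sym identity))

-- The 2-adic shape of an exponent

parity : ∀ n → (∃[ k ] n ≡ 2 * k) ⊎ (∃[ k ] n ≡ suc (2 * k))
parity zero    = inj₁ (0 , refl)
parity (suc n) with parity n
... | inj₁ (k , refl) = inj₂ (k , refl)
... | inj₂ (k , refl) = inj₁ (suc k , cong suc (sym (ℕ.+-suc k (k + 0))))

odd-part : ∀ n → 0 < n → ∃[ r ] ∃[ k ] n ≡ 2 ^ r * suc (2 * k)
odd-part n n>0 = go n (<-wellFounded n) n>0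
  where
  go : ∀ n → Acc _<_ n → 0 < n → ∃[ r ] ∃[ k ] n ≡ 2 ^ r * suc (2 * k)
  go n (acc rec) n>0 with parity n
  ... | inj₂ (k , refl) = 0 , k , sym (ℕ.+-identityʳ _)
  ... | inj₁ (suc l , refl) with go (suc l) (rec (s≤s (ℕ.m≤m+n (suc l) (l + 0) ⟨≤⟩ ℕ.≤-reflexive eq))) (s≤s z≤n)
    where
    _⟨≤⟩_ = ℕ.≤-trans
    eq : suc l + (l + 0) ≡ l + suc (l + 0)
    eq = sym (ℕ.+-suc l (l + 0))
  ... | r , k , eq = suc r , k , trans (cong (2 *_) eq) (sym (ℕ.*-assoc 2 (2 ^ r) (suc (2 * k))))

even-part : ∀ n → 0 < n → ∃[ r ] ∃[ k ] 2 * n ≡ 2 ^ suc r * suc (2 * k)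
even-part n n>0 = let r , k , eq = odd-part n n>0 in r , k , trans (cong (2 *_) eq) (sym (ℕ.*-assoc 2 (2 ^ r) (suc (2 * k))))

2^≡suc : ∀ r → ∃[ e ] 2 ^ r ≡ suc e
2^≡suc r with 2 ^ r in eq
... | zero  = contradiction eq (ℕ.>⇒≢ (ℕ.m^n>0 2 r))
... | suc e = e , refl

Adjacent : ℕ → ℕ → Set
Adjacent m n = m ≡ suc n ⊎ n ≡ suc m

σ**≡geo*geo : ∀ p a → σ** p a ≡ (𝟙 +ₚ p) *ₚ geo p (upper a) *ₚ geo p (lower a)
σ**≡geo*geo p a = cong (_*ₚ geo p (lower a)) (sym (geo-closed p (upper a)))

-- For odd a the two geometric sums in `σ** p a` have equal length and combine to `geo p (a + 1)`.
-- For even a the lengths are consecutive; either can be the even one, 2^(r+1) (2k+1), and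
-- `Adjacent` covers both orders. The exponent e = 2^(r+1) - 1 is given by an equation to avoid
-- truncated subtraction.
data Shape (a : ℕ) : Set where
  odd  : ∀ r k → suc a ≡ 2 ^ suc r * suc (2 * k) →
         (∀ p e → 𝟙 +ₚ p ≢ 𝟘 → 2 ^ suc r ≡ suc e → σ** p a ≡ (𝟙 +ₚ p) ^ₚ e *ₚ geo p (suc (2 * k)) ^ₚ (2 ^ suc r)) →
         Shape a
  even : ∀ r k l → suc a ≡ 2 ^ suc r * suc (2 * k) + suc (2 * l) → Adjacent (2 ^ suc r * suc (2 * k)) (suc (2 * l)) →
         (∀ p → 𝟙 +ₚ p ≢ 𝟘 → σ** p a ≡ (𝟙 +ₚ p) ^ₚ (2 ^ suc r) *ₚ (geo p (suc (2 * k)) ^ₚ (2 ^ suc r) *ₚ geo p (suc (2 * l)))) →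
         Shape a

shape : ∀ a → 0 < a → Shape a
shape a a>0 with ℕ.m≤n⇒m<n∨m≡n (lower≤upper a)
... | inj₂ t≡s = let r , k , eq = odd-part (upper a) (s≤s z≤n) in odd r k (sum r k eq) (formula r k eq)
  where
  double : ∀ {r k} → upper a ≡ 2 ^ r * suc (2 * k) → 2 * upper a ≡ 2 ^ suc r * suc (2 * k)
  double {r} {k} eq = trans (cong (2 *_) eq) (sym (ℕ.*-assoc 2 (2 ^ r) (suc (2 * k))))
  sum : ∀ r k → upper a ≡ 2 ^ r * suc (2 * k) → suc a ≡ 2 ^ suc r * suc (2 * k)
  sum r k eq = begin
    suc a                     ≡⟨ upper+lower a ⟨
    upper a + lower a         ≡⟨ cong (upper a +_) (trans t≡s (sym (ℕ.+-identityʳ (upper a)))) ⟩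
    2 * upper a               ≡⟨ double {r} {k} eq ⟩
    2 ^ suc r * suc (2 * k)   ∎
  formula : ∀ r k → upper a ≡ 2 ^ r * suc (2 * k) → ∀ p e → 𝟙 +ₚ p ≢ 𝟘 → 2 ^ suc r ≡ suc e →
            σ** p a ≡ (𝟙 +ₚ p) ^ₚ e *ₚ geo p (suc (2 * k)) ^ₚ (2 ^ suc r)
  formula r k eq p e 1+p≢𝟘 E≡ = begin
    σ** p a                                                  ≡⟨ σ**≡geo*geo p a ⟩
    (𝟙 +ₚ p) *ₚ geo p (upper a) *ₚ geo p (lower a)           ≡⟨ cong (λ t → (𝟙 +ₚ p) *ₚ geo p (upper a) *ₚ geo p t) t≡s ⟩
    (𝟙 +ₚ p) *ₚ geo p (upper a) *ₚ geo p (upper a)           ≡⟨ *ₚ-assoc (𝟙 +ₚ p) _ _ ⟩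
    (𝟙 +ₚ p) *ₚ (geo p (upper a) *ₚ geo p (upper a))         ≡⟨ geo-double p (upper a) 1+p≢𝟘 ⟨
    geo p (2 * upper a)                                      ≡⟨ cong (geo p) (double {r} {k} eq) ⟩
    geo p (2 ^ suc r * suc (2 * k))                          ≡⟨ geo-2^* p (suc r) (suc (2 * k)) e 1+p≢𝟘 E≡ ⟩
    (𝟙 +ₚ p) ^ₚ e *ₚ geo p (suc (2 * k)) ^ₚ (2 ^ suc r)      ∎
... | inj₁ t<s = choose (parity (lower a))
  where
  s≡ : upper a ≡ suc (lower a)
  s≡ = ℕ.≤-antisym (upper≤suc-lower a) t<s
  formula : ∀ r k l → (∀ p → geo p (upper a) *ₚ geo p (lower a) ≡ geo p (2 ^ suc r * suc (2 * k)) *ₚ geo p (suc (2 * l))) →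
            ∀ p → 𝟙 +ₚ p ≢ 𝟘 →
            σ** p a ≡ (𝟙 +ₚ p) ^ₚ (2 ^ suc r) *ₚ (geo p (suc (2 * k)) ^ₚ (2 ^ suc r) *ₚ geo p (suc (2 * l)))
  formula r k l eq p 1+p≢𝟘 = let e , E≡ = 2^≡suc (suc r); g = geo p (suc (2 * k)) ^ₚ (2 ^ suc r); g′ = geo p (suc (2 * l)) in begin
    σ** p a                                                      ≡⟨ σ**≡geo*geo p a ⟩
    (𝟙 +ₚ p) *ₚ geo p (upper a) *ₚ geo p (lower a)               ≡⟨ *ₚ-assoc (𝟙 +ₚ p) _ _ ⟩
    (𝟙 +ₚ p) *ₚ (geo p (upper a) *ₚ geo p (lower a))             ≡⟨ cong ((𝟙 +ₚ p) *ₚ_) (eq p) ⟩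
    (𝟙 +ₚ p) *ₚ (geo p (2 ^ suc r * suc (2 * k)) *ₚ g′)          ≡⟨ cong (λ t → (𝟙 +ₚ p) *ₚ (t *ₚ g′)) (geo-2^* p (suc r) (suc (2 * k)) e 1+p≢𝟘 E≡) ⟩
    (𝟙 +ₚ p) *ₚ ((𝟙 +ₚ p) ^ₚ e *ₚ g *ₚ g′)                       ≡⟨ solve 4 (λ a b c d → a :* (b :* c :* d) := a :* b :* (c :* d)) refl (𝟙 +ₚ p) ((𝟙 +ₚ p) ^ₚ e) g g′ ⟩
    (𝟙 +ₚ p) ^ₚ suc e *ₚ (g *ₚ g′)                               ≡⟨ cong (λ n → (𝟙 +ₚ p) ^ₚ n *ₚ (g *ₚ g′)) (sym E≡) ⟩
    (𝟙 +ₚ p) ^ₚ (2 ^ suc r) *ₚ (g *ₚ g′)                         ∎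
  choose : (∃[ k ] lower a ≡ 2 * k) ⊎ (∃[ k ] lower a ≡ suc (2 * k)) → Shape a
  choose (inj₂ (l , t≡)) with even-part (suc l) (s≤s z≤n)
  ... | r , k , eq = even r k l (trans (sym (upper+lower a)) (cong₂ _+_ s≡Em t≡)) (inj₁ (trans (sym eq) 2l≡))
        (formula r k l (λ p → cong₂ (λ s t → geo p s *ₚ geo p t) s≡Em t≡))
    where
    2l≡ : 2 * suc l ≡ suc (suc (2 * l))
    2l≡ = cong suc (ℕ.+-suc l (l + 0))
    s≡Em : upper a ≡ 2 ^ suc r * suc (2 * k)
    s≡Em = trans s≡ (trans (cong suc t≡) (trans (sym 2l≡) eq))
  choose (inj₁ (zero , t≡)) = contradiction (ℕ.suc-injective (trans (sym (upper+lower a)) (cong₂ _+_ (trans s≡ (cong suc t≡)) t≡))) (ℕ.>⇒≢ a>0)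
  choose (inj₁ (suc l , t≡)) with even-part (suc l) (s≤s z≤n)
  ... | r , k , eq = even r k (suc l) (trans (sym (upper+lower a)) (trans (ℕ.+-comm (upper a) (lower a)) (cong₂ _+_ t≡Em s≡′))) (inj₂ (cong suc eq))
        (formula r k (suc l) (λ p → trans (*ₚ-comm (geo p (upper a)) (geo p (lower a))) (cong₂ (λ s t → geo p s *ₚ geo p t) t≡Em s≡′)))
    where
    t≡Em : lower a ≡ 2 ^ suc r * suc (2 * k)
    t≡Em = trans t≡ eq
    s≡′ : upper a ≡ suc (2 * suc l)
    s≡′ = trans s≡ (cong suc t≡)

-- The four primes x, y = 1 + x, P, Q

-- Of X and X+1 only 1 + x = y, D x = 1 and deg x = 1 are kept, besides irreducibility. These facts
-- are symmetric in x and y, so `swap` transfers each result on σ** x a to σ** y b. That 1 + P has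
-- no factor Q comes from deg P ≤ deg Q.
record Setting : Set where
  field
    x y P Q       : Poly
    1+x≡y         : 𝟙 +ₚ x ≡ y
    Dx≡𝟙          : D x ≡ 𝟙
    deg-x         : deg x ≡ 1
    primes        : DistinctPrimes (x ∷ y ∷ P ∷ Q ∷ [])
    degP≤degQ     : deg P ≤ deg Q
    i j u v w     : ℕ
    1+P           : 𝟙 +ₚ P ≡ mono (x ∷ y ∷ P ∷ Q ∷ []) (i ∷ j ∷ 0 ∷ 0 ∷ [])
    1+Q           : 𝟙 +ₚ Q ≡ mono (x ∷ y ∷ P ∷ Q ∷ []) (u ∷ v ∷ w ∷ 0 ∷ [])
    i>0           : 0 < i
    j>0           : 0 < j
    u>0           : 0 < u
    v>0           : 0 < v

  M : ℕ → ℕ → ℕ → ℕ → Poly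
  M a b c d = mono (x ∷ y ∷ P ∷ Q ∷ []) (a ∷ b ∷ c ∷ d ∷ [])

  M-injective : ∀ {a b c d a′ b′ c′ d′} → M a b c d ≡ M a′ b′ c′ d′ → a ≡ a′ × b ≡ b′ × c ≡ c′ × d ≡ d′
  M-injective {a} {b} {c} {d} {a′} {b′} {c′} {d′} eq with mono-injective primes (a ∷ b ∷ c ∷ d ∷ []) (a′ ∷ b′ ∷ c′ ∷ d′ ∷ []) eq
  ... | refl = refl , refl , refl , refl

  M-* : ∀ a b c d a′ b′ c′ d′ → M a b c d *ₚ M a′ b′ c′ d′ ≡ M (a + a′) (b + b′) (c + c′) (d + d′)
  M-* a b c d a′ b′ c′ d′ = mono-* (x ∷ y ∷ P ∷ Q ∷ []) (a ∷ b ∷ c ∷ d ∷ []) (a′ ∷ b′ ∷ c′ ∷ d′ ∷ [])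

  M-^ : ∀ a b c d n → M a b c d ^ₚ n ≡ M (a * n) (b * n) (c * n) (d * n)
  M-^ a b c d n = mono-^ (x ∷ y ∷ P ∷ Q ∷ []) (a ∷ b ∷ c ∷ d ∷ []) n

  irr-x : Irreducible x
  irr-x = case primes of λ { (prime irr _ _) → irr }

  irr-y : Irreducible y
  irr-y = case primes of λ { (prime _ _ (prime irr _ _)) → irr }

  irr-P : Irreducible P
  irr-P = case primes of λ { (prime _ _ (prime _ _ (prime irr _ _))) → irr }

  irr-Q : Irreducible Q
  irr-Q = case primes of λ { (prime _ _ (prime _ _ (prime _ _ (prime irr _ _)))) → irr }

  M-x : ∀ a → M a 0 0 0 ≡ x ^ₚ a
  M-x a = *ₚ-identityʳ (x ^ₚ a)

  M-y : ∀ b → M 0 b 0 0 ≡ y ^ₚ b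
  M-y b = *ₚ-identityʳ (y ^ₚ b)

  M-P : ∀ c → M 0 0 c 0 ≡ P ^ₚ c
  M-P c = *ₚ-identityʳ (P ^ₚ c)

  M-Q : ∀ d → M 0 0 0 d ≡ Q ^ₚ d
  M-Q d = *ₚ-identityʳ (Q ^ₚ d)

  x∣M : ∀ a b c d → x ∣ M (suc a) b c d
  x∣M a b c d = ∣-*ʳ _ (p∣p*q x (x ^ₚ a))

  y∣M : ∀ a b c d → y ∣ M a (suc b) c d
  y∣M a b c d = ∣-*ˡ (x ^ₚ a) (∣-*ʳ _ (p∣p*q y (y ^ₚ b)))

  P^∣M : ∀ a b c c′ d → P ^ₚ c ∣ M a b (c + c′) d
  P^∣M a b c c′ d = ∣-*ˡ (x ^ₚ a) (∣-*ˡ (y ^ₚ b) (∣-*ʳ _ (divides (P ^ₚ c′) (sym (^ₚ-+ P c c′)))))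

  Q^∣M : ∀ a b c d d′ → Q ^ₚ d ∣ M a b c (d + d′)
  Q^∣M a b c d d′ = ∣-*ˡ (x ^ₚ a) (∣-*ˡ (y ^ₚ b) (∣-*ˡ (P ^ₚ c) (∣-*ʳ 𝟙 (divides (Q ^ₚ d′) (sym (^ₚ-+ Q d d′))))))

  deg-y : deg y ≡ 1
  deg-y = trans (cong deg (sym 1+x≡y)) (trans (deg-1+ x (subst (0 <_) (sym deg-x) (s≤s z≤n))) deg-x)

  deg-M : ∀ a b c d → deg (M a b c d) ≡ a + (b + (c * deg P + d * deg Q))
  deg-M a b c d = trans (deg-mono primes (a ∷ b ∷ c ∷ d ∷ []))
    (cong₂ _+_ (linear a deg-x) (cong₂ _+_ (linear b deg-y) (cong (c * deg P +_) (ℕ.+-identityʳ _))))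
    where
    linear : ∀ a {n} → n ≡ 1 → a * n ≡ a
    linear a refl = ℕ.*-identityʳ a

  degP≡ : deg P ≡ i + j
  degP≡ = begin
    deg P              ≡⟨ deg-1+ P (irreducible⇒deg>0 irr-P) ⟨
    deg (𝟙 +ₚ P)       ≡⟨ cong deg 1+P ⟩
    deg (M i j 0 0)    ≡⟨ deg-M i j 0 0 ⟩
    i + (j + 0)        ≡⟨ cong (i +_) (ℕ.+-identityʳ j) ⟩
    i + j              ∎

  degQ≡ : deg Q ≡ u + (v + w * deg P)
  degQ≡ = begin
    deg Q                          ≡⟨ deg-1+ Q (irreducible⇒deg>0 irr-Q) ⟨
    deg (𝟙 +ₚ Q)                   ≡⟨ cong deg 1+Q ⟩
    deg (M u v w 0)                ≡⟨ deg-M u v w 0 ⟩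
    u + (v + (w * deg P + 0))      ≡⟨ cong (λ n → u + (v + n)) (ℕ.+-identityʳ _) ⟩
    u + (v + w * deg P)            ∎

  Dy≡𝟙 : D y ≡ 𝟙
  Dy≡𝟙 = trans (cong D (sym 1+x≡y)) (trans (D-+ 𝟙 x) Dx≡𝟙)

  1+y≡x : 𝟙 +ₚ y ≡ x
  1+y≡x = trans (cong (𝟙 +ₚ_) (sym 1+x≡y)) (solve 1 (λ x → con true :+ (con true :+ x) := x) refl x)

  1+x≢𝟘 : 𝟙 +ₚ x ≢ 𝟘
  1+x≢𝟘 = subst (_≢ 𝟘) (sym 1+x≡y) (proj₁ irr-y)

mono-swap : ∀ {n} x y (ps : Vec Poly n) a b es → mono (y ∷ x ∷ ps) (b ∷ a ∷ es) ≡ mono (x ∷ y ∷ ps) (a ∷ b ∷ es)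
mono-swap x y ps a b es = solve 3 (λ p q r → q :* (p :* r) := p :* (q :* r)) refl (x ^ₚ a) (y ^ₚ b) (mono ps es)

swap : Setting → Setting
swap S = record
  { x = y ; y = x ; P = P ; Q = Q ; 1+x≡y = 1+y≡x ; Dx≡𝟙 = Dy≡𝟙 ; deg-x = deg-y
  ; primes = case primes of λ { (prime ix (x≢y ∷ x≢) (prime iy y≢ dist)) → prime iy ((x≢y ∘ sym) ∷ y≢) (prime ix x≢ dist) }
  ; degP≤degQ = degP≤degQ
  ; i = j ; j = i ; u = v ; v = u ; w = w
  ; 1+P = trans 1+P (sym (mono-swap x y (P ∷ Q ∷ []) i j (0 ∷ 0 ∷ [])))
  ; 1+Q = trans 1+Q (sym (mono-swap x y (P ∷ Q ∷ []) u v (w ∷ 0 ∷ [])))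
  ; i>0 = j>0 ; j>0 = i>0 ; u>0 = v>0 ; v>0 = u>0 }
  where open Setting S

-- Odd geometric sums that are products of the four primes

data Bit : ℕ → Set where
  0# : Bit 0
  1# : Bit 1

module Sources (S : Setting) where
  open Setting S

  -- geo x m = P^c Q^d with m = 2k+1; the degree then determines m.
  record Source (k c d : ℕ) : Set where
    constructor source
    field
      bit-c  : Bit c
      bit-d  : Bit d
      geo≡   : geo x (suc (2 * k)) ≡ M 0 0 c d
      2k≡    : 2 * k ≡ c * deg P + d * deg Q

  -- The sum is 1 modulo x, and 1 modulo y because its number of terms is odd; moreover it is
  -- squarefree. So only P and Q can occur, each at most once.
  ∣M⇒source : ∀ k {a b c d} → geo x (suc (2 * k)) ∣ M a b c d → ∃[ c′ ] ∃[ d′ ] Source k c′ d′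
  ∣M⇒source k {a} {b} {c} {d} g∣ with ∣-mono⇒mono primes (a ∷ b ∷ c ∷ d ∷ []) g∣
  ... | suc a ∷ b ∷ c ∷ d ∷ [] , eq = contradiction (subst (x ∣_) (sym eq) (x∣M a b c d)) (p∤geo (2 * k) (proj₁ (proj₂ irr-x)))
  ... | zero ∷ suc b ∷ c ∷ d ∷ [] , eq =
    contradiction (subst (y ∣_) (sym eq) (y∣M 0 b c d)) (∣1+p⇒∤geo-odd k 1+x≢𝟘 irr-y (subst (y ∣_) (sym 1+x≡y) (∣-refl y)))
  ... | zero ∷ zero ∷ c ∷ d ∷ [] , eq = c , d , source (bitP c eq) (bitQ d eq) eq (begin
      2 * k                         ≡⟨ ℕ.*-identityʳ (2 * k) ⟨
      2 * k * 1                     ≡⟨ cong (2 * k *_) deg-x ⟨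
      2 * k * deg x                 ≡⟨ deg-geo (2 * k) irr-x ⟨
      deg (geo x (suc (2 * k)))     ≡⟨ cong deg eq ⟩
      deg (M 0 0 c d)               ≡⟨ deg-M 0 0 c d ⟩
      c * deg P + d * deg Q         ∎)
    where
    square : ∀ p → p ^ₚ 2 ≡ p *ₚ p
    square p = cong (p *ₚ_) (*ₚ-identityʳ p)
    bitP : ∀ c → geo x (suc (2 * k)) ≡ M 0 0 c d → Bit c
    bitP 0 _ = 0#
    bitP 1 _ = 1#
    bitP (suc (suc c)) eq = contradiction (subst₂ _∣_ (square P) (sym eq) (P^∣M 0 0 2 c d)) (square-∤-geo-odd k irr-P Dx≡𝟙)
    bitQ : ∀ d → geo x (suc (2 * k)) ≡ M 0 0 c d → Bit d
    bitQ 0 _ = 0#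
    bitQ 1 _ = 1#
    bitQ (suc (suc d)) eq = contradiction (subst₂ _∣_ (square Q) (sym eq) (Q^∣M 0 0 c 2 d)) (square-∤-geo-odd k irr-Q Dx≡𝟙)

  -- From 1 + geo x m = x · geo x (m-1).
  1+geo≡x*y*geo : ∀ n r k′ e → n ≡ 2 ^ suc r * suc (2 * k′) → 2 ^ suc r ≡ suc e →
    𝟙 +ₚ geo x (suc n) ≡ x *ₚ (y ^ₚ e *ₚ geo x (suc (2 * k′)) ^ₚ (2 ^ suc r))
  1+geo≡x*y*geo n r k′ e n≡ E≡ = begin
    𝟙 +ₚ geo x (suc n)                                                    ≡⟨ cong (𝟙 +ₚ_) (geo-suc x n) ⟩
    𝟙 +ₚ (𝟙 +ₚ x *ₚ geo x n)                                              ≡⟨ solve 1 (λ t → con true :+ (con true :+ t) := t) refl (x *ₚ geo x n) ⟩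
    x *ₚ geo x n                                                          ≡⟨ cong (λ n → x *ₚ geo x n) n≡ ⟩
    x *ₚ geo x (2 ^ suc r * suc (2 * k′))                                 ≡⟨ cong (x *ₚ_) (geo-2^* x (suc r) (suc (2 * k′)) e 1+x≢𝟘 E≡) ⟩
    x *ₚ ((𝟙 +ₚ x) ^ₚ e *ₚ geo x (suc (2 * k′)) ^ₚ (2 ^ suc r))           ≡⟨ cong (λ t → x *ₚ (t ^ₚ e *ₚ geo x (suc (2 * k′)) ^ₚ (2 ^ suc r))) 1+x≡y ⟩
    x *ₚ (y ^ₚ e *ₚ geo x (suc (2 * k′)) ^ₚ (2 ^ suc r))                  ∎

  -- The comparison of multiplicities in 1 + geo x (2k+1) = x y^(E-1) (geo x m′)^E, where 2k = E m′,
  -- E = 2^(r+1) and m′ = 2k′+1. As geo x m′ divides the left side, it is again of the form P^c′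
  -- Q^d′.
  record PredSource (k a b c d : ℕ) : Set where
    constructor predSource
    field
      {r k′ c′ d′} : ℕ
      src  : Source k′ c′ d′
      2k≡  : 2 * k ≡ 2 ^ suc r * suc (2 * k′)
      a≡   : a ≡ 1
      b≡   : suc b ≡ 2 ^ suc r
      c≡   : c ≡ c′ * 2 ^ suc r
      d≡   : d ≡ d′ * 2 ^ suc r

  1+geo≡M : ∀ k a b c d → 𝟙 +ₚ geo x (suc (2 * suc k)) ≡ M a b c d → PredSource (suc k) a b c d
  1+geo≡M k a b c d eq = go (even-part (suc k) (s≤s z≤n))
    where
    go : (∃[ r ] ∃[ k′ ] 2 * suc k ≡ 2 ^ suc r * suc (2 * k′)) → PredSource (suc k) a b c d
    go (r , k′ , n≡) = finish (∣M⇒source k′ {a} {b} {c} {d} g∣)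
      where
      E = 2 ^ suc r
      e = proj₁ (2^≡suc (suc r))
      E≡ : E ≡ suc e
      E≡ = proj₂ (2^≡suc (suc r))
      g = geo x (suc (2 * k′))
      M≡ : M a b c d ≡ x *ₚ (y ^ₚ e *ₚ g ^ₚ E)
      M≡ = trans (sym eq) (1+geo≡x*y*geo (2 * suc k) r k′ e n≡ E≡)
      g∣ : g ∣ M a b c d
      g∣ = subst (g ∣_) (sym M≡) (∣-*ˡ x (∣-*ˡ (y ^ₚ e) (subst (λ n → g ∣ g ^ₚ n) (sym E≡) (p∣p*q g (g ^ₚ e)))))
      M≡′ : ∀ c′ d′ → g ≡ M 0 0 c′ d′ → M a b c d ≡ M 1 e (c′ * E) (d′ * E)
      M≡′ c′ d′ g≡ = begin
        M a b c d                                       ≡⟨ M≡ ⟩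
        x *ₚ (y ^ₚ e *ₚ g ^ₚ E)                         ≡⟨ cong (λ t → x *ₚ (y ^ₚ e *ₚ t ^ₚ E)) g≡ ⟩
        x *ₚ (y ^ₚ e *ₚ M 0 0 c′ d′ ^ₚ E)               ≡⟨ cong (λ t → x *ₚ (y ^ₚ e *ₚ t)) (M-^ 0 0 c′ d′ E) ⟩
        x *ₚ (y ^ₚ e *ₚ M 0 0 (c′ * E) (d′ * E))        ≡⟨ cong (_*ₚ (y ^ₚ e *ₚ M 0 0 (c′ * E) (d′ * E))) (^ₚ-1 x) ⟨
        M 1 e (c′ * E) (d′ * E)                         ∎
      finish : ∃[ c′ ] ∃[ d′ ] Source k′ c′ d′ → PredSource (suc k) a b c d
      finish (c′ , d′ , src) =
        let a≡ , b≡ , c≡ , d≡ = M-injective {a} {b} {c} {d} {1} {e} {c′ * E} {d′ * E} (M≡′ c′ d′ (Source.geo≡ src))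
        in predSource {r = r} src n≡ a≡ (trans (cong suc b≡) (sym E≡)) c≡ d≡

  geo-P^1 : ∀ {k} → Source k 1 0 → geo x (suc (2 * k)) ≡ P
  geo-P^1 src = trans (Source.geo≡ src) (trans (M-P 1) (^ₚ-1 P))

  geo-Q^1 : ∀ {k} → Source k 0 1 → geo x (suc (2 * k)) ≡ Q
  geo-Q^1 src = trans (Source.geo≡ src) (trans (M-Q 1) (^ₚ-1 Q))

  2k≡degP : ∀ {k} → Source k 1 0 → 2 * k ≡ deg P
  2k≡degP src = trans (Source.2k≡ src) (trans (ℕ.+-identityʳ _) (ℕ.+-identityʳ _))

  2k≡degQ : ∀ {k} → Source k 0 1 → 2 * k ≡ deg Q
  2k≡degQ src = trans (Source.2k≡ src) (ℕ.+-identityʳ _)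

  record SourceP : Set where
    constructor sourceP
    field
      {r}     : ℕ
      i≡1     : i ≡ 1
      1+j≡    : suc j ≡ 2 ^ suc r
      degP≡2^ : deg P ≡ 2 ^ suc r
      geo≡P   : geo x (suc (deg P)) ≡ P

  -- 1 + P contains neither P nor Q, so the odd part of deg P is 1. This leaves P = 1 + x
  -- y^(2^(r+1)-1).
  source-P : ∀ {k} → Source k 1 0 → SourceP
  source-P {zero}  src = contradiction (2k≡degP src) (ℕ.<⇒≢ (irreducible⇒deg>0 irr-P))
  source-P {suc k} src = go (1+geo≡M k i j 0 0 (trans (cong (𝟙 +ₚ_) (geo-P^1 src)) 1+P))
    where
    zero-factor : ∀ r c → 0 ≡ c * 2 ^ suc r → c ≡ 0
    zero-factor r c eq with ℕ.m*n≡0⇒m≡0∨n≡0 c (sym eq)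
    ... | inj₁ c≡0 = c≡0
    ... | inj₂ E≡0 = contradiction E≡0 (ℕ.>⇒≢ (ℕ.m^n>0 2 (suc r)))
    go : PredSource (suc k) i j 0 0 → SourceP
    go (predSource {r} {k′} {c′} {d′} src′ n≡ i≡ j≡ c≡ d≡) =
      sourceP {r = r} i≡ j≡ (trans (sym (2k≡degP src)) 2k≡E) (trans (cong (λ n → geo x (suc n)) (sym (2k≡degP src))) (geo-P^1 src))
      where
      2k≡E : 2 * suc k ≡ 2 ^ suc r
      2k≡E = begin
        2 * suc k                                        ≡⟨ n≡ ⟩
        2 ^ suc r * suc (2 * k′)                         ≡⟨ cong (λ n → 2 ^ suc r * suc n) (Source.2k≡ src′) ⟩
        2 ^ suc r * suc (c′ * deg P + d′ * deg Q)        ≡⟨ cong₂ (λ c d → 2 ^ suc r * suc (c * deg P + d * deg Q)) (zero-factor r c′ c≡) (zero-factor r d′ d≡) ⟩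
        2 ^ suc r * 1                                    ≡⟨ ℕ.*-identityʳ _ ⟩
        2 ^ suc r                                        ∎

  record SourceQ : Set where
    constructor sourceQ
    field
      {r c k′} : ℕ
      u≡1      : u ≡ 1
      1+v≡     : suc v ≡ 2 ^ suc r
      w≡       : w ≡ c * 2 ^ suc r
      src      : Source k′ c 0
      degQ≡*   : deg Q ≡ 2 ^ suc r * suc (c * deg P)
      geo≡Q    : geo x (suc (deg Q)) ≡ Q

  -- 1 + Q is prime to Q but may contain P, so the odd part of deg Q need not be 1: the inner sum
  -- `geo x (2k′+1)` is 1 or P according to c.
  source-Q : ∀ {k} → Source k 0 1 → SourceQ
  source-Q {zero}  src = contradiction (2k≡degQ src) (ℕ.<⇒≢ (irreducible⇒deg>0 irr-Q))
  source-Q {suc k} src = go (1+geo≡M k u v w 0 (trans (cong (𝟙 +ₚ_) (geo-Q^1 src)) 1+Q))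
    where
    go : PredSource (suc k) u v w 0 → SourceQ
    go (predSource {r} {d′ = suc d′} _ _ _ _ _ d≡) =
      contradiction (sym d≡) (ℕ.>⇒≢ (ℕ.≤-trans (ℕ.m^n>0 2 (suc r)) (ℕ.m≤m+n _ (d′ * 2 ^ suc r))))
    go (predSource {r} {d′ = zero} src′ n≡ u≡ v≡ w≡ _) = sourceQ {r = r} u≡ v≡ w≡ src′
      (trans (sym (2k≡degQ src)) (trans n≡ (cong (λ n → 2 ^ suc r * suc n) (trans (Source.2k≡ src′) (ℕ.+-identityʳ _)))))
      (trans (cong (λ n → geo x (suc n)) (sym (2k≡degQ src))) (geo-Q^1 src))

  x∣1+P : x ∣ 𝟙 +ₚ P
  x∣1+P = subst (x ∣_) (sym 1+P) (positive i>0)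
    where
    positive : ∀ {i} → 0 < i → x ∣ M i j 0 0
    positive {suc i} _ = x∣M i j 0 0

  y∣1+P : y ∣ 𝟙 +ₚ P
  y∣1+P = subst (y ∣_) (sym 1+P) (positive j>0)
    where
    positive : ∀ {j} → 0 < j → y ∣ M i j 0 0
    positive {suc j} _ = y∣M i j 0 0

  x∣1+Q : x ∣ 𝟙 +ₚ Q
  x∣1+Q = subst (x ∣_) (sym 1+Q) (positive u>0)
    where
    positive : ∀ {u} → 0 < u → x ∣ M u v w 0
    positive {suc u} _ = x∣M u v w 0

  y∣1+Q : y ∣ 𝟙 +ₚ Q
  y∣1+Q = subst (y ∣_) (sym 1+Q) (positive v>0)
    where
    positive : ∀ {v} → 0 < v → y ∣ M u v w 0
    positive {suc v} _ = y∣M u v w 0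

  -- A nontrivial sum is prime to x, y and P, hence equal to Q^d. By `geo-odd≡prime-power`, d = f +
  -- 1 with f deg Q < deg P ≤ deg Q, so f = 0.
  geo-P-∣M : ∀ k {a b c d} → geo P (suc (2 * k)) ∣ M a b c d → k ≡ 0 ⊎ geo P (suc (2 * k)) ≡ Q
  geo-P-∣M zero    _ = inj₁ refl
  geo-P-∣M (suc k) {a} {b} {c} {d} g∣ with ∣-mono⇒mono primes (a ∷ b ∷ c ∷ d ∷ []) g∣
  ... | suc a ∷ b ∷ c ∷ d ∷ [] , eq =
    contradiction (subst (x ∣_) (sym eq) (x∣M a b c d)) (∣1+p⇒∤geo-odd {p = P} (suc k) (1+-nonzero (proj₁ (proj₂ irr-P))) irr-x x∣1+P)
  ... | zero ∷ suc b ∷ c ∷ d ∷ [] , eq =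
    contradiction (subst (y ∣_) (sym eq) (y∣M 0 b c d)) (∣1+p⇒∤geo-odd {p = P} (suc k) (1+-nonzero (proj₁ (proj₂ irr-P))) irr-y y∣1+P)
  ... | zero ∷ zero ∷ suc c ∷ d ∷ [] , eq =
    contradiction (subst₂ _∣_ (^ₚ-1 P) (sym eq) (P^∣M 0 0 1 c d)) (p∤geo (2 * suc k) (proj₁ (proj₂ irr-P)))
  ... | zero ∷ zero ∷ zero ∷ d ∷ [] , eq = inj₂ (trans g≡Qᵈ (trans (cong (Q ^ₚ_) d≡1) (^ₚ-1 Q)))
    where
    g≡Qᵈ : geo P (suc (2 * suc k)) ≡ Q ^ₚ d
    g≡Qᵈ = trans eq (M-Q d)
    d≡1 : d ≡ 1
    d≡1 with geo-odd≡prime-power k d irr-P irr-Q g≡Qᵈ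
    ... | zero  , d≡ , _  = d≡
    ... | suc f , _  , lt = contradiction (ℕ.≤-trans degP≤degQ (ℕ.m≤m+n (deg Q) (f * deg Q))) (ℕ.<⇒≱ lt)

  -- A nontrivial sum would be P^(f+1) with f deg P < deg Q, hence of degree below 2 deg Q; but a
  -- sum of at least three powers of Q has degree at least 2 deg Q.
  geo-Q-∣M : ∀ k {a b c d} → geo Q (suc (2 * k)) ∣ M a b c d → k ≡ 0
  geo-Q-∣M zero    _ = refl
  geo-Q-∣M (suc k) {a} {b} {c} {d} g∣ with ∣-mono⇒mono primes (a ∷ b ∷ c ∷ d ∷ []) g∣
  ... | suc a ∷ b ∷ c ∷ d ∷ [] , eq =
    contradiction (subst (x ∣_) (sym eq) (x∣M a b c d)) (∣1+p⇒∤geo-odd {p = Q} (suc k) (1+-nonzero (proj₁ (proj₂ irr-Q))) irr-x x∣1+Q)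
  ... | zero ∷ suc b ∷ c ∷ d ∷ [] , eq =
    contradiction (subst (y ∣_) (sym eq) (y∣M 0 b c d)) (∣1+p⇒∤geo-odd {p = Q} (suc k) (1+-nonzero (proj₁ (proj₂ irr-Q))) irr-y y∣1+Q)
  ... | zero ∷ zero ∷ c ∷ suc d ∷ [] , eq =
    contradiction (subst₂ _∣_ (^ₚ-1 Q) (sym eq) (Q^∣M 0 0 c 1 d)) (p∤geo (2 * suc k) (proj₁ (proj₂ irr-Q)))
  ... | zero ∷ zero ∷ c ∷ zero ∷ [] , eq with geo-odd≡prime-power k c irr-Q irr-P (trans eq (M-P c))
  ... | f , refl , lt = contradiction degrees (ℕ.<⇒≢ (ℕ.≤-trans (ℕ.+-mono-≤-< degP≤degQ lt) 2q≤))
    where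
    degrees : suc f * deg P ≡ 2 * suc k * deg Q
    degrees = trans (sym (deg-^ₚ (suc f) (proj₁ irr-P))) (trans (cong deg (sym (trans eq (M-P c)))) (deg-geo (2 * suc k) irr-Q))
    2q≤ : deg Q + deg Q ≤ 2 * suc k * deg Q
    2q≤ = subst (_≤ 2 * suc k * deg Q) (cong (deg Q +_) (ℕ.+-identityʳ (deg Q))) (ℕ.*-monoˡ-≤ (deg Q) (ℕ.*-monoʳ-≤ 2 {1} {suc k} (s≤s z≤n)))

-- The derivation x y D and the equation geo x m = P Q

-- The image of n in F₂ as a constant polynomial: the factor that comes from differentiating an n-th
-- power.
parₚ : ℕ → Poly
parₚ zero    = 𝟘
parₚ (suc n) = 𝟙 +ₚ parₚ n

parₚ-even : ∀ k → parₚ (2 * k) ≡ 𝟘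
parₚ-even zero    = refl
parₚ-even (suc k) = begin
  𝟙 +ₚ parₚ (k + suc (k + 0))   ≡⟨ cong (λ n → 𝟙 +ₚ parₚ n) (ℕ.+-suc k (k + 0)) ⟩
  𝟙 +ₚ (𝟙 +ₚ parₚ (2 * k))      ≡⟨ cong (λ t → 𝟙 +ₚ (𝟙 +ₚ t)) (parₚ-even k) ⟩
  𝟘                             ∎

parₚ-odd : ∀ k → parₚ (suc (2 * k)) ≡ 𝟙
parₚ-odd k = cong (𝟙 +ₚ_) (parₚ-even k)

data Parity (n : ℕ) : Set where
  isEven : ∀ k → n ≡ 2 * k → parₚ n ≡ 𝟘 → Parity n
  isOdd  : ∀ k → n ≡ suc (2 * k) → parₚ n ≡ 𝟙 → Parity n

parityₚ : ∀ n → Parity n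
parityₚ n with parity n
... | inj₁ (k , refl) = isEven k refl (parₚ-even k)
... | inj₂ (k , refl) = isOdd k refl (parₚ-odd k)

square-injective : ∀ p q → p *ₚ p ≡ q *ₚ q → p ≡ q
square-injective p q eq with (p +ₚ q) ≟ₚ 𝟘
... | yes p+q≡𝟘 = +ₚ-zero⇒≡ p q p+q≡𝟘
... | no p+q≢𝟘  = contradiction (trans (solve 2 (λ p q → (p :+ q) :* (p :+ q) := p :* p :+ q :* q) refl p q) (≡⇒+ₚ-zero eq))
                    (*ₚ-nonzero p+q≢𝟘 p+q≢𝟘)

module Logarithmic (S : Setting) where
  open Setting S
  open Sources S

  -- The derivation for which x and y, hence all monomials in them, are eigenvectors.
  θ : Poly → Poly
  θ f = x *ₚ (y *ₚ D f)

  θ-+ : ∀ f g → θ (f +ₚ g) ≡ θ f +ₚ θ g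
  θ-+ f g = trans (cong (λ t → x *ₚ (y *ₚ t)) (D-+ f g))
    (solve 4 (λ x y a b → x :* (y :* (a :+ b)) := x :* (y :* a) :+ x :* (y :* b)) refl x y (D f) (D g))

  θ-* : ∀ f g → θ (f *ₚ g) ≡ θ f *ₚ g +ₚ f *ₚ θ g
  θ-* f g = trans (cong (λ t → x *ₚ (y *ₚ t)) (D-* f g))
    (solve 6 (λ x y f g a b → x :* (y :* (a :* g :+ f :* b)) := x :* (y :* a) :* g :+ f :* (x :* (y :* b))) refl x y f g (D f) (D g))

  θ-square-* : ∀ f g → θ (f *ₚ f *ₚ g) ≡ f *ₚ f *ₚ θ g
  θ-square-* f g = trans (cong (λ t → x *ₚ (y *ₚ t)) (D-square-* f g))
    (solve 4 (λ x y f b → x :* (y :* (f :* f :* b)) := f :* f :* (x :* (y :* b))) refl x y f (D g))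

  x+y≡𝟙 : x +ₚ y ≡ 𝟙
  x+y≡𝟙 = trans (cong (x +ₚ_) (sym 1+x≡y)) (solve 1 (λ x → x :+ (con true :+ x) := con true) refl x)

  θ-x^ : ∀ n → θ (x ^ₚ n) ≡ parₚ n *ₚ y *ₚ x ^ₚ n
  θ-x^ zero    = solve 2 (λ x y → x :* (y :* con false) := con false) refl x y
  θ-x^ (suc n) = begin
    θ (x *ₚ x ^ₚ n)                                               ≡⟨ θ-* x (x ^ₚ n) ⟩
    x *ₚ (y *ₚ D x) *ₚ x ^ₚ n +ₚ x *ₚ θ (x ^ₚ n)                  ≡⟨ cong₂ (λ a b → x *ₚ (y *ₚ a) *ₚ x ^ₚ n +ₚ x *ₚ b) Dx≡𝟙 (θ-x^ n) ⟩
    x *ₚ (y *ₚ 𝟙) *ₚ x ^ₚ n +ₚ x *ₚ (parₚ n *ₚ y *ₚ x ^ₚ n)       ≡⟨ solve 4 (λ x y z e → x :* (y :* con true) :* z :+ x :* (e :* y :* z) := (con true :+ e) :* y :* (x :* z)) refl x y (x ^ₚ n) (parₚ n) ⟩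
    (𝟙 +ₚ parₚ n) *ₚ y *ₚ (x *ₚ x ^ₚ n)                           ∎

  θ-y^ : ∀ n → θ (y ^ₚ n) ≡ parₚ n *ₚ x *ₚ y ^ₚ n
  θ-y^ zero    = solve 2 (λ x y → x :* (y :* con false) := con false) refl x y
  θ-y^ (suc n) = begin
    θ (y *ₚ y ^ₚ n)                                               ≡⟨ θ-* y (y ^ₚ n) ⟩
    x *ₚ (y *ₚ D y) *ₚ y ^ₚ n +ₚ y *ₚ θ (y ^ₚ n)                  ≡⟨ cong₂ (λ a b → x *ₚ (y *ₚ a) *ₚ y ^ₚ n +ₚ y *ₚ b) Dy≡𝟙 (θ-y^ n) ⟩
    x *ₚ (y *ₚ 𝟙) *ₚ y ^ₚ n +ₚ y *ₚ (parₚ n *ₚ x *ₚ y ^ₚ n)       ≡⟨ solve 4 (λ x y z e → x :* (y :* con true) :* z :+ y :* (e :* x :* z) := (con true :+ e) :* x :* (y :* z)) refl x y (y ^ₚ n) (parₚ n) ⟩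
    (𝟙 +ₚ parₚ n) *ₚ x *ₚ (y *ₚ y ^ₚ n)                           ∎

  eigenvalue : ℕ → ℕ → Poly
  eigenvalue a b = parₚ a *ₚ y +ₚ parₚ b *ₚ x

  θ-monomial : ∀ a b → θ (M a b 0 0) ≡ eigenvalue a b *ₚ M a b 0 0
  θ-monomial a b = begin
    θ (x ^ₚ a *ₚ (y ^ₚ b *ₚ 𝟙))        ≡⟨ cong (λ t → θ (x ^ₚ a *ₚ t)) (*ₚ-identityʳ _) ⟩
    θ (x ^ₚ a *ₚ y ^ₚ b)               ≡⟨ θ-* (x ^ₚ a) (y ^ₚ b) ⟩
    θ (x ^ₚ a) *ₚ y ^ₚ b +ₚ x ^ₚ a *ₚ θ (y ^ₚ b)   ≡⟨ cong₂ (λ s t → s *ₚ y ^ₚ b +ₚ x ^ₚ a *ₚ t) (θ-x^ a) (θ-y^ b) ⟩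
    parₚ a *ₚ y *ₚ x ^ₚ a *ₚ y ^ₚ b +ₚ x ^ₚ a *ₚ (parₚ b *ₚ x *ₚ y ^ₚ b)
      ≡⟨ solve 6 (λ x y u v e f → e :* y :* u :* v :+ u :* (f :* x :* v) := (e :* y :+ f :* x) :* (u :* (v :* con true))) refl x y (x ^ₚ a) (y ^ₚ b) (parₚ a) (parₚ b) ⟩
    eigenvalue a b *ₚ M a b 0 0        ∎

  -- θ multiplies x^a y^b by a y + b x, and x + y = 1 leaves the four eigenvalues 0, y, x and 1.
  data Eigen (a b : ℕ) : Set where
    even-even : eigenvalue a b ≡ 𝟘 → Eigen a b
    odd-even  : ∀ k → a ≡ suc (2 * k) → eigenvalue a b ≡ y → Eigen a b
    even-odd  : ∀ k → b ≡ suc (2 * k) → eigenvalue a b ≡ x → Eigen a b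
    odd-odd   : eigenvalue a b ≡ 𝟙 → Eigen a b

  eigen : ∀ a b → Eigen a b
  eigen a b with parityₚ a | parityₚ b
  ... | isEven _ _ e   | isEven _ _ f   = even-even (cong₂ (λ s t → s *ₚ y +ₚ t *ₚ x) e f)
  ... | isOdd k a≡ e   | isEven _ _ f   = odd-even k a≡ (trans (cong₂ (λ s t → s *ₚ y +ₚ t *ₚ x) e f) (+ₚ-identityʳ y))
  ... | isEven _ _ e   | isOdd k b≡ f   = even-odd k b≡ (cong₂ (λ s t → s *ₚ y +ₚ t *ₚ x) e f)
  ... | isOdd _ _ e    | isOdd _ _ f    = odd-odd (trans (cong₂ (λ s t → s *ₚ y +ₚ t *ₚ x) e f) (trans (+ₚ-comm y x) x+y≡𝟙))

  x∤y : ¬ x ∣ y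
  x∤y x∣y = proj₁ (proj₂ irr-x) (∣𝟙⇒≡𝟙 (subst (x ∣_) x+y≡𝟙 (∣-+ₚ (∣-refl x) x∣y)))

  y∤x : ¬ y ∣ x
  y∤x y∣x = proj₁ (proj₂ irr-y) (∣𝟙⇒≡𝟙 (subst (y ∣_) x+y≡𝟙 (∣-+ₚ y∣x (∣-refl y))))

  P∤x : ¬ P ∣ x
  P∤x P∣x with irreducible-∣⇒≡ irr-P irr-x P∣x | primes
  ... | refl | prime _ (_ ∷ x≢x ∷ _) _ = x≢x refl

  P∤y : ¬ P ∣ y
  P∤y P∣y with irreducible-∣⇒≡ irr-P irr-y P∣y | primes
  ... | refl | prime _ _ (prime _ (y≢y ∷ _) _) = y≢y refl

  P∤monomial : ∀ a b → ¬ P ∣ M a b 0 0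
  P∤monomial a b P∣ with euclid (x ^ₚ a) (y ^ₚ b *ₚ 𝟙) irr-P P∣
  ... | inj₁ P∣xᵃ = P∤x (∣-^ₚ⇒∣ x a irr-P P∣xᵃ)
  ... | inj₂ P∣yᵇ = P∤y (∣-^ₚ⇒∣ y b irr-P (subst (P ∣_) (*ₚ-identityʳ _) P∣yᵇ))

  monomial≢𝟘 : ∀ a b → M a b 0 0 ≢ 𝟘
  monomial≢𝟘 a b = mono-nonzero primes (a ∷ b ∷ 0 ∷ 0 ∷ [])

  x∤geo : ∀ n → ¬ x ∣ geo x (suc n)
  x∤geo n = p∤geo n (proj₁ (proj₂ irr-x))

  y∤geo-odd : ∀ n → ¬ y ∣ geo x (suc (2 * n))
  y∤geo-odd n = ∣1+p⇒∤geo-odd n 1+x≢𝟘 irr-y (subst (y ∣_) (sym 1+x≡y) (∣-refl y))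

  xy-square : ∀ k → Poly
  xy-square k = x *ₚ (y *ₚ (geo x k *ₚ geo x k))

  -- Squares are constants and D (x y) = x + y = 1. Thus 1 + geo x (2k+1) is fixed by θ for every k.
  θ-xy-square : ∀ k → θ (xy-square k) ≡ xy-square k
  θ-xy-square k = begin
    θ (x *ₚ (y *ₚ (R *ₚ R)))                             ≡⟨ cong θ (solve 3 (λ x y r → x :* (y :* (r :* r)) := r :* r :* (x :* y)) refl x y R) ⟩
    θ (R *ₚ R *ₚ (x *ₚ y))                               ≡⟨ θ-square-* R (x *ₚ y) ⟩
    R *ₚ R *ₚ (x *ₚ (y *ₚ D (x *ₚ y)))                   ≡⟨ cong (λ t → R *ₚ R *ₚ (x *ₚ (y *ₚ t))) Dxy ⟩
    R *ₚ R *ₚ (x *ₚ (y *ₚ 𝟙))                            ≡⟨ solve 3 (λ x y r → r :* r :* (x :* (y :* con true)) := x :* (y :* (r :* r))) refl x y R ⟩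
    x *ₚ (y *ₚ (R *ₚ R))                                 ∎
    where
    R = geo x k
    Dxy : D (x *ₚ y) ≡ 𝟙
    Dxy = trans (D-* x y) (trans (cong₂ (λ a b → a *ₚ y +ₚ x *ₚ b) Dx≡𝟙 Dy≡𝟙)
            (trans (solve 2 (λ x y → con true :* y :+ x :* con true := x :+ y) refl x y) x+y≡𝟙))

  P*Q≡ : ∀ {k} → Source k 1 1 → P *ₚ Q ≡ 𝟙 +ₚ xy-square k
  P*Q≡ {k} (source _ _ geo≡ _) = begin
    P *ₚ Q                                              ≡⟨ solve 2 (λ p q → p :* q := p :* con true :* (q :* con true :* con true)) refl P Q ⟩
    M 0 0 1 1                                           ≡⟨ geo≡ ⟨
    geo x (suc (2 * k))                                 ≡⟨ geo-odd x k 1+x≢𝟘 ⟩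
    𝟙 +ₚ x *ₚ ((𝟙 +ₚ x) *ₚ (geo x k *ₚ geo x k))        ≡⟨ cong (λ t → 𝟙 +ₚ x *ₚ (t *ₚ (geo x k *ₚ geo x k))) 1+x≡y ⟩
    𝟙 +ₚ xy-square k                                    ∎

  m : Poly
  m = M i j 0 0

  P≡1+m : P ≡ 𝟙 +ₚ m
  P≡1+m = trans (solve 1 (λ p → p := con true :+ (con true :+ p)) refl P) (cong (𝟙 +ₚ_) 1+P)

  Q≡1+ : Q ≡ 𝟙 +ₚ M u v w 0
  Q≡1+ = trans (solve 1 (λ p → p := con true :+ (con true :+ p)) refl Q) (cong (𝟙 +ₚ_) 1+Q)

  xy-square≡ : ∀ {k} → Source k 1 1 → xy-square k ≡ m +ₚ P *ₚ M u v w 0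
  xy-square≡ {k} src = begin
    xy-square k                        ≡⟨ solve 1 (λ t → t := con true :+ (con true :+ t)) refl (xy-square k) ⟩
    𝟙 +ₚ (𝟙 +ₚ xy-square k)            ≡⟨ cong (𝟙 +ₚ_) (P*Q≡ src) ⟨
    𝟙 +ₚ P *ₚ Q                        ≡⟨ cong (λ q → 𝟙 +ₚ P *ₚ q) Q≡1+ ⟩
    𝟙 +ₚ P *ₚ (𝟙 +ₚ n)                 ≡⟨ solve 2 (λ p n → con true :+ p :* (con true :+ n) := (con true :+ p) :+ p :* n) refl P n ⟩
    (𝟙 +ₚ P) +ₚ P *ₚ n                 ≡⟨ cong (_+ₚ P *ₚ n) 1+P ⟩
    m +ₚ P *ₚ n                        ∎
    where n = M u v w 0

  -- This is θ F = F for F = 1 + PQ. If w > 0, it shows modulo P that i and j are odd, so both sides vanish.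
  θ-relation : ∀ {k} → Source k 1 1 → (eigenvalue i j +ₚ 𝟙) *ₚ m ≡ θ (P *ₚ M u v w 0) +ₚ P *ₚ M u v w 0
  θ-relation {k} src = begin
    (eigenvalue i j +ₚ 𝟙) *ₚ m                          ≡⟨ solve 4 (λ e m a b → (e :+ con true) :* m := (e :* m :+ a) :+ (m :+ b) :+ (a :+ b)) refl (eigenvalue i j) m (θ n) n ⟩
    (eigenvalue i j *ₚ m +ₚ θ n) +ₚ (m +ₚ n) +ₚ (θ n +ₚ n)  ≡⟨ cong (λ t → (t +ₚ θ n) +ₚ (m +ₚ n) +ₚ (θ n +ₚ n)) (θ-monomial i j) ⟨
    (θ m +ₚ θ n) +ₚ (m +ₚ n) +ₚ (θ n +ₚ n)              ≡⟨ cong (λ t → t +ₚ (m +ₚ n) +ₚ (θ n +ₚ n)) (θ-+ m n) ⟨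
    θ (m +ₚ n) +ₚ (m +ₚ n) +ₚ (θ n +ₚ n)                ≡⟨ cong (λ t → t +ₚ (θ n +ₚ n)) θF+F ⟩
    θ n +ₚ n                                            ∎
    where
    n = P *ₚ M u v w 0
    θF+F : θ (m +ₚ n) +ₚ (m +ₚ n) ≡ 𝟘
    θF+F = ≡⇒+ₚ-zero (subst (λ F → θ F ≡ F) (xy-square≡ src) (θ-xy-square k))

  P∤eigenvalue+1 : ∀ a b → eigenvalue a b +ₚ 𝟙 ≢ 𝟘 → ¬ P ∣ eigenvalue a b +ₚ 𝟙
  P∤eigenvalue+1 a b ≢𝟘 P∣ with eigen a b
  ... | even-even eq   = proj₁ (proj₂ irr-P) (∣𝟙⇒≡𝟙 (subst (P ∣_) (cong (_+ₚ 𝟙) eq) P∣))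
  ... | odd-even _ _ eq = P∤x (subst (P ∣_) (trans (cong (_+ₚ 𝟙) eq) (trans (+ₚ-comm y 𝟙) 1+y≡x)) P∣)
  ... | even-odd _ _ eq = P∤y (subst (P ∣_) (trans (cong (_+ₚ 𝟙) eq) (trans (+ₚ-comm x 𝟙) 1+x≡y)) P∣)
  ... | odd-odd eq     = ≢𝟘 (cong (_+ₚ 𝟙) eq)

  θ-P^ : ∀ n → P *ₚ θ (P ^ₚ n) ≡ parₚ n *ₚ P ^ₚ n *ₚ θ P
  θ-P^ zero    = solve 3 (λ p x y → p :* (x :* (y :* con false)) := con false) refl P x y
  θ-P^ (suc n) = begin
    P *ₚ θ (P *ₚ P ^ₚ n)                                        ≡⟨ cong (P *ₚ_) (θ-* P (P ^ₚ n)) ⟩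
    P *ₚ (θ P *ₚ P ^ₚ n +ₚ P *ₚ θ (P ^ₚ n))                     ≡⟨ cong (λ t → P *ₚ (θ P *ₚ P ^ₚ n +ₚ t)) (θ-P^ n) ⟩
    P *ₚ (θ P *ₚ P ^ₚ n +ₚ parₚ n *ₚ P ^ₚ n *ₚ θ P)             ≡⟨ solve 4 (λ p t q e → p :* (t :* q :+ e :* q :* t) := (con true :+ e) :* (p :* q) :* t) refl P (θ P) (P ^ₚ n) (parₚ n) ⟩
    (𝟙 +ₚ parₚ n) *ₚ (P *ₚ P ^ₚ n) *ₚ θ P                       ∎

  M-split : ∀ a b c → M a b c 0 ≡ M a b 0 0 *ₚ P ^ₚ c
  M-split a b c = solve 3 (λ a b c → a :* (b :* (c :* con true)) := a :* (b :* con true) :* c) refl (x ^ₚ a) (y ^ₚ b) (P ^ₚ c)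

  -- For even w the polynomial on the right of `θ-relation` comes from P² n′, where n′ contains P
  -- with the exponent w′ = w - 1. Since P divides (eigenvalue + 1) m but not m, the left side
  -- vanishes, which leaves θ n′ = n′. As w′ is odd, the logarithmic derivative of n′ contains θ P /
  -- P, so P would divide θ P = x y D P, impossible for an irreducible P.
  source-PQ⇒w-odd : ∀ {k w′} → Source k 1 1 → w ≡ suc w′ → ∃[ l ] w ≡ suc (2 * l)
  source-PQ⇒w-odd {k} {w′} src w≡ with parityₚ w′
  ... | isEven l w′≡ _ = l , trans w≡ (cong suc w′≡)
  ... | isOdd _ _ par≡𝟙 = ⊥-elim P∣contradiction
    where
    n′ = M u v w′ 0
    μ = M u v 0 0
    Pn≡ : P *ₚ M u v w 0 ≡ P *ₚ P *ₚ n′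
    Pn≡ = trans (cong (λ w → P *ₚ M u v w 0) w≡)
      (solve 4 (λ p a b c → p :* (a :* (b :* (p :* c :* con true))) := p :* p :* (a :* (b :* (c :* con true)))) refl P (x ^ₚ u) (y ^ₚ v) (P ^ₚ w′))
    relation : (eigenvalue i j +ₚ 𝟙) *ₚ m ≡ P *ₚ P *ₚ (θ n′ +ₚ n′)
    relation = begin
      (eigenvalue i j +ₚ 𝟙) *ₚ m                           ≡⟨ θ-relation src ⟩
      θ (P *ₚ M u v w 0) +ₚ P *ₚ M u v w 0                 ≡⟨ cong (λ t → θ t +ₚ t) Pn≡ ⟩
      θ (P *ₚ P *ₚ n′) +ₚ P *ₚ P *ₚ n′                     ≡⟨ cong (_+ₚ P *ₚ P *ₚ n′) (θ-square-* P n′) ⟩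
      P *ₚ P *ₚ θ n′ +ₚ P *ₚ P *ₚ n′                       ≡⟨ *ₚ-distribˡ (P *ₚ P) (θ n′) n′ ⟨
      P *ₚ P *ₚ (θ n′ +ₚ n′)                               ∎
    e+1≡𝟘 : eigenvalue i j +ₚ 𝟙 ≡ 𝟘
    e+1≡𝟘 = go ((eigenvalue i j +ₚ 𝟙) ≟ₚ 𝟘)
      where
      P∣ : P ∣ (eigenvalue i j +ₚ 𝟙) *ₚ m
      P∣ = divides (P *ₚ (θ n′ +ₚ n′)) (trans (sym (*ₚ-assoc P P (θ n′ +ₚ n′))) (sym relation))
      go : Dec (eigenvalue i j +ₚ 𝟙 ≡ 𝟘) → eigenvalue i j +ₚ 𝟙 ≡ 𝟘
      go (yes eq) = eq
      go (no neq) = ⊥-elim ([ P∤eigenvalue+1 i j neq , P∤monomial i j ]′ (euclid (eigenvalue i j +ₚ 𝟙) m irr-P P∣))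
    θn′≡n′ : θ n′ ≡ n′
    θn′≡n′ = +ₚ-zero⇒≡ (θ n′) n′ (*ₚ-cancelˡ (P *ₚ P) (θ n′ +ₚ n′) 𝟘 (*ₚ-nonzero (proj₁ irr-P) (proj₁ irr-P))
      (trans (sym relation) (trans (cong (_*ₚ m) e+1≡𝟘) (sym (*ₚ-zeroʳ (P *ₚ P))))))
    Pθn′ : P *ₚ θ n′ ≡ n′ *ₚ (P *ₚ eigenvalue u v +ₚ θ P)
    Pθn′ = begin
      P *ₚ θ n′                                                          ≡⟨ cong (λ t → P *ₚ θ t) (M-split u v w′) ⟩
      P *ₚ θ (μ *ₚ P ^ₚ w′)                                              ≡⟨ cong (P *ₚ_) (θ-* μ (P ^ₚ w′)) ⟩
      P *ₚ (θ μ *ₚ P ^ₚ w′ +ₚ μ *ₚ θ (P ^ₚ w′))                          ≡⟨ solve 5 (λ p t q m s → p :* (t :* q :+ m :* s) := p :* t :* q :+ m :* (p :* s)) refl P (θ μ) (P ^ₚ w′) μ (θ (P ^ₚ w′)) ⟩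
      P *ₚ θ μ *ₚ P ^ₚ w′ +ₚ μ *ₚ (P *ₚ θ (P ^ₚ w′))                     ≡⟨ cong₂ (λ s t → P *ₚ s *ₚ P ^ₚ w′ +ₚ μ *ₚ t) (θ-monomial u v) (θ-P^ w′) ⟩
      P *ₚ (eigenvalue u v *ₚ μ) *ₚ P ^ₚ w′ +ₚ μ *ₚ (parₚ w′ *ₚ P ^ₚ w′ *ₚ θ P)  ≡⟨ cong (λ e → P *ₚ (eigenvalue u v *ₚ μ) *ₚ P ^ₚ w′ +ₚ μ *ₚ (e *ₚ P ^ₚ w′ *ₚ θ P)) par≡𝟙 ⟩
      P *ₚ (eigenvalue u v *ₚ μ) *ₚ P ^ₚ w′ +ₚ μ *ₚ (𝟙 *ₚ P ^ₚ w′ *ₚ θ P)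
        ≡⟨ solve 5 (λ p e m q t → p :* (e :* m) :* q :+ m :* (con true :* q :* t) := m :* q :* (p :* e :+ t)) refl P (eigenvalue u v) μ (P ^ₚ w′) (θ P) ⟩
      μ *ₚ P ^ₚ w′ *ₚ (P *ₚ eigenvalue u v +ₚ θ P)                       ≡⟨ cong (_*ₚ (P *ₚ eigenvalue u v +ₚ θ P)) (M-split u v w′) ⟨
      n′ *ₚ (P *ₚ eigenvalue u v +ₚ θ P)                                 ∎
    P≡ : P ≡ P *ₚ eigenvalue u v +ₚ θ P
    P≡ = *ₚ-cancelˡ n′ P (P *ₚ eigenvalue u v +ₚ θ P) (mono-nonzero primes (u ∷ v ∷ w′ ∷ 0 ∷ [])) (trans (*ₚ-comm n′ P) (trans (cong (P *ₚ_) (sym θn′≡n′)) Pθn′))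
    P∣θP : P ∣ θ P
    P∣θP = ∣-+ₚ-cancel (P *ₚ eigenvalue u v) (θ P) (subst (P ∣_) P≡ (∣-refl P)) (p∣p*q P (eigenvalue u v))
    P∣contradiction : ⊥
    P∣contradiction =
      [ P∤x , [ P∤y , irreducible-∤-D irr-P irr-P ℕ.≤-refl ]′ ∘ euclid y (D P) irr-P ]′ (euclid x (y *ₚ D P) irr-P P∣θP)

  -- Here m = x^a y^(b+1) and n = x^(a+1) y^b, so m + n = x^a y^b because x + y = 1. Dividing by x y
  -- gives R² = x^(a-1) y^(b-1) (1 + x^(a+1) y^(b+1)) with R = geo x k. R is prime to x, so a = 1;
  -- then k = b + 2 is odd, R is prime to y as well, and b = 1.
  mersenne-pair : ∀ k a b l → xy-square k ≡ M a (suc b) 0 0 +ₚ (M (suc a) b 0 0 +ₚ M a (suc b) 0 0 *ₚ M (suc a) b 0 0) →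
                  0 < a → b ≡ suc (2 * l) → k ≡ suc (a + b) → a ≡ 1 × b ≡ 1
  mersenne-pair k (suc a) .(suc (2 * l)) l eq _ refl refl = cong suc a≡0 , cong suc 2l≡0
    where
    b = 2 * l
    R = geo x k
    μ = M (suc a) (suc b) 0 0
    μ′ = M a b 0 0
    square : R *ₚ R ≡ μ′ *ₚ (𝟙 +ₚ x *ₚ (y *ₚ μ))
    square = *ₚ-cancelˡ (x *ₚ y) (R *ₚ R) (μ′ *ₚ (𝟙 +ₚ x *ₚ (y *ₚ μ))) (*ₚ-nonzero (proj₁ irr-x) (proj₁ irr-y)) (begin
      x *ₚ y *ₚ (R *ₚ R)                              ≡⟨ *ₚ-assoc x y (R *ₚ R) ⟩
      xy-square k                                     ≡⟨ eq ⟩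
      M (suc a) (suc (suc b)) 0 0 +ₚ (M (suc (suc a)) (suc b) 0 0 +ₚ M (suc a) (suc (suc b)) 0 0 *ₚ M (suc (suc a)) (suc b) 0 0)
        ≡⟨ solve 4 (λ x y s t → x :* s :* (y :* (y :* t) :* con true) :+ (x :* (x :* s) :* (y :* t :* con true) :+ x :* s :* (y :* (y :* t) :* con true) :* (x :* (x :* s) :* (y :* t :* con true)))
             := (x :* y) :* (s :* (t :* con true)) :* ((x :+ y) :+ x :* (y :* (x :* s :* (y :* t :* con true))))) refl x y (x ^ₚ a) (y ^ₚ b) ⟩
      x *ₚ y *ₚ μ′ *ₚ ((x +ₚ y) +ₚ x *ₚ (y *ₚ μ))     ≡⟨ cong (λ t → x *ₚ y *ₚ μ′ *ₚ (t +ₚ x *ₚ (y *ₚ μ))) x+y≡𝟙 ⟩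
      x *ₚ y *ₚ μ′ *ₚ (𝟙 +ₚ x *ₚ (y *ₚ μ))            ≡⟨ *ₚ-assoc (x *ₚ y) μ′ (𝟙 +ₚ x *ₚ (y *ₚ μ)) ⟩
      x *ₚ y *ₚ (μ′ *ₚ (𝟙 +ₚ x *ₚ (y *ₚ μ)))          ∎)
    ∣μ′⇒∣R : ∀ {t} → Irreducible t → t ∣ μ′ → t ∣ R
    ∣μ′⇒∣R {t} irr t∣ = [ id , id ]′ (euclid R R irr (subst (t ∣_) (sym square) (∣-*ʳ (𝟙 +ₚ x *ₚ (y *ₚ μ)) t∣)))
    a-zero : ∀ a → (x ∣ M a b 0 0 → ⊥) → a ≡ 0
    a-zero zero    _ = refl
    a-zero (suc a) f = ⊥-elim (f (x∣M a b 0 0))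
    a≡0 : a ≡ 0
    a≡0 = a-zero a (λ x∣ → x∤geo (suc a + suc b) (∣μ′⇒∣R irr-x x∣))
    k≡odd : suc (suc a + suc b) ≡ suc (2 * suc l)
    k≡odd = trans (cong (λ a → suc (suc a + suc b)) a≡0) (cong (suc ∘ suc) (sym (ℕ.+-suc l (l + 0))))
    b-zero : ∀ b → (y ∣ M a b 0 0 → ⊥) → b ≡ 0
    b-zero zero    _ = refl
    b-zero (suc b) f = ⊥-elim (f (y∣M a b 0 0))
    2l≡0 : 2 * l ≡ 0
    2l≡0 = b-zero b (λ y∣ → y∤geo-odd (suc l) (subst (λ n → y ∣ geo x n) k≡odd (∣μ′⇒∣R irr-y y∣)))

  -- Both factors are powers of t, with exponents of sum 2. The exponents 1 and 1 would give f = 0.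
  square-split : ∀ {t} f g → Irreducible t → f ≢ 𝟘 → (t +ₚ f) *ₚ (t +ₚ g) ≡ t *ₚ t → t +ₚ f ≡ 𝟙 ⊎ t +ₚ g ≡ 𝟙
  square-split {t} f g irr f≢𝟘 eq = go (split-prime-power 2 (t +ₚ f) (t +ₚ g) irr (proj₁ (proj₂ irr) ∘ ∣𝟙⇒≡𝟙) (λ ())
      (trans eq (solve 1 (λ t → t :* t := t :* (t :* con true) :* con true) refl t)))
    where
    go : (∃[ e₁ ] ∃[ e₂ ] ∃[ E ] ∃[ R ] t +ₚ f ≡ t ^ₚ e₁ *ₚ E × t +ₚ g ≡ t ^ₚ e₂ *ₚ R × e₁ + e₂ ≡ 2 × E *ₚ R ≡ 𝟙) → t +ₚ f ≡ 𝟙 ⊎ t +ₚ g ≡ 𝟙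
    go (0 , _ , E , R , f≡ , _ , _ , ER≡) = inj₁ (trans f≡ (∣𝟙⇒≡𝟙 (divides R ER≡)))
    go (1 , _ , E , R , f≡ , _ , _ , ER≡) = contradiction f≡𝟘 f≢𝟘
      where
      f≡𝟘 : f ≡ 𝟘
      f≡𝟘 = begin
        f                      ≡⟨ solve 2 (λ t f → f := t :+ (t :+ f)) refl t f ⟩
        t +ₚ (t +ₚ f)          ≡⟨ cong (t +ₚ_) (trans f≡ (cong (t ^ₚ 1 *ₚ_) (∣𝟙⇒≡𝟙 (divides R ER≡)))) ⟩
        t +ₚ t *ₚ 𝟙 *ₚ 𝟙       ≡⟨ solve 1 (λ t → t :+ t :* con true :* con true := con false) refl t ⟩
        𝟘                      ∎
    go (2 , 0 , E , R , _ , g≡ , _ , ER≡) = inj₂ (trans g≡ (∣𝟙⇒≡𝟙 (divides E (trans (*ₚ-comm R E) ER≡))))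

  module Mersenne {k} (src : Source k 1 1) (w≡0 : w ≡ 0) where
    n : Poly
    n = M u v 0 0

    n≡ : M u v w 0 ≡ n
    n≡ = cong (λ w → M u v w 0) w≡0

    F≡ : xy-square k ≡ m +ₚ (n +ₚ m *ₚ n)
    F≡ = trans (xy-square≡ src) (trans (cong₂ (λ p n → m +ₚ p *ₚ n) P≡1+m n≡)
      (cong (m +ₚ_) (*ₚ-distribʳ n 𝟙 m)))

    -- This is `θ-relation` for w = 0 with P = 1 + m substituted; e and f are the eigenvalues of the
    -- two monomials, so all cases become identities between m, n, x and y.
    relation : ∀ {e f} → eigenvalue i j ≡ e → eigenvalue u v ≡ f →
               (e +ₚ 𝟙) *ₚ m ≡ (f +ₚ 𝟙) *ₚ n +ₚ (e +ₚ f +ₚ 𝟙) *ₚ (m *ₚ n)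
    relation {e} {f} e≡ f≡ = begin
      (e +ₚ 𝟙) *ₚ m                                   ≡⟨ cong (λ e → (e +ₚ 𝟙) *ₚ m) e≡ ⟨
      (eigenvalue i j +ₚ 𝟙) *ₚ m                      ≡⟨ θ-relation src ⟩
      θ (P *ₚ M u v w 0) +ₚ P *ₚ M u v w 0            ≡⟨ cong (λ t → θ t +ₚ t) (cong₂ _*ₚ_ P≡1+m n≡) ⟩
      θ ((𝟙 +ₚ m) *ₚ n) +ₚ (𝟙 +ₚ m) *ₚ n              ≡⟨ cong (_+ₚ (𝟙 +ₚ m) *ₚ n) (trans (cong θ (*ₚ-distribʳ n 𝟙 m)) (trans (θ-+ n (m *ₚ n)) (cong (θ n +ₚ_) (θ-* m n)))) ⟩
      θ n +ₚ (θ m *ₚ n +ₚ m *ₚ θ n) +ₚ (𝟙 +ₚ m) *ₚ n  ≡⟨ cong₂ (λ s t → t +ₚ (s *ₚ n +ₚ m *ₚ t) +ₚ (𝟙 +ₚ m) *ₚ n) (trans (θ-monomial i j) (cong (_*ₚ m) e≡)) (trans (θ-monomial u v) (cong (_*ₚ n) f≡)) ⟩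
      f *ₚ n +ₚ (e *ₚ m *ₚ n +ₚ m *ₚ (f *ₚ n)) +ₚ (𝟙 +ₚ m) *ₚ n
        ≡⟨ solve 4 (λ e f m n → f :* n :+ (e :* m :* n :+ m :* (f :* n)) :+ (con true :+ m) :* n := (f :+ con true) :* n :+ (e :+ f :+ con true) :* (m :* n)) refl e f m n ⟩
      (f +ₚ 𝟙) *ₚ n +ₚ (e +ₚ f +ₚ 𝟙) *ₚ (m *ₚ n)      ∎

    not-even-even : ∀ {p} a b → Irreducible p → 𝟙 +ₚ p ≡ M a b 0 0 → eigenvalue a b ≢ 𝟘
    not-even-even {p} a b irr eq e≡𝟘 = irreducible⇒D≢𝟘 irr Dp≡𝟘
      where
      θ≡𝟘 : x *ₚ (y *ₚ D (M a b 0 0)) ≡ x *ₚ (y *ₚ 𝟘)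
      θ≡𝟘 = trans (θ-monomial a b) (trans (cong (_*ₚ M a b 0 0) e≡𝟘) (solve 2 (λ x y → con false := x :* (y :* con false)) refl x y))
      Dp≡𝟘 : D p ≡ 𝟘
      Dp≡𝟘 = trans (sym (D-+ 𝟙 p)) (trans (cong D eq) (*ₚ-cancelˡ y (D (M a b 0 0)) 𝟘 (proj₁ irr-y)
        (*ₚ-cancelˡ x (y *ₚ D (M a b 0 0)) (y *ₚ 𝟘) (proj₁ irr-x) θ≡𝟘)))

    m≢𝟘 : m ≢ 𝟘
    m≢𝟘 = monomial≢𝟘 i j

    n≢𝟘 : n ≢ 𝟘
    n≢𝟘 = monomial≢𝟘 u v

    1+Q′ : 𝟙 +ₚ Q ≡ n
    1+Q′ = trans 1+Q n≡

    ≢y : ∀ {a b} → 0 < a → M a b 0 0 ≢ y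
    ≢y {a} {b} a>0 eq = ℕ.>⇒≢ a>0 (proj₁ (M-injective {a} {b} {0} {0} {0} {1} {0} {0} (trans eq (sym (trans (M-y 1) (^ₚ-1 y))))))

    ≢x : ∀ {a b} → 0 < b → M a b 0 0 ≢ x
    ≢x {a} {b} b>0 eq = ℕ.>⇒≢ b>0 (proj₁ (proj₂ (M-injective {a} {b} {0} {0} {1} {0} {0} {0} (trans eq (sym (trans (M-x 1) (^ₚ-1 x)))))))

    x+≡𝟙 : ∀ {f} → x +ₚ f ≡ 𝟙 → f ≡ y
    x+≡𝟙 {f} eq = trans (solve 2 (λ x f → f := (x :+ f) :+ x) refl x f) (trans (cong (_+ₚ x) eq) 1+x≡y)

    y+≡𝟙 : ∀ {f} → y +ₚ f ≡ 𝟙 → f ≡ x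
    y+≡𝟙 {f} eq = trans (solve 2 (λ x f → f := (x :+ f) :+ x) refl y f) (trans (cong (_+ₚ y) eq) 1+y≡x)

    divides-other : ∀ {s t} f g → f ≢ 𝟘 → f *ₚ s +ₚ f *ₚ (t *ₚ g) ≡ 𝟘 → t ∣ s
    divides-other {s} {t} f g f≢𝟘 eq = divides g (sym (*ₚ-cancelˡ f s (t *ₚ g) f≢𝟘 (+ₚ-zero⇒≡ (f *ₚ s) (f *ₚ (t *ₚ g)) eq)))

    k≡ : ∀ {a b} → i + j + (u + v) ≡ a + suc b + (suc a + b) → k ≡ suc (a + b)
    k≡ {a} {b} eq = ℕ.*-cancelˡ-≡ k (suc (a + b)) 2 (begin
      2 * k                              ≡⟨ Source.2k≡ src ⟩
      1 * deg P + 1 * deg Q              ≡⟨ cong₂ _+_ (trans (ℕ.*-identityˡ _) degP≡) (trans (ℕ.*-identityˡ _) degQ≡) ⟩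
      i + j + (u + (v + w * deg P))      ≡⟨ cong (λ w → i + j + (u + (v + w * deg P))) w≡0 ⟩
      i + j + (u + (v + 0))              ≡⟨ cong (λ t → i + j + (u + t)) (ℕ.+-identityʳ v) ⟩
      i + j + (u + v)                    ≡⟨ eq ⟩
      a + suc b + (suc a + b)            ≡⟨ solveℕ 2 (λ a b → a ⊕ (κ 1 ⊕ b) ⊕ (κ 1 ⊕ a ⊕ b) ⊜ κ 2 ⊗ (κ 1 ⊕ (a ⊕ b))) refl a b ⟩
      2 * suc (a + b)                    ∎)

    Result : Set
    Result = (i ≡ 1 × j ≡ 2 × u ≡ 2 × v ≡ 1) ⊎ (i ≡ 2 × j ≡ 1 × u ≡ 1 × v ≡ 2)

    first : ∀ l → v ≡ suc (2 * l) → x *ₚ m ≡ y *ₚ n → Result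
    first l v-odd eq = inj₁ (proj₁ pair , trans j≡ (cong suc (proj₂ pair)) , trans u≡ (cong suc (proj₁ pair)) , proj₂ pair)
      where
      exponents≡ : suc i ≡ u × j ≡ suc v × 0 ≡ 0 × 0 ≡ 0
      exponents≡ = M-injective {suc i} {j} {0} {0} {u} {suc v} {0} {0} (trans (*ₚ-assoc x (x ^ₚ i) _)
        (trans eq (solve 3 (λ y s t → y :* (s :* (t :* con true)) := s :* (y :* t :* con true)) refl y (x ^ₚ u) (y ^ₚ v))))
      u≡ = sym (proj₁ exponents≡)
      j≡ = proj₁ (proj₂ exponents≡)
      pair : i ≡ 1 × v ≡ 1
      pair = mersenne-pair k i v l
        (trans F≡ (cong₂ (λ j u → M i j 0 0 +ₚ (M u v 0 0 +ₚ M i j 0 0 *ₚ M u v 0 0)) j≡ u≡)) i>0 v-odd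
        (k≡ (cong₂ (λ j u → i + j + (u + v)) j≡ u≡))

    second : ∀ l → j ≡ suc (2 * l) → y *ₚ m ≡ x *ₚ n → Result
    second l j-odd eq = inj₂ (trans i≡ (cong suc (proj₁ pair)) , proj₂ pair , proj₁ pair , trans v≡ (cong suc (proj₂ pair)))
      where
      exponents≡ : i ≡ suc u × suc j ≡ v × 0 ≡ 0 × 0 ≡ 0
      exponents≡ = M-injective {i} {suc j} {0} {0} {suc u} {v} {0} {0} (trans
        (solve 3 (λ y s t → s :* (y :* t :* con true) := y :* (s :* (t :* con true))) refl y (x ^ₚ i) (y ^ₚ j))
        (trans eq (sym (*ₚ-assoc x (x ^ₚ u) _))))
      i≡ = proj₁ exponents≡
      v≡ = sym (proj₁ (proj₂ exponents≡))
      pair : u ≡ 1 × j ≡ 1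
      pair = mersenne-pair k u j l
        (trans F≡ (trans (solve 2 (λ m n → m :+ (n :+ m :* n) := n :+ (m :+ n :* m)) refl m n)
          (cong₂ (λ i v → M u v 0 0 +ₚ (M i j 0 0 +ₚ M u v 0 0 *ₚ M i j 0 0)) i≡ v≡))) u>0 j-odd
        (k≡ (trans (ℕ.+-comm (i + j) (u + v)) (cong₂ (λ i v → u + v + (i + j)) i≡ v≡)))

    -- The eigenvalue 0 is excluded because D P and D Q do not vanish. Among the others, 1 and 1
    -- give m n = 0; a single 1 makes y divide x or x divide y; equal eigenvalues y give (x + m) (x
    -- + n) = x², and similarly for x. Only the mixed cases x m = y n and y m = x n survive, and
    -- they are settled by `mersenne-pair`.
    mersenne : Result
    mersenne = cases (eigen i j) (eigen u v)
      where
      cases : Eigen i j → Eigen u v → Result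
      cases (even-even e) _ = ⊥-elim (not-even-even i j irr-P 1+P e)
      cases _ (even-even f) = ⊥-elim (not-even-even u v irr-Q 1+Q′ f)
      cases (odd-odd e) (odd-odd f) = ⊥-elim (*ₚ-nonzero m≢𝟘 n≢𝟘 (sym (relation e f)))
      cases (odd-odd e) (odd-even _ _ f) = ⊥-elim (y∤x (divides-other {x} {y} n m n≢𝟘 (begin
        n *ₚ x +ₚ n *ₚ (y *ₚ m)                          ≡⟨ cong (λ t → n *ₚ t +ₚ n *ₚ (y *ₚ m)) 1+y≡x ⟨
        n *ₚ (𝟙 +ₚ y) +ₚ n *ₚ (y *ₚ m)                   ≡⟨ solve 3 (λ y m n → n :* (con true :+ y) :+ n :* (y :* m) := (y :+ con true) :* n :+ (con true :+ y :+ con true) :* (m :* n)) refl y m n ⟩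
        (y +ₚ 𝟙) *ₚ n +ₚ (𝟙 +ₚ y +ₚ 𝟙) *ₚ (m *ₚ n)       ≡⟨ relation e f ⟨
        𝟘                                                ∎)))
      cases (odd-odd e) (even-odd _ _ f) = ⊥-elim (x∤y (divides-other {y} {x} n m n≢𝟘 (begin
        n *ₚ y +ₚ n *ₚ (x *ₚ m)                          ≡⟨ cong (λ t → n *ₚ t +ₚ n *ₚ (x *ₚ m)) 1+x≡y ⟨
        n *ₚ (𝟙 +ₚ x) +ₚ n *ₚ (x *ₚ m)                   ≡⟨ solve 3 (λ y m n → n :* (con true :+ y) :+ n :* (y :* m) := (y :+ con true) :* n :+ (con true :+ y :+ con true) :* (m :* n)) refl x m n ⟩
        (x +ₚ 𝟙) *ₚ n +ₚ (𝟙 +ₚ x +ₚ 𝟙) *ₚ (m *ₚ n)       ≡⟨ relation e f ⟨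
        𝟘                                                ∎)))
      cases (odd-even _ _ e) (odd-odd f) = ⊥-elim (y∤x (divides-other {x} {y} m n m≢𝟘 (begin
        m *ₚ x +ₚ m *ₚ (y *ₚ n)                          ≡⟨ cong (λ t → m *ₚ t +ₚ m *ₚ (y *ₚ n)) 1+y≡x ⟨
        m *ₚ (𝟙 +ₚ y) +ₚ m *ₚ (y *ₚ n)                   ≡⟨ solve 3 (λ y m n → m :* (con true :+ y) :+ m :* (y :* n) := (y :+ con true) :* m :+ (y :+ con true :+ con true) :* (m :* n)) refl y m n ⟩
        (y +ₚ 𝟙) *ₚ m +ₚ (y +ₚ 𝟙 +ₚ 𝟙) *ₚ (m *ₚ n)       ≡⟨ ≡⇒+ₚ-zero (relation e f) ⟩
        𝟘                                                ∎)))
      cases (even-odd _ _ e) (odd-odd f) = ⊥-elim (x∤y (divides-other {y} {x} m n m≢𝟘 (begin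
        m *ₚ y +ₚ m *ₚ (x *ₚ n)                          ≡⟨ cong (λ t → m *ₚ t +ₚ m *ₚ (x *ₚ n)) 1+x≡y ⟨
        m *ₚ (𝟙 +ₚ x) +ₚ m *ₚ (x *ₚ n)                   ≡⟨ solve 3 (λ y m n → m :* (con true :+ y) :+ m :* (y :* n) := (y :+ con true) :* m :+ (y :+ con true :+ con true) :* (m :* n)) refl x m n ⟩
        (x +ₚ 𝟙) *ₚ m +ₚ (x +ₚ 𝟙 +ₚ 𝟙) *ₚ (m *ₚ n)       ≡⟨ ≡⇒+ₚ-zero (relation e f) ⟩
        𝟘                                                ∎)))
      cases (odd-even _ _ e) (odd-even _ _ f) = ⊥-elim ([ ≢y {i} {j} i>0 ∘ x+≡𝟙 , ≢y {u} {v} u>0 ∘ x+≡𝟙 ]′ (square-split m n irr-x m≢𝟘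
        (+ₚ-zero⇒≡ ((x +ₚ m) *ₚ (x +ₚ n)) (x *ₚ x) (begin
          (x +ₚ m) *ₚ (x +ₚ n) +ₚ x *ₚ x                           ≡⟨ solve 3 (λ x m n → (x :+ m) :* (x :+ n) :+ x :* x := x :* m :+ (x :* n :+ m :* n)) refl x m n ⟩
          x *ₚ m +ₚ (x *ₚ n +ₚ m *ₚ n)                             ≡⟨ cong (λ x → x *ₚ m +ₚ (x *ₚ n +ₚ m *ₚ n)) (trans (sym 1+y≡x) (+ₚ-comm 𝟙 y)) ⟩
          (y +ₚ 𝟙) *ₚ m +ₚ ((y +ₚ 𝟙) *ₚ n +ₚ m *ₚ n)               ≡⟨ solve 3 (λ y m n → (y :+ con true) :* m :+ ((y :+ con true) :* n :+ m :* n) := (y :+ con true) :* m :+ ((y :+ con true) :* n :+ (y :+ y :+ con true) :* (m :* n))) refl y m n ⟩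
          (y +ₚ 𝟙) *ₚ m +ₚ ((y +ₚ 𝟙) *ₚ n +ₚ (y +ₚ y +ₚ 𝟙) *ₚ (m *ₚ n))  ≡⟨ ≡⇒+ₚ-zero (relation e f) ⟩
          𝟘                                                        ∎))))
      cases (even-odd _ _ e) (even-odd _ _ f) = ⊥-elim ([ ≢x {i} {j} j>0 ∘ y+≡𝟙 , ≢x {u} {v} v>0 ∘ y+≡𝟙 ]′ (square-split m n irr-y m≢𝟘
        (+ₚ-zero⇒≡ ((y +ₚ m) *ₚ (y +ₚ n)) (y *ₚ y) (begin
          (y +ₚ m) *ₚ (y +ₚ n) +ₚ y *ₚ y                           ≡⟨ solve 3 (λ x m n → (x :+ m) :* (x :+ n) :+ x :* x := x :* m :+ (x :* n :+ m :* n)) refl y m n ⟩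
          y *ₚ m +ₚ (y *ₚ n +ₚ m *ₚ n)                             ≡⟨ cong (λ x → x *ₚ m +ₚ (x *ₚ n +ₚ m *ₚ n)) (trans (sym 1+x≡y) (+ₚ-comm 𝟙 x)) ⟩
          (x +ₚ 𝟙) *ₚ m +ₚ ((x +ₚ 𝟙) *ₚ n +ₚ m *ₚ n)               ≡⟨ solve 3 (λ y m n → (y :+ con true) :* m :+ ((y :+ con true) :* n :+ m :* n) := (y :+ con true) :* m :+ ((y :+ con true) :* n :+ (y :+ y :+ con true) :* (m :* n))) refl x m n ⟩
          (x +ₚ 𝟙) *ₚ m +ₚ ((x +ₚ 𝟙) *ₚ n +ₚ (x +ₚ x +ₚ 𝟙) *ₚ (m *ₚ n))  ≡⟨ ≡⇒+ₚ-zero (relation e f) ⟩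
          𝟘                                                        ∎))))
      cases (odd-even _ _ e) (even-odd l v-odd f) = first l v-odd (begin
        x *ₚ m                                           ≡⟨ cong (_*ₚ m) (trans (sym 1+y≡x) (+ₚ-comm 𝟙 y)) ⟩
        (y +ₚ 𝟙) *ₚ m                                    ≡⟨ relation e f ⟩
        (x +ₚ 𝟙) *ₚ n +ₚ (y +ₚ x +ₚ 𝟙) *ₚ (m *ₚ n)       ≡⟨ cong₂ (λ s t → s *ₚ n +ₚ (t +ₚ 𝟙) *ₚ (m *ₚ n)) (trans (+ₚ-comm x 𝟙) 1+x≡y) (trans (+ₚ-comm y x) x+y≡𝟙) ⟩
        y *ₚ n +ₚ 𝟘                                      ≡⟨ +ₚ-identityʳ _ ⟩
        y *ₚ n                                           ∎)
      cases (even-odd l j-odd e) (odd-even _ _ f) = second l j-odd (begin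
        y *ₚ m                                           ≡⟨ cong (_*ₚ m) (trans (sym 1+x≡y) (+ₚ-comm 𝟙 x)) ⟩
        (x +ₚ 𝟙) *ₚ m                                    ≡⟨ relation e f ⟩
        (y +ₚ 𝟙) *ₚ n +ₚ (x +ₚ y +ₚ 𝟙) *ₚ (m *ₚ n)       ≡⟨ cong₂ (λ s t → s *ₚ n +ₚ (t +ₚ 𝟙) *ₚ (m *ₚ n)) (trans (+ₚ-comm y 𝟙) 1+y≡x) x+y≡𝟙 ⟩
        x *ₚ n +ₚ 𝟘                                      ≡⟨ +ₚ-identityʳ _ ⟩
        x *ₚ n                                           ∎)

-- Traces and the reducibility of geo x (2^r + 1)

∑ : ℕ → (ℕ → Poly) → Poly
∑ zero    f = 𝟘
∑ (suc n) f = f n +ₚ ∑ n f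

-- The map s ↦ s² + s is additive and telescopes along successive squares: the usual reason why a
-- trace lies in F₂.
∑-telescope : ∀ n f → (∀ i → f (suc i) ≡ f i *ₚ f i) → ∑ n f *ₚ ∑ n f +ₚ ∑ n f ≡ f n +ₚ f 0
∑-telescope zero    f sq = sym (+ₚ-self (f 0))
∑-telescope (suc n) f sq = begin
  (f n +ₚ ∑ n f) *ₚ (f n +ₚ ∑ n f) +ₚ (f n +ₚ ∑ n f)
    ≡⟨ solve 2 (λ a s → (a :+ s) :* (a :+ s) :+ (a :+ s) := a :* a :+ a :+ (s :* s :+ s)) refl (f n) (∑ n f) ⟩
  f n *ₚ f n +ₚ f n +ₚ (∑ n f *ₚ ∑ n f +ₚ ∑ n f)        ≡⟨ cong₂ (λ s t → s +ₚ f n +ₚ t) (sym (sq n)) (∑-telescope n f sq) ⟩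
  f (suc n) +ₚ f n +ₚ (f n +ₚ f 0)                      ≡⟨ solve 3 (λ a b c → a :+ b :+ (b :+ c) := a :+ c) refl (f (suc n)) (f n) (f 0) ⟩
  f (suc n) +ₚ f 0                                      ∎

∑-∣ : ∀ n {p} f g → (∀ i → i < n → p ∣ f i +ₚ g i) → p ∣ ∑ n f +ₚ ∑ n g
∑-∣ zero    f g h = ∣𝟘 _
∑-∣ (suc n) {p} f g h = subst (p ∣_) (+ₚ-medial (f n) (g n) (∑ n f) (∑ n g))
  (∣-+ₚ (h n ℕ.≤-refl) (∑-∣ n f g (λ i i<n → h i (ℕ.m<n⇒m<1+n i<n))))

∑-size : ∀ n N f → (∀ i → i < n → size (f i) ≤ N) → size (∑ n f) ≤ N
∑-size zero    N f h = z≤n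
∑-size (suc n) N f h = size-+ₚ N (f n) (∑ n f) (h n ℕ.≤-refl) (∑-size n N f (λ i i<n → h i (ℕ.m<n⇒m<1+n i<n)))

∑-D : ∀ n f → (∀ i → D (f (suc i)) ≡ 𝟘) → D (∑ (suc n) f) ≡ D (f 0)
∑-D zero    f h = cong D (+ₚ-identityʳ (f 0))
∑-D (suc n) f h = trans (D-+ (f (suc n)) (∑ (suc n) f)) (cong₂ _+ₚ_ (h n) (∑-D n f h))

*-∑ : ∀ p n f → p *ₚ ∑ n f ≡ ∑ n (λ i → p *ₚ f i)
*-∑ p zero    f = *ₚ-zeroʳ p
*-∑ p (suc n) f = trans (*ₚ-distribˡ p (f n) (∑ n f)) (cong (p *ₚ f n +ₚ_) (*-∑ p n f))

module Trace (S : Setting) where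
  open Setting S
  open Logarithmic S using (x∤y; x+y≡𝟙)

  size-x^ : ∀ n → size (x ^ₚ n) ≡ suc n
  size-x^ n = trans (size≡suc-deg (^ₚ-nonzero n (proj₁ irr-x)))
    (cong suc (trans (deg-^ₚ n (proj₁ irr-x)) (trans (cong (n *_) deg-x) (ℕ.*-identityʳ n))))

  -- Modulo R = geo x (2^r+1) we have z = x^(2^r) = 1/x, so Tr = Σ_{i<r} x^(2^i) + z^(2^i) satisfies Tr² = Tr
  -- and R divides Tr or Tr + 1.  Multiplying by x^J, J = 2^(r-1), turns this into a polynomial V of degree at most deg R
  -- with derivative x^(J-2) y², while D R is a power of y.
  geo-2^+1-reducible : ∀ ρ {R} → Irreducible R → ¬ R ∣ x → geo x (suc (2 ^ (3 + ρ))) ≢ R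
  geo-2^+1-reducible ρ {R} irr R∤x geo≡R = [ case-T 𝟘 (inj₁ refl) ∘ subst (R ∣_) (sym (+ₚ-identityʳ Tr)) , case-T 𝟙 (inj₂ refl) ]′
                                             (euclid Tr (Tr +ₚ 𝟙) irr R∣Tr²+Tr)
    where
    r = 3 + ρ
    J = 2 ^ (2 + ρ)
    z = x ^ₚ (2 ^ r)
    f g : ℕ → Poly
    f i = x ^ₚ (2 ^ i) +ₚ z ^ₚ (2 ^ i)
    -- Modulo R this is x^J f i, with z replaced by 1/x. The choice J = 2^(r-1) is the largest 2^i
    -- for i < r: it keeps both exponents nonnegative and at most 2J = deg R.
    g i = x ^ₚ (J + 2 ^ i) +ₚ x ^ₚ (J ∸ 2 ^ i)
    Tr = ∑ r f
    R∣1+xz : R ∣ 𝟙 +ₚ x *ₚ z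
    R∣1+xz = subst₂ _∣_ geo≡R (geo-closed x (suc (2 ^ r))) (∣-*ˡ (𝟙 +ₚ x) (∣-refl (geo x (suc (2 ^ r)))))
    ∣^ : ∀ {q} n e → n ≡ suc e → R ∣ q → R ∣ q ^ₚ n
    ∣^ {q} .(suc e) e refl R∣q = ∣-*ʳ (q ^ₚ e) R∣q
    R∣1+xz^ : ∀ i → R ∣ 𝟙 +ₚ x ^ₚ (2 ^ i) *ₚ z ^ₚ (2 ^ i)
    R∣1+xz^ i = subst (R ∣_) (trans (1+-^-2^ (x *ₚ z) i) (cong (𝟙 +ₚ_) (*ₚ-^ₚ x z (2 ^ i))))
      (∣^ (2 ^ i) (proj₁ (2^≡suc i)) (proj₂ (2^≡suc i)) R∣1+xz)
    R∣x+z^ : R ∣ x +ₚ z ^ₚ (2 ^ r)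
    R∣x+z^ = [ (λ R∣z → ⊥-elim (R∤x (∣-^ₚ⇒∣ x (2 ^ r) irr R∣z))) , id ]′ (euclid z (x +ₚ z ^ₚ (2 ^ r)) irr
      (subst (R ∣_) (solve 3 (λ x z s → (con true :+ x :* z) :+ (con true :+ z :* s) := z :* (x :+ s)) refl x z (z ^ₚ (2 ^ r)))
        (∣-+ₚ R∣1+xz (R∣1+xz^ r))))
    f-square : ∀ i → f (suc i) ≡ f i *ₚ f i
    f-square i = trans (cong₂ _+ₚ_ (^ₚ-double x (2 ^ i)) (^ₚ-double z (2 ^ i)))
      (solve 2 (λ a b → a :* a :+ b :* b := (a :+ b) :* (a :+ b)) refl (x ^ₚ (2 ^ i)) (z ^ₚ (2 ^ i)))
    R∣Tr²+Tr : R ∣ Tr *ₚ (Tr +ₚ 𝟙)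
    R∣Tr²+Tr = subst (R ∣_) (begin
      x +ₚ z ^ₚ (2 ^ r)                                ≡⟨ solve 3 (λ x z s → x :+ s := z :+ s :+ (x :* con true :+ z :* con true)) refl x z (z ^ₚ (2 ^ r)) ⟩
      f r +ₚ f 0                                       ≡⟨ ∑-telescope r f f-square ⟨
      Tr *ₚ Tr +ₚ Tr                                      ≡⟨ solve 1 (λ t → t :* t :+ t := t :* (t :+ con true)) refl Tr ⟩
      Tr *ₚ (Tr +ₚ 𝟙)                                    ∎) R∣x+z^
    J≤ : ∀ i → i < r → 2 ^ i ≤ J
    J≤ i i<r = ℕ.^-monoʳ-≤ 2 (s≤s⁻¹ i<r)
    term : ∀ i → i < r → R ∣ x ^ₚ J *ₚ f i +ₚ g i
    term i i<r = subst (R ∣_) (begin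
      s *ₚ (𝟙 +ₚ t *ₚ ζ)                               ≡⟨ solve 3 (λ s t z → s :* (con true :+ t :* z) := (s :* t) :* (t :+ z) :+ ((s :* t) :* t :+ s)) refl s t ζ ⟩
      (s *ₚ t) *ₚ (t +ₚ ζ) +ₚ ((s *ₚ t) *ₚ t +ₚ s)     ≡⟨ cong (λ q → q *ₚ (t +ₚ ζ) +ₚ (q *ₚ t +ₚ s)) st≡ ⟩
      x ^ₚ J *ₚ (t +ₚ ζ) +ₚ (x ^ₚ J *ₚ t +ₚ s)         ≡⟨ cong (λ q → x ^ₚ J *ₚ (t +ₚ ζ) +ₚ (q +ₚ s)) (^ₚ-+ x J (2 ^ i)) ⟨
      x ^ₚ J *ₚ f i +ₚ g i                             ∎) (∣-*ˡ s (R∣1+xz^ i))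
      where
      s = x ^ₚ (J ∸ 2 ^ i)
      t = x ^ₚ (2 ^ i)
      ζ = z ^ₚ (2 ^ i)
      st≡ : s *ₚ t ≡ x ^ₚ J
      st≡ = trans (sym (^ₚ-+ x (J ∸ 2 ^ i) (2 ^ i))) (cong (x ^ₚ_) (ℕ.m∸n+n≡m (J≤ i i<r)))
    e₀ = proj₁ (2^≡suc ρ)
    J′ = 2 ^ (1 + ρ)
    j″ = suc (2 * e₀)
    J′≡ : J′ ≡ suc j″
    J′≡ = trans (cong (2 *_) (proj₂ (2^≡suc ρ))) (cong suc (ℕ.+-suc e₀ (e₀ + 0)))
    -- For i > 0 the exponents J + 2^i and J - 2^i are even, so only `g 0` contributes to the
    -- derivative of V.
    Dg-suc : ∀ i → D (g (suc i)) ≡ 𝟘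
    Dg-suc i = trans (D-+ (x ^ₚ (J + 2 ^ suc i)) (x ^ₚ (J ∸ 2 ^ suc i)))
      (cong₂ _+ₚ_ (trans (cong (λ n → D (x ^ₚ n)) (sym (ℕ.*-distribˡ-+ 2 J′ (2 ^ i)))) (D-^-even x (J′ + 2 ^ i)))
                  (trans (cong (λ n → D (x ^ₚ n)) (sym (ℕ.*-distribˡ-∸ 2 J′ (2 ^ i)))) (D-^-even x (J′ ∸ 2 ^ i))))
    D-odd-power : ∀ n → D (x ^ₚ suc (2 * n)) ≡ x ^ₚ (2 * n)
    D-odd-power n = trans (D-^-odd x n) (trans (cong (x ^ₚ (2 * n) *ₚ_) Dx≡𝟙) (*ₚ-identityʳ _))
    Dg0 : D (g 0) ≡ y *ₚ y *ₚ x ^ₚ (2 * j″)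
    Dg0 = begin
      D (x ^ₚ (J + 1) +ₚ x ^ₚ (J ∸ 1))                         ≡⟨ D-+ (x ^ₚ (J + 1)) (x ^ₚ (J ∸ 1)) ⟩
      D (x ^ₚ (J + 1)) +ₚ D (x ^ₚ (J ∸ 1))                     ≡⟨ cong₂ (λ a b → D (x ^ₚ a) +ₚ D (x ^ₚ b)) (trans (ℕ.+-comm J 1) (cong (λ n → suc (2 * n)) J′≡)) (trans (cong (λ n → 2 * n ∸ 1) J′≡) (ℕ.+-suc j″ (j″ + 0))) ⟩
      D (x ^ₚ suc (2 * suc j″)) +ₚ D (x ^ₚ suc (2 * j″))       ≡⟨ cong₂ _+ₚ_ (D-odd-power (suc j″)) (D-odd-power j″) ⟩
      x ^ₚ (2 * suc j″) +ₚ x ^ₚ (2 * j″)                       ≡⟨ cong (λ n → x *ₚ x ^ₚ n +ₚ x ^ₚ (2 * j″)) (ℕ.+-suc j″ (j″ + 0)) ⟩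
      x *ₚ (x *ₚ x ^ₚ (2 * j″)) +ₚ x ^ₚ (2 * j″)               ≡⟨ solve 2 (λ x s → x :* (x :* s) :+ s := (con true :+ x) :* (con true :+ x) :* s) refl x (x ^ₚ (2 * j″)) ⟩
      (𝟙 +ₚ x) *ₚ (𝟙 +ₚ x) *ₚ x ^ₚ (2 * j″)                    ≡⟨ cong (λ y → y *ₚ y *ₚ x ^ₚ (2 * j″)) 1+x≡y ⟩
      y *ₚ y *ₚ x ^ₚ (2 * j″)                                  ∎
    J₁ = proj₁ (2^≡suc (2 + ρ))
    2J≡ : 2 ^ r ≡ suc (suc (2 * J₁))
    2J≡ = trans (cong (2 *_) (proj₂ (2^≡suc (2 + ρ)))) (cong suc (ℕ.+-suc J₁ (J₁ + 0)))
    DR : D R ≡ y ^ₚ (2 * J₁)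
    DR = begin
      D R                                                      ≡⟨ cong D geo≡R ⟨
      D (geo x (suc (2 ^ r)))                                  ≡⟨ cong D (geo-suc x (2 ^ r)) ⟩
      D (𝟙 +ₚ x *ₚ geo x (2 ^ r))                              ≡⟨ D-+ 𝟙 (x *ₚ geo x (2 ^ r)) ⟩
      D (x *ₚ geo x (2 ^ r))                                   ≡⟨ cong (λ t → D (x *ₚ t)) geo≡ ⟩
      D (x *ₚ y ^ₚ suc (2 * J₁))                               ≡⟨ D-* x (y ^ₚ suc (2 * J₁)) ⟩
      D x *ₚ y ^ₚ suc (2 * J₁) +ₚ x *ₚ D (y ^ₚ suc (2 * J₁))   ≡⟨ cong₂ (λ a b → a *ₚ y ^ₚ suc (2 * J₁) +ₚ x *ₚ b) Dx≡𝟙 (trans (D-^-odd y J₁) (cong (y ^ₚ (2 * J₁) *ₚ_) Dy≡𝟙)) ⟩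
      𝟙 *ₚ (y *ₚ y ^ₚ (2 * J₁)) +ₚ x *ₚ (y ^ₚ (2 * J₁) *ₚ 𝟙)   ≡⟨ solve 3 (λ x y s → con true :* (y :* s) :+ x :* (s :* con true) := (x :+ y) :* s) refl x y (y ^ₚ (2 * J₁)) ⟩
      (x +ₚ y) *ₚ y ^ₚ (2 * J₁)                                ≡⟨ cong (_*ₚ y ^ₚ (2 * J₁)) x+y≡𝟙 ⟩
      y ^ₚ (2 * J₁)                                            ∎
      where
      geo≡ : geo x (2 ^ r) ≡ y ^ₚ suc (2 * J₁)
      geo≡ = begin
        geo x (2 ^ r)                                          ≡⟨ cong (geo x) (ℕ.*-identityʳ (2 ^ r)) ⟨
        geo x (2 ^ r * 1)                                      ≡⟨ geo-2^* x r 1 (suc (2 * J₁)) 1+x≢𝟘 2J≡ ⟩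
        (𝟙 +ₚ x) ^ₚ suc (2 * J₁) *ₚ 𝟙 ^ₚ (2 ^ r)               ≡⟨ cong₂ (λ a b → a ^ₚ suc (2 * J₁) *ₚ b) 1+x≡y (𝟙-^ₚ (2 ^ r)) ⟩
        y ^ₚ suc (2 * J₁) *ₚ 𝟙                                 ≡⟨ *ₚ-identityʳ _ ⟩
        y ^ₚ suc (2 * J₁)                                      ∎
    case-T : ∀ c → c ≡ 𝟘 ⊎ c ≡ 𝟙 → ¬ R ∣ Tr +ₚ c
    case-T c c≡ R∣Tr+c = decide (V ≟ₚ 𝟘)
      where
      V = ∑ r g +ₚ c *ₚ x ^ₚ J
      R∣V : R ∣ V
      R∣V = ∣-+ₚ-cancel (x ^ₚ J *ₚ (Tr +ₚ c)) V (subst (R ∣_) (begin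
        ∑ r (λ i → x ^ₚ J *ₚ f i) +ₚ ∑ r g                       ≡⟨ cong (_+ₚ ∑ r g) (*-∑ (x ^ₚ J) r f) ⟨
        x ^ₚ J *ₚ Tr +ₚ ∑ r g                                     ≡⟨ solve 4 (λ s t c g → s :* t :+ g := s :* (t :+ c) :+ (g :+ c :* s)) refl (x ^ₚ J) Tr c (∑ r g) ⟩
        x ^ₚ J *ₚ (Tr +ₚ c) +ₚ V                                  ∎) (∑-∣ r (λ i → x ^ₚ J *ₚ f i) g term)) (∣-*ˡ (x ^ₚ J) R∣Tr+c)
      N = suc (J + J)
      small : ∀ n → n ≤ J + J → size (x ^ₚ n) ≤ N
      small n n≤ = ℕ.≤-trans (ℕ.≤-reflexive (size-x^ n)) (s≤s n≤)
      c-small : c ≡ 𝟘 ⊎ c ≡ 𝟙 → size (c *ₚ x ^ₚ J) ≤ N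
      c-small (inj₁ refl) = z≤n
      c-small (inj₂ refl) = small J (ℕ.m≤m+n J J)
      V-small : size V ≤ N
      V-small = size-+ₚ N (∑ r g) (c *ₚ x ^ₚ J) (∑-size r N g (λ i i<r → size-+ₚ N (x ^ₚ (J + 2 ^ i)) (x ^ₚ (J ∸ 2 ^ i))
        (small (J + 2 ^ i) (ℕ.+-monoʳ-≤ J (J≤ i i<r))) (small (J ∸ 2 ^ i) (ℕ.≤-trans (ℕ.m∸n≤m J (2 ^ i)) (ℕ.m≤m+n J J))))) (c-small c≡)
      degR : deg R ≡ J + J
      degR = begin
        deg R                             ≡⟨ cong deg geo≡R ⟨
        deg (geo x (suc (2 ^ r)))         ≡⟨ deg-geo (2 ^ r) irr-x ⟩
        2 ^ r * deg x                     ≡⟨ trans (cong (2 ^ r *_) deg-x) (ℕ.*-identityʳ (2 ^ r)) ⟩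
        2 ^ r                             ≡⟨ cong (J +_) (ℕ.+-identityʳ J) ⟩
        J + J                             ∎
      Dc : c ≡ 𝟘 ⊎ c ≡ 𝟙 → D (c *ₚ x ^ₚ J) ≡ 𝟘
      Dc (inj₁ refl) = refl
      Dc (inj₂ refl) = D-^-even x J′
      DV : D V ≡ y *ₚ y *ₚ x ^ₚ (2 * j″)
      DV = trans (D-+ (∑ r g) (c *ₚ x ^ₚ J)) (trans (cong₂ _+ₚ_ (trans (∑-D (2 + ρ) g Dg-suc) Dg0) (Dc c≡)) (+ₚ-identityʳ _))
      decide : Dec (V ≡ 𝟘) → ⊥
      decide (yes V≡𝟘) = *ₚ-nonzero {y *ₚ y} {x ^ₚ (2 * j″)} (*ₚ-nonzero (proj₁ irr-y) (proj₁ irr-y)) (^ₚ-nonzero (2 * j″) (proj₁ irr-x)) (trans (sym DV) (cong D V≡𝟘))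
      -- Here r ≥ 3 enters: J - 2 is positive, so x divides D V = D R, a power of y. For r = 2 there
      -- is no contradiction, since J - 2 = 0.
      decide (no V≢𝟘) = x∤y (∣-^ₚ⇒∣ y (2 * J₁) irr-x (subst (x ∣_) (trans (sym DV) (trans (cong D (sym R≡V)) DR)) (∣-*ˡ (y *ₚ y) (p∣p*q x (x ^ₚ (2 * e₀ + (j″ + 0)))))))
        where
        R≡V : R ≡ V
        R≡V = ∣-deg≡⇒≡ V≢𝟘 R∣V (subst (deg V ≤_) (sym degR) (s≤s⁻¹ (subst (_≤ N) (size≡suc-deg V≢𝟘) V-small)))

-- The case Q = geo P m, m > 1 odd

module GeoP (S : Setting) (k : ℕ) (geo≡Q : geo (Setting.P S) (suc (2 * suc k)) ≡ Setting.Q S) where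
  open Setting S
  open Sources S
  open Logarithmic S

  1+P≢𝟘 : 𝟙 +ₚ P ≢ 𝟘
  1+P≢𝟘 = 1+-nonzero (proj₁ (proj₂ irr-P))

  record ExponentsQ : Set where
    constructor exponentsQ
    field
      {r e}   : ℕ
      2^≡     : 2 ^ suc r ≡ suc e
      2k≡     : 2 * suc k ≡ 2 ^ suc r
      u≡      : u ≡ i * e
      v≡      : v ≡ j * e
      w≡1     : w ≡ 1

  -- 1 + Q = P geo P (m-1) = P (1 + P)^(E-1) g^E, where E is the 2-part of m - 1 and g an odd
  -- geometric sum in P. By `geo-P-∣M` g is 1 or Q, and Q does not divide 1 + Q. So m - 1 = E is a
  -- power of two, and P occurs exactly once.
  exponents-Q : ExponentsQ
  exponents-Q = go (even-part (suc k) (s≤s z≤n))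
    where
    go : (∃[ r ] ∃[ k′ ] 2 * suc k ≡ 2 ^ suc r * suc (2 * k′)) → ExponentsQ
    go (r , k′ , n≡) = [ finish , (λ g≡Q → ⊥-elim (Q∤1+Q (subst (_∣ M u v w 0) g≡Q g∣))) ]′ (geo-P-∣M k′ {u} {v} {w} {0} g∣)
      where
      E = 2 ^ suc r
      e = proj₁ (2^≡suc (suc r))
      E≡ : E ≡ suc e
      E≡ = proj₂ (2^≡suc (suc r))
      g = geo P (suc (2 * k′))
      M≡ : M u v w 0 ≡ P *ₚ ((𝟙 +ₚ P) ^ₚ e *ₚ g ^ₚ E)
      M≡ = begin
        M u v w 0                                  ≡⟨ 1+Q ⟨
        𝟙 +ₚ Q                                     ≡⟨ cong (𝟙 +ₚ_) geo≡Q ⟨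
        𝟙 +ₚ geo P (suc (2 * suc k))               ≡⟨ cong (𝟙 +ₚ_) (geo-suc P (2 * suc k)) ⟩
        𝟙 +ₚ (𝟙 +ₚ P *ₚ geo P (2 * suc k))         ≡⟨ solve 1 (λ t → con true :+ (con true :+ t) := t) refl (P *ₚ geo P (2 * suc k)) ⟩
        P *ₚ geo P (2 * suc k)                     ≡⟨ cong (λ n → P *ₚ geo P n) n≡ ⟩
        P *ₚ geo P (E * suc (2 * k′))              ≡⟨ cong (P *ₚ_) (geo-2^* P (suc r) (suc (2 * k′)) e 1+P≢𝟘 E≡) ⟩
        P *ₚ ((𝟙 +ₚ P) ^ₚ e *ₚ g ^ₚ E)             ∎
      g∣ : g ∣ M u v w 0
      g∣ = subst (g ∣_) (sym M≡) (∣-*ˡ P (∣-*ˡ ((𝟙 +ₚ P) ^ₚ e) (subst (λ n → g ∣ g ^ₚ n) (sym E≡) (p∣p*q g (g ^ₚ e)))))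
      Q∤1+Q : ¬ Q ∣ M u v w 0
      Q∤1+Q Q∣ = proj₁ (proj₂ irr-Q) (∣𝟙⇒≡𝟙 (∣-+ₚ-cancel Q 𝟙 (subst (Q ∣_) (trans (sym 1+Q) (+ₚ-comm 𝟙 Q)) Q∣) (∣-refl Q)))
      finish : k′ ≡ 0 → ExponentsQ
      finish k′≡0 =
        let u≡ , v≡ , w≡ , _ = M-injective {u} {v} {w} {0} {i * e} {j * e} {1} {0} (begin
              M u v w 0                                  ≡⟨ M≡ ⟩
              P *ₚ ((𝟙 +ₚ P) ^ₚ e *ₚ g ^ₚ E)             ≡⟨ cong₂ (λ s t → P *ₚ (s ^ₚ e *ₚ t)) 1+P (trans (cong (λ k → geo P (suc (2 * k)) ^ₚ E) k′≡0) (𝟙-^ₚ E)) ⟩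
              P *ₚ (M i j 0 0 ^ₚ e *ₚ 𝟙)                 ≡⟨ cong (P *ₚ_) (trans (*ₚ-identityʳ _) (M-^ i j 0 0 e)) ⟩
              P *ₚ M (i * e) (j * e) 0 0                 ≡⟨ solve 3 (λ p s t → p :* (s :* (t :* con true)) := s :* (t :* (p :* con true :* con true))) refl P (x ^ₚ (i * e)) (y ^ₚ (j * e)) ⟩
              M (i * e) (j * e) 1 0                      ∎)
        in exponentsQ {r = r} E≡ (trans n≡ (trans (cong (λ k → E * suc (2 * k)) k′≡0) (ℕ.*-identityʳ E))) u≡ v≡ w≡

  N : ℕ
  N = suc (suc k)

  K : Poly
  K = geo P N

  P∤K : ¬ P ∣ K
  P∤K = p∤geo (suc k) (proj₁ (proj₂ irr-P))

  -- For m = 2 (k+1) + 1, 1 + P Q = 1 + P geo P m is geo P (m+1), and m + 1 = 2N is even.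
  xy-square≡K² : ∀ {l} → Source l 1 1 → xy-square l ≡ (𝟙 +ₚ P) *ₚ (K *ₚ K)
  xy-square≡K² {l} src = begin
    xy-square l                                ≡⟨ solve 1 (λ t → t := con true :+ (con true :+ t)) refl (xy-square l) ⟩
    𝟙 +ₚ (𝟙 +ₚ xy-square l)                    ≡⟨ cong (𝟙 +ₚ_) (P*Q≡ src) ⟨
    𝟙 +ₚ P *ₚ Q                                ≡⟨ cong (λ q → 𝟙 +ₚ P *ₚ q) geo≡Q ⟨
    𝟙 +ₚ P *ₚ geo P (suc (2 * suc k))          ≡⟨ geo-suc P (suc (2 * suc k)) ⟨
    geo P (suc (suc (2 * suc k)))              ≡⟨ cong (λ n → geo P (suc n)) (ℕ.+-suc (suc k) (suc k + 0)) ⟨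
    geo P (2 * N)                              ≡⟨ geo-double P N 1+P≢𝟘 ⟩
    (𝟙 +ₚ P) *ₚ (K *ₚ K)                       ∎

  -- If geo x (2 (l+1) + 1) = P Q held too, then 1 + P Q would be both x y R² and (1 + P) K² = x^i
  -- y^j K². Since y R² is prime to x, this leaves i = 1, x prime to K, and R² = K² y^(j-1).
  module NoSourcePQ (l : ℕ) (src : Source (suc l) 1 1) (i′ j₁ : ℕ) (i≡ : i ≡ suc i′) (j≡ : j ≡ suc j₁) where
    R : Poly
    R = geo x (suc l)

    x∤yRR : ¬ x ∣ y *ₚ (R *ₚ R)
    x∤yRR = ∤-*ₚ irr-x x∤y (∤-*ₚ irr-x (x∤geo l) (x∤geo l))

    yRR≡ : y *ₚ (R *ₚ R) ≡ M i′ (suc j₁) 0 0 *ₚ (K *ₚ K)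
    yRR≡ = *ₚ-cancelˡ x (y *ₚ (R *ₚ R)) (M i′ (suc j₁) 0 0 *ₚ (K *ₚ K)) (proj₁ irr-x) (begin
      xy-square (suc l)                          ≡⟨ xy-square≡K² src ⟩
      (𝟙 +ₚ P) *ₚ (K *ₚ K)                       ≡⟨ cong (_*ₚ (K *ₚ K)) (trans 1+P (cong₂ (λ i j → M i j 0 0) i≡ j≡)) ⟩
      M (suc i′) (suc j₁) 0 0 *ₚ (K *ₚ K)        ≡⟨ solve 4 (λ x s t q → x :* s :* t :* q := x :* (s :* t :* q)) refl x (x ^ₚ i′) (y ^ₚ suc j₁ *ₚ 𝟙) (K *ₚ K) ⟩
      x *ₚ (M i′ (suc j₁) 0 0 *ₚ (K *ₚ K))       ∎)

    x∤K : ¬ x ∣ K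
    x∤K x∣K = x∤yRR (subst (x ∣_) (sym yRR≡) (∣-*ˡ (M i′ (suc j₁) 0 0) (∣-*ʳ K x∣K)))

    i′≡0 : ∀ i′ → y *ₚ (R *ₚ R) ≡ M i′ (suc j₁) 0 0 *ₚ (K *ₚ K) → i′ ≡ 0
    i′≡0 zero    _  = refl
    i′≡0 (suc i) eq = ⊥-elim (x∤yRR (subst (x ∣_) (sym eq) (∣-*ʳ (K *ₚ K) (x∣M i (suc j₁) 0 0))))

    RR≡ : R *ₚ R ≡ K *ₚ K *ₚ y ^ₚ j₁
    RR≡ = *ₚ-cancelˡ y (R *ₚ R) (K *ₚ K *ₚ y ^ₚ j₁) (proj₁ irr-y) (begin
      y *ₚ (R *ₚ R)                              ≡⟨ yRR≡ ⟩
      M i′ (suc j₁) 0 0 *ₚ (K *ₚ K)              ≡⟨ cong (λ i → M i (suc j₁) 0 0 *ₚ (K *ₚ K)) (i′≡0 i′ yRR≡) ⟩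
      y *ₚ y ^ₚ j₁ *ₚ 𝟙 *ₚ (K *ₚ K)              ≡⟨ solve 3 (λ y s q → y :* s :* con true :* (q :* q) := y :* (q :* q :* s)) refl y (y ^ₚ j₁) K ⟩
      y *ₚ (K *ₚ K *ₚ y ^ₚ j₁)                   ∎)

    K≢𝟘 : K ≢ 𝟘
    K≢𝟘 = geo-nonzero (suc k) (proj₁ (proj₂ irr-P))

    D-y-odd : ∀ n → D (y ^ₚ suc (2 * n)) ≡ y ^ₚ (2 * n)
    D-y-odd n = trans (D-^-odd y n) (trans (cong (y ^ₚ (2 * n) *ₚ_) Dy≡𝟙) (*ₚ-identityʳ _))

    -- The derivative of the square R² = K² y^j₁ vanishes, but for odd j₁ it would be K² y^(j₁-1).
    j₁-not-odd : ∀ n → j₁ ≢ suc (2 * n)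
    j₁-not-odd n j₁≡ = *ₚ-nonzero {K *ₚ K} {y ^ₚ (2 * n)} (*ₚ-nonzero K≢𝟘 K≢𝟘) (^ₚ-nonzero (2 * n) (proj₁ irr-y)) (begin
      K *ₚ K *ₚ y ^ₚ (2 * n)               ≡⟨ cong (K *ₚ K *ₚ_) (D-y-odd n) ⟨
      K *ₚ K *ₚ D (y ^ₚ suc (2 * n))       ≡⟨ D-square-* K (y ^ₚ suc (2 * n)) ⟨
      D (K *ₚ K *ₚ y ^ₚ suc (2 * n))       ≡⟨ cong (λ j → D (K *ₚ K *ₚ y ^ₚ j)) j₁≡ ⟨
      D (K *ₚ K *ₚ y ^ₚ j₁)                ≡⟨ cong D RR≡ ⟨
      D (R *ₚ R)                           ≡⟨ trans (D-* R R) (solve 2 (λ r s → s :* r :+ r :* s := con false) refl R (D R)) ⟩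
      𝟘                                    ∎)

    -- Now R = Y K with Y² = y^(j-1), and 1 + P = x y Y². Hence U = x Y (1 + x^(l+1)) equals (1 + P)
    -- K = 1 + P^N. As N - 1 is even and D P = Y², D U = P^(N-1) Y²; evaluating θ U from the product
    -- form as well gives `relation`.
    module Even (j′ : ℕ) (j₁≡ : j₁ ≡ 2 * j′) (t : ℕ) (k≡ : suc k ≡ 2 * suc t) where
      Y : Poly
      Y = y ^ₚ j′

      R≡ : R ≡ Y *ₚ K
      R≡ = square-injective R (Y *ₚ K) (begin
        R *ₚ R                        ≡⟨ RR≡ ⟩
        K *ₚ K *ₚ y ^ₚ j₁             ≡⟨ cong (K *ₚ K *ₚ_) (trans (cong (y ^ₚ_) j₁≡) (^ₚ-double y j′)) ⟩
        K *ₚ K *ₚ (Y *ₚ Y)            ≡⟨ solve 2 (λ k y → k :* k :* (y :* y) := y :* k :* (y :* k)) refl K Y ⟩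
        Y *ₚ K *ₚ (Y *ₚ K)            ∎)

      yR≡ : 𝟙 +ₚ x ^ₚ suc l ≡ y *ₚ (Y *ₚ K)
      yR≡ = trans (sym (geo-closed x (suc l))) (cong₂ _*ₚ_ 1+x≡y R≡)

      1+P≡ : 𝟙 +ₚ P ≡ x *ₚ (y *ₚ (Y *ₚ Y))
      1+P≡ = begin
        𝟙 +ₚ P                        ≡⟨ 1+P ⟩
        M i j 0 0                     ≡⟨ cong₂ (λ i j → M i j 0 0) (trans i≡ (cong suc (i′≡0 i′ yRR≡))) (trans j≡ (cong suc j₁≡)) ⟩
        x *ₚ 𝟙 *ₚ (y *ₚ y ^ₚ (2 * j′) *ₚ 𝟙)   ≡⟨ solve 3 (λ x y s → x :* con true :* (y :* s :* con true) := x :* (y :* s)) refl x y (y ^ₚ (2 * j′)) ⟩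
        x *ₚ (y *ₚ y ^ₚ (2 * j′))     ≡⟨ cong (λ s → x *ₚ (y *ₚ s)) (^ₚ-double y j′) ⟩
        x *ₚ (y *ₚ (Y *ₚ Y))          ∎

      W U : Poly
      W = P ^ₚ (2 * suc t)
      U = x *ₚ (Y *ₚ (𝟙 +ₚ x ^ₚ suc l))

      DP≡ : D P ≡ Y *ₚ Y
      DP≡ = begin
        D P                                         ≡⟨ D-+ 𝟙 P ⟨
        D (𝟙 +ₚ P)                                  ≡⟨ cong D (trans 1+P≡ (solve 3 (λ x y s → x :* (y :* (s :* s)) := s :* s :* (x :* y)) refl x y Y)) ⟩
        D (Y *ₚ Y *ₚ (x *ₚ y))                      ≡⟨ D-square-* Y (x *ₚ y) ⟩
        Y *ₚ Y *ₚ D (x *ₚ y)                        ≡⟨ cong (Y *ₚ Y *ₚ_) (trans (D-* x y) (cong₂ (λ a b → a *ₚ y +ₚ x *ₚ b) Dx≡𝟙 Dy≡𝟙)) ⟩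
        Y *ₚ Y *ₚ (𝟙 *ₚ y +ₚ x *ₚ 𝟙)                ≡⟨ cong (Y *ₚ Y *ₚ_) (trans (solve 2 (λ x y → con true :* y :+ x :* con true := x :+ y) refl x y) x+y≡𝟙) ⟩
        Y *ₚ Y *ₚ 𝟙                                 ≡⟨ *ₚ-identityʳ _ ⟩
        Y *ₚ Y                                      ∎

      U≡ : U ≡ 𝟙 +ₚ P ^ₚ N
      U≡ = begin
        x *ₚ (Y *ₚ (𝟙 +ₚ x ^ₚ suc l))       ≡⟨ cong (λ s → x *ₚ (Y *ₚ s)) yR≡ ⟩
        x *ₚ (Y *ₚ (y *ₚ (Y *ₚ K)))         ≡⟨ solve 4 (λ x y s k → x :* (s :* (y :* (s :* k))) := x :* (y :* (s :* s)) :* k) refl x y Y K ⟩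
        x *ₚ (y *ₚ (Y *ₚ Y)) *ₚ K           ≡⟨ cong (_*ₚ K) 1+P≡ ⟨
        (𝟙 +ₚ P) *ₚ K                       ≡⟨ geo-closed P N ⟩
        𝟙 +ₚ P ^ₚ N                         ∎

      DU : D U ≡ W *ₚ (Y *ₚ Y)
      DU = begin
        D U                           ≡⟨ cong D U≡ ⟩
        D (𝟙 +ₚ P ^ₚ N)               ≡⟨ D-+ 𝟙 (P ^ₚ N) ⟩
        D (P ^ₚ N)                    ≡⟨ cong (λ n → D (P ^ₚ suc n)) k≡ ⟩
        D (P ^ₚ suc (2 * suc t))      ≡⟨ D-^-odd P (suc t) ⟩
        W *ₚ D P                      ≡⟨ cong (W *ₚ_) DP≡ ⟩
        W *ₚ (Y *ₚ Y)                 ∎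

      Z : Poly
      Z = x ^ₚ suc l

      θU : θ U ≡ x *ₚ Y *ₚ ((y +ₚ parₚ j′ *ₚ x) *ₚ (𝟙 +ₚ Z) +ₚ parₚ (suc l) *ₚ y *ₚ Z)
      θU = begin
        θ (x *ₚ (Y *ₚ (𝟙 +ₚ Z)))                                               ≡⟨ θ-* x (Y *ₚ (𝟙 +ₚ Z)) ⟩
        x *ₚ (y *ₚ D x) *ₚ (Y *ₚ (𝟙 +ₚ Z)) +ₚ x *ₚ θ (Y *ₚ (𝟙 +ₚ Z))           ≡⟨ cong₂ (λ a b → x *ₚ (y *ₚ a) *ₚ (Y *ₚ (𝟙 +ₚ Z)) +ₚ x *ₚ b) Dx≡𝟙 (trans (θ-* Y (𝟙 +ₚ Z)) (cong₂ (λ a b → a *ₚ (𝟙 +ₚ Z) +ₚ Y *ₚ b) (θ-y^ j′) (trans (θ-+ 𝟙 Z) (cong₂ _+ₚ_ (solve 2 (λ x y → x :* (y :* con false) := con false) refl x y) (θ-x^ (suc l)))))) ⟩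
        x *ₚ (y *ₚ 𝟙) *ₚ (Y *ₚ (𝟙 +ₚ Z)) +ₚ x *ₚ (parₚ j′ *ₚ x *ₚ Y *ₚ (𝟙 +ₚ Z) +ₚ Y *ₚ (𝟘 +ₚ parₚ (suc l) *ₚ y *ₚ Z))
          ≡⟨ solve 6 (λ x y s z e f → x :* (y :* con true) :* (s :* (con true :+ z)) :+ x :* (e :* x :* s :* (con true :+ z) :+ s :* (con false :+ f :* y :* z))
               := x :* s :* ((y :+ e :* x) :* (con true :+ z) :+ f :* y :* z)) refl x y Y Z (parₚ j′) (parₚ (suc l)) ⟩
        x *ₚ Y *ₚ ((y +ₚ parₚ j′ *ₚ x) *ₚ (𝟙 +ₚ Z) +ₚ parₚ (suc l) *ₚ y *ₚ Z)  ∎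

      Y≢𝟘 : Y ≢ 𝟘
      Y≢𝟘 = ^ₚ-nonzero j′ (proj₁ irr-y)

      relation : y *ₚ (W *ₚ Y) ≡ (y +ₚ parₚ j′ *ₚ x) *ₚ (𝟙 +ₚ Z) +ₚ parₚ (suc l) *ₚ y *ₚ Z
      relation = *ₚ-cancelˡ (x *ₚ Y) (y *ₚ (W *ₚ Y)) ((y +ₚ parₚ j′ *ₚ x) *ₚ (𝟙 +ₚ Z) +ₚ parₚ (suc l) *ₚ y *ₚ Z)
        (*ₚ-nonzero (proj₁ irr-x) Y≢𝟘) (begin
          x *ₚ Y *ₚ (y *ₚ (W *ₚ Y))      ≡⟨ solve 4 (λ x y s w → x :* s :* (y :* (w :* s)) := x :* (y :* (w :* (s :* s)))) refl x y Y W ⟩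
          x *ₚ (y *ₚ (W *ₚ (Y *ₚ Y)))    ≡⟨ cong (λ s → x *ₚ (y *ₚ s)) DU ⟨
          θ U                            ≡⟨ θU ⟩
          x *ₚ Y *ₚ ((y +ₚ parₚ j′ *ₚ x) *ₚ (𝟙 +ₚ Z) +ₚ parₚ (suc l) *ₚ y *ₚ Z)  ∎)

      relation′ : ∀ {e f} → parₚ j′ ≡ e → parₚ (suc l) ≡ f → y *ₚ (W *ₚ Y) ≡ (y +ₚ e *ₚ x) *ₚ (𝟙 +ₚ Z) +ₚ f *ₚ y *ₚ Z
      relation′ refl refl = relation

      P∣W : P ∣ W
      P∣W = p∣p*q P (P ^ₚ (t + suc (t + 0)))

      P∣lhs : ∀ {s} → y *ₚ (W *ₚ Y) ≡ s → P ∣ s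
      P∣lhs eq = subst (P ∣_) eq (∣-*ˡ y (∣-*ʳ Y P∣W))

      P∤Y : ¬ P ∣ Y
      P∤Y = P∤y ∘ ∣-^ₚ⇒∣ y j′ irr-P

      P∤yYK : ¬ P ∣ y *ₚ (Y *ₚ K)
      P∤yYK = ∤-*ₚ irr-P P∤y (∤-*ₚ irr-P P∤Y P∤K)

      -- P divides the left side of `relation`. In the first three cases the right side is a product
      -- of y, Y and K, all prime to P. If j′ and l + 1 are both odd, dividing by y leaves W Y = Y K
      -- + Z; then y divides Y, hence also the power Z of x.
      absurd : Parity j′ → Parity (suc l) → ⊥
      absurd (isEven _ _ e) (isEven _ _ f) = ∤-*ₚ irr-P P∤y P∤yYK (P∣lhs (begin
        y *ₚ (W *ₚ Y)                                      ≡⟨ relation′ e f ⟩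
        (y +ₚ 𝟘) *ₚ (𝟙 +ₚ Z) +ₚ 𝟘                          ≡⟨ trans (+ₚ-identityʳ _) (cong (_*ₚ (𝟙 +ₚ Z)) (+ₚ-identityʳ y)) ⟩
        y *ₚ (𝟙 +ₚ Z)                                      ≡⟨ cong (y *ₚ_) yR≡ ⟩
        y *ₚ (y *ₚ (Y *ₚ K))                               ∎))
      absurd (isEven _ _ e) (isOdd _ _ f) = P∤y (P∣lhs (begin
        y *ₚ (W *ₚ Y)                                      ≡⟨ relation′ e f ⟩
        (y +ₚ 𝟘) *ₚ (𝟙 +ₚ Z) +ₚ y *ₚ Z                     ≡⟨ solve 2 (λ y z → (y :+ con false) :* (con true :+ z) :+ y :* z := y) refl y Z ⟩
        y                                                  ∎))
      absurd (isOdd _ _ e) (isEven _ _ f) = P∤yYK (P∣lhs (begin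
        y *ₚ (W *ₚ Y)                                      ≡⟨ relation′ e f ⟩
        (y +ₚ x) *ₚ (𝟙 +ₚ Z) +ₚ 𝟘                          ≡⟨ trans (+ₚ-identityʳ _) (cong (_*ₚ (𝟙 +ₚ Z)) (trans (+ₚ-comm y x) x+y≡𝟙)) ⟩
        𝟙 +ₚ Z                                             ≡⟨ yR≡ ⟩
        y *ₚ (Y *ₚ K)                                      ∎))
      absurd (isOdd h j′≡ e) (isOdd _ _ f) = y∤x (∣-^ₚ⇒∣ x (suc l) irr-y (∣-+ₚ-cancel (Y *ₚ K) Z
          (subst (y ∣_) WY≡ (∣-*ˡ W y∣Y)) (∣-*ʳ K y∣Y)))
        where
        y∣Y : y ∣ Y
        y∣Y = subst (λ n → y ∣ y ^ₚ n) (sym j′≡) (p∣p*q y (y ^ₚ (2 * h)))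
        WY≡ : W *ₚ Y ≡ Y *ₚ K +ₚ Z
        WY≡ = *ₚ-cancelˡ y (W *ₚ Y) (Y *ₚ K +ₚ Z) (proj₁ irr-y) (begin
          y *ₚ (W *ₚ Y)                                    ≡⟨ relation′ e f ⟩
          (y +ₚ x) *ₚ (𝟙 +ₚ Z) +ₚ y *ₚ Z                   ≡⟨ cong (λ s → s *ₚ (𝟙 +ₚ Z) +ₚ y *ₚ Z) (trans (+ₚ-comm y x) x+y≡𝟙) ⟩
          𝟙 +ₚ Z +ₚ y *ₚ Z                                 ≡⟨ cong (_+ₚ y *ₚ Z) yR≡ ⟩
          y *ₚ (Y *ₚ K) +ₚ y *ₚ Z                          ≡⟨ *ₚ-distribˡ y (Y *ₚ K) Z ⟨
          y *ₚ (Y *ₚ K +ₚ Z)                               ∎)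

  no-source-PQ : ∀ {l} → ¬ Source l 1 1
  no-source-PQ {zero}  src = ℕ.<⇒≢ (ℕ.≤-trans (irreducible⇒deg>0 irr-P) (ℕ.≤-trans (ℕ.m≤m+n (deg P) 0) (ℕ.m≤m+n (1 * deg P) _))) (Source.2k≡ src)
  no-source-PQ {suc l} src = go i j refl refl i>0 j>0 exponents-Q
    where
    go : ∀ i′ j′ → i ≡ i′ → j ≡ j′ → 0 < i′ → 0 < j′ → ExponentsQ → ⊥
    go (suc i′) (suc j₁) i≡ j≡ _ _ (exponentsQ {r} _ 2k≡ _ _ _) = cases r k≡2^
      where
      open NoSourcePQ l src i′ j₁ i≡ j≡
      k≡2^ : suc k ≡ 2 ^ r
      k≡2^ = ℕ.*-cancelˡ-≡ (suc k) (2 ^ r) 2 2k≡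
      cases : ∀ r → suc k ≡ 2 ^ r → ⊥
      -- In this case N = 2, and K = 1 + P is divisible by x. For all larger powers of two N is odd.
      cases zero eq = x∤K (subst (λ n → x ∣ geo P (suc n)) (sym eq) (subst (x ∣_) (solve 1 (λ p → con true :+ p := p :* con true :+ (con true :+ con false)) refl P) x∣1+P))
      cases (suc r) eq with 2^≡suc r
      ... | t , 2^r≡ with parityₚ j₁
      ... | isOdd n j₁≡ _   = j₁-not-odd n j₁≡
      ... | isEven j′ j₁≡ _ = Even.absurd j′ j₁≡ t (trans eq (cong (2 *_) 2^r≡)) (parityₚ j′) (parityₚ (suc l))

-- Arithmetic of the exponents

data ZeroOrPow2 : ℕ → Set where
  zero : ZeroOrPow2 0
  pow  : ∀ r → ZeroOrPow2 (2 ^ r)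

-- The exponents a for which σ** p a is a power of 1 + p.
Trivial : ℕ → Set
Trivial n = n ≡ 2 ⊎ (∃[ r ] suc n ≡ 2 ^ suc r)

2^≢0 : ∀ r → 2 ^ r ≢ 0
2^≢0 r = ℕ.>⇒≢ (ℕ.m^n>0 2 r)

2^≡odd : ∀ r n → 2 ^ r ≡ suc (2 * n) → r ≡ 0 × n ≡ 0
2^≡odd zero    zero    _  = refl , refl
2^≡odd (suc r) n       eq = contradiction eq (ℕ.even≢odd (2 ^ r) n)

2^*odd≡2^ : ∀ r n s → 2 ^ r * suc (2 * n) ≡ 2 ^ s → n ≡ 0
2^*odd≡2^ zero    n s       eq = proj₂ (2^≡odd s n (trans (sym eq) (ℕ.+-identityʳ _)))
2^*odd≡2^ (suc r) n zero    eq = contradiction (trans (sym eq) (ℕ.*-assoc 2 (2 ^ r) (suc (2 * n)))) (λ e → ℕ.even≢odd (2 ^ r * suc (2 * n)) 0 (sym e))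
2^*odd≡2^ (suc r) n (suc s) eq = 2^*odd≡2^ r n s (ℕ.*-cancelˡ-≡ _ _ 2 (trans (sym (ℕ.*-assoc 2 (2 ^ r) (suc (2 * n)))) eq))

data Small : ℕ → ℕ → Set where
  s00 : Small 0 0
  s01 : Small 0 1
  s10 : Small 1 0
  s12 : Small 1 2
  s21 : Small 2 1

Small-sym : ∀ {m n} → Small m n → Small n m
Small-sym s00 = s00
Small-sym s01 = s10
Small-sym s10 = s01
Small-sym s12 = s21
Small-sym s21 = s12

small-0-2^ : ∀ r s → suc (2 ^ r) ≡ 2 ^ s → Small 0 (2 ^ r)
small-0-2^ zero    s _  = s01
small-0-2^ (suc r) s eq = contradiction (proj₂ (2^≡odd s (2 ^ r) (sym eq))) (2^≢0 r)

small-1-2^ : ∀ r s → suc (1 + 2 ^ r) ≡ 2 ^ s → Small 1 (2 ^ r)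
small-1-2^ zero          s       eq = case proj₂ (2^≡odd s 1 (sym eq)) of λ ()
small-1-2^ (suc zero)    s       _  = s12
small-1-2^ (suc (suc r)) (suc s) eq = contradiction
  (proj₂ (2^≡odd s (2 ^ r) (sym (ℕ.*-cancelˡ-≡ (suc (2 * 2 ^ r)) (2 ^ s) 2 (trans (ℕ.*-suc 2 (2 * 2 ^ r)) eq))))) (2^≢0 r)

-- 2^s - 1 has s binary digits 1, and a sum of two powers of two has at most two; so s ≤ 2 and m + n
-- is 0, 1 or 3.
small : ∀ {m n} → ZeroOrPow2 m → ZeroOrPow2 n → ∀ s → suc (m + n) ≡ 2 ^ s → Small m n
small zero          zero          s _  = s00
small zero          (pow r)       s eq = small-0-2^ r s eq
small (pow r)       zero          s eq = Small-sym (small-0-2^ r s (trans (cong suc (sym (ℕ.+-identityʳ (2 ^ r)))) eq))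
small (pow zero)    (pow r)       s eq = small-1-2^ r s eq
small (pow (suc r)) (pow zero)    s eq = Small-sym (small-1-2^ (suc r) s (trans (cong suc (ℕ.+-comm 1 (2 ^ suc r))) eq))
small (pow (suc r)) (pow (suc t)) s eq = contradiction
  (proj₂ (2^≡odd s (2 ^ r + 2 ^ t) (trans (sym eq) (cong suc (sym (ℕ.*-distribˡ-+ 2 (2 ^ r) (2 ^ t)))))))
  (ℕ.>⇒≢ (ℕ.≤-trans (ℕ.m^n>0 2 r) (ℕ.m≤m+n (2 ^ r) (2 ^ t))))

data TrivialSum : ℕ → ℕ → Set where
  ts00 : TrivialSum 0 0
  ts01 : TrivialSum 0 1
  ts10 : TrivialSum 1 0
  ts02 : TrivialSum 0 2
  ts11 : TrivialSum 1 1
  ts20 : TrivialSum 2 0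
  ts12 : TrivialSum 1 2
  ts21 : TrivialSum 2 1

-- In particular the sum is at most 3 and each summand at most 2, the bounds that make the search
-- for w = 0 finite.
trivialSum : ∀ {m n} → ZeroOrPow2 m → ZeroOrPow2 n → Trivial (m + n) → TrivialSum m n
trivialSum {0} {2} _ _ (inj₁ refl) = ts02
trivialSum {1} {1} _ _ (inj₁ refl) = ts11
trivialSum {2} {0} _ _ (inj₁ refl) = ts20
trivialSum {suc (suc (suc _))} _ _ (inj₁ ())
trivialSum zm zn (inj₂ (r , eq)) with small zm zn (suc r) eq
... | s00 = ts00
... | s01 = ts01
... | s10 = ts10
... | s12 = ts12
... | s21 = ts21

-- The possible exponents of y, P, Q in σ** x a, where p = deg P, q = deg Q, and Ok c d says that P^c Q^d is
-- of the form geo x m (for m = 1 + cp + dq).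
data Profile (p q : ℕ) (Ok : ℕ → ℕ → Set) (a : ℕ) : ℕ → ℕ → ℕ → Set where
  odd  : ∀ r {c d e} → Bit c → Bit d → Ok c d → suc a ≡ 2 ^ suc r * suc (c * p + d * q) → 2 ^ suc r ≡ suc e →
         Profile p q Ok a e (c * 2 ^ suc r) (d * 2 ^ suc r)
  even : ∀ r {c d c′ d′} → Bit c → Bit d → Bit c′ → Bit d′ → Ok c d → Ok c′ d′ →
         suc a ≡ 2 ^ suc r * suc (c * p + d * q) + suc (c′ * p + d′ * q) →
         Adjacent (2 ^ suc r * suc (c * p + d * q)) (suc (c′ * p + d′ * q)) → c * c′ ≡ 0 → d * d′ ≡ 0 →
         Profile p q Ok a (2 ^ suc r) (c * 2 ^ suc r + c′) (d * 2 ^ suc r + d′)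

2^suc≥2 : ∀ r → 2 ≤ 2 ^ suc r
2^suc≥2 r = ℕ.*-monoʳ-≤ 2 (ℕ.m^n>0 2 r)

adjacent-≤ : ∀ {m n} → Adjacent m n → m ≤ suc n
adjacent-≤ (inj₁ refl) = ℕ.≤-refl
adjacent-≤ {m} (inj₂ refl) = ℕ.≤-trans (ℕ.n≤1+n m) (ℕ.n≤1+n (suc m))

adjacent-≥ : ∀ {m n} → Adjacent m n → n ≤ suc m
adjacent-≥ (inj₁ eq) = adjacent-≤ (inj₂ eq)
adjacent-≥ (inj₂ eq) = adjacent-≤ (inj₁ eq)

bit-exponent : ∀ r {c} → Bit c → ZeroOrPow2 (c * 2 ^ suc r)
bit-exponent r 0# = zero
bit-exponent r 1# = subst ZeroOrPow2 (sym (ℕ.+-identityʳ _)) (pow (suc r))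

bits-exponent : ∀ r {c c′} → Bit c → Bit c′ → c * c′ ≡ 0 → ZeroOrPow2 (c * 2 ^ suc r + c′)
bits-exponent r 0# 0# _ = zero
bits-exponent r 0# 1# _ = pow 0
bits-exponent r 1# 0# _ = subst ZeroOrPow2 (sym (trans (ℕ.+-identityʳ _) (ℕ.+-identityʳ _))) (pow (suc r))

module _ {p q : ℕ} {Ok : ℕ → ℕ → Set} {a α₁ αP αQ : ℕ} where

  profile-P : Profile p q Ok a α₁ αP αQ → ZeroOrPow2 αP
  profile-P (odd r bc _ _ _ _) = bit-exponent r bc
  profile-P (even r bc _ bc′ _ _ _ _ _ cc′ _) = bits-exponent r bc bc′ cc′

  profile-Q : Profile p q Ok a α₁ αP αQ → ZeroOrPow2 αQ
  profile-Q (odd r _ bd _ _ _) = bit-exponent r bd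
  profile-Q (even r _ bd _ bd′ _ _ _ _ _ dd′) = bits-exponent r bd bd′ dd′

  no-Q : (∀ c → ¬ Ok c 1) → Profile p q Ok a α₁ αP αQ → αQ ≡ 0
  no-Q none (odd r _ 0# _ _ _)               = refl
  no-Q none (odd r _ 1# ok _ _)              = ⊥-elim (none _ ok)
  no-Q none (even r _ 0# _ 0# _ _ _ _ _ _)   = refl
  no-Q none (even r _ 1# _ _ ok _ _ _ _ _)   = ⊥-elim (none _ ok)
  no-Q none (even r _ 0# _ 1# _ ok _ _ _ _)  = ⊥-elim (none _ ok)

  has-P : Profile p q Ok a α₁ αP αQ → αP ≢ 0 → ∃[ d ] Bit d × Ok 1 d
  has-P (odd r 0# _ _ _ _) ≢0                       = contradiction refl ≢0
  has-P (odd r 1# bd ok _ _) _                      = _ , bd , ok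
  has-P (even r 0# _ 0# _ _ _ _ _ _ _) ≢0           = contradiction refl ≢0
  has-P (even r 1# bd _ _ ok _ _ _ _ _) _           = _ , bd , ok
  has-P (even r 0# _ 1# bd′ _ ok _ _ _ _) _         = _ , bd′ , ok

  has-Q : Profile p q Ok a α₁ αP αQ → αQ ≢ 0 → ∃[ c ] Bit c × Ok c 1
  has-Q (odd r _ 0# _ _ _) ≢0                       = contradiction refl ≢0
  has-Q (odd r bc 1# ok _ _) _                      = _ , bc , ok
  has-Q (even r _ 0# _ 0# _ _ _ _ _ _) ≢0           = contradiction refl ≢0
  has-Q (even r bc 1# _ _ ok _ _ _ _ _) _           = _ , bc , ok
  has-Q (even r _ 0# bc′ 1# _ ok _ _ _ _) _         = _ , bc′ , ok

1+1≡⇒trivial : ∀ {a} r → suc a ≡ 2 ^ suc r * 1 + 1 → Adjacent (2 ^ suc r * 1) 1 → a ≡ 2 × 2 ^ suc r ≡ 2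
1+1≡⇒trivial r eq adj with trans (sym (ℕ.*-identityʳ _)) (E≡2 adj)
  where
  E≡2 : Adjacent (2 ^ suc r * 1) 1 → 2 ^ suc r * 1 ≡ 2
  E≡2 (inj₁ eq) = eq
  E≡2 (inj₂ eq) = contradiction (sym (trans (ℕ.suc-injective eq) (ℕ.*-identityʳ _))) (2^≢0 (suc r))
... | E≡2 = ℕ.suc-injective (trans eq (cong (λ E → E * 1 + 1) E≡2)) , E≡2

-- Without P and Q every geometric sum involved is 1, so that σ** x a = y^a. The degrees put no
-- bound on such an a; the equality of α₁ and a passes it on to the equation for the exponent of y.
trivial-profile : ∀ {p q Ok a α₁} → Profile p q Ok a α₁ 0 0 → Trivial a × α₁ ≡ a
trivial-profile {p} {q} {Ok} {a} {α₁} prof = go prof refl refl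
  where
  go : ∀ {αP αQ} → Profile p q Ok a α₁ αP αQ → αP ≡ 0 → αQ ≡ 0 → Trivial a × α₁ ≡ a
  go (odd r 0# 0# _ eq E≡) _ _ = inj₂ (r , trans eq (ℕ.*-identityʳ _)) , ℕ.suc-injective (trans (sym E≡) (trans (sym (ℕ.*-identityʳ _)) (sym eq)))
  go (odd r 1# _ _ _ _) eq _ = contradiction (trans (sym (ℕ.+-identityʳ _)) eq) (2^≢0 (suc r))
  go (odd r 0# 1# _ _ _) _ eq = contradiction (trans (sym (ℕ.+-identityʳ _)) eq) (2^≢0 (suc r))
  go (even r 0# 0# 0# 0# _ _ eq adj _ _) _ _ = let a≡2 , E≡2 = 1+1≡⇒trivial r eq adj in inj₁ a≡2 , trans E≡2 (sym a≡2)
  go (even r 1# _ _ _ _ _ _ _ _ _) eq _ = contradiction (trans (sym (ℕ.+-identityʳ _)) (ℕ.m+n≡0⇒m≡0 _ eq)) (2^≢0 (suc r))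
  go (even r 0# 1# _ _ _ _ _ _ _ _) _ eq = contradiction (trans (sym (ℕ.+-identityʳ _)) (ℕ.m+n≡0⇒m≡0 _ eq)) (2^≢0 (suc r))
  go (even r 0# 0# 1# _ _ _ _ _ _ _) () _
  go (even r 0# 0# 0# 1# _ _ _ _ _ _) _ ()

trivial-even⇒2 : ∀ {n} m → Trivial n → n ≡ 2 * m → n ≡ 2
trivial-even⇒2 m (inj₁ n≡2) _ = n≡2
trivial-even⇒2 m (inj₂ (r , eq)) n≡ = contradiction (trans (sym eq) (cong suc n≡)) (ℕ.even≢odd (2 ^ r) m)

-- The case w > 0

-- By `small` the summands of a sum of the form 2^s - 1 are at most 2, and here one of them is at
-- least 4.
no-trivial-4+ : ∀ {n} C → ZeroOrPow2 n → ¬ Trivial (n + 2 * 2 ^ suc C)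
no-trivial-4+ {n} C zn (inj₁ eq) = contradiction (subst (4 ≤_) eq (ℕ.≤-trans (ℕ.*-monoʳ-≤ 2 (2^suc≥2 C)) (ℕ.m≤n+m (2 * 2 ^ suc C) n))) λ { (s≤s (s≤s ())) }
no-trivial-4+ C zn (inj₂ (r , eq)) = large (small zn (pow (suc (suc C))) (suc r) eq) (ℕ.*-monoʳ-≤ 2 (2^suc≥2 C))
  where
  large : ∀ {m n} → Small m n → 4 ≤ n → ⊥
  large s00 ()
  large s01 (s≤s ())
  large s10 ()
  large s12 (s≤s (s≤s ()))
  large s21 (s≤s ())

+0+0 : ∀ n → n + 0 + 0 ≡ n
+0+0 n = trans (ℕ.+-identityʳ (n + 0)) (ℕ.+-identityʳ n)

2^≡1⇒≡0 : ∀ r → 2 ^ r ≡ 1 → r ≡ 0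
2^≡1⇒≡0 r eq = proj₁ (2^≡odd r 0 eq)

small-positive : ∀ {m n} → Small m n → m ≢ 0 → n ≢ 0 → (m ≡ 1 × n ≡ 2) ⊎ (m ≡ 2 × n ≡ 1)
small-positive s00 m≢0 _ = contradiction refl m≢0
small-positive s01 m≢0 _ = contradiction refl m≢0
small-positive s10 _ n≢0 = contradiction refl n≢0
small-positive s12 _ _   = inj₁ (refl , refl)
small-positive s21 _ _   = inj₂ (refl , refl)

-- This treats Q = geo x m with w = 2^(C+1) and P = 1 + x y^(p-1), where only the x side contributes
-- Q. For odd a, k is an even trivial number, so k = 2 and h = βP + 2w. For even a, either P and Q
-- sit at the two neighbours, when sizes force 2^(r+1) = w and again h = βP + 2w, or Q alone is
-- adjacent to a power of two, or the lengths are too far apart. The value βP + 2w is never trivial.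
no-source-w-2^ : ∀ {p q w Ok a α₁ αP αQ βP h k} C D →
  p ≡ 2 ^ suc D → w ≡ 2 ^ suc C → q ≡ w * suc p → ¬ (C ≡ 0 × D ≡ 0) → ¬ Ok 1 1 →
  Profile p q Ok a α₁ αP αQ → αQ ≢ 0 → ZeroOrPow2 βP → Trivial h → Trivial k →
  h ≡ αP + (βP + w * k) → k ≡ αQ → ⊥
no-source-w-2^ {p} {q} {w} {βP = βP} C D refl refl q≡ ¬00 ¬11 prof αQ≢0 zβ th tk h≡ k≡ = go prof αQ≢0 th tk h≡ k≡
  where
  W = 2 ^ suc C
  1*q≡ : 1 * q ≡ W * suc p
  1*q≡ = trans (ℕ.+-identityʳ q) q≡
  absurd-h : ∀ {h} → Trivial h → h ≡ βP + 2 * W → ⊥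
  absurd-h th refl = no-trivial-4+ C zβ th
  p<q : p < q
  p<q = subst (p <_) (sym q≡) (ℕ.m≤n*m (suc p) W ⦃ ℕ.m^n≢0 2 (suc C) ⦄)
  p≥2 : 2 ≤ p
  p≥2 = 2^suc≥2 D
  too-large : ∀ r c′ → Bit c′ → ¬ Adjacent (2 ^ suc r * suc (1 * q)) (suc (c′ * p + 0))
  too-large r c′ bc adj = ℕ.<⇒≱ (s≤s (s≤s (ℕ.≤-trans (s≤s (c′p≤ bc)) (ℕ.≤-trans p<q (ℕ.m≤m+n q q)))))
    (ℕ.≤-trans (ℕ.≤-reflexive eq) (ℕ.≤-trans (ℕ.*-monoˡ-≤ (suc (1 * q)) (2^suc≥2 r)) (adjacent-≤ adj)))
    where
    c′p≤ : Bit c′ → c′ * p + 0 ≤ p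
    c′p≤ 0# = z≤n
    c′p≤ 1# = ℕ.≤-reflexive (+0+0 p)
    eq : suc (suc q + q) ≡ 2 * suc (1 * q)
    eq = solveℕ 1 (λ q → κ 1 ⊕ (κ 1 ⊕ q ⊕ q) ⊜ κ 2 ⊗ (κ 1 ⊕ κ 1 ⊗ q)) refl q
  same-power : ∀ E → Adjacent (E * suc p) (suc (W * suc p)) → E ≡ W
  same-power E (inj₂ eq) = sym (ℕ.*-cancelʳ-≡ W E (suc p) (ℕ.suc-injective eq))
  same-power E (inj₁ eq) with ℕ.≤-<-connex E W
  ... | inj₁ E≤W = contradiction (ℕ.*-monoˡ-≤ (suc p) E≤W) (ℕ.<⇒≱ (subst (W * suc p <_) (sym eq) (ℕ.m<n⇒m<1+n ℕ.≤-refl)))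
  ... | inj₂ W<E = contradiction (ℕ.≤-trans (ℕ.+-monoˡ-≤ (W * suc p) (s≤s p≥2)) (ℕ.≤-trans (ℕ.*-monoˡ-≤ (suc p) W<E) (ℕ.≤-reflexive eq))) (ℕ.<⇒≱ ℕ.≤-refl)
  -- The power 2^(r+1) cannot be w (p + 1), as p + 1 > 1 is odd. If it is w (p + 1) + 2, halving
  -- gives 2^r = 1 + 2^C + 2^(C+D+1), whose only solution C = D = 0 is excluded by hypothesis.
  not-power : ∀ r → ¬ Adjacent (2 ^ suc r * 1) (suc (W * suc p))
  not-power r (inj₂ eq) = 2^≢0 D (2^*odd≡2^ (suc C) (2 ^ D) (suc r) (trans (ℕ.suc-injective eq) (ℕ.*-identityʳ _)))
  not-power r (inj₁ eq) with small-positive (small (pow C) (pow (C + suc D)) r eq′) (2^≢0 C) (2^≢0 (C + suc D))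
    where
    eq′ : suc (2 ^ C + 2 ^ (C + suc D)) ≡ 2 ^ r
    eq′ = ℕ.*-cancelˡ-≡ _ _ 2 (begin
      2 * suc (2 ^ C + 2 ^ (C + suc D))         ≡⟨ cong (λ n → 2 * suc (2 ^ C + n)) (ℕ.^-distribˡ-+-* 2 C (suc D)) ⟩
      2 * suc (2 ^ C + 2 ^ C * p)               ≡⟨ solveℕ 2 (λ c p → κ 2 ⊗ (κ 1 ⊕ (c ⊕ c ⊗ p)) ⊜ κ 2 ⊕ (κ 2 ⊗ c) ⊗ (κ 1 ⊕ p)) refl (2 ^ C) p ⟩
      suc (suc (W * suc p))                     ≡⟨ eq ⟨
      2 ^ suc r * 1                             ≡⟨ ℕ.*-identityʳ _ ⟩
      2 ^ suc r                                 ∎)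
  ... | inj₁ (C≡ , D≡) = ¬00 (C≡0 , 2^≡1⇒≡0 D (ℕ.*-cancelˡ-≡ _ _ 2 (trans (cong (λ C → 2 ^ (C + suc D)) (sym C≡0)) D≡)))
    where C≡0 = 2^≡1⇒≡0 C C≡
  ... | inj₂ (_ , CD≡) = case ℕ.m+n≡0⇒n≡0 C (2^≡1⇒≡0 (C + suc D) CD≡) of λ ()
  go : ∀ {a α₁ αP αQ h k} → Profile p q _ a α₁ αP αQ → αQ ≢ 0 → Trivial h → Trivial k → h ≡ αP + (βP + W * k) → k ≡ αQ → ⊥
  go (odd r _ 0# _ _ _) αQ≢0 _ _ _ _ = αQ≢0 refl
  go (odd r 1# 1# ok _ _) _ _ _ _ _ = ¬11 ok
  go {h = h} {k} (odd r 0# 1# _ _ _) _ th tk h≡ k≡ = absurd-h th (trans h≡ (cong (βP +_) (trans (cong (W *_) k≡2) (ℕ.*-comm W 2))))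
    where
    k≡2 : k ≡ 2
    k≡2 = trivial-even⇒2 (2 ^ r) tk (trans k≡ (ℕ.+-identityʳ _))
  go (even r _ 0# _ 0# _ _ _ _ _ _) αQ≢0 _ _ _ _ = αQ≢0 refl
  go (even r 1# 1# _ _ ok _ _ _ _ _) _ _ _ _ _ = ¬11 ok
  go (even r 0# 1# bc′ 0# _ _ _ adj _ _) _ _ _ _ _ = too-large r _ bc′ adj
  go (even r bc 0# 1# 1# _ ok _ _ _ _) _ _ _ _ _ = ¬11 ok
  go (even r 1# 0# 0# 1# _ _ _ adj _ _) _ th _ h≡ refl = absurd-h th (trans h≡ (begin
      1 * 2 ^ suc r + 0 + (βP + W * 1)    ≡⟨ cong₂ (λ m n → m + (βP + n)) (trans (+0+0 (2 ^ suc r)) E≡W) (ℕ.*-identityʳ W) ⟩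
      W + (βP + W)                        ≡⟨ solveℕ 2 (λ w b → w ⊕ (b ⊕ w) ⊜ b ⊕ κ 2 ⊗ w) refl W βP ⟩
      βP + 2 * W                          ∎))
    where
    E≡W : 2 ^ suc r ≡ W
    E≡W = same-power (2 ^ suc r) (subst₂ (λ m n → Adjacent (2 ^ suc r * suc m) (suc n)) (+0+0 p) 1*q≡ adj)
  go (even r 0# 0# 0# 1# _ _ _ adj _ _) _ _ _ _ _ = not-power r (subst (λ n → Adjacent (2 ^ suc r * 1) (suc n)) 1*q≡ adj)

-- For even a, P can only be the sum of odd length: at the even length, 2^(r+1) (p + 1) would be too
-- far from 1. So αP = 1 there, and αP = 2^(r+1) for odd a.
P-only : ∀ {p q Ok a α₁ αP αQ} → 0 < p → Profile p q Ok a α₁ αP αQ → αQ ≡ 0 → αP ≢ 0 →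
  (αP ≡ 1 × Adjacent α₁ (suc p) × suc a ≡ α₁ + suc p) ⊎ (2 ≤ αP × suc a ≡ αP * suc p × suc α₁ ≡ αP)
P-only p>0 (odd r 0# _ _ _ _) _ αP≢0 = contradiction refl αP≢0
P-only p>0 (odd r 1# 1# _ _ _) αQ≡0 _ = contradiction (trans (sym (ℕ.+-identityʳ _)) αQ≡0) (2^≢0 (suc r))
P-only {p} p>0 (odd r 1# 0# _ eq E≡) _ _ = inj₂ (subst (2 ≤_) (sym (ℕ.+-identityʳ _)) (2^suc≥2 r)
  , trans eq (cong₂ (λ E n → E * suc n) (sym (ℕ.+-identityʳ (2 ^ suc r))) (+0+0 p)) , trans (sym E≡) (sym (ℕ.+-identityʳ _)))
P-only p>0 (even r _ 1# _ _ _ _ _ _ _ _) αQ≡0 _ = contradiction (trans (sym (ℕ.+-identityʳ _)) (ℕ.m+n≡0⇒m≡0 _ αQ≡0)) (2^≢0 (suc r))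
P-only p>0 (even r _ 0# _ 1# _ _ _ _ _ _) () _
P-only p>0 (even r 0# 0# 0# 0# _ _ _ _ _ _) _ αP≢0 = contradiction refl αP≢0
P-only {p} p>0 (even r 0# 0# 1# 0# _ _ eq adj _ _) _ _ = inj₁ (refl
  , subst₂ (λ m n → Adjacent m (suc n)) (ℕ.*-identityʳ _) (+0+0 p) adj , trans eq (cong₂ (λ m n → m + suc n) (ℕ.*-identityʳ _) (+0+0 p)))
P-only {p} p>0 (even r 1# 0# 0# 0# _ _ _ adj _ _) _ _ = contradiction (adjacent-≤ adj) (ℕ.<⇒≱ (ℕ.≤-trans (s≤s (s≤s (s≤s z≤n)))
  (ℕ.*-mono-≤ (2^suc≥2 r) (s≤s (subst (1 ≤_) (sym (+0+0 p)) p>0)))))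

data QSource (p q a α₁ : ℕ) : ℕ → ℕ → Set where
  none   : ∀ {αP} → QSource p q a α₁ αP 0
  double : ∀ r → QSource p q a α₁ (2 ^ suc r) (2 ^ suc r)
  single : ∀ r → α₁ ≡ 2 ^ suc r → Adjacent α₁ (suc (p + q)) → suc a ≡ α₁ + suc (p + q) → QSource p q a α₁ 1 1

-- As geo x m is never Q alone, Q enters together with P. For even a both sit at the odd length,
-- because 2 (1 + p + q) is too far from 1.
qSource : ∀ {p q Ok a α₁ αP αQ} → 0 < p → ¬ Ok 0 1 → Profile p q Ok a α₁ αP αQ → QSource p q a α₁ αP αQ
qSource p>0 ¬01 (odd r _ 0# _ _ _) = none
qSource p>0 ¬01 (odd r 0# 1# ok _ _) = ⊥-elim (¬01 ok)
qSource p>0 ¬01 (odd r 1# 1# _ _ _) = subst₂ (QSource _ _ _ _) (sym (ℕ.+-identityʳ _)) (sym (ℕ.+-identityʳ _)) (double r)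
qSource p>0 ¬01 (even r _ 0# _ 0# _ _ _ _ _ _) = none
qSource p>0 ¬01 (even r 0# 1# _ _ ok _ _ _ _ _) = ⊥-elim (¬01 ok)
qSource p>0 ¬01 (even r _ 0# 0# 1# _ ok _ _ _ _) = ⊥-elim (¬01 ok)
qSource {p} {q} p>0 ¬01 (even r 1# 1# 0# 0# _ _ _ adj _ _) = contradiction (adjacent-≤ adj) (ℕ.<⇒≱ (ℕ.≤-trans (s≤s (s≤s (s≤s z≤n)))
  (ℕ.*-mono-≤ (2^suc≥2 r) (s≤s (ℕ.≤-trans p>0 (ℕ.≤-trans (ℕ.m≤m+n p 0) (ℕ.m≤m+n (p + 0) (q + 0))))))))
qSource {p} {q} p>0 ¬01 (even r 0# 0# 1# 1# _ _ eq adj _ _) = single r refl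
  (subst₂ (λ m n → Adjacent m (suc n)) (ℕ.*-identityʳ _) p+q adj) (trans eq (cong₂ (λ m n → m + suc n) (ℕ.*-identityʳ _) p+q))
  where
  p+q : 1 * p + 1 * q ≡ p + q
  p+q = cong₂ _+_ (ℕ.+-identityʳ p) (ℕ.+-identityʳ q)

2^<2^⇒2*≤ : ∀ r s → 2 ^ r < 2 ^ s → 2 * 2 ^ r ≤ 2 ^ s
2^<2^⇒2*≤ r s lt with ℕ.≤-<-connex s r
... | inj₁ s≤r = contradiction (ℕ.^-monoʳ-≤ 2 s≤r) (ℕ.<⇒≱ lt)
... | inj₂ r<s = ℕ.^-monoʳ-≤ 2 r<s

-- If both sides contain Q, then αP = αQ and βP = βQ, so h = k + w k is even and at least 4, hence
-- not trivial. If only x does and αQ is even, then k = 2 and h = 2 + βP + 2w, which is even and at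
-- least 4 unless βP = 1; in that case h + 1 = 2 (2l + 3) is no power of two. If αQ = 1, the parity
-- of h leaves βP = 0 and βP = 1, which the sizes of a and b refute in `Single`.
no-source-w-odd : ∀ {p q i j u v l Okx Oky a α₁ αP αQ b β₁ βP βQ h k} → let w = suc (2 * l) in
  0 < p → 0 < i → 0 < u → 0 < v → q ≡ u + (v + w * p) → ¬ Okx 0 1 → ¬ Oky 0 1 →
  Profile p q Okx a α₁ αP αQ → Profile p q Oky b β₁ βP βQ → αQ ≢ 0 → Trivial h → Trivial k →
  a ≡ β₁ + (i * h + u * k) → b ≡ α₁ + (j * h + v * k) → h ≡ αP + (βP + w * k) → k ≡ αQ + βQ → ⊥
no-source-w-odd {p} {q} {i} {j} {u} {v} {l} {h = h} {k} p>0 i>0 u>0 v>0 q≡ ¬01x ¬01y profx profy αQ≢0 th tk a≡ b≡ h≡ k≡ =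
  go (qSource p>0 ¬01x profx) (qSource p>0 ¬01y profy) profy αQ≢0 a≡ b≡ h≡ k≡
  where
  w = suc (2 * l)
  even-h : ∀ m → h ≡ 2 * suc (suc m) → ⊥
  even-h m eq = case trans (sym eq) (trivial-even⇒2 (suc (suc m)) th eq) of λ e → case ℕ.*-cancelˡ-≡ (suc (suc m)) 1 2 e of λ ()
  both : ∀ m n → m ≢ 0 → n ≢ 0 → k ≡ m + n → h ≡ m + (n + w * k) → ⊥
  both zero    n       m≢0 _   _  _  = m≢0 refl
  both (suc m) zero    _   n≢0 _  _  = n≢0 refl
  both (suc m) (suc n) _   _   k≡ h≡ = even-h (m + n + l * k) (begin
    h                                              ≡⟨ h≡ ⟩
    suc m + (suc n + w * k)                        ≡⟨ solveℕ 4 (λ m n l k → (κ 1 ⊕ m) ⊕ ((κ 1 ⊕ n) ⊕ (κ 1 ⊕ κ 2 ⊗ l) ⊗ k)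
                                                        ⊜ (κ 1 ⊕ m ⊕ (κ 1 ⊕ n)) ⊕ k ⊕ κ 2 ⊗ (l ⊗ k)) refl m n l k ⟩
    suc m + suc n + k + 2 * (l * k)                ≡⟨ cong (λ t → suc m + suc n + t + 2 * (l * k)) k≡ ⟩
    suc m + suc n + (suc m + suc n) + 2 * (l * k)  ≡⟨ solveℕ 3 (λ m n t → (κ 1 ⊕ m) ⊕ (κ 1 ⊕ n) ⊕ ((κ 1 ⊕ m) ⊕ (κ 1 ⊕ n)) ⊕ κ 2 ⊗ t
                                                        ⊜ κ 2 ⊗ (κ 2 ⊕ (m ⊕ n ⊕ t))) refl m n (l * k) ⟩
    2 * suc (suc (m + n + l * k))                  ∎)
  double-only : ∀ {βP} → ZeroOrPow2 βP → k ≡ 2 → h ≡ 2 + (βP + w * 2) → ⊥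
  double-only zero k≡2 h≡ = even-h (2 * l) (trans h≡ (solveℕ 1 (λ l → κ 2 ⊕ (κ 1 ⊕ κ 2 ⊗ l) ⊗ κ 2 ⊜ κ 2 ⊗ (κ 2 ⊕ κ 2 ⊗ l)) refl l))
  double-only (pow (suc s)) k≡2 h≡ = even-h (2 ^ s + 2 * l) (trans h≡ (solveℕ 2 (λ t l → κ 2 ⊕ (κ 2 ⊗ t ⊕ (κ 1 ⊕ κ 2 ⊗ l) ⊗ κ 2) ⊜ κ 2 ⊗ (κ 2 ⊕ (t ⊕ κ 2 ⊗ l))) refl (2 ^ s) l))
  double-only (pow zero) k≡2 h≡ = [ (λ h≡2 → case trans (sym h≡2) h≡ of λ ()) , (λ (s , eq) → case proj₂ (2^≡odd s (suc l)
      (sym (ℕ.*-cancelˡ-≡ (suc (2 * suc l)) (2 ^ s) 2 (trans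
        (solveℕ 1 (λ l → κ 2 ⊗ (κ 1 ⊕ κ 2 ⊗ (κ 1 ⊕ l)) ⊜ κ 4 ⊕ (κ 1 ⊕ κ 2 ⊗ l) ⊗ κ 2) refl l)
        (trans (cong suc (sym h≡)) eq))))) of λ ()) ]′ th
  module Single {a b E : ℕ} (r : ℕ) (E≡ : E ≡ 2 ^ suc r) (adj : Adjacent E (suc (p + q))) (a-eq : suc a ≡ E + suc (p + q)) (k≡1 : k ≡ 1) where
    a≡′ : a ≡ E + (p + q)
    a≡′ = ℕ.suc-injective (trans a-eq (ℕ.+-suc E (p + q)))
    p+q≤E : p + q ≤ E
    p+q≤E = s≤s⁻¹ (adjacent-≥ adj)
    q≥ : 2 + p ≤ q
    q≥ = subst (2 + p ≤_) (sym q≡) (ℕ.+-mono-≤ u>0 (ℕ.+-mono-≤ v>0 (ℕ.m≤m+n p (2 * l * p))))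
    -- From E < b it follows that b is not 2, so b + 1 is a power of two above E, hence at least 2E.
    -- But b + 2 ≤ a = E + p + q ≤ 2E.
    no-P : ∀ {β₁} → Trivial b → β₁ ≡ b → a ≡ β₁ + (i * h + u * k) → b ≡ E + (j * h + v * k) → h ≡ 2 → ⊥
    no-P tb refl a≡ b≡ h≡2 = trivial-b tb
      where
      E<b : E < b
      E<b = subst (E <_) (sym b≡) (ℕ.≤-trans (ℕ.≤-reflexive (ℕ.+-comm 1 E)) (ℕ.+-monoʳ-≤ E (ℕ.≤-trans (subst (λ k → 1 ≤ v * k) (sym k≡1) (subst (1 ≤_) (sym (ℕ.*-identityʳ v)) v>0)) (ℕ.m≤n+m (v * k) (j * h)))))
      E≥2 : 2 ≤ E
      E≥2 = subst (2 ≤_) (sym E≡) (2^suc≥2 r)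
      2+b≤a : 2 + b ≤ a
      2+b≤a = subst (2 + b ≤_) (sym a≡) (ℕ.≤-trans (ℕ.≤-reflexive (ℕ.+-comm 2 b)) (ℕ.+-monoʳ-≤ b (ℕ.≤-trans (subst (λ h → 2 ≤ i * h) (sym h≡2) (ℕ.*-monoˡ-≤ 2 i>0)) (ℕ.m≤m+n (i * h) (u * k)))))
      a≤2E : a ≤ 2 * E
      a≤2E = subst₂ _≤_ (sym a≡′) (cong (E +_) (sym (ℕ.+-identityʳ E))) (ℕ.+-monoʳ-≤ E p+q≤E)
      trivial-b : Trivial b → ⊥
      trivial-b (inj₁ b≡2) = ℕ.<⇒≱ (subst (E <_) b≡2 E<b) E≥2
      trivial-b (inj₂ (s , eq)) = ℕ.<⇒≱ 2+b≤a (ℕ.≤-trans a≤2E (ℕ.≤-trans 2E≤ (ℕ.≤-reflexive (sym eq))))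
        where
        2E≤ : 2 * E ≤ 2 ^ suc s
        2E≤ = subst (λ E → 2 * E ≤ 2 ^ suc s) (sym E≡) (2^<2^⇒2*≤ (suc r) (suc s) (subst₂ _<_ E≡ eq (ℕ.m<n⇒m<1+n E<b)))
    -- The contradiction is b = β₁ + p ≤ 2p + 2 ≤ p + q ≤ E < b.
    with-P : ∀ {β₁} → Adjacent β₁ (suc p) → suc b ≡ β₁ + suc p → b ≡ E + (j * h + v * k) → ⊥
    with-P {β₁} adj′ b-eq b≡ = ℕ.<⇒≱ (ℕ.≤-trans (s≤s (ℕ.≤-trans (ℕ.≤-reflexive b≡′) (ℕ.+-monoˡ-≤ p (adjacent-≤ adj′)))) (ℕ.≤-reflexive (cong suc (ℕ.+-comm (suc (suc p)) p))))
        (ℕ.≤-trans (s≤s (ℕ.+-monoʳ-≤ p q≥)) (ℕ.≤-trans (s≤s p+q≤E) E<b))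
      where
      b≡′ : b ≡ β₁ + p
      b≡′ = ℕ.suc-injective (trans b-eq (ℕ.+-suc β₁ p))
      E<b : E < b
      E<b = subst (E <_) (sym b≡) (ℕ.≤-trans (ℕ.≤-reflexive (ℕ.+-comm 1 E)) (ℕ.+-monoʳ-≤ E (ℕ.≤-trans (subst (λ k → 1 ≤ v * k) (sym k≡1) (subst (1 ≤_) (sym (ℕ.*-identityʳ v)) v>0)) (ℕ.m≤n+m (v * k) (j * h)))))
  go : ∀ {Ok a α₁ αP αQ b β₁ βP βQ} → QSource p q a α₁ αP αQ → QSource p q b β₁ βP βQ → Profile p q Ok b β₁ βP βQ → αQ ≢ 0 →
       a ≡ β₁ + (i * h + u * k) → b ≡ α₁ + (j * h + v * k) → h ≡ αP + (βP + w * k) → k ≡ αQ + βQ → ⊥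
  go none _ _ αQ≢0 _ _ _ _ = αQ≢0 refl
  go (double r) (double s) _ _ _ _ h≡ k≡ = both (2 ^ suc r) (2 ^ suc s) (2^≢0 (suc r)) (2^≢0 (suc s)) k≡ h≡
  go (double r) (single _ _ _ _) _ _ _ _ h≡ k≡ = both (2 ^ suc r) 1 (2^≢0 (suc r)) (λ ()) k≡ h≡
  go (single _ _ _ _) (double s) _ _ _ _ h≡ k≡ = both 1 (2 ^ suc s) (λ ()) (2^≢0 (suc s)) k≡ h≡
  go (single _ _ _ _) (single _ _ _ _) _ _ _ _ h≡ k≡ = both 1 1 (λ ()) (λ ()) k≡ h≡
  go {βP = βP} (double r) none profy _ _ _ h≡ k≡ = double-only (profile-P profy) k≡2 (trans h≡ (cong₂ (λ E k → E + (βP + w * k)) E≡2 k≡2))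
    where
    k≡E : k ≡ 2 ^ suc r
    k≡E = trans k≡ (ℕ.+-identityʳ _)
    k≡2 : k ≡ 2
    k≡2 = trivial-even⇒2 (2 ^ r) tk k≡E
    E≡2 : 2 ^ suc r ≡ 2
    E≡2 = trans (sym k≡E) k≡2
  go {b = b} {β₁} {βP} (single r E≡ adj a-eq) none profy _ a≡ b≡ h≡ k≡1 = split (profile-P profy) profy h≡
    where
    open Single {b = b} r E≡ adj a-eq k≡1
    1+w*k : ∀ n → 1 + (n + w * k) ≡ n + 2 * suc l
    1+w*k n = trans (cong (λ k → 1 + (n + w * k)) k≡1) (solveℕ 2 (λ n l → κ 1 ⊕ (n ⊕ (κ 1 ⊕ κ 2 ⊗ l) ⊗ κ 1) ⊜ n ⊕ κ 2 ⊗ (κ 1 ⊕ l)) refl n l)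
    split : ∀ {βP} → ZeroOrPow2 βP → Profile p q _ b β₁ βP 0 → h ≡ 1 + (βP + w * k) → ⊥
    split zero prof h≡ = let tb , β₁≡b = trivial-profile prof in
      no-P tb β₁≡b a≡ b≡ (trivial-even⇒2 (suc l) th (trans h≡ (1+w*k 0)))
    split (pow (suc s)) prof h≡ = even′ (2^≡suc s)
      where
      even′ : ∃[ e ] 2 ^ s ≡ suc e → ⊥
      even′ (e , eq) = even-h (e + l) (trans h≡ (trans (1+w*k (2 ^ suc s)) (trans (sym (ℕ.*-distribˡ-+ 2 (2 ^ s) (suc l)))
        (cong (2 *_) (trans (cong (_+ suc l) eq) (cong suc (ℕ.+-suc e l)))))))
    split (pow zero) prof h≡ with P-only p>0 prof refl (λ ())
    ... | inj₁ (_ , adj′ , b-eq) = with-P adj′ b-eq b≡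
    ... | inj₂ (s≤s () , _)

-- The exponents of 1 + P and Q in σ** P h, when Q = geo P N
data ProfileP (N h : ℕ) : ℕ → ℕ → Set where
  odd  : ∀ r {e} → suc h ≡ 2 ^ suc r * N → 2 ^ suc r ≡ suc e → ProfileP N h e (2 ^ suc r)
  even : ∀ r → suc h ≡ 2 ^ suc r + N → Adjacent (2 ^ suc r) N → ProfileP N h (2 ^ suc r) 1

sum-1-2 : ∀ {m n} → ZeroOrPow2 m → ZeroOrPow2 n → ∀ ρ → suc (m + n) ≡ 2 ^ (2 + ρ) → ρ ≡ 0 × ((m ≡ 1 × n ≡ 2) ⊎ (m ≡ 2 × n ≡ 1))
sum-1-2 zm zn ρ eq = go (small zm zn (2 + ρ) eq) eq
  where
  2≢ : 2 ≢ 2 ^ (2 + ρ)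
  2≢ eq = case 2^≡1⇒≡0 (1 + ρ) (sym (ℕ.*-cancelˡ-≡ 1 (2 ^ (1 + ρ)) 2 eq)) of λ ()
  ρ≡0 : 4 ≡ 2 ^ (2 + ρ) → ρ ≡ 0
  ρ≡0 eq = 2^≡1⇒≡0 ρ (sym (ℕ.*-cancelˡ-≡ 1 (2 ^ ρ) 2 (ℕ.*-cancelˡ-≡ 2 (2 ^ (1 + ρ)) 2 eq)))
  go : ∀ {m n} → Small m n → suc (m + n) ≡ 2 ^ (2 + ρ) → ρ ≡ 0 × ((m ≡ 1 × n ≡ 2) ⊎ (m ≡ 2 × n ≡ 1))
  go s00 eq = case 2^≡1⇒≡0 (2 + ρ) (sym eq) of λ ()
  go s01 eq = contradiction eq 2≢
  go s10 eq = contradiction eq 2≢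
  go s12 eq = ρ≡0 eq , inj₁ (refl , refl)
  go s21 eq = ρ≡0 eq , inj₂ (refl , refl)

zeroOrPow2-odd : ∀ n → ZeroOrPow2 (suc (2 * n)) → n ≡ 0
zeroOrPow2-odd n z = go z refl
  where
  go : ∀ {m} → ZeroOrPow2 m → m ≡ suc (2 * n) → n ≡ 0
  go (pow r) eq = proj₂ (2^≡odd r n eq)

sum-5 : ∀ {m n} → ZeroOrPow2 m → ZeroOrPow2 n → m + n ≡ 5 → (m ≡ 1 × n ≡ 4) ⊎ (m ≡ 4 × n ≡ 1)
sum-5 {0} _ zn refl = case zeroOrPow2-odd 2 zn of λ ()
sum-5 {1} _ _ refl = inj₁ (refl , refl)
sum-5 {2} _ zn refl = case zeroOrPow2-odd 1 zn of λ ()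
sum-5 {3} zm _ refl = case zeroOrPow2-odd 1 zm of λ ()
sum-5 {4} _ _ refl = inj₂ (refl , refl)
sum-5 {5} zm _ refl = case zeroOrPow2-odd 2 zm of λ ()

-- The constructor names list h, αP and βP. In all cases ρ = 0, so the only geometric sum in P that
-- remains is 1 + P + P².
data Heads (ρ αP βP : ℕ) : ℕ → ℕ → ℕ → Set where
  h4-12 : ρ ≡ 0 → αP ≡ 1 → βP ≡ 2 → Heads ρ αP βP 4 1 2
  h4-21 : ρ ≡ 0 → αP ≡ 2 → βP ≡ 1 → Heads ρ αP βP 4 1 2
  h5-12 : ρ ≡ 0 → αP ≡ 1 → βP ≡ 2 → Heads ρ αP βP 5 2 1
  h5-21 : ρ ≡ 0 → αP ≡ 2 → βP ≡ 1 → Heads ρ αP βP 5 2 1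
  h6-14 : ρ ≡ 0 → αP ≡ 1 → βP ≡ 4 → Heads ρ αP βP 6 1 4
  h6-41 : ρ ≡ 0 → αP ≡ 4 → βP ≡ 1 → Heads ρ αP βP 6 1 4

-- Let N = 2^(ρ+1) + 1. For odd h, k is an even trivial number, so k = 2; if 2^(r+1) = N - 1, then k
-- = 1 and h = 2^(ρ+2). Both give αP + βP + 1 = 2^(ρ+2), so ρ = 0 and the summands are 1 and 2. If
-- 2^(r+1) = N + 1, then 2^r = 2^ρ + 1, so ρ = 0, h = 6 and αP + βP = 5.
heads : ∀ {ρ αP βP h γ₁ γQ k} → ZeroOrPow2 αP → ZeroOrPow2 βP → ProfileP (suc (2 ^ suc ρ)) h γ₁ γQ → Trivial k →
        h ≡ αP + (βP + 1 * k) → k ≡ γQ → Heads ρ αP βP h k γ₁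
heads {ρ} {αP} {βP} {h} {γ₁} {k = k} zα zβ (odd r h-eq E≡) tk h≡ refl = finish ρ≡0 (proj₂ sums)
  where
  k≡2 : k ≡ 2
  k≡2 = trivial-even⇒2 (2 ^ r) tk refl
  sums : ρ ≡ 0 × ((αP ≡ 1 × βP ≡ 2) ⊎ (αP ≡ 2 × βP ≡ 1))
  sums = sum-1-2 zα zβ ρ (ℕ.+-cancelʳ-≡ 2 _ _ (begin
    suc (αP + βP) + 2                ≡⟨ solveℕ 2 (λ a b → κ 1 ⊕ (a ⊕ b) ⊕ κ 2 ⊜ κ 1 ⊕ (a ⊕ (b ⊕ κ 1 ⊗ κ 2))) refl αP βP ⟩
    suc (αP + (βP + 1 * 2))          ≡⟨ cong (λ k → suc (αP + (βP + 1 * k))) k≡2 ⟨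
    suc (αP + (βP + 1 * k))          ≡⟨ cong suc h≡ ⟨
    suc h                            ≡⟨ h-eq ⟩
    k * suc (2 ^ suc ρ)              ≡⟨ cong (_* suc (2 ^ suc ρ)) k≡2 ⟩
    2 * suc (2 ^ suc ρ)              ≡⟨ ℕ.*-suc 2 (2 ^ suc ρ) ⟩
    2 + 2 ^ (2 + ρ)                  ≡⟨ ℕ.+-comm 2 (2 ^ (2 + ρ)) ⟩
    2 ^ (2 + ρ) + 2                  ∎))
  ρ≡0 = proj₁ sums
  finish : ρ ≡ 0 → (αP ≡ 1 × βP ≡ 2) ⊎ (αP ≡ 2 × βP ≡ 1) → Heads ρ αP βP h k γ₁
  finish ρ≡0 (inj₁ (α≡ , β≡)) = subst₂ (λ h kγ → Heads ρ αP βP h (proj₁ kγ) (proj₂ kγ))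
    (sym (trans h≡ (trans (cong₂ (λ a b → a + (b + 1 * k)) α≡ β≡) (cong (λ k → 1 + (2 + 1 * k)) k≡2))))
    (cong₂ _,_ (sym k≡2) (ℕ.suc-injective (trans (sym k≡2) E≡))) (h5-12 ρ≡0 α≡ β≡)
  finish ρ≡0 (inj₂ (α≡ , β≡)) = subst₂ (λ h kγ → Heads ρ αP βP h (proj₁ kγ) (proj₂ kγ))
    (sym (trans h≡ (trans (cong₂ (λ a b → a + (b + 1 * k)) α≡ β≡) (cong (λ k → 2 + (1 + 1 * k)) k≡2))))
    (cong₂ _,_ (sym k≡2) (ℕ.suc-injective (trans (sym k≡2) E≡))) (h5-21 ρ≡0 α≡ β≡)
heads {ρ} {αP} {βP} {h} zα zβ (even r h-eq (inj₂ N≡)) _ h≡ refl = finish (proj₁ sums) (proj₂ sums)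
  where
  E≡ : 2 ^ suc r ≡ 2 ^ suc ρ
  E≡ = sym (ℕ.suc-injective N≡)
  h≡2E : h ≡ 2 ^ (2 + ρ)
  h≡2E = ℕ.suc-injective (trans h-eq (trans (cong (_+ suc (2 ^ suc ρ)) E≡)
    (solveℕ 1 (λ e → e ⊕ (κ 1 ⊕ e) ⊜ κ 1 ⊕ κ 2 ⊗ e) refl (2 ^ suc ρ))))
  sums = sum-1-2 zα zβ ρ (trans (solveℕ 2 (λ a b → κ 1 ⊕ (a ⊕ b) ⊜ a ⊕ (b ⊕ κ 1)) refl αP βP) (trans (sym h≡) h≡2E))
  finish : ρ ≡ 0 → (αP ≡ 1 × βP ≡ 2) ⊎ (αP ≡ 2 × βP ≡ 1) → Heads ρ αP βP h 1 (2 ^ suc r)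
  finish ρ≡0 (inj₁ (α≡ , β≡)) = subst₂ (λ h γ → Heads ρ αP βP h 1 γ) (sym (trans h≡2E (cong (λ ρ → 2 ^ (2 + ρ)) ρ≡0)))
    (sym (trans E≡ (cong (λ ρ → 2 ^ suc ρ) ρ≡0))) (h4-12 ρ≡0 α≡ β≡)
  finish ρ≡0 (inj₂ (α≡ , β≡)) = subst₂ (λ h γ → Heads ρ αP βP h 1 γ) (sym (trans h≡2E (cong (λ ρ → 2 ^ (2 + ρ)) ρ≡0)))
    (sym (trans E≡ (cong (λ ρ → 2 ^ suc ρ) ρ≡0))) (h4-21 ρ≡0 α≡ β≡)
heads {ρ} {αP} {βP} {h} zα zβ (even r h-eq (inj₁ E≡)) _ h≡ refl = finish (sum-5 zα zβ sum≡5)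
  where
  ρ≡0 : ρ ≡ 0
  ρ≡0 = go (small-0-2^ ρ r (sym (ℕ.*-cancelˡ-≡ (2 ^ r) (suc (2 ^ ρ)) 2 (trans E≡ (sym (ℕ.*-suc 2 (2 ^ ρ)))))))
    where
    go′ : ∀ {n} → Small 0 n → n ≢ 0 → n ≡ 1
    go′ s00 n≢0 = contradiction refl n≢0
    go′ s01 _   = refl
    go : Small 0 (2 ^ ρ) → ρ ≡ 0
    go s = 2^≡1⇒≡0 ρ (go′ s (2^≢0 ρ))
  E≡4 : 2 ^ suc r ≡ 4
  E≡4 = trans E≡ (cong (λ ρ → suc (suc (2 ^ suc ρ))) ρ≡0)
  h≡6 : h ≡ 6
  h≡6 = ℕ.suc-injective (trans h-eq (cong₂ (λ E ρ → E + suc (2 ^ suc ρ)) E≡4 ρ≡0))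
  sum≡5 : αP + βP ≡ 5
  sum≡5 = ℕ.suc-injective (trans (solveℕ 2 (λ a b → κ 1 ⊕ (a ⊕ b) ⊜ a ⊕ (b ⊕ κ 1)) refl αP βP) (trans (sym h≡) h≡6))
  finish : (αP ≡ 1 × βP ≡ 4) ⊎ (αP ≡ 4 × βP ≡ 1) → Heads ρ αP βP h 1 (2 ^ suc r)
  finish (inj₁ (α≡ , β≡)) = subst₂ (λ h γ → Heads ρ αP βP h 1 γ) (sym h≡6) (sym E≡4) (h6-14 ρ≡0 α≡ β≡)
  finish (inj₂ (α≡ , β≡)) = subst₂ (λ h γ → Heads ρ αP βP h 1 γ) (sym h≡6) (sym E≡4) (h6-41 ρ≡0 α≡ β≡)

Quadruple : Set
Quadruple = ℕ × ℕ × ℕ × ℕ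

geoP-solutions : List Quadruple
geoP-solutions = (4 , 5 , 4 , 1) ∷ (5 , 4 , 4 , 1) ∷ (4 , 5 , 5 , 2) ∷ (5 , 4 , 5 , 2) ∷ []

-- Both αP and βP are positive, so i = j = 1 and deg P = 2. The one that is at least 2 determines
-- its exponent, as in b + 1 = 3 βP and β₁ = βP - 1, and the equation for a then gives the other.
-- For h = 6 this fails: b = 11 would need α₁ = 6, but α₁ is adjacent to deg P + 1 = 3.
geoP-exponents : ∀ {ρ e i j u v p q Okx Oky a α₁ αP b β₁ βP h γ₁ γQ k} →
  2 ^ suc ρ ≡ suc e → u ≡ i * e → v ≡ j * e → p ≡ i + j → (αP ≢ 0 → i ≡ 1) → (βP ≢ 0 → j ≡ 1) →
  Profile p q Okx a α₁ αP 0 → Profile p q Oky b β₁ βP 0 → ProfileP (suc (2 ^ suc ρ)) h γ₁ γQ → Trivial k →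
  a ≡ β₁ + (i * γ₁ + u * k) → b ≡ α₁ + (j * γ₁ + v * k) → h ≡ αP + (βP + 1 * k) → k ≡ γQ →
  i ≡ 1 × j ≡ 1 × u ≡ 1 × v ≡ 1 × (a , b , h , k) ∈ geoP-solutions
geoP-exponents {ρ} {e} 2^≡ refl refl refl i≡ j≡ profx profy profP tk a≡ b≡ h≡ k≡ =
  go (heads {ρ} (profile-P profx) (profile-P profy) profP tk h≡ k≡) 2^≡ i≡ j≡ profx profy a≡ b≡
  where
  P-double : ∀ {q Ok a α₁} E → Profile 2 q Ok a α₁ (2 + E) 0 → suc a ≡ (2 + E) * 3 × suc α₁ ≡ 2 + E
  P-double E prof with P-only (s≤s z≤n) prof refl (λ ())
  ... | inj₂ (_ , eq , eq′) = eq , eq′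
  P-single : ∀ {q Ok a α₁} → Profile 2 q Ok a α₁ 1 0 → Adjacent α₁ 3
  P-single prof with P-only (s≤s z≤n) prof refl (λ ())
  ... | inj₁ (_ , adj , _) = adj
  ... | inj₂ (s≤s () , _)
  go : ∀ {ρ i j q Okx Oky a α₁ αP b β₁ βP h γ₁ k} → Heads ρ αP βP h k γ₁ → 2 ^ suc ρ ≡ suc e →
       (αP ≢ 0 → i ≡ 1) → (βP ≢ 0 → j ≡ 1) → Profile (i + j) q Okx a α₁ αP 0 → Profile (i + j) q Oky b β₁ βP 0 →
       a ≡ β₁ + (i * γ₁ + i * e * k) → b ≡ α₁ + (j * γ₁ + j * e * k) →
       i ≡ 1 × j ≡ 1 × i * e ≡ 1 × j * e ≡ 1 × (a , b , h , k) ∈ geoP-solutions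
  go {a = a} {b = b} (h4-12 refl refl refl) refl i≡ j≡ profx profy a≡ b≡ with i≡ (λ ()) | j≡ (λ ())
  ... | refl | refl = refl , refl , refl , refl , first (P-double 0 profy) a≡
    where
    first : suc b ≡ 6 × suc _ ≡ 2 → a ≡ _ + 3 → (a , b , 4 , 1) ∈ geoP-solutions
    first (refl , refl) refl = here refl
  go {a = a} {b = b} (h4-21 refl refl refl) refl i≡ j≡ profx profy a≡ b≡ with i≡ (λ ()) | j≡ (λ ())
  ... | refl | refl = refl , refl , refl , refl , second (P-double 0 profx) b≡
    where
    second : suc a ≡ 6 × suc _ ≡ 2 → b ≡ _ + 3 → (a , b , 4 , 1) ∈ geoP-solutions
    second (refl , refl) refl = there (here refl)
  go {a = a} {b = b} (h5-12 refl refl refl) refl i≡ j≡ profx profy a≡ b≡ with i≡ (λ ()) | j≡ (λ ())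
  ... | refl | refl = refl , refl , refl , refl , first (P-double 0 profy) a≡
    where
    first : suc b ≡ 6 × suc _ ≡ 2 → a ≡ _ + 3 → (a , b , 5 , 2) ∈ geoP-solutions
    first (refl , refl) refl = there (there (here refl))
  go {a = a} {b = b} (h5-21 refl refl refl) refl i≡ j≡ profx profy a≡ b≡ with i≡ (λ ()) | j≡ (λ ())
  ... | refl | refl = refl , refl , refl , refl , second (P-double 0 profx) b≡
    where
    second : suc a ≡ 6 × suc _ ≡ 2 → b ≡ _ + 3 → (a , b , 5 , 2) ∈ geoP-solutions
    second (refl , refl) refl = there (there (there (here refl)))
  go {α₁ = α₁} {b = b} (h6-14 refl refl refl) refl i≡ j≡ profx profy a≡ b≡ with i≡ (λ ()) | j≡ (λ ())
  ... | refl | refl = ⊥-elim (absurd (P-double 2 profy) b≡ (P-single profx))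
    where
    absurd : suc b ≡ 12 × suc _ ≡ 4 → b ≡ α₁ + 5 → Adjacent α₁ 3 → ⊥
    absurd (refl , _) () (inj₁ refl)
    absurd (refl , _) () (inj₂ refl)
  go {a = a} {b = b} {β₁ = β₁} (h6-41 refl refl refl) refl i≡ j≡ profx profy a≡ b≡ with i≡ (λ ()) | j≡ (λ ())
  ... | refl | refl = ⊥-elim (absurd (P-double 2 profx) a≡ (P-single profy))
    where
    absurd : suc a ≡ 12 × suc _ ≡ 4 → a ≡ β₁ + 5 → Adjacent β₁ 3 → ⊥
    absurd (refl , _) () (inj₁ refl)
    absurd (refl , _) () (inj₂ refl)

-- The finite search for w = 0

_⇒_ : Bool → Bool → Bool
false ⇒ _ = true
true  ⇒ b = b

infixr 3 _⇒_

⇒-elim : ∀ {b c} → T (b ⇒ c) → T b → T c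
⇒-elim {true} c _ = c

implies : List Bool → Bool → Bool
implies []       c = c
implies (b ∷ bs) c = b ⇒ implies bs c

implies-elim : ∀ bs {c} → T (implies bs c) → All T bs → T c
implies-elim []          t []       = t
implies-elim (true ∷ bs) t (_ ∷ ts) = implies-elim bs t ts

∧-elim : ∀ {b c} → T (b ∧ c) → T b × T c
∧-elim {true} c = _ , c

forBits : (ℕ → Bool) → Bool
forBits f = f 0 ∧ f 1

forBits-elim : ∀ f {c} → T (forBits f) → Bit c → T (f c)
forBits-elim f t 0# = proj₁ (∧-elim {f 0} t)
forBits-elim f t 1# = proj₂ (∧-elim {f 0} t)

adjacentᵇ : ℕ → ℕ → Bool
adjacentᵇ m n = (m ≡ᵇ suc n) ∨ (n ≡ᵇ suc m)

adjacentᵇ-complete : ∀ m n → Adjacent m n → T (adjacentᵇ m n)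
adjacentᵇ-complete m n (inj₁ eq) = Equivalence.from Bool.T-∨ (inj₁ (ℕ.≡⇒≡ᵇ m (suc n) eq))
adjacentᵇ-complete m n (inj₂ eq) = Equivalence.from (Bool.T-∨ {m ≡ᵇ suc n}) (inj₂ (ℕ.≡⇒≡ᵇ n (suc m) eq))

Test : Set
Test = ℕ → ℕ → ℕ → ℕ → Bool

module Search (p q : ℕ) (ok : ℕ → ℕ → Bool) (φ : Test) where
  m : ℕ → ℕ → ℕ
  m c d = suc (c * p + d * q)

  evens : (c d c′ d′ r : ℕ) → Bool
  evens c d c′ d′ r = let E = 2 ^ suc r in
    adjacentᵇ (E * m c d) (m c′ d′) ⇒ φ (pred (E * m c d + m c′ d′)) E (c * E + c′) (d * E + d′)

  -- The values r ≤ 2 suffice: if c or d is 1, multiplicities of at most 2 give 2^(r+1) = 2;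
  -- otherwise 2^(r+1) is adjacent to m c′ d′ ≤ 1 + p + q ≤ 9, hence less than 16.
  evens₃ : (c d c′ d′ : ℕ) → Bool
  evens₃ c d c′ d′ = ok c′ d′ ⇒ (evens c d c′ d′ 0 ∧ (evens c d c′ d′ 1 ∧ evens c d c′ d′ 2))

  row : (c d : ℕ) → Bool
  -- For odd a with P or Q present only 2^(r+1) = 2 is possible, so that a + 1 = 2 m and the linear
  -- prime has multiplicity 2 - 1 = 1.
  row c d = ok c d ⇒ (φ (pred (2 * m c d)) 1 (c * 2) (d * 2) ∧ forBits λ c′ → forBits λ d′ → evens₃ c d c′ d′)

  all : Bool
  all = forBits λ c → forBits λ d → row c d

  row-elim : ∀ {c d} → T all → Bit c → Bit d → T (ok c d) →
             T (φ (pred (2 * m c d)) 1 (c * 2) (d * 2)) × T (forBits λ c′ → forBits λ d′ → evens₃ c d c′ d′)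
  row-elim {c} {d} t bc bd o = ∧-elim (⇒-elim {ok c d} (forBits-elim (row c) (forBits-elim (λ c → forBits (row c)) t bc) bd) o)

  evens-elim : ∀ {c d c′ d′} r → T all → Bit c → Bit d → Bit c′ → Bit d′ → T (ok c d) → T (ok c′ d′) → r ≤ 2 → T (evens c d c′ d′ r)
  evens-elim {c} {d} {c′} {d′} r t bc bd bc′ bd′ o o′ r≤2 = pick r r≤2
    where
    t₃ : T (evens c d c′ d′ 0 ∧ (evens c d c′ d′ 1 ∧ evens c d c′ d′ 2))
    t₃ = ⇒-elim {ok c′ d′} (forBits-elim (evens₃ c d c′) (forBits-elim (λ c′ → forBits (evens₃ c d c′)) (proj₂ (row-elim t bc bd o)) bc′) bd′) o′
    pick : ∀ r → r ≤ 2 → T (evens c d c′ d′ r)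
    pick 0 _ = proj₁ (∧-elim {evens c d c′ d′ 0} t₃)
    pick 1 _ = proj₁ (∧-elim {evens c d c′ d′ 1} (proj₂ (∧-elim {evens c d c′ d′ 0} t₃)))
    pick 2 _ = proj₂ (∧-elim {evens c d c′ d′ 1} (proj₂ (∧-elim {evens c d c′ d′ 0} t₃)))
    pick (suc (suc (suc _))) (s≤s (s≤s ()))

  2^suc≤2⇒0 : ∀ r → 2 ^ suc r ≤ 2 → r ≡ 0
  2^suc≤2⇒0 zero    _  = refl
  2^suc≤2⇒0 (suc r) le = contradiction le (ℕ.<⇒≱ (ℕ.≤-trans (s≤s (s≤s (s≤s z≤n))) (ℕ.*-monoʳ-≤ 2 (2^suc≥2 r))))

  2^suc≤10⇒≤2 : ∀ r → 2 ^ suc r ≤ 10 → r ≤ 2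
  2^suc≤10⇒≤2 r le with ℕ.≤-<-connex r 2
  ... | inj₁ r≤2 = r≤2
  ... | inj₂ 2<r = contradiction (ℕ.≤-trans (ℕ.^-monoʳ-≤ 2 (s≤s 2<r)) le) (ℕ.<⇒≱ (ℕ.m≤m+n 11 5))

  -- For odd a with c = d = 0 the bounds on αP and αQ say nothing about r. These profiles escape the
  -- enumeration and form the first alternative.
  sound : ∀ {a α₁ αP αQ} → p + q ≤ 8 → Profile p q (λ c d → T (ok c d)) a α₁ αP αQ → αP ≤ 2 → αQ ≤ 2 →
          (αP ≡ 0 × αQ ≡ 0) ⊎ (T all → T (φ a α₁ αP αQ))
  sound _ (odd r 0# 0# _ _ _) _ _ = inj₁ (refl , refl)
  sound {a} {α₁} _ (odd r {c} {d} bc bd o eq E≡) αP≤ αQ≤ = go bc bd αP≤ αQ≤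
    where
    use : r ≡ 0 → T all → T (φ a α₁ (c * 2 ^ suc r) (d * 2 ^ suc r))
    use refl t = subst₂ (λ a e → T (φ a e (c * 2) (d * 2))) (cong pred (sym eq)) (ℕ.suc-injective E≡) (proj₁ (row-elim t bc bd o))
    go : ∀ {c′ d′} → Bit c′ → Bit d′ → c′ * 2 ^ suc r ≤ 2 → d′ * 2 ^ suc r ≤ 2 →
         (c′ * 2 ^ suc r ≡ 0 × d′ * 2 ^ suc r ≡ 0) ⊎ (T all → T (φ a α₁ (c * 2 ^ suc r) (d * 2 ^ suc r)))
    go 0# 0# _ _ = inj₁ (refl , refl)
    go 1# _  αP≤ _ = inj₂ (use (2^suc≤2⇒0 r (subst (_≤ 2) (ℕ.+-identityʳ _) αP≤)))
    go 0# 1# _ αQ≤ = inj₂ (use (2^suc≤2⇒0 r (subst (_≤ 2) (ℕ.+-identityʳ _) αQ≤)))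
  sound p+q≤8 (even r {c} {d} {c′} {d′} bc bd bc′ bd′ o o′ eq adj _ _) αP≤ αQ≤ = inj₂ λ t →
    subst (λ a → T (φ a (2 ^ suc r) (c * 2 ^ suc r + c′) (d * 2 ^ suc r + d′))) (cong pred (sym eq))
      (⇒-elim {adjacentᵇ (2 ^ suc r * m c d) (m c′ d′)} (evens-elim r t bc bd bc′ bd′ o o′ (r≤2 bc bd αP≤ αQ≤ adj))
        (adjacentᵇ-complete (2 ^ suc r * m c d) (m c′ d′) adj))
    where
    m≤9 : Bit c′ → Bit d′ → m c′ d′ ≤ 9
    m≤9 bc′ bd′ = s≤s (ℕ.≤-trans (ℕ.+-mono-≤ (bit* bc′) (bit* bd′)) p+q≤8)
      where
      bit* : ∀ {c n} → Bit c → c * n ≤ n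
      bit* 0# = z≤n
      bit* {n = n} 1# = ℕ.≤-reflexive (ℕ.+-identityʳ n)
    r≤2 : ∀ {c d} → Bit c → Bit d → c * 2 ^ suc r + c′ ≤ 2 → d * 2 ^ suc r + d′ ≤ 2 → Adjacent (2 ^ suc r * m c d) (m c′ d′) → r ≤ 2
    r≤2 0# 0# _ _ adj = 2^suc≤10⇒≤2 r (ℕ.≤-trans (ℕ.≤-reflexive (sym (ℕ.*-identityʳ _))) (ℕ.≤-trans (adjacent-≤ adj) (s≤s (m≤9 bc′ bd′))))
    r≤2 1# _  αP≤ _ _ = subst (_≤ 2) (sym (2^suc≤2⇒0 r (ℕ.≤-trans (ℕ.≤-reflexive (sym (ℕ.+-identityʳ _))) (ℕ.≤-trans (ℕ.m≤m+n _ c′) αP≤)))) z≤n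
    r≤2 0# 1# _ αQ≤ _ = subst (_≤ 2) (sym (2^suc≤2⇒0 r (ℕ.≤-trans (ℕ.≤-reflexive (sym (ℕ.+-identityʳ _))) (ℕ.≤-trans (ℕ.m≤m+n _ d′) αQ≤)))) z≤n

Profile-map : ∀ {p q a α₁ αP αQ} {Ok Ok′ : ℕ → ℕ → Set} → (∀ {c d} → Bit c → Bit d → Ok c d → Ok′ c d) →
              Profile p q Ok a α₁ αP αQ → Profile p q Ok′ a α₁ αP αQ
Profile-map f (odd r bc bd o eq E≡) = odd r bc bd (f bc bd o) eq E≡
Profile-map f (even r bc bd bc′ bd′ o o′ eq adj cc dd) = even r bc bd bc′ bd′ (f bc bd o) (f bc′ bd′ o′) eq adj cc dd

-- A necessary condition for geo x m = P^c Q^d when w = 0, which is enough for a search. A single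
-- prime must be 1 + x y or 1 + x y³, as the trace argument excludes 1 + x y^(2^r-1) for r > 2; the
-- entry for P Q keeps only the exponents i and j of the two pairs found in `Mersenne.mersenne`.
ok : (i j u v : ℕ) → ℕ → ℕ → Bool
ok i j u v 0 0 = true
ok i j u v 1 0 = (i ≡ᵇ 1) ∧ ((j ≡ᵇ 1) ∨ (j ≡ᵇ 3))
ok i j u v 0 1 = (u ≡ᵇ 1) ∧ ((v ≡ᵇ 1) ∨ (v ≡ᵇ 3))
ok i j u v 1 1 = ((i ≡ᵇ 1) ∧ (j ≡ᵇ 2)) ∨ ((i ≡ᵇ 2) ∧ (j ≡ᵇ 1))
ok i j u v _ _ = false

_≡ᵇ₄_ : Quadruple → Quadruple → Bool
(a , b , h , k) ≡ᵇ₄ (a′ , b′ , h′ , k′) = (a ≡ᵇ a′) ∧ ((b ≡ᵇ b′) ∧ ((h ≡ᵇ h′) ∧ (k ≡ᵇ k′)))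

elem : Quadruple → List Quadruple → Bool
elem s []       = false
elem s (t ∷ ts) = (s ≡ᵇ₄ t) ∨ elem s ts

elem⇒∈ : ∀ s ts → T (elem s ts) → s ∈ ts
elem⇒∈ s@(a , b , h , k) (t@(a′ , b′ , h′ , k′) ∷ ts) e with Equivalence.to (Bool.T-∨ {s ≡ᵇ₄ t}) e
... | inj₂ e′ = there (elem⇒∈ s ts e′)
... | inj₁ e′ =
  let a≡ , e₁ = ∧-elim {a ≡ᵇ a′} e′
      b≡ , e₂ = ∧-elim {b ≡ᵇ b′} e₁
      h≡ , k≡ = ∧-elim {h ≡ᵇ h′} e₂
  in here (cong₂ _,_ (ℕ.≡ᵇ⇒≡ a a′ a≡) (cong₂ _,_ (ℕ.≡ᵇ⇒≡ b b′ b≡) (cong₂ _,_ (ℕ.≡ᵇ⇒≡ h h′ h≡) (ℕ.≡ᵇ⇒≡ k k′ k≡))))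

trivialᵇ : ℕ → Bool
trivialᵇ n = (n ≡ᵇ 2) ∨ (suc n ≡ᵇ 2 ^ ⌊log₂ suc n ⌋)

trivialᵇ-complete : ∀ {n} → Trivial n → T (trivialᵇ n)
trivialᵇ-complete {n} (inj₁ eq) = Equivalence.from Bool.T-∨ (inj₁ (ℕ.≡⇒≡ᵇ n 2 eq))
trivialᵇ-complete {n} (inj₂ (r , eq)) = Equivalence.from (Bool.T-∨ {n ≡ᵇ 2}) (inj₂ (ℕ.≡⇒≡ᵇ (suc n) (2 ^ ⌊log₂ suc n ⌋)
  (trans eq (cong (2 ^_) (trans (sym (⌊log₂[2^n]⌋≡n (suc r))) (cong ⌊log₂_⌋ (sym eq)))))))

module Solutions (i j u v : ℕ) (sols : List Quadruple) where
  p q : ℕ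
  p = i + j
  q = u + v

  premises : ℕ → ℕ → ℕ → ℕ → ℕ → ℕ → List Bool
  premises a α₁ b β₁ h k =
    (1 ≤ᵇ h) ∷ (1 ≤ᵇ k) ∷ (h ≤ᵇ 3) ∷ (k ≤ᵇ 3) ∷ (a ≡ᵇ β₁ + (i * h + u * k)) ∷ (b ≡ᵇ α₁ + (j * h + v * k)) ∷ []

  test : ℕ → ℕ → ℕ → ℕ → Test
  test a α₁ αP αQ b β₁ βP βQ = implies (premises a α₁ b β₁ (αP + βP) (αQ + βQ)) (elem (a , b , αP + βP , αQ + βQ) sols)

  -- A trivial exponent a (or b) is not bounded, but determined by the profile of the other one.
  test-both test-a test-b : Test
  test-both a α₁ αP αQ = Search.all p q (ok j i v u) (test a α₁ αP αQ)
  test-a b β₁ βP βQ = let a = β₁ + (i * βP + u * βQ) in trivialᵇ a ⇒ test a a 0 0 b β₁ βP βQ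
  test-b a α₁ αP αQ = let b = α₁ + (j * αP + v * αQ) in trivialᵇ b ⇒ test a α₁ αP αQ b b 0 0

  check : Bool
  check = Search.all p q (ok i j u v) test-both ∧ (Search.all p q (ok j i v u) test-a ∧ Search.all p q (ok i j u v) test-b)

  solutions : ∀ {a α₁ αP αQ b β₁ βP βQ} → T check → p + q ≤ 8 →
    Profile p q (λ c d → T (ok i j u v c d)) a α₁ αP αQ → Profile p q (λ c d → T (ok j i v u c d)) b β₁ βP βQ →
    αP ≤ 2 → αQ ≤ 2 → βP ≤ 2 → βQ ≤ 2 → let h = αP + βP ; k = αQ + βQ in
    1 ≤ h → 1 ≤ k → h ≤ 3 → k ≤ 3 → a ≡ β₁ + (i * h + u * k) → b ≡ α₁ + (j * h + v * k) → (a , b , h , k) ∈ sols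
  solutions {a} {α₁} {αP} {αQ} {b} {β₁} {βP} {βQ} t p+q≤8 profx profy αP≤ αQ≤ βP≤ βQ≤ h≥1 k≥1 h≤3 k≤3 a≡ b≡ =
    elem⇒∈ (a , b , αP + βP , αQ + βQ) sols (implies-elim (premises a α₁ b β₁ (αP + βP) (αQ + βQ)) passed
      (ℕ.≤⇒≤ᵇ h≥1 ∷ ℕ.≤⇒≤ᵇ k≥1 ∷ ℕ.≤⇒≤ᵇ h≤3 ∷ ℕ.≤⇒≤ᵇ k≤3 ∷ ℕ.≡⇒≡ᵇ a (β₁ + (i * (αP + βP) + u * (αQ + βQ))) a≡ ∷ ℕ.≡⇒≡ᵇ b (α₁ + (j * (αP + βP) + v * (αQ + βQ))) b≡ ∷ []))
    where
    t₁ = proj₁ (∧-elim {Search.all p q (ok i j u v) test-both} t)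
    t₂₃ = proj₂ (∧-elim {Search.all p q (ok i j u v) test-both} t)
    t₂ = proj₁ (∧-elim {Search.all p q (ok j i v u) test-a} t₂₃)
    t₃ = proj₂ (∧-elim {Search.all p q (ok j i v u) test-a} t₂₃)
    trivial : ∀ {Ok a α₁ αP αQ} → Profile p q Ok a α₁ αP αQ → αP ≡ 0 × αQ ≡ 0 → Trivial a × α₁ ≡ a
    trivial prof (refl , refl) = trivial-profile prof
    case-a : αP ≡ 0 × αQ ≡ 0 → T (test-a b β₁ βP βQ) → Trivial a × α₁ ≡ a → T (test a α₁ αP αQ b β₁ βP βQ)
    case-a (refl , refl) t (ta , refl) = ⇒-elim {trivialᵇ a} (subst (λ a → T (trivialᵇ a ⇒ test a a 0 0 b β₁ βP βQ)) (sym a≡) t) (trivialᵇ-complete ta)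
    case-b : βP ≡ 0 × βQ ≡ 0 → T (test-b a α₁ αP αQ) → Trivial b × β₁ ≡ b → T (test a α₁ αP αQ b β₁ βP βQ)
    case-b (refl , refl) t (tb , refl) = ⇒-elim {trivialᵇ b} (subst (λ b → T (trivialᵇ b ⇒ test a α₁ αP αQ b b 0 0))
      (sym (trans b≡ (cong₂ (λ h k → α₁ + (j * h + v * k)) (ℕ.+-identityʳ αP) (ℕ.+-identityʳ αQ)))) t) (trivialᵇ-complete tb)
    case-ab : αP ≡ 0 × αQ ≡ 0 → βP ≡ 0 × βQ ≡ 0 → T (test a α₁ αP αQ b β₁ βP βQ)
    case-ab (refl , refl) (refl , refl) = case h≥1 of λ ()
    passed : T (test a α₁ αP αQ b β₁ βP βQ)
    Zero : ℕ → ℕ → Set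
    Zero m n = m ≡ 0 × n ≡ 0
    use-both : (Zero βP βQ ⊎ (T (test-both a α₁ αP αQ) → T (test a α₁ αP αQ b β₁ βP βQ))) →
               (Zero αP αQ ⊎ (T (Search.all p q (ok i j u v) test-b) → T (test-b a α₁ αP αQ))) →
               T (test-both a α₁ αP αQ) → T (test a α₁ αP αQ b β₁ βP βQ)
    use-both (inj₂ f)   _          t = f t
    use-both (inj₁ β≡0) (inj₁ α≡0) _ = case-ab α≡0 β≡0
    use-both (inj₁ β≡0) (inj₂ f)   _ = case-b β≡0 (f t₃) (trivial profy β≡0)
    use : (Zero αP αQ ⊎ (T (Search.all p q (ok i j u v) test-both) → T (test-both a α₁ αP αQ))) →
          (Zero βP βQ ⊎ (T (Search.all p q (ok j i v u) test-a) → T (test-a b β₁ βP βQ))) → T (test a α₁ αP αQ b β₁ βP βQ)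
    use (inj₁ α≡0) (inj₁ β≡0) = case-ab α≡0 β≡0
    use (inj₁ α≡0) (inj₂ f)   = case-a α≡0 (f t₂) (trivial profx α≡0)
    use (inj₂ f)   _          = use-both (Search.sound p q (ok j i v u) (test a α₁ αP αQ) p+q≤8 profy βP≤ βQ≤)
      (Search.sound p q (ok i j u v) test-b p+q≤8 profx αP≤ αQ≤) (f t₁)
    passed = use (Search.sound p q (ok i j u v) test-both p+q≤8 profx αP≤ αQ≤) (Search.sound p q (ok j i v u) test-a p+q≤8 profy βP≤ βQ≤)

-- P = 1 + x^i y^j and Q = 1 + x^u y^v, with the exponents (a , b , h , k) of the solutions x^a y^b P^h Q^k.
data MersennePair : (i j u v : ℕ) → List Quadruple → Set where
  p11-q13 : MersennePair 1 1 1 3 ((10 , 7 , 2 , 1) ∷ [])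
  p11-q31 : MersennePair 1 1 3 1 ((7 , 10 , 2 , 1) ∷ [])
  p13-q11 : MersennePair 1 3 1 1 ((10 , 7 , 1 , 2) ∷ [])
  p31-q11 : MersennePair 3 1 1 1 ((7 , 10 , 1 , 2) ∷ [])
  p13-q31 : MersennePair 1 3 3 1 ((8 , 8 , 1 , 1) ∷ (8 , 9 , 1 , 2) ∷ (9 , 8 , 2 , 1) ∷ (9 , 9 , 2 , 2) ∷ [])
  p31-q13 : MersennePair 3 1 1 3 ((8 , 8 , 1 , 1) ∷ (9 , 8 , 1 , 2) ∷ (8 , 9 , 2 , 1) ∷ (9 , 9 , 2 , 2) ∷ [])
  p12-q21 : MersennePair 1 2 2 1 ((7 , 13 , 2 , 2) ∷ (13 , 7 , 2 , 2) ∷ (14 , 14 , 2 , 2) ∷ [])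
  p21-q12 : MersennePair 2 1 1 2 ((7 , 13 , 2 , 2) ∷ (13 , 7 , 2 , 2) ∷ (14 , 14 , 2 , 2) ∷ [])

mersennePair-check : ∀ {i j u v sols} → MersennePair i j u v sols → T (Solutions.check i j u v sols)
mersennePair-check p11-q13 = _
mersennePair-check p11-q31 = _
mersennePair-check p13-q11 = _
mersennePair-check p31-q11 = _
mersennePair-check p13-q31 = _
mersennePair-check p31-q13 = _
mersennePair-check p12-q21 = _
mersennePair-check p21-q12 = _

mersennePair-degrees : ∀ {i j u v sols} → MersennePair i j u v sols → i + j + (u + v) ≤ 8
mersennePair-degrees p11-q13 = ℕ.≤ᵇ⇒≤ _ _ _
mersennePair-degrees p11-q31 = ℕ.≤ᵇ⇒≤ _ _ _
mersennePair-degrees p13-q11 = ℕ.≤ᵇ⇒≤ _ _ _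
mersennePair-degrees p31-q11 = ℕ.≤ᵇ⇒≤ _ _ _
mersennePair-degrees p13-q31 = ℕ.≤ᵇ⇒≤ _ _ _
mersennePair-degrees p31-q13 = ℕ.≤ᵇ⇒≤ _ _ _
mersennePair-degrees p12-q21 = ℕ.≤ᵇ⇒≤ _ _ _
mersennePair-degrees p21-q12 = ℕ.≤ᵇ⇒≤ _ _ _

mersennePair-solutions : ∀ {i j u v sols a α₁ αP αQ b β₁ βP βQ h k} → MersennePair i j u v sols →
  Profile (i + j) (u + v) (λ c d → T (ok i j u v c d)) a α₁ αP αQ → Profile (i + j) (u + v) (λ c d → T (ok j i v u c d)) b β₁ βP βQ →
  Trivial h → Trivial k → 0 < h → 0 < k → h ≡ αP + βP → k ≡ αQ + βQ →
  a ≡ β₁ + (i * h + u * k) → b ≡ α₁ + (j * h + v * k) → (a , b , h , k) ∈ sols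
mersennePair-solutions {i} {j} {u} {v} {sols} pair profx profy th tk h>0 k>0 refl refl a≡ b≡ =
  let αP≤ , βP≤ , h≤ = bounds (trivialSum (profile-P profx) (profile-P profy) th)
      αQ≤ , βQ≤ , k≤ = bounds (trivialSum (profile-Q profx) (profile-Q profy) tk)
  in Solutions.solutions i j u v sols (mersennePair-check pair) (mersennePair-degrees pair) profx profy αP≤ αQ≤ βP≤ βQ≤ h>0 k>0 h≤ k≤ a≡ b≡
  where
  bounds : ∀ {m n} → TrivialSum m n → m ≤ 2 × n ≤ 2 × m + n ≤ 3
  bounds ts00 = ℕ.≤ᵇ⇒≤ 0 2 _ , ℕ.≤ᵇ⇒≤ 0 2 _ , ℕ.≤ᵇ⇒≤ 0 3 _
  bounds ts01 = ℕ.≤ᵇ⇒≤ 0 2 _ , ℕ.≤ᵇ⇒≤ 1 2 _ , ℕ.≤ᵇ⇒≤ 1 3 _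
  bounds ts10 = ℕ.≤ᵇ⇒≤ 1 2 _ , ℕ.≤ᵇ⇒≤ 0 2 _ , ℕ.≤ᵇ⇒≤ 1 3 _
  bounds ts02 = ℕ.≤ᵇ⇒≤ 0 2 _ , ℕ.≤ᵇ⇒≤ 2 2 _ , ℕ.≤ᵇ⇒≤ 2 3 _
  bounds ts11 = ℕ.≤ᵇ⇒≤ 1 2 _ , ℕ.≤ᵇ⇒≤ 1 2 _ , ℕ.≤ᵇ⇒≤ 2 3 _
  bounds ts20 = ℕ.≤ᵇ⇒≤ 2 2 _ , ℕ.≤ᵇ⇒≤ 0 2 _ , ℕ.≤ᵇ⇒≤ 2 3 _
  bounds ts12 = ℕ.≤ᵇ⇒≤ 1 2 _ , ℕ.≤ᵇ⇒≤ 2 2 _ , ℕ.≤ᵇ⇒≤ 3 3 _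
  bounds ts21 = ℕ.≤ᵇ⇒≤ 2 2 _ , ℕ.≤ᵇ⇒≤ 1 2 _ , ℕ.≤ᵇ⇒≤ 3 3 _

-- The factorisations of σ** x a, σ** P h and σ** Q k

module Profiles (S : Setting) where
  open Setting S
  open Sources S

  Ok : ℕ → ℕ → Set
  Ok c d = ∃[ k ] Source k c d

  -- R would divide 1 + x^n for two consecutive values of n, hence their sum, which is y times a
  -- power of x. So the two sums in an even profile share neither P nor Q.
  adjacent-coprime : ∀ {R} → Irreducible R → ¬ R ∣ x → ¬ R ∣ y → ∀ r m n → Adjacent (2 ^ suc r * m) n →
                     R ∣ geo x m → ¬ R ∣ geo x n
  adjacent-coprime {R} irr R∤x R∤y r m n adj R∣m R∣n = go adj
    where
    E = 2 ^ suc r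
    e = proj₁ (2^≡suc (suc r))
    R∣xⁿ : R ∣ 𝟙 +ₚ x ^ₚ n
    R∣xⁿ = subst (R ∣_) (geo-closed x n) (∣-*ˡ (𝟙 +ₚ x) R∣n)
    R∣xᴱᵐ : R ∣ 𝟙 +ₚ x ^ₚ (E * m)
    R∣xᴱᵐ = subst (R ∣_) (trans (sym (geo-2^ x (suc r) m)) (geo-closed x (E * m)))
      (subst (λ n → R ∣ ((𝟙 +ₚ x) *ₚ geo x m) ^ₚ n) (sym (proj₂ (2^≡suc (suc r)))) (∣-*ʳ (((𝟙 +ₚ x) *ₚ geo x m) ^ₚ e) (∣-*ˡ (𝟙 +ₚ x) R∣m)))
    consecutive : ∀ n → R ∣ 𝟙 +ₚ x ^ₚ n → ¬ R ∣ 𝟙 +ₚ x ^ₚ suc n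
    consecutive n R∣ R∣′ = ∤-*ₚ irr R∤y (R∤x ∘ ∣-^ₚ⇒∣ x n irr) (subst (R ∣_) (begin
      𝟙 +ₚ x ^ₚ n +ₚ (𝟙 +ₚ x *ₚ x ^ₚ n)     ≡⟨ solve 2 (λ x s → con true :+ s :+ (con true :+ x :* s) := (con true :+ x) :* s) refl x (x ^ₚ n) ⟩
      (𝟙 +ₚ x) *ₚ x ^ₚ n                    ≡⟨ cong (_*ₚ x ^ₚ n) 1+x≡y ⟩
      y *ₚ x ^ₚ n                           ∎) (∣-+ₚ R∣ R∣′))
    go : Adjacent (E * m) n → ⊥
    go (inj₁ eq) = consecutive n R∣xⁿ (subst (λ k → R ∣ 𝟙 +ₚ x ^ₚ k) eq R∣xᴱᵐ)
    go (inj₂ eq) = consecutive (E * m) R∣xᴱᵐ (subst (λ k → R ∣ 𝟙 +ₚ x ^ₚ k) eq R∣xⁿ)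

  record σ**x-Profile (a : ℕ) : Set where
    constructor σ**x-profile
    field
      {α₁ αP αQ} : ℕ
      profile    : Profile (deg P) (deg Q) Ok a α₁ αP αQ
      σ**≡       : σ** x a ≡ M 0 α₁ αP αQ

  P∣geo : ∀ {k d} → Source k 1 d → P ∣ geo x (suc (2 * k))
  P∣geo {d = d} src = subst₂ _∣_ (^ₚ-1 P) (sym (Source.geo≡ src)) (P^∣M 0 0 1 0 d)

  Q∣geo : ∀ {k c} → Source k c 1 → Q ∣ geo x (suc (2 * k))
  Q∣geo {c = c} src = subst₂ _∣_ (^ₚ-1 Q) (sym (Source.geo≡ src)) (Q^∣M 0 0 c 1 0)

  distinct : ¬ P ∣ x × ¬ P ∣ y × ¬ Q ∣ x × ¬ Q ∣ y × P ≢ Q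
  distinct with primes
  ... | prime ix (_ ∷ x≢P ∷ x≢Q ∷ []) (prime iy (y≢P ∷ y≢Q ∷ []) (prime iP (P≢Q ∷ []) (prime iQ [] []))) =
    (x≢P ∘ sym ∘ irreducible-∣⇒≡ iP ix) , (y≢P ∘ sym ∘ irreducible-∣⇒≡ iP iy)
    , (x≢Q ∘ sym ∘ irreducible-∣⇒≡ iQ ix) , (y≢Q ∘ sym ∘ irreducible-∣⇒≡ iQ iy) , P≢Q

  disjoint-P : ∀ {c d c′ d′ k l} r → Source k c d → Source l c′ d′ → Adjacent (2 ^ suc r * suc (2 * k)) (suc (2 * l)) → c * c′ ≡ 0
  disjoint-P r src@(source 0# _ _ _) src′ adj = refl
  disjoint-P r src@(source 1# _ _ _) src′@(source 0# _ _ _) adj = refl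
  disjoint-P {k = k} {l} r src@(source 1# _ _ _) src′@(source 1# _ _ _) adj = ⊥-elim
    (adjacent-coprime irr-P (proj₁ distinct) (proj₁ (proj₂ distinct)) r (suc (2 * k)) (suc (2 * l)) adj (P∣geo src) (P∣geo src′))

  disjoint-Q : ∀ {c d c′ d′ k l} r → Source k c d → Source l c′ d′ → Adjacent (2 ^ suc r * suc (2 * k)) (suc (2 * l)) → d * d′ ≡ 0
  disjoint-Q r src@(source _ 0# _ _) src′ adj = refl
  disjoint-Q r src@(source _ 1# _ _) src′@(source _ 0# _ _) adj = refl
  disjoint-Q {k = k} {l} r src@(source _ 1# _ _) src′@(source _ 1# _ _) adj = ⊥-elim
    (adjacent-coprime irr-Q (proj₁ (proj₂ (proj₂ distinct))) (proj₁ (proj₂ (proj₂ (proj₂ distinct)))) r (suc (2 * k)) (suc (2 * l)) adj (Q∣geo src) (Q∣geo src′))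

  ∣power : ∀ (g : Poly) r → g ∣ g ^ₚ (2 ^ suc r)
  ∣power g r = subst (λ n → g ∣ g ^ₚ n) (sym (proj₂ (2^≡suc (suc r)))) (p∣p*q g (g ^ₚ proj₁ (2^≡suc (suc r))))

  profile-x : ∀ a A B H K → 0 < a → σ** x a ∣ M A B H K → σ**x-Profile a
  profile-x a A B H K a>0 σ∣ = go (shape a a>0)
    where
    go : Shape a → σ**x-Profile a
    go (odd r k eq formula) = finish (∣M⇒source k {A} {B} {H} {K} (∣-trans (subst (g ∣_) (sym σ≡) (∣-*ˡ ((𝟙 +ₚ x) ^ₚ e) (∣power g r))) σ∣))
      where
      g = geo x (suc (2 * k))
      e = proj₁ (2^≡suc (suc r))
      σ≡ = formula x e 1+x≢𝟘 (proj₂ (2^≡suc (suc r)))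
      finish : ∃[ c ] ∃[ d ] Source k c d → σ**x-Profile a
      finish (c , d , src@(source bc bd geo≡ 2k≡)) = σ**x-profile
        (odd r bc bd (k , src) (trans eq (cong (λ n → 2 ^ suc r * suc n) 2k≡)) (proj₂ (2^≡suc (suc r)))) (begin
          σ** x a                                                ≡⟨ σ≡ ⟩
          (𝟙 +ₚ x) ^ₚ e *ₚ g ^ₚ (2 ^ suc r)                      ≡⟨ cong₂ (λ s t → s ^ₚ e *ₚ t ^ₚ (2 ^ suc r)) 1+x≡y geo≡ ⟩
          y ^ₚ e *ₚ M 0 0 c d ^ₚ (2 ^ suc r)                     ≡⟨ cong (y ^ₚ e *ₚ_) (M-^ 0 0 c d (2 ^ suc r)) ⟩
          M 0 e (c * 2 ^ suc r) (d * 2 ^ suc r)                  ∎)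
    go (even r k l eq adj formula) = finish
        (∣M⇒source k {A} {B} {H} {K} (∣-trans (subst (g ∣_) (sym σ≡) (∣-*ˡ ((𝟙 +ₚ x) ^ₚ E) (∣-*ʳ g′ (∣power g r)))) σ∣))
        (∣M⇒source l {A} {B} {H} {K} (∣-trans (subst (g′ ∣_) (sym σ≡) (∣-*ˡ ((𝟙 +ₚ x) ^ₚ E) (∣-*ˡ (g ^ₚ E) (∣-refl g′)))) σ∣))
      where
      E = 2 ^ suc r
      g = geo x (suc (2 * k))
      g′ = geo x (suc (2 * l))
      σ≡ = formula x 1+x≢𝟘
      finish : ∃[ c ] ∃[ d ] Source k c d → ∃[ c′ ] ∃[ d′ ] Source l c′ d′ → σ**x-Profile a
      finish (c , d , src@(source bc bd geo≡ 2k≡)) (c′ , d′ , src′@(source bc′ bd′ geo≡′ 2l≡)) = σ**x-profile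
        (even r bc bd bc′ bd′ (k , src) (l , src′) (trans eq (cong₂ (λ m n → E * suc m + suc n) 2k≡ 2l≡))
          (subst₂ (λ m n → Adjacent (E * suc m) (suc n)) 2k≡ 2l≡ adj) (disjoint-P r src src′ adj) (disjoint-Q r src src′ adj)) (begin
          σ** x a                                                ≡⟨ σ≡ ⟩
          (𝟙 +ₚ x) ^ₚ E *ₚ (g ^ₚ E *ₚ g′)                        ≡⟨ cong₂ (λ s t → s ^ₚ E *ₚ t) 1+x≡y (cong₂ (λ s t → s ^ₚ E *ₚ t) geo≡ geo≡′) ⟩
          y ^ₚ E *ₚ (M 0 0 c d ^ₚ E *ₚ M 0 0 c′ d′)              ≡⟨ cong (λ t → y ^ₚ E *ₚ (t *ₚ M 0 0 c′ d′)) (M-^ 0 0 c d E) ⟩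
          y ^ₚ E *ₚ (M 0 0 (c * E) (d * E) *ₚ M 0 0 c′ d′)       ≡⟨ cong (y ^ₚ E *ₚ_) (M-* 0 0 (c * E) (d * E) 0 0 c′ d′) ⟩
          M 0 E (c * E + c′) (d * E + d′)                        ∎)

  1+P≢𝟘 : 𝟙 +ₚ P ≢ 𝟘
  1+P≢𝟘 = 1+-nonzero (proj₁ (proj₂ irr-P))

  1+Q≢𝟘 : 𝟙 +ₚ Q ≢ 𝟘
  1+Q≢𝟘 = 1+-nonzero (proj₁ (proj₂ irr-Q))

  1+P^ : ∀ n → (𝟙 +ₚ P) ^ₚ n ≡ M (i * n) (j * n) 0 0
  1+P^ n = trans (cong (_^ₚ n) 1+P) (M-^ i j 0 0 n)

  1+Q^ : ∀ n → (𝟙 +ₚ Q) ^ₚ n ≡ M (u * n) (v * n) (w * n) 0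
  1+Q^ n = trans (cong (_^ₚ n) 1+Q) (M-^ u v w 0 n)

  σ**-odd-trivial : ∀ R a r → suc a ≡ 2 ^ suc r * 1 → 𝟙 +ₚ R ≢ 𝟘 →
    (∀ p e → 𝟙 +ₚ p ≢ 𝟘 → 2 ^ suc r ≡ suc e → σ** p a ≡ (𝟙 +ₚ p) ^ₚ e *ₚ geo p 1 ^ₚ (2 ^ suc r)) →
    Trivial a × σ** R a ≡ (𝟙 +ₚ R) ^ₚ a
  σ**-odd-trivial R a r eq 1+R≢𝟘 formula = inj₂ (r , trans eq (ℕ.*-identityʳ _)) , (begin
    σ** R a                                     ≡⟨ formula R a 1+R≢𝟘 (trans (sym (ℕ.*-identityʳ _)) (sym eq)) ⟩
    (𝟙 +ₚ R) ^ₚ a *ₚ 𝟙 ^ₚ (2 ^ suc r)           ≡⟨ cong ((𝟙 +ₚ R) ^ₚ a *ₚ_) (𝟙-^ₚ (2 ^ suc r)) ⟩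
    (𝟙 +ₚ R) ^ₚ a *ₚ 𝟙                          ≡⟨ *ₚ-identityʳ _ ⟩
    (𝟙 +ₚ R) ^ₚ a                               ∎)

  σ**-even-trivial : ∀ R a r → suc a ≡ 2 ^ suc r * 1 + 1 → Adjacent (2 ^ suc r * 1) 1 → 𝟙 +ₚ R ≢ 𝟘 →
    (∀ p → 𝟙 +ₚ p ≢ 𝟘 → σ** p a ≡ (𝟙 +ₚ p) ^ₚ (2 ^ suc r) *ₚ (geo p 1 ^ₚ (2 ^ suc r) *ₚ geo p 1)) →
    Trivial a × σ** R a ≡ (𝟙 +ₚ R) ^ₚ a
  σ**-even-trivial R a r eq adj 1+R≢𝟘 formula = let a≡2 , E≡2 = 1+1≡⇒trivial r eq adj in inj₁ a≡2 , (begin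
    σ** R a                                                       ≡⟨ formula R 1+R≢𝟘 ⟩
    (𝟙 +ₚ R) ^ₚ (2 ^ suc r) *ₚ (𝟙 ^ₚ (2 ^ suc r) *ₚ 𝟙)            ≡⟨ cong ((𝟙 +ₚ R) ^ₚ (2 ^ suc r) *ₚ_) (trans (*ₚ-identityʳ _) (𝟙-^ₚ (2 ^ suc r))) ⟩
    (𝟙 +ₚ R) ^ₚ (2 ^ suc r) *ₚ 𝟙                                  ≡⟨ *ₚ-identityʳ _ ⟩
    (𝟙 +ₚ R) ^ₚ (2 ^ suc r)                                       ≡⟨ cong ((𝟙 +ₚ R) ^ₚ_) (trans E≡2 (sym a≡2)) ⟩
    (𝟙 +ₚ R) ^ₚ a                                                 ∎)

  profile-Q′ : ∀ k A B H K → 0 < k → σ** Q k ∣ M A B H K → Trivial k × σ** Q k ≡ M (u * k) (v * k) (w * k) 0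
  profile-Q′ k A B H K k>0 σ∣ = let t , eq = go (shape k k>0) in t , trans eq (1+Q^ k)
    where
    go : Shape k → Trivial k × σ** Q k ≡ (𝟙 +ₚ Q) ^ₚ k
    go (odd r l eq formula) = finish (geo-Q-∣M l {A} {B} {H} {K} (∣-trans (subst (g ∣_) (sym (formula Q e 1+Q≢𝟘 (proj₂ (2^≡suc (suc r))))) (∣-*ˡ ((𝟙 +ₚ Q) ^ₚ e) (∣power g r))) σ∣)) eq formula
      where
      g = geo Q (suc (2 * l))
      e = proj₁ (2^≡suc (suc r))
      finish : ∀ {l} → l ≡ 0 → suc k ≡ 2 ^ suc r * suc (2 * l) →
        (∀ p e → 𝟙 +ₚ p ≢ 𝟘 → 2 ^ suc r ≡ suc e → σ** p k ≡ (𝟙 +ₚ p) ^ₚ e *ₚ geo p (suc (2 * l)) ^ₚ (2 ^ suc r)) → Trivial k × σ** Q k ≡ (𝟙 +ₚ Q) ^ₚ k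
      finish refl eq formula = σ**-odd-trivial Q k r eq 1+Q≢𝟘 formula
    go (even r l l′ eq adj formula) = finish
        (geo-Q-∣M l {A} {B} {H} {K} (∣-trans (subst (g ∣_) (sym σ≡) (∣-*ˡ ((𝟙 +ₚ Q) ^ₚ E) (∣-*ʳ g′ (∣power g r)))) σ∣))
        (geo-Q-∣M l′ {A} {B} {H} {K} (∣-trans (subst (g′ ∣_) (sym σ≡) (∣-*ˡ ((𝟙 +ₚ Q) ^ₚ E) (∣-*ˡ (g ^ₚ E) (∣-refl g′)))) σ∣)) eq adj formula
      where
      E = 2 ^ suc r
      g = geo Q (suc (2 * l))
      g′ = geo Q (suc (2 * l′))
      σ≡ = formula Q 1+Q≢𝟘
      finish : ∀ {l l′} → l ≡ 0 → l′ ≡ 0 → suc k ≡ 2 ^ suc r * suc (2 * l) + suc (2 * l′) → Adjacent (2 ^ suc r * suc (2 * l)) (suc (2 * l′)) →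
        (∀ p → 𝟙 +ₚ p ≢ 𝟘 → σ** p k ≡ (𝟙 +ₚ p) ^ₚ (2 ^ suc r) *ₚ (geo p (suc (2 * l)) ^ₚ (2 ^ suc r) *ₚ geo p (suc (2 * l′)))) → Trivial k × σ** Q k ≡ (𝟙 +ₚ Q) ^ₚ k
      finish refl refl eq adj formula = σ**-even-trivial Q k r eq adj 1+Q≢𝟘 formula

  record GeoPProfile (h : ℕ) : Set where
    constructor geoPProfile
    field
      {κ′ γ₁ γQ} : ℕ
      geo≡Q    : geo P (suc (2 * suc κ′)) ≡ Q
      profileP : ProfileP (suc (2 * suc κ′)) h γ₁ γQ
      σ**≡     : σ** P h ≡ M (i * γ₁) (j * γ₁) 0 γQ

  profile-P′ : ∀ h A B H K → 0 < h → σ** P h ∣ M A B H K → (Trivial h × σ** P h ≡ M (i * h) (j * h) 0 0) ⊎ GeoPProfile h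
  profile-P′ h A B H K h>0 σ∣ = go (shape h h>0)
    where
    Result : Set
    Result = (Trivial h × σ** P h ≡ M (i * h) (j * h) 0 0) ⊎ GeoPProfile h
    positive : ∀ l → geo P (suc (2 * l)) ≡ Q → ∃[ κ′ ] l ≡ suc κ′
    positive zero    eq = contradiction (sym eq) (proj₁ (proj₂ irr-Q))
    positive (suc l) _  = l , refl
    power-Q : ∀ n m → (𝟙 +ₚ P) ^ₚ n *ₚ Q ^ₚ m ≡ M (i * n) (j * n) 0 m
    power-Q n m = begin
      (𝟙 +ₚ P) ^ₚ n *ₚ Q ^ₚ m                    ≡⟨ cong₂ _*ₚ_ (1+P^ n) (sym (M-Q m)) ⟩
      M (i * n) (j * n) 0 0 *ₚ M 0 0 0 m         ≡⟨ M-* (i * n) (j * n) 0 0 0 0 0 m ⟩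
      M (i * n + 0) (j * n + 0) 0 m              ≡⟨ cong₂ (λ a b → M a b 0 m) (ℕ.+-identityʳ (i * n)) (ℕ.+-identityʳ (j * n)) ⟩
      M (i * n) (j * n) 0 m                      ∎
    go : Shape h → Result
    go (odd r l eq formula) = finish (geo-P-∣M l {A} {B} {H} {K} (∣-trans (subst (g ∣_) (sym (formula P e 1+P≢𝟘 (proj₂ (2^≡suc (suc r))))) (∣-*ˡ ((𝟙 +ₚ P) ^ₚ e) (∣power g r))) σ∣)) eq formula
      where
      g = geo P (suc (2 * l))
      e = proj₁ (2^≡suc (suc r))
      finish : ∀ {l} → l ≡ 0 ⊎ geo P (suc (2 * l)) ≡ Q → suc h ≡ 2 ^ suc r * suc (2 * l) →
        (∀ p e → 𝟙 +ₚ p ≢ 𝟘 → 2 ^ suc r ≡ suc e → σ** p h ≡ (𝟙 +ₚ p) ^ₚ e *ₚ geo p (suc (2 * l)) ^ₚ (2 ^ suc r)) → Result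
      finish (inj₁ refl) eq formula = let t , σ≡ = σ**-odd-trivial P h r eq 1+P≢𝟘 formula in inj₁ (t , trans σ≡ (1+P^ h))
      finish {l} (inj₂ geo≡) eq formula with positive l geo≡
      ... | κ′ , refl = inj₂ (geoPProfile {κ′ = κ′} geo≡ (odd r eq (proj₂ (2^≡suc (suc r))))
        (trans (formula P e 1+P≢𝟘 (proj₂ (2^≡suc (suc r)))) (trans (cong (λ t → (𝟙 +ₚ P) ^ₚ e *ₚ t ^ₚ (2 ^ suc r)) geo≡) (power-Q e (2 ^ suc r)))))
    go (even r l l′ eq adj formula) = finish
        (geo-P-∣M l {A} {B} {H} {K} (∣-trans (subst (g ∣_) (sym σ≡) (∣-*ˡ ((𝟙 +ₚ P) ^ₚ E) (∣-*ʳ g′ (∣power g r)))) σ∣))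
        (geo-P-∣M l′ {A} {B} {H} {K} (∣-trans (subst (g′ ∣_) (sym σ≡) (∣-*ˡ ((𝟙 +ₚ P) ^ₚ E) (∣-*ˡ (g ^ₚ E) (∣-refl g′)))) σ∣)) eq adj formula
      where
      E = 2 ^ suc r
      g = geo P (suc (2 * l))
      g′ = geo P (suc (2 * l′))
      σ≡ = formula P 1+P≢𝟘
      -- Q cannot arise at the even length: geo P m = Q fixes m by its degree, so the odd length is
      -- at most m, while 2m > m + 1.
      too-large : ∀ m n → n ≤ 3 + m → ¬ Adjacent (2 ^ suc r * (3 + m)) n
      too-large m n n≤ adj = ℕ.<⇒≱ (ℕ.≤-trans (s≤s (s≤s n≤)) (ℕ.≤-trans (ℕ.m≤m+n (5 + m) (m + 1)) (ℕ.≤-reflexive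
          (solveℕ 1 (λ m → κ 5 ⊕ m ⊕ (m ⊕ κ 1) ⊜ κ 2 ⊗ (κ 3 ⊕ m)) refl m))))
        (ℕ.≤-trans (ℕ.*-monoˡ-≤ (3 + m) (2^suc≥2 r)) (adjacent-≤ adj))
      finish : ∀ {l l′} → l ≡ 0 ⊎ geo P (suc (2 * l)) ≡ Q → l′ ≡ 0 ⊎ geo P (suc (2 * l′)) ≡ Q →
        suc h ≡ 2 ^ suc r * suc (2 * l) + suc (2 * l′) → Adjacent (2 ^ suc r * suc (2 * l)) (suc (2 * l′)) →
        (∀ p → 𝟙 +ₚ p ≢ 𝟘 → σ** p h ≡ (𝟙 +ₚ p) ^ₚ (2 ^ suc r) *ₚ (geo p (suc (2 * l)) ^ₚ (2 ^ suc r) *ₚ geo p (suc (2 * l′)))) → Result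
      finish (inj₁ refl) (inj₁ refl) eq adj formula = let t , σ≡ = σ**-even-trivial P h r eq adj 1+P≢𝟘 formula in inj₁ (t , trans σ≡ (1+P^ h))
      finish {l′ = l′} (inj₁ refl) (inj₂ geo≡) eq adj formula with positive l′ geo≡
      ... | κ′ , refl = inj₂ (geoPProfile {κ′ = κ′} geo≡
        (even r (trans eq (cong (_+ suc (2 * suc κ′)) (ℕ.*-identityʳ E))) (subst (λ n → Adjacent n (suc (2 * suc κ′))) (ℕ.*-identityʳ E) adj))
        (begin
          σ** P h                                                          ≡⟨ formula P 1+P≢𝟘 ⟩
          (𝟙 +ₚ P) ^ₚ E *ₚ (𝟙 ^ₚ E *ₚ geo P (suc (2 * suc κ′)))            ≡⟨ cong₂ (λ s t → (𝟙 +ₚ P) ^ₚ E *ₚ (s *ₚ t)) (𝟙-^ₚ E) (trans geo≡ (sym (^ₚ-1 Q))) ⟩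
          (𝟙 +ₚ P) ^ₚ E *ₚ Q ^ₚ 1                                          ≡⟨ power-Q E 1 ⟩
          M (i * E) (j * E) 0 1                                            ∎))
      finish {l} {l′} (inj₂ geo≡) l′-cases eq adj formula with positive l geo≡
      ... | κ′ , refl = ⊥-elim (too-large (2 * κ′) (suc (2 * l′)) (l′≤ l′-cases) (subst (λ n → Adjacent (E * suc n) (suc (2 * l′))) 2κ≡ adj))
        where
        p-nonZero = >-nonZero (irreducible⇒deg>0 irr-P)
        2κ≡ : 2 * suc κ′ ≡ 2 + 2 * κ′
        2κ≡ = cong suc (ℕ.+-suc κ′ (κ′ + 0))
        l′≤ : ∀ {l′} → l′ ≡ 0 ⊎ geo P (suc (2 * l′)) ≡ Q → suc (2 * l′) ≤ 3 + 2 * κ′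
        l′≤ (inj₁ refl) = s≤s z≤n
        l′≤ {l′} (inj₂ geo≡′) = s≤s (ℕ.≤-reflexive (trans (ℕ.*-cancelʳ-≡ (2 * l′) (2 * suc κ′) (deg P) ⦃ p-nonZero ⦄
          (trans (sym (deg-geo (2 * l′) irr-P)) (trans (cong deg (trans geo≡′ (sym geo≡))) (deg-geo (2 * suc κ′) irr-P)))) 2κ≡))

-- Exclusion of w > 0 when σ** P h is a power of 1 + P

module NoSource (S : Setting) where
  open Setting S
  open Sources S
  open Logarithmic S
  open Profiles S using (Ok)

  w-odd : ∀ {w′} → w ≡ suc w′ → Ok 1 1 → ∃[ l ] w ≡ suc (2 * l)
  w-odd w≡ (_ , src) = source-PQ⇒w-odd src w≡

  w-even : Ok 0 1 → ∃[ n ] w ≡ 2 * n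
  w-even (_ , src) with source-Q src
  ... | sourceQ {r} {c} _ _ w≡ _ _ _ = c * 2 ^ r , trans w≡ (solveℕ 2 (λ c s → c ⊗ (κ 2 ⊗ s) ⊜ κ 2 ⊗ (c ⊗ s)) refl c (2 ^ r))

  -- The factorisation is geo x 7 = (1 + x y²) (1 + x² y), the two cubic factors of x^7 + 1. This is
  -- the case that `no-source-w-2^` leaves open.
  geo-7-reducible : geo x 7 ≢ Q
  geo-7-reducible geo≡ = [ f≢𝟙 , f≢Q ]′ (proj₂ (proj₂ irr-Q) f (g , f*g≡Q))
    where
    f g : Poly
    f = 𝟙 +ₚ x *ₚ (y *ₚ y)
    g = 𝟙 +ₚ x *ₚ (x *ₚ y)
    f*g≡Q : f *ₚ g ≡ Q
    f*g≡Q = trans (trans (cong (λ y → (𝟙 +ₚ x *ₚ (y *ₚ y)) *ₚ (𝟙 +ₚ x *ₚ (x *ₚ y))) (sym 1+x≡y))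
      (solve 1 (λ x → (con true :+ x :* ((con true :+ x) :* (con true :+ x))) :* (con true :+ x :* (x :* (con true :+ x)))
        := x :^ 6 :+ (x :^ 5 :+ (x :^ 4 :+ (x :^ 3 :+ (x :^ 2 :+ (x :+ con true)))))) refl x)) (trans geo-7 geo≡)
      where
      geo-7 : _ ≡ geo x 7
      geo-7 = solve 1 (λ x → x :^ 6 :+ (x :^ 5 :+ (x :^ 4 :+ (x :^ 3 :+ (x :^ 2 :+ (x :+ con true))))) :=
        x :* (x :* (x :* (x :* (x :* (x :* con true))))) :+ (x :* (x :* (x :* (x :* (x :* con true)))) :+ (x :* (x :* (x :* (x :* con true))) :+
        (x :* (x :* (x :* con true)) :+ (x :* (x :* con true) :+ (x :* con true :+ (con true :+ con false))))))) refl x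
    cancel-1 : ∀ {s} → 𝟙 +ₚ s ≡ 𝟙 → s ≡ 𝟘
    cancel-1 {s} eq = trans (solve 1 (λ s → s := con true :+ (con true :+ s)) refl s) (cong (𝟙 +ₚ_) eq)
    f≢𝟙 : f ≢ 𝟙
    f≢𝟙 eq = *ₚ-nonzero (proj₁ irr-x) (*ₚ-nonzero (proj₁ irr-y) (proj₁ irr-y)) (cancel-1 eq)
    f≢Q : f ≢ Q
    f≢Q eq = *ₚ-nonzero (proj₁ irr-x) (*ₚ-nonzero (proj₁ irr-x) (proj₁ irr-y)) (cancel-1 (*ₚ-cancelˡ Q g 𝟙 (proj₁ irr-Q)
      (trans (cong (_*ₚ g) (sym eq)) (trans f*g≡Q (sym (*ₚ-identityʳ Q))))))

module Refute (S : Setting) where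
  open Setting S
  open Sources S
  module X = NoSource S
  module Y = NoSource (swap S)
  module Sy = Sources (swap S)
  open Profiles S using () renaming (Ok to Okx)
  open Profiles (swap S) using () renaming (Ok to Oky)

  -- Q occurs in σ** x a through geo x m = P Q, which makes w odd, or through geo x m = Q, which
  -- makes w even. The parity of w then rules out the other form for x and for y, and the two
  -- arithmetic lemmas apply.
  refute : ∀ {a α₁ αP αQ b β₁ βP βQ h k w′} → w ≡ suc w′ →
    Profile (deg P) (deg Q) Okx a α₁ αP αQ → Profile (deg P) (deg Q) Oky b β₁ βP βQ → αQ ≢ 0 → Trivial h → Trivial k →
    a ≡ β₁ + (i * h + u * k) → b ≡ α₁ + (j * h + v * k) → h ≡ αP + (βP + w * k) → k ≡ αQ + βQ → ⊥
  refute {a} {α₁} {αP} {αQ} {b} {β₁} {βP} {βQ} {h} {k} {w′} w≡ profx profy αQ≢0 th tk a≡ b≡ h≡ k≡ = by-source (has-Q profx αQ≢0)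
    where
    odd-and-even : ∃[ l ] w ≡ suc (2 * l) → ∃[ n ] w ≡ 2 * n → ⊥
    odd-and-even (l , w≡odd) (n , w≡even) = ℕ.even≢odd n l (trans (sym w≡even) w≡odd)
    w-odd-case : ∃[ l ] w ≡ suc (2 * l) → ⊥
    w-odd-case (l , w-odd) = no-source-w-odd {i = i} {j} {u} {v} {l} (irreducible⇒deg>0 irr-P) i>0 u>0 v>0
      (trans degQ≡ (cong (λ w → u + (v + w * deg P)) w-odd))
      (λ ok → odd-and-even (l , w-odd) (X.w-even ok)) (λ ok → odd-and-even (l , w-odd) (Y.w-even ok))
      profx profy αQ≢0 th tk a≡ b≡ (trans h≡ (cong (λ w → αP + (βP + w * k)) w-odd)) k≡
    w-2^-case : SourceQ → ⊥
    w-2^-case (sourceQ {C} {c} u≡1 1+v≡ w≡c src degQ≡* geo≡Q) = with-bit (Source.bit-c src) refl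
      where
      with-bit : ∀ {c′} → Bit c′ → c ≡ c′ → ⊥
      with-bit 0# c≡0 = case trans (sym w≡) (trans w≡c (cong (_* 2 ^ suc C) c≡0)) of λ ()
      with-bit 1# c≡1 = with-P (source-P (subst (λ c → Source _ c 0) c≡1 src))
        where
        w≡2^ : w ≡ 2 ^ suc C
        w≡2^ = trans w≡c (trans (cong (_* 2 ^ suc C) c≡1) (ℕ.+-identityʳ _))
        w-even : ∃[ n ] w ≡ 2 * n
        w-even = 2 ^ C , w≡2^
        with-P : SourceP → ⊥
        with-P (sourceP {D} i≡1 1+j≡ degP≡2^ _) = no-source-w-2^ C D degP≡2^ w≡2^ q≡ ¬00 (λ ok → odd-and-even (X.w-odd w≡ ok) w-even)
          profx αQ≢0 (profile-P profy) th tk h≡ (trans k≡ (trans (cong (αQ +_) (no-Q no-Q-y profy)) (ℕ.+-identityʳ αQ)))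
          where
          q≡ : deg Q ≡ w * suc (deg P)
          q≡ = trans degQ≡* (cong₂ (λ E n → E * suc n) (sym w≡2^) (trans (cong (_* deg P) c≡1) (ℕ.+-identityʳ (deg P))))
          ¬00 : ¬ (C ≡ 0 × D ≡ 0)
          ¬00 (C≡0 , D≡0) = X.geo-7-reducible (trans (cong (λ n → geo x (suc n)) (sym q≡6)) geo≡Q)
            where
            q≡6 : deg Q ≡ 6
            q≡6 = trans q≡ (cong₂ (λ w p → w * suc p) (trans w≡2^ (cong (λ C → 2 ^ suc C) C≡0)) (trans degP≡2^ (cong (λ D → 2 ^ suc D) D≡0)))
          power≡2 : ∀ n → 2 ^ suc n ≡ 2 → n ≡ 0
          power≡2 n eq = 2^≡1⇒≡0 n (ℕ.*-cancelˡ-≡ (2 ^ n) 1 2 eq)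
          -- If Q were an odd sum in y too, u + 1 would be a power of two E with w = E; since u = 1,
          -- w = 2 and C = 0. Then P would also be a sum in y, so that j = 1 and D = 0, the excluded
          -- case.
          no-Q-y : ∀ c → ¬ Oky c 1
          no-Q-y c (l , src) = go (Sy.Source.bit-c src) src
            where
            go : ∀ {c} → Bit c → Sy.Source l c 1 → ⊥
            go 1# src = odd-and-even (Y.w-odd w≡ (l , src)) w-even
            go 0# src = go′ (Sy.source-Q src)
              where
              go′ : Sy.SourceQ → ⊥
              go′ (Sy.sourceQ {C′} {c′} _ 1+u≡ w≡c′ src′ _ _) = bit′ (Sy.Source.bit-c src′) refl
                where
                bit′ : ∀ {c″} → Bit c″ → c′ ≡ c″ → ⊥
                bit′ 0# c′≡0 = case trans (sym w≡) (trans w≡c′ (cong (_* 2 ^ suc C′) c′≡0)) of λ ()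
                bit′ 1# c′≡1 = ¬00 (C≡0 , power≡2 D (trans (sym 1+j≡) (cong suc (Sy.SourceP.i≡1 (Sy.source-P (subst (λ c → Sy.Source _ c 0) c′≡1 src′))))))
                  where
                  C′≡0 : C′ ≡ 0
                  C′≡0 = power≡2 C′ (trans (sym 1+u≡) (cong suc u≡1))
                  C≡0 : C ≡ 0
                  C≡0 = power≡2 C (trans (sym w≡2^) (trans w≡c′ (trans (cong₂ (λ c C → c * 2 ^ suc C) c′≡1 C′≡0) refl)))
    by-source : ∃[ c ] Bit c × Okx c 1 → ⊥
    by-source (_ , 1# , ok)        = w-odd-case (X.w-odd w≡ ok)
    by-source (_ , 0# , (_ , src)) = w-2^-case (source-Q src)

-- The possible P and Q for w = 0

MersenneExponents : ℕ → ℕ → Set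
MersenneExponents i j = (i ≡ 1 × j ≡ 1) ⊎ (i ≡ 1 × j ≡ 3) ⊎ (i ≡ 3 × j ≡ 1)

mersennePair : ∀ {i j u v} → MersenneExponents i j → MersenneExponents u v → ¬ (i ≡ u × j ≡ v) → ∃[ sols ] MersennePair i j u v sols
mersennePair (inj₁ (refl , refl))        (inj₁ (refl , refl))        ≢ = ⊥-elim (≢ (refl , refl))
mersennePair (inj₁ (refl , refl))        (inj₂ (inj₁ (refl , refl))) _ = _ , p11-q13
mersennePair (inj₁ (refl , refl))        (inj₂ (inj₂ (refl , refl))) _ = _ , p11-q31
mersennePair (inj₂ (inj₁ (refl , refl))) (inj₁ (refl , refl))        _ = _ , p13-q11
mersennePair (inj₂ (inj₁ (refl , refl))) (inj₂ (inj₁ (refl , refl))) ≢ = ⊥-elim (≢ (refl , refl))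
mersennePair (inj₂ (inj₁ (refl , refl))) (inj₂ (inj₂ (refl , refl))) _ = _ , p13-q31
mersennePair (inj₂ (inj₂ (refl , refl))) (inj₁ (refl , refl))        _ = _ , p31-q11
mersennePair (inj₂ (inj₂ (refl , refl))) (inj₂ (inj₁ (refl , refl))) _ = _ , p31-q13
mersennePair (inj₂ (inj₂ (refl , refl))) (inj₂ (inj₂ (refl , refl))) ≢ = ⊥-elim (≢ (refl , refl))

module MersenneSources (S : Setting) (w≡0 : Setting.w S ≡ 0) where
  open Setting S
  open Sources S
  open Profiles S using (Ok; distinct)

  -- For 2^(r+1) ≥ 8 the trace argument makes geo x (2^(r+1) + 1) reducible, so only 2 and 4 remain.
  small-exponent : ∀ {R n} r → Irreducible R → ¬ R ∣ x → deg R ≡ 2 ^ suc r → geo x (suc (deg R)) ≡ R → suc n ≡ 2 ^ suc r → n ≡ 1 ⊎ n ≡ 3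
  small-exponent 0 _ _ _ _ eq = inj₁ (ℕ.suc-injective eq)
  small-exponent 1 _ _ _ _ eq = inj₂ (ℕ.suc-injective eq)
  small-exponent (suc (suc r)) irr R∤x degR geo≡ _ =
    ⊥-elim (Trace.geo-2^+1-reducible S r irr R∤x (trans (cong (λ n → geo x (suc n)) (sym degR)) geo≡))

  exponents-P : Ok 1 0 → i ≡ 1 × (j ≡ 1 ⊎ j ≡ 3)
  exponents-P (_ , src) with source-P src
  ... | sourceP {r} i≡1 1+j≡ degP geo≡ = i≡1 , small-exponent r irr-P (proj₁ distinct) degP geo≡ 1+j≡

  exponents-Q : Ok 0 1 → u ≡ 1 × (v ≡ 1 ⊎ v ≡ 3)
  exponents-Q (_ , src) with source-Q src
  ... | sourceQ {r} {c} u≡1 1+v≡ w≡ _ degQ geo≡ = u≡1 , small-exponent r irr-Q (proj₁ (proj₂ (proj₂ distinct))) degQ′ geo≡ 1+v≡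
    where
    c≡0 : c ≡ 0
    c≡0 = [ id , (λ E≡0 → contradiction E≡0 (2^≢0 (suc r))) ]′ (ℕ.m*n≡0⇒m≡0∨n≡0 c (trans (sym w≡) w≡0))
    degQ′ : deg Q ≡ 2 ^ suc r
    degQ′ = trans degQ (trans (cong (λ c → 2 ^ suc r * suc (c * deg P)) c≡0) (ℕ.*-identityʳ _))

  exponents-PQ : Ok 1 1 → (i ≡ 1 × j ≡ 2 × u ≡ 2 × v ≡ 1) ⊎ (i ≡ 2 × j ≡ 1 × u ≡ 1 × v ≡ 2)
  exponents-PQ (_ , src) = Logarithmic.Mersenne.mersenne S src w≡0

  Ok⇒ok : ∀ {c d} → Bit c → Bit d → Ok c d → T (ok i j u v c d)
  Ok⇒ok 0# 0# _ = _
  Ok⇒ok 1# 0# o = go (exponents-P o)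
    where
    go : i ≡ 1 × (j ≡ 1 ⊎ j ≡ 3) → T (ok i j u v 1 0)
    go (i≡ , inj₁ j≡) = subst₂ (λ i j → T (ok i j u v 1 0)) (sym i≡) (sym j≡) _
    go (i≡ , inj₂ j≡) = subst₂ (λ i j → T (ok i j u v 1 0)) (sym i≡) (sym j≡) _
  Ok⇒ok 0# 1# o = go (exponents-Q o)
    where
    go : u ≡ 1 × (v ≡ 1 ⊎ v ≡ 3) → T (ok i j u v 0 1)
    go (u≡ , inj₁ v≡) = subst₂ (λ u v → T (ok i j u v 0 1)) (sym u≡) (sym v≡) _
    go (u≡ , inj₂ v≡) = subst₂ (λ u v → T (ok i j u v 0 1)) (sym u≡) (sym v≡) _
  Ok⇒ok 1# 1# o = go (exponents-PQ o)
    where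
    go : (i ≡ 1 × j ≡ 2 × u ≡ 2 × v ≡ 1) ⊎ (i ≡ 2 × j ≡ 1 × u ≡ 1 × v ≡ 2) → T (ok i j u v 1 1)
    go (inj₁ (i≡ , j≡ , _)) = subst₂ (λ i j → T (ok i j u v 1 1)) (sym i≡) (sym j≡) _
    go (inj₂ (i≡ , j≡ , _)) = subst₂ (λ i j → T (ok i j u v 1 1)) (sym i≡) (sym j≡) _

-- Comparing multiplicities in σ** A = A

module Classify (S : Setting) (a b h k : ℕ) (a>0 : 0 < a) (b>0 : 0 < b) (h>0 : 0 < h) (k>0 : 0 < k)
                (perfect : σ** (Setting.x S) a *ₚ (σ** (Setting.y S) b *ₚ (σ** (Setting.P S) h *ₚ (σ** (Setting.Q S) k *ₚ 𝟙))) ≡ Setting.M S a b h k) where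
  open Setting S
  open Sources S
  module Sy = Sources (swap S)
  module Px = Profiles S
  module Py = Profiles (swap S)

  M-swap : ∀ a b c d → Setting.M (swap S) b a c d ≡ M a b c d
  M-swap a b c d = mono-swap x y (P ∷ Q ∷ []) a b (c ∷ d ∷ [])

  σx∣ : σ** x a ∣ M a b h k
  σx∣ = divides _ perfect

  σy∣ : σ** y b ∣ M a b h k
  σy∣ = subst (σ** y b ∣_) perfect (∣-*ˡ (σ** x a) (p∣p*q (σ** y b) (σ** P h *ₚ (σ** Q k *ₚ 𝟙))))

  σP∣ : σ** P h ∣ M a b h k
  σP∣ = subst (σ** P h ∣_) perfect (∣-*ˡ (σ** x a) (∣-*ˡ (σ** y b) (p∣p*q (σ** P h) (σ** Q k *ₚ 𝟙))))

  σQ∣ : σ** Q k ∣ M a b h k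
  σQ∣ = subst (σ** Q k ∣_) perfect (∣-*ˡ (σ** x a) (∣-*ˡ (σ** y b) (∣-*ˡ (σ** P h) (p∣p*q (σ** Q k) 𝟙))))

  Result : Set
  Result = (∃[ sols ] MersennePair i j u v sols × w ≡ 0 × (a , b , h , k) ∈ sols)
         ⊎ (i ≡ 1 × j ≡ 1 × u ≡ 1 × v ≡ 1 × w ≡ 1 × (a , b , h , k) ∈ geoP-solutions)

  trivial-Q : Trivial k × σ** Q k ≡ M (u * k) (v * k) (w * k) 0
  trivial-Q = Px.profile-Q′ k a b h k k>0 σQ∣

  tk : Trivial k
  tk = proj₁ trivial-Q

  module WithProfiles (α : Px.σ**x-Profile a) (β : Py.σ**x-Profile b) where
    open Px.σ**x-Profile α using (α₁; αP; αQ) renaming (profile to profx; σ**≡ to σx≡)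
    open Py.σ**x-Profile β using () renaming (α₁ to β₁; αP to βP; αQ to βQ; profile to profy; σ**≡ to σy≡)

    valuations : ∀ γ γQ → σ** P h ≡ M (i * γ) (j * γ) 0 γQ →
      a ≡ β₁ + (i * γ + u * k) × b ≡ α₁ + (j * γ + v * k) × h ≡ αP + (βP + w * k) × k ≡ αQ + (βQ + γQ)
    valuations γ γQ σP≡ =
      let a≡ , b≡ , h≡ , k≡ = M-injective {a} {b} {h} {k} {β₁ + (i * γ + u * k)} {α₁ + (j * γ + v * k)} {αP + (βP + w * k)} {αQ + (βQ + (γQ + 0))} (begin
            M a b h k                                                                    ≡⟨ perfect ⟨
            σ** x a *ₚ (σ** y b *ₚ (σ** P h *ₚ (σ** Q k *ₚ 𝟙)))                           ≡⟨ cong₂ (λ s t → s *ₚ (t *ₚ (σ** P h *ₚ (σ** Q k *ₚ 𝟙)))) σx≡ (trans σy≡ (M-swap β₁ 0 βP βQ)) ⟩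
            Mx *ₚ (My *ₚ (σ** P h *ₚ (σ** Q k *ₚ 𝟙)))                                     ≡⟨ cong₂ (λ s t → Mx *ₚ (My *ₚ (s *ₚ t))) σP≡ (trans (*ₚ-identityʳ _) (proj₂ trivial-Q)) ⟩
            Mx *ₚ (My *ₚ (M (i * γ) (j * γ) 0 γQ *ₚ M (u * k) (v * k) (w * k) 0))         ≡⟨ cong (λ t → Mx *ₚ (My *ₚ t)) (M-* (i * γ) (j * γ) 0 γQ (u * k) (v * k) (w * k) 0) ⟩
            Mx *ₚ (My *ₚ M (i * γ + u * k) (j * γ + v * k) (w * k) (γQ + 0))              ≡⟨ cong (Mx *ₚ_) (M-* β₁ 0 βP βQ (i * γ + u * k) (j * γ + v * k) (w * k) (γQ + 0)) ⟩
            Mx *ₚ M (β₁ + (i * γ + u * k)) (j * γ + v * k) (βP + w * k) (βQ + (γQ + 0))   ≡⟨ M-* 0 α₁ αP αQ (β₁ + (i * γ + u * k)) (j * γ + v * k) (βP + w * k) (βQ + (γQ + 0)) ⟩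
            M (β₁ + (i * γ + u * k)) (α₁ + (j * γ + v * k)) (αP + (βP + w * k)) (αQ + (βQ + (γQ + 0))) ∎)
      in a≡ , b≡ , h≡ , trans k≡ (cong (λ n → αQ + (βQ + n)) (ℕ.+-identityʳ γQ))
      where
      Mx = M 0 α₁ αP αQ
      My = M β₁ 0 βP βQ

    module GeoPCase {κ′ γ₁ γQ r e : ℕ} (geo≡Q : geo P (suc (2 * suc κ′)) ≡ Q) (profP : ProfileP (suc (2 * suc κ′)) h γ₁ γQ)
                    (σP≡ : σ** P h ≡ M (i * γ₁) (j * γ₁) 0 γQ) (2^≡ : 2 ^ suc r ≡ suc e) (2k≡ : 2 * suc κ′ ≡ 2 ^ suc r)
                    (u≡ : u ≡ i * e) (v≡ : v ≡ j * e) (w≡1 : w ≡ 1) where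
      no-even : ∀ {r c} → Bit c → 1 ≢ c * 2 ^ suc r
      no-even 0# ()
      no-even {r} 1# eq = ℕ.even≢odd (2 ^ r) 0 (sym (trans eq (ℕ.+-identityʳ _)))

      -- In the case geo x m = Q the exponent w is a multiple of some 2^(r+1), so it is not 1; the
      -- case P Q is `GeoP.no-source-PQ`. Hence Q comes from σ** P h alone, and k = γQ.
      no-x : ∀ c → ¬ Px.Ok c 1
      no-x c (l , src) = go (Source.bit-c src) src
        where
        go : ∀ {c} → Bit c → Source l c 1 → ⊥
        go 1# src = GeoP.no-source-PQ S κ′ geo≡Q src
        go 0# src = let s = source-Q src in no-even {SourceQ.r s} (Source.bit-c (SourceQ.src s)) (trans (sym w≡1) (SourceQ.w≡ s))

      no-y : ∀ c → ¬ Py.Ok c 1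
      no-y c (l , src) = go (Sy.Source.bit-c src) src
        where
        go : ∀ {c} → Bit c → Sy.Source l c 1 → ⊥
        go 1# src = GeoP.no-source-PQ (swap S) κ′ geo≡Q src
        go 0# src = let s = Sy.source-Q src in no-even {Sy.SourceQ.r s} (Sy.Source.bit-c (Sy.SourceQ.src s)) (trans (sym w≡1) (Sy.SourceQ.w≡ s))

      i-one : αP ≢ 0 → i ≡ 1
      i-one αP≢0 = go (has-P profx αP≢0)
        where
        go : ∃[ d ] Bit d × Px.Ok 1 d → i ≡ 1
        go (_ , 0# , (_ , src)) = SourceP.i≡1 (source-P src)
        go (_ , 1# , o)         = ⊥-elim (no-x 1 o)

      j-one : βP ≢ 0 → j ≡ 1
      j-one βP≢0 = go (has-P profy βP≢0)
        where
        go : ∃[ d ] Bit d × Py.Ok 1 d → j ≡ 1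
        go (_ , 0# , (_ , src)) = Sy.SourceP.i≡1 (Sy.source-P src)
        go (_ , 1# , o)         = ⊥-elim (no-y 1 o)

      αQ≡0 : αQ ≡ 0
      αQ≡0 = no-Q no-x profx

      βQ≡0 : βQ ≡ 0
      βQ≡0 = no-Q no-y profy

      profx′ : Profile (deg P) (deg Q) Px.Ok a α₁ αP 0
      profx′ = subst (Profile (deg P) (deg Q) Px.Ok a α₁ αP) αQ≡0 profx

      profy′ : Profile (deg P) (deg Q) Py.Ok b β₁ βP 0
      profy′ = subst (Profile (deg P) (deg Q) Py.Ok b β₁ βP) βQ≡0 profy

      a≡ : a ≡ β₁ + (i * γ₁ + u * k)
      a≡ = proj₁ (valuations γ₁ γQ σP≡)

      b≡ : b ≡ α₁ + (j * γ₁ + v * k)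
      b≡ = proj₁ (proj₂ (valuations γ₁ γQ σP≡))

      h≡ : h ≡ αP + (βP + 1 * k)
      h≡ = trans (proj₁ (proj₂ (proj₂ (valuations γ₁ γQ σP≡)))) (cong (λ w → αP + (βP + w * k)) w≡1)

      k≡ : k ≡ γQ
      k≡ = trans (proj₂ (proj₂ (proj₂ (valuations γ₁ γQ σP≡)))) (cong₂ (λ s t → s + (t + γQ)) αQ≡0 βQ≡0)

      solution : i ≡ 1 × j ≡ 1 × u ≡ 1 × v ≡ 1 × (a , b , h , k) ∈ geoP-solutions
      solution = geoP-exponents {ρ = r} {e = e} {i = i} {j = j} 2^≡ u≡ v≡ degP≡ i-one j-one profx′ profy′
        (subst (λ n → ProfileP (suc n) h γ₁ γQ) 2k≡ profP) tk a≡ b≡ h≡ k≡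

    geoP-case : Px.GeoPProfile h → Result
    geoP-case (Px.geoPProfile {κ′} {γ₁} {γQ} geo≡Q profP σP≡) = go (GeoP.exponents-Q S κ′ geo≡Q)
      where
      go : GeoP.ExponentsQ S κ′ geo≡Q → Result
      go (GeoP.exponentsQ {r} {e} 2^≡ 2k≡ u≡ v≡ w≡1) = finish (GeoPCase.solution {r = r} geo≡Q profP σP≡ 2^≡ 2k≡ u≡ v≡ w≡1)
        where
        finish : i ≡ 1 × j ≡ 1 × u ≡ 1 × v ≡ 1 × (a , b , h , k) ∈ geoP-solutions → Result
        finish (i≡ , j≡ , u≡1 , v≡1 , sol) = inj₂ (i≡ , j≡ , u≡1 , v≡1 , w≡1 , sol)

    module TrivialP (th : Trivial h) (σP≡ : σ** P h ≡ M (i * h) (j * h) 0 0) where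
      a≡ : a ≡ β₁ + (i * h + u * k)
      a≡ = proj₁ (valuations h 0 σP≡)
      b≡ : b ≡ α₁ + (j * h + v * k)
      b≡ = proj₁ (proj₂ (valuations h 0 σP≡))
      h≡ : h ≡ αP + (βP + w * k)
      h≡ = proj₁ (proj₂ (proj₂ (valuations h 0 σP≡)))
      k≡ : k ≡ αQ + βQ
      k≡ = trans (proj₂ (proj₂ (proj₂ (valuations h 0 σP≡)))) (cong (αQ +_) (ℕ.+-identityʳ βQ))

      -- Swapping twice changes proof fields only, so the components of a source carry over
      -- unchanged.
      swap-swap : ∀ {c d} → Px.Ok c d → Profiles.Ok (swap (swap S)) c d
      swap-swap (l , source bc bd geo≡ 2k≡) = l , Sources.source bc bd geo≡ 2k≡

      w-positive : ∀ w′ → w ≡ suc w′ → ⊥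
      w-positive w′ w≡ = go (αQ ℕ.≟ 0)
        where
        go : Dec (αQ ≡ 0) → ⊥
        go (no αQ≢0)  = Refute.refute S w≡ profx profy αQ≢0 th tk a≡ b≡ h≡ k≡
        -- Since k > 0, Q divides σ** y b in this case, and x and y exchange their roles.
        go (yes αQ≡0) = Refute.refute (swap S) w≡ profy (Profile-map (λ _ _ → swap-swap) profx) βQ≢0 th tk b≡ a≡
          (trans h≡ (solveℕ 3 (λ m n t → m ⊕ (n ⊕ t) ⊜ n ⊕ (m ⊕ t)) refl αP βP (w * k))) (trans k≡ (ℕ.+-comm αQ βQ))
          where
          βQ≢0 : βQ ≢ 0
          βQ≢0 βQ≡0 = ℕ.>⇒≢ k>0 (trans k≡ (cong₂ _+_ αQ≡0 βQ≡0))

      module Mersenne (w≡0 : w ≡ 0) where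
        module Mx = MersenneSources S w≡0
        module My = MersenneSources (swap S) w≡0

        h≡′ : h ≡ αP + βP
        h≡′ = trans h≡ (cong (αP +_) (trans (cong (λ w → βP + w * k) w≡0) (ℕ.+-identityʳ βP)))

        degQ≡′ : deg Q ≡ u + v
        degQ≡′ = trans degQ≡ (cong (u +_) (trans (cong (λ w → v + w * deg P) w≡0) (ℕ.+-identityʳ v)))

        Pair : Set
        Pair = ∃[ sols ] MersennePair i j u v sols

        from-PQ : (i ≡ 1 × j ≡ 2 × u ≡ 2 × v ≡ 1) ⊎ (i ≡ 2 × j ≡ 1 × u ≡ 1 × v ≡ 2) → Pair
        from-PQ = go
          where
          go : ∀ {i j u v} → (i ≡ 1 × j ≡ 2 × u ≡ 2 × v ≡ 1) ⊎ (i ≡ 2 × j ≡ 1 × u ≡ 1 × v ≡ 2) → ∃[ sols ] MersennePair i j u v sols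
          go (inj₁ (refl , refl , refl , refl)) = _ , p12-q21
          go (inj₂ (refl , refl , refl , refl)) = _ , p21-q12

        from-QP : (j ≡ 1 × i ≡ 2 × v ≡ 2 × u ≡ 1) ⊎ (j ≡ 2 × i ≡ 1 × v ≡ 1 × u ≡ 2) → Pair
        from-QP (inj₁ (j≡ , i≡ , v≡ , u≡)) = from-PQ (inj₂ (i≡ , j≡ , u≡ , v≡))
        from-QP (inj₂ (j≡ , i≡ , v≡ , u≡)) = from-PQ (inj₁ (i≡ , j≡ , u≡ , v≡))

        from-x : ∀ {i j} → i ≡ 1 × (j ≡ 1 ⊎ j ≡ 3) → MersenneExponents i j
        from-x (i≡ , inj₁ j≡) = inj₁ (i≡ , j≡)
        from-x (i≡ , inj₂ j≡) = inj₂ (inj₁ (i≡ , j≡))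

        from-y : ∀ {i j} → j ≡ 1 × (i ≡ 1 ⊎ i ≡ 3) → MersenneExponents i j
        from-y (j≡ , inj₁ i≡) = inj₁ (i≡ , j≡)
        from-y (j≡ , inj₂ i≡) = inj₂ (inj₂ (i≡ , j≡))

        -- As h > 0 and w = 0, P divides σ** x a or σ** y b. If it enters there together with Q in
        -- one geometric sum, both primes are known at once; otherwise its own exponents are.
        type-P : Pair ⊎ MersenneExponents i j
        type-P = go (αP ℕ.≟ 0)
          where
          x-side : ∃[ d ] Bit d × Px.Ok 1 d → Pair ⊎ MersenneExponents i j
          x-side (_ , 0# , o) = inj₂ (from-x (Mx.exponents-P o))
          x-side (_ , 1# , o) = inj₁ (from-PQ (Mx.exponents-PQ o))
          y-side : ∃[ d ] Bit d × Py.Ok 1 d → Pair ⊎ MersenneExponents i j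
          y-side (_ , 0# , o) = inj₂ (from-y (My.exponents-P o))
          y-side (_ , 1# , o) = inj₁ (from-QP (My.exponents-PQ o))
          go : Dec (αP ≡ 0) → Pair ⊎ MersenneExponents i j
          go (no αP≢0)  = x-side (has-P profx αP≢0)
          go (yes αP≡0) = y-side (has-P profy λ βP≡0 → ℕ.>⇒≢ h>0 (trans h≡′ (cong₂ _+_ αP≡0 βP≡0)))

        type-Q : Pair ⊎ MersenneExponents u v
        type-Q = go (αQ ℕ.≟ 0)
          where
          x-side : ∃[ c ] Bit c × Px.Ok c 1 → Pair ⊎ MersenneExponents u v
          x-side (_ , 0# , o) = inj₂ (from-x (Mx.exponents-Q o))
          x-side (_ , 1# , o) = inj₁ (from-PQ (Mx.exponents-PQ o))
          y-side : ∃[ c ] Bit c × Py.Ok c 1 → Pair ⊎ MersenneExponents u v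
          y-side (_ , 0# , o) = inj₂ (from-y (My.exponents-Q o))
          y-side (_ , 1# , o) = inj₁ (from-QP (My.exponents-PQ o))
          go : Dec (αQ ≡ 0) → Pair ⊎ MersenneExponents u v
          go (no αQ≢0)  = x-side (has-Q profx αQ≢0)
          go (yes αQ≡0) = y-side (has-Q profy λ βQ≡0 → ℕ.>⇒≢ k>0 (trans k≡ (cong₂ _+_ αQ≡0 βQ≡0)))

        distinct-exponents : ¬ (i ≡ u × j ≡ v)
        distinct-exponents (i≡u , j≡v) = proj₂ (proj₂ (proj₂ (proj₂ Px.distinct))) (trans (sym (cancel P)) (trans (cong (𝟙 +ₚ_) 1+P≡1+Q) (cancel Q)))
          where
          cancel : ∀ s → 𝟙 +ₚ (𝟙 +ₚ s) ≡ s
          cancel s = solve 1 (λ s → con true :+ (con true :+ s) := s) refl s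
          1+P≡1+Q : 𝟙 +ₚ P ≡ 𝟙 +ₚ Q
          1+P≡1+Q = trans 1+P (trans (cong₂ (λ i j → M i j 0 0) i≡u j≡v) (trans (cong (λ w → M u v w 0) (sym w≡0)) (sym 1+Q)))

        pair : Pair
        pair = go type-P type-Q
          where
          go : Pair ⊎ MersenneExponents i j → Pair ⊎ MersenneExponents u v → Pair
          go (inj₁ pr) _ = pr
          go (inj₂ _) (inj₁ pr) = pr
          go (inj₂ tp) (inj₂ tq) = mersennePair tp tq distinct-exponents

        profx′ : Profile (i + j) (u + v) (λ c d → T (ok i j u v c d)) a α₁ αP αQ
        profx′ = subst₂ (λ p q → Profile p q (λ c d → T (ok i j u v c d)) a α₁ αP αQ) degP≡ degQ≡′ (Profile-map Mx.Ok⇒ok profx)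

        profy′ : Profile (i + j) (u + v) (λ c d → T (ok j i v u c d)) b β₁ βP βQ
        profy′ = subst₂ (λ p q → Profile p q (λ c d → T (ok j i v u c d)) b β₁ βP βQ) degP≡ degQ≡′ (Profile-map My.Ok⇒ok profy)

        result : Pair → Result
        result (sols , pr) = inj₁ (sols , pr , w≡0 , mersennePair-solutions pr profx′ profy′ th tk h>0 k>0 h≡′ k≡ a≡ b≡)

      result : Result
      result = go w refl
        where
        go : ∀ w′ → w ≡ w′ → Result
        go zero    w≡ = Mersenne.result w≡ (Mersenne.pair w≡)
        go (suc _) w≡ = ⊥-elim (w-positive _ w≡)

  result : Result
  result = [ (λ (th , σP≡) → TrivialP.result th σP≡) , geoP-case ]′ (Px.profile-P′ h a b h k h>0 σP∣)
    where
    open WithProfiles (Px.profile-x a a b h k a>0 σx∣) (Py.profile-x b b a h k b>0 (subst (σ** y b ∣_) (sym (M-swap a b h k)) σy∣))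

-- The prime factors of a bi-unitary perfect polynomial

distinctPrimes : ∀ L → Unique L → (∀ p → p ∈ L → Irreducible p) → DistinctPrimes (Vec.fromList L)
distinctPrimes []      _            _   = []
distinctPrimes (p ∷ L) (p∉L ∷ uniq) irr = prime (irr p (here refl)) (fromAll p∉L) (distinctPrimes L uniq (λ q q∈ → irr q (there q∈)))
  where
  fromAll : ∀ {L} → All (p ≢_) L → VAll (p ≢_) (Vec.fromList L)
  fromAll []         = []
  fromAll (p≢ ∷ all) = p≢ ∷ fromAll all

1+p∣σ** : ∀ p a → 𝟙 +ₚ p ∣ σ** p a
1+p∣σ** p a = subst (𝟙 +ₚ p ∣_) (sym (σ**≡geo*geo p a)) (∣-*ʳ (geo p (lower a)) (p∣p*q (𝟙 +ₚ p) (geo p (upper a))))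

1+p∣σ**-product : ∀ {p} L as → p ∈ L → 𝟙 +ₚ p ∣ σ**-product (Vec.fromList L) as
1+p∣σ**-product (p ∷ L) (a ∷ as) (here refl) = ∣-*ʳ (σ**-product (Vec.fromList L) as) (1+p∣σ** p a)
1+p∣σ**-product (q ∷ L) (a ∷ as) (there p∈)  = ∣-*ˡ (σ** q a) (1+p∣σ**-product L as p∈)

PrimeDivisors : Poly → List Poly → Set
PrimeDivisors A L = Unique L × (∀ P → (P ∈ L) ⇔ (Irreducible P × P ∣ₚ A))

PrimeDivisors-↭ : ∀ {A L L′} → L ↭ L′ → PrimeDivisors A L → PrimeDivisors A L′
PrimeDivisors-↭ L↭L′ (uniq , member) = Unique-resp-↭ L↭L′ uniq , λ P →
  mk⇔ (λ P∈ → Equivalence.to (member P) (∈-resp-↭ (↭-sym L↭L′) P∈)) (λ d → ∈-resp-↭ L↭L′ (Equivalence.from (member P) d))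

perfect-factorisation : ∀ {A} L → PrimeDivisors A L → BiUnitaryPerfect A →
  ∃[ as ] A ≡ mono (Vec.fromList L) (Vec.map suc as) × σ**-product (Vec.fromList L) (Vec.map suc as) ≡ mono (Vec.fromList L) (Vec.map suc as)
perfect-factorisation {A} L (uniq , member) (A≢𝟘 , σ) =
  let as , A≡ = factorisation dist A A≢𝟘 (fromMembers L (λ p p∈ → from∣ₚ (proj₂ (Equivalence.to (member p) p∈)))) all-in
  in as , A≡ , σ**-functional (σ**-mono dist as) (subst (λ A → IsSigma** A A) A≡ σ)
  where
  dist = distinctPrimes L uniq (λ p p∈ → proj₁ (Equivalence.to (member p) p∈))
  fromMembers : ∀ L → (∀ p → p ∈ L → p ∣ A) → VAll (_∣ A) (Vec.fromList L)
  fromMembers []      _ = []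
  fromMembers (p ∷ L) f = f p (here refl) ∷ fromMembers L (λ q q∈ → f q (there q∈))
  avoid : ∀ {p} L → p ∈ L → ¬ VAll (p ≢_) (Vec.fromList L)
  avoid (_ ∷ L) (here refl) (p≢p ∷ _)   = p≢p refl
  avoid (_ ∷ L) (there p∈)  (_ ∷ p≢ps) = avoid L p∈ p≢ps
  all-in : ∀ {p} → Irreducible p → p ∣ A → ¬ VAll (p ≢_) (Vec.fromList L)
  all-in irr p∣A = avoid L (Equivalence.from (member _) (irr , to∣ₚ p∣A))

-- Modulo a linear t the prime p is a constant, and this constant is 1 because t does not divide p.
linear-∣-1+ : ∀ t {p} → deg t ≡ 1 → Irreducible p → p ≢ t → t ∣ 𝟙 +ₚ p
linear-∣-1+ t {p} deg-t irr p≢t = go (divMod p t t≢𝟘)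
  where
  t≢𝟘 : t ≢ 𝟘
  t≢𝟘 refl = case deg-t of λ ()
  small-remainder : ∀ r → size r < size t → r ≡ 𝟘 ⊎ r ≡ 𝟙
  small-remainder 𝟘 _ = inj₁ refl
  small-remainder (nz one) _ = inj₂ refl
  small-remainder (nz (_ ∷ₙ r)) lt = contradiction (subst (suc (suc (degNz r)) <_) (trans (size≡suc-deg t≢𝟘) (cong suc deg-t)) lt) λ { (s≤s (s≤s ())) }
  go : ∃[ q ] ∃[ r ] p ≡ t *ₚ q +ₚ r × size r < size t → t ∣ 𝟙 +ₚ p
  go (q , r , p≡ , lt) = [ (λ r≡𝟘 → contradiction (sym (irreducible-∣⇒≡ (deg≡1⇒irreducible deg-t) irr (divides q (sym (trans p≡ (trans (cong (t *ₚ q +ₚ_) r≡𝟘) (+ₚ-identityʳ _))))))) p≢t)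
    , (λ r≡𝟙 → divides q (trans (solve 1 (λ s → s := con true :+ (s :+ con true)) refl (t *ₚ q)) (cong (𝟙 +ₚ_) (sym (trans p≡ (cong (t *ₚ q +ₚ_) r≡𝟙)))))) ]′
    (small-remainder r lt)

Linear : Poly → Set
Linear p = p ≡ X ⊎ p ≡ X+1

linear? : ∀ p → Dec (Linear p)
linear? p = (p ≟ₚ X) ⊎-dec (p ≟ₚ X+1)

nonlinear-member : ∀ p q r L → Unique (p ∷ q ∷ r ∷ L) → ∃[ s ] s ∈ p ∷ q ∷ r ∷ L × ¬ Linear s
nonlinear-member p q r L ((p≢q ∷ p≢r ∷ _) ∷ (q≢r ∷ _) ∷ _) with linear? p | linear? q | linear? r
... | no p∤ | _ | _ = p , here refl , p∤
... | yes _ | no q∤ | _ = q , there (here refl) , q∤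
... | yes _ | yes _ | no r∤ = r , there (there (here refl)) , r∤
... | yes (inj₁ refl) | yes (inj₁ refl) | yes _ = contradiction refl p≢q
... | yes (inj₂ refl) | yes (inj₂ refl) | yes _ = contradiction refl p≢q
... | yes (inj₁ refl) | yes (inj₂ refl) | yes (inj₁ refl) = contradiction refl p≢r
... | yes (inj₁ refl) | yes (inj₂ refl) | yes (inj₂ refl) = contradiction refl q≢r
... | yes (inj₂ refl) | yes (inj₁ refl) | yes (inj₂ refl) = contradiction refl p≢r
... | yes (inj₂ refl) | yes (inj₁ refl) | yes (inj₁ refl) = contradiction refl q≢r

∈⇒↭ : ∀ {p : Poly} {L} → p ∈ L → ∃[ L′ ] L ↭ p ∷ L′
∈⇒↭ p∈ with ∈-∃++ p∈
... | ys , zs , refl = ys ++ zs , shift _ ys zs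

-- Among three distinct primes one, t, is neither X nor X+1. Both X and X+1 then divide 1 + t, which
-- divides σ**(A) = A.
linear-factors : ∀ {A} L → length L ≡ 4 → PrimeDivisors A L → BiUnitaryPerfect A →
                 ∃[ P ] ∃[ Q ] deg P ≤ deg Q × PrimeDivisors A (X ∷ X+1 ∷ P ∷ Q ∷ [])
linear-factors {A} L@(p ∷ q ∷ r ∷ s ∷ []) _ pd@(uniq , member) perf = sort (∈⇒↭ X∈)
  where
  nonlinear = nonlinear-member p q r (s ∷ []) uniq
  t = proj₁ nonlinear
  t∈ : t ∈ L
  t∈ = proj₁ (proj₂ nonlinear)
  fact = perfect-factorisation L pd perf
  1+t∣A : 𝟙 +ₚ t ∣ A
  1+t∣A = subst (𝟙 +ₚ t ∣_) (trans (proj₂ (proj₂ fact)) (sym (proj₁ (proj₂ fact)))) (1+p∣σ**-product L (Vec.map suc (proj₁ fact)) t∈)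
  linear∈ : ∀ ℓ → deg ℓ ≡ 1 → Linear ℓ → ℓ ∈ L
  linear∈ ℓ deg-ℓ lin = Equivalence.from (member ℓ) (deg≡1⇒irreducible deg-ℓ
    , to∣ₚ (∣-trans (linear-∣-1+ ℓ deg-ℓ (proj₁ (Equivalence.to (member t) t∈)) (λ t≡ℓ → proj₂ (proj₂ nonlinear) (subst Linear (sym t≡ℓ) lin))) 1+t∣A))
  X∈ : X ∈ L
  X∈ = linear∈ X refl (inj₁ refl)
  X+1∈ : X+1 ∈ L
  X+1∈ = linear∈ X+1 refl (inj₂ refl)
  order : ∀ P Q → L ↭ X ∷ X+1 ∷ P ∷ Q ∷ [] → ∃[ P ] ∃[ Q ] deg P ≤ deg Q × PrimeDivisors A (X ∷ X+1 ∷ P ∷ Q ∷ [])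
  order P Q L↭ with ℕ.≤-total (deg P) (deg Q)
  ... | inj₁ P≤Q = P , Q , P≤Q , PrimeDivisors-↭ L↭ pd
  ... | inj₂ Q≤P = Q , P , Q≤P , PrimeDivisors-↭ (↭-trans L↭ (↭-prep X (↭-prep X+1 (↭-swap P Q ↭-refl)))) pd
  sort : ∃[ L′ ] L ↭ X ∷ L′ → ∃[ P ] ∃[ Q ] deg P ≤ deg Q × PrimeDivisors A (X ∷ X+1 ∷ P ∷ Q ∷ [])
  sort (L′ , L↭) with ∈-resp-↭ L↭ X+1∈
  ... | there X+1∈L′ with ∈⇒↭ X+1∈L′
  ... | L″ , L′↭ with ↭-length (↭-trans L↭ (↭-prep X L′↭))
  sort (L′ , L↭) | there _ | P ∷ Q ∷ [] , L′↭ | refl = order P Q (↭-trans L↭ (↭-prep X L′↭))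

-- P and Q are written through their exponents. For given numbers this is a closed polynomial, so
-- that membership in the list, directly or after `bar`, is decided by computation.
value : (i j u v w : ℕ) → Quadruple → Poly
value i j u v w (a , b , h , k) = X ^ₚ a *ₚ (X+1 ^ₚ b *ₚ (P ^ₚ h *ₚ (Q ^ₚ k *ₚ 𝟙)))
  where
  P = 𝟙 +ₚ X ^ₚ i *ₚ X+1 ^ₚ j
  Q = 𝟙 +ₚ X ^ₚ u *ₚ (X+1 ^ₚ v *ₚ P ^ₚ w)

Listed : Poly → Set
Listed A = A ∈ candidates ⊎ bar A ∈ candidates

listed? : ∀ A → Dec (Listed A)
listed? A = (A ∈? candidates) ⊎-dec (bar A ∈? candidates)
  where open DecMembership _≟ₚ_

mersennePair-listed : ∀ {i j u v sols} → MersennePair i j u v sols → All (λ s → Listed (value i j u v 0 s)) sols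
mersennePair-listed {sols = sols} p11-q13 = toWitness {a? = All.all? (λ s → listed? (value 1 1 1 3 0 s)) sols} _
mersennePair-listed {sols = sols} p11-q31 = toWitness {a? = All.all? (λ s → listed? (value 1 1 3 1 0 s)) sols} _
mersennePair-listed {sols = sols} p13-q11 = toWitness {a? = All.all? (λ s → listed? (value 1 3 1 1 0 s)) sols} _
mersennePair-listed {sols = sols} p31-q11 = toWitness {a? = All.all? (λ s → listed? (value 3 1 1 1 0 s)) sols} _
mersennePair-listed {sols = sols} p13-q31 = toWitness {a? = All.all? (λ s → listed? (value 1 3 3 1 0 s)) sols} _
mersennePair-listed {sols = sols} p31-q13 = toWitness {a? = All.all? (λ s → listed? (value 3 1 1 3 0 s)) sols} _
mersennePair-listed {sols = sols} p12-q21 = toWitness {a? = All.all? (λ s → listed? (value 1 2 2 1 0 s)) sols} _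
mersennePair-listed {sols = sols} p21-q12 = toWitness {a? = All.all? (λ s → listed? (value 2 1 1 2 0 s)) sols} _

geoP-listed : All (λ s → Listed (value 1 1 1 1 1 s)) geoP-solutions
geoP-listed = toWitness {a? = All.all? (λ s → listed? (value 1 1 1 1 1 s)) geoP-solutions} _

module Main {A : Poly} (P Q : Poly) (degP≤degQ : deg P ≤ deg Q) (pd : PrimeDivisors A (X ∷ X+1 ∷ P ∷ Q ∷ [])) (perf : BiUnitaryPerfect A) where
  ps : Vec Poly 4
  ps = X ∷ X+1 ∷ P ∷ Q ∷ []

  dist : DistinctPrimes ps
  dist = distinctPrimes (X ∷ X+1 ∷ P ∷ Q ∷ []) (proj₁ pd) (λ p p∈ → proj₁ (Equivalence.to (proj₂ pd p) p∈))

  irr-P : Irreducible P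
  irr-P = case dist of λ { (prime _ _ (prime _ _ (prime irr _ _))) → irr }

  irr-Q : Irreducible Q
  irr-Q = case dist of λ { (prime _ _ (prime _ _ (prime _ _ (prime irr _ _)))) → irr }

  deg>0 : 0 < deg P × 0 < deg Q
  deg>0 = irreducible⇒deg>0 irr-P , irreducible⇒deg>0 irr-Q

  X∣1+ : ∀ {R} → Irreducible R → R ≢ X → X ∣ 𝟙 +ₚ R
  X∣1+ = linear-∣-1+ X refl

  X+1∣1+ : ∀ {R} → Irreducible R → R ≢ X+1 → X+1 ∣ 𝟙 +ₚ R
  X+1∣1+ = linear-∣-1+ X+1 refl

  ≢linear : (P ≢ X × P ≢ X+1) × (Q ≢ X × Q ≢ X+1)
  ≢linear = case dist of λ { (prime _ (_ ∷ X≢P ∷ X≢Q ∷ []) (prime _ (X+1≢P ∷ X+1≢Q ∷ []) _)) → ((X≢P ∘ sym) , (X+1≢P ∘ sym)) , ((X≢Q ∘ sym) , (X+1≢Q ∘ sym)) }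

  R∤1+R : ∀ {R} → Irreducible R → ¬ R ∣ 𝟙 +ₚ R
  R∤1+R {R} irr R∣ = p∤1+p* (proj₁ (proj₂ irr)) (subst (λ s → R ∣ 𝟙 +ₚ s) (sym (*ₚ-identityʳ R)) R∣)

  i-positive : ∀ {R} i es → X ∣ 𝟙 +ₚ R → 𝟙 +ₚ R ≡ mono ps (i ∷ es) → 0 < i
  i-positive (suc i) es _  _  = s≤s z≤n
  i-positive zero    es X∣ eq = contradiction (subst (X ∣_) eq X∣) (case dist of λ { (prime irr X≢ rest) → ∤-mono irr rest X≢ es })

  j-positive : ∀ {R} i j es → X+1 ∣ 𝟙 +ₚ R → 𝟙 +ₚ R ≡ mono ps (i ∷ j ∷ es) → 0 < j
  j-positive i (suc j) es _  _  = s≤s z≤n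
  j-positive i zero    es X+1∣ eq = contradiction (subst (X+1 ∣_) eq X+1∣)
    (case dist of λ { (prime irr (X≢X+1 ∷ _) (prime irr′ X+1≢ rest)) → ∤-*ₚ irr′ (X≢X+1 ∘ sym ∘ irreducible-∣⇒≡ irr′ irr ∘ ∣-^ₚ⇒∣ X i irr′) (∤-mono irr′ rest X+1≢ es) })

  P-exponent : ∀ i j c d → 𝟙 +ₚ P ≡ mono ps (i ∷ j ∷ c ∷ d ∷ []) → c ≡ 0
  P-exponent i j zero    d _  = refl
  P-exponent i j (suc c) d eq = contradiction (subst (P ∣_) (sym eq) (∣-*ˡ (X ^ₚ i) (∣-*ˡ (X+1 ^ₚ j) (∣-*ʳ (Q ^ₚ d *ₚ 𝟙) (p∣p*q P (P ^ₚ c)))))) (R∤1+R irr-P)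

  Q-exponent : ∀ {R} i j c d → ¬ Q ∣ 𝟙 +ₚ R → 𝟙 +ₚ R ≡ mono ps (i ∷ j ∷ c ∷ d ∷ []) → d ≡ 0
  Q-exponent i j c zero    _  _  = refl
  Q-exponent i j c (suc d) Q∤ eq = contradiction (subst (Q ∣_) (sym eq) (∣-*ˡ (X ^ₚ i) (∣-*ˡ (X+1 ^ₚ j) (∣-*ˡ (P ^ₚ c) (∣-*ʳ 𝟙 (p∣p*q Q (Q ^ₚ d))))))) Q∤

  -- Both Q and X would divide 1 + P, which has degree at most deg Q.
  Q∤1+P : ¬ Q ∣ 𝟙 +ₚ P
  Q∤1+P Q∣ = proj₁ (proj₂ ≢linear) (sym (irreducible-∣⇒≡ (deg≡1⇒irreducible refl) irr-Q (subst (X ∣_) (sym Q≡1+P) (X∣1+ irr-P (proj₁ (proj₁ ≢linear))))))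
    where
    Q≡1+P : Q ≡ 𝟙 +ₚ P
    Q≡1+P = ∣-deg≡⇒≡ (1+-nonzero (proj₁ (proj₂ irr-P))) Q∣ (subst (_≤ deg Q) (sym (deg-1+ P (proj₁ deg>0))) degP≤degQ)

  module Exponents (a b h k : ℕ) (A≡ : A ≡ mono ps (suc a ∷ suc b ∷ suc h ∷ suc k ∷ []))
                   (σ≡ : σ**-product ps (suc a ∷ suc b ∷ suc h ∷ suc k ∷ []) ≡ mono ps (suc a ∷ suc b ∷ suc h ∷ suc k ∷ [])) where
    es : Vec ℕ 4
    es = suc a ∷ suc b ∷ suc h ∷ suc k ∷ []

    1+P∣ : 𝟙 +ₚ P ∣ mono ps es
    1+P∣ = subst (𝟙 +ₚ P ∣_) σ≡ (1+p∣σ**-product (X ∷ X+1 ∷ P ∷ Q ∷ []) es (there (there (here refl))))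

    1+Q∣ : 𝟙 +ₚ Q ∣ mono ps es
    1+Q∣ = subst (𝟙 +ₚ Q ∣_) σ≡ (1+p∣σ**-product (X ∷ X+1 ∷ P ∷ Q ∷ []) es (there (there (there (here refl)))))

    module WithForms (i j u v w : ℕ) (1+P≡ : 𝟙 +ₚ P ≡ mono ps (i ∷ j ∷ 0 ∷ 0 ∷ [])) (1+Q≡ : 𝟙 +ₚ Q ≡ mono ps (u ∷ v ∷ w ∷ 0 ∷ [])) where
      S : Setting
      S = record
        { x = X ; y = X+1 ; P = P ; Q = Q ; 1+x≡y = refl ; Dx≡𝟙 = refl ; deg-x = refl ; primes = dist ; degP≤degQ = degP≤degQ
        ; i = i ; j = j ; u = u ; v = v ; w = w ; 1+P = 1+P≡ ; 1+Q = 1+Q≡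
        ; i>0 = i-positive {P} i (j ∷ 0 ∷ 0 ∷ []) (X∣1+ irr-P (proj₁ (proj₁ ≢linear))) 1+P≡
        ; j>0 = j-positive {P} i j (0 ∷ 0 ∷ []) (X+1∣1+ irr-P (proj₂ (proj₁ ≢linear))) 1+P≡
        ; u>0 = i-positive {Q} u (v ∷ w ∷ 0 ∷ []) (X∣1+ irr-Q (proj₁ (proj₂ ≢linear))) 1+Q≡
        ; v>0 = j-positive {Q} u v (w ∷ 0 ∷ []) (X+1∣1+ irr-Q (proj₂ (proj₂ ≢linear))) 1+Q≡ }

      cancel : ∀ s → s ≡ 𝟙 +ₚ (𝟙 +ₚ s)
      cancel s = solve 1 (λ s → s := con true :+ (con true :+ s)) refl s

      P≡ : P ≡ 𝟙 +ₚ X ^ₚ i *ₚ X+1 ^ₚ j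
      P≡ = trans (cancel P) (cong (𝟙 +ₚ_) (trans 1+P≡ (cong (X ^ₚ i *ₚ_) (*ₚ-identityʳ (X+1 ^ₚ j)))))

      Q≡ : Q ≡ 𝟙 +ₚ X ^ₚ u *ₚ (X+1 ^ₚ v *ₚ P ^ₚ w)
      Q≡ = trans (cancel Q) (cong (𝟙 +ₚ_) (trans 1+Q≡ (cong (λ s → X ^ₚ u *ₚ (X+1 ^ₚ v *ₚ s)) (*ₚ-identityʳ (P ^ₚ w)))))

      A≡value : A ≡ value i j u v w (suc a , suc b , suc h , suc k)
      A≡value = trans A≡ (cong₂ (λ p q → X ^ₚ suc a *ₚ (X+1 ^ₚ suc b *ₚ (p ^ₚ suc h *ₚ (q ^ₚ suc k *ₚ 𝟙)))) P≡
        (trans Q≡ (cong (λ p → 𝟙 +ₚ X ^ₚ u *ₚ (X+1 ^ₚ v *ₚ p ^ₚ w)) P≡)))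

      listed : Classify.Result S (suc a) (suc b) (suc h) (suc k) (s≤s z≤n) (s≤s z≤n) (s≤s z≤n) (s≤s z≤n) σ≡ → Listed A
      listed (inj₁ (sols , pair , w≡0 , sol)) = subst Listed (sym (trans A≡value (cong (λ w → value i j u v w (suc a , suc b , suc h , suc k)) w≡0)))
        (All.lookup (mersennePair-listed pair) sol)
      listed (inj₂ (i≡ , j≡ , u≡ , v≡ , w≡ , sol)) = subst Listed (sym (trans A≡value
        (trans (cong₂ (λ i j → value i j u v w (suc a , suc b , suc h , suc k)) i≡ j≡)
        (trans (cong₂ (λ u v → value 1 1 u v w (suc a , suc b , suc h , suc k)) u≡ v≡)
               (cong (λ w → value 1 1 1 1 w (suc a , suc b , suc h , suc k)) w≡)))))
        (All.lookup geoP-listed sol)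

      result : Listed A
      result = listed (Classify.result S (suc a) (suc b) (suc h) (suc k) (s≤s z≤n) (s≤s z≤n) (s≤s z≤n) (s≤s z≤n) σ≡)

    result : Listed A
    result = go (∣-mono⇒mono dist es 1+P∣) (∣-mono⇒mono dist es 1+Q∣)
      where
      go : ∃[ fs ] 𝟙 +ₚ P ≡ mono ps fs → ∃[ gs ] 𝟙 +ₚ Q ≡ mono ps gs → Listed A
      go (i ∷ j ∷ c ∷ d ∷ [] , 1+P≡) (u ∷ v ∷ w ∷ z ∷ [] , 1+Q≡) = WithForms.result i j u v w
        (trans 1+P≡ (cong₂ (λ c d → mono ps (i ∷ j ∷ c ∷ d ∷ [])) (P-exponent i j c d 1+P≡) (Q-exponent {P} i j c d Q∤1+P 1+P≡)))
        (trans 1+Q≡ (cong (λ z → mono ps (u ∷ v ∷ w ∷ z ∷ [])) (Q-exponent {Q} u v w z (R∤1+R irr-Q) 1+Q≡)))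

  result : Listed A
  result = go (perfect-factorisation (X ∷ X+1 ∷ P ∷ Q ∷ []) pd perf)
    where
    go : ∃[ as ] A ≡ mono ps (Vec.map suc as) × σ**-product ps (Vec.map suc as) ≡ mono ps (Vec.map suc as) → Listed A
    go (a ∷ b ∷ h ∷ k ∷ [] , A≡ , σ≡) = Exponents.result a b h k A≡ σ≡

theorem1p2 : (A : Poly) → BiUnitaryPerfect A → HasOmega A 4
    → A ∈ candidates ⊎ bar A ∈ candidates
theorem1p2 A perf (L , uniq , member , len) =
  let P , Q , P≤Q , pd = linear-factors L len (uniq , member) perf in Main.result P Q P≤Q pd perf
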